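{- Let $\ell$ be a positive integer and $k=5\ell$. There is a constant $c>0$ depending only on $k,\ell$ such that for every integer $N\geq 3$, \[ \mathscr{M}_{(k,\ell)}(N)\geq \frac{N}{k+\ell}+c\,\frac{\log N}{\log\log N}. \]
   Context: For positive integers $k>\ell$, a set $S$ of positive integers is $(k,\ell)$-sum-free if for all (not necessarily distinct) $x_1,\dots,x_k,y_1,\dots,y_\ell\in S$ one has $x_1+\dots+x_k\neq y_1+\dots+y_\ell$. For a finite set $A$ of positive integers, $\mathscr{M}_{(k,\ell)}(A)$ is the maximum size of a $(k,\ell)$-sum-free subset of $A$, and $\mathscr{M}_{(k,\ell)}(N)=\inf\{\mathscr{M}_{(k,\ell)}(A): A\subseteq\mathbb{Z}_{>0},\ |A|=N\}$. -}

module Defs where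

open import Data.Nat as ℕ using (ℕ; zero; suc)
open import Data.Integer as ℤ using (ℤ; +_)
open import Data.Rational as ℚ using (ℚ; 0ℚ; 1ℚ; _/_; ↥_; ↧ₙ_)
open import Data.List using (List; length; sum)
open import Data.List.Relation.Unary.All using (All)
open import Data.List.Relation.Unary.Unique.Propositional using (Unique)
open import Data.List.Membership.Propositional using (_∈_)
open import Data.Vec as Vec using (Vec)
import Data.Vec.Relation.Unary.All as VAll
open import Data.Product using (Σ; _×_)
open import Relation.Binary.PropositionalEquality using (_≡_; _≢_)

PosSet : List ℕ → Set
PosSet A = Unique A × All (λ a → 1 ℕ.≤ a) A

SubsetOf : List ℕ → List ℕ → Set
SubsetOf S A = Unique S × All (λ x → x ∈ A) S

SumFree : ℕ → ℕ → List ℕ → Set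
SumFree k l S =
  (xs : Vec ℕ k) (ys : Vec ℕ l) →
  VAll.All (λ x → x ∈ S) xs → VAll.All (λ y → y ∈ S) ys →
  Vec.sum xs ≢ Vec.sum ys

-- Real-number inequalities involving the natural logarithm, expressed
-- exactly through rationals.

_^ℚ_ : ℚ → ℕ → ℚ
q ^ℚ zero = 1ℚ
q ^ℚ suc n = q ℚ.* (q ^ℚ n)

expTerm : ℚ → ℕ → ℚ
expTerm s zero = 1ℚ
expTerm s (suc i) = (expTerm s i ℚ.* s) ℚ.* ((+ 1) / suc i)

expPartial : ℚ → ℕ → ℚ
expPartial s zero = 0ℚ
expPartial s (suc n) = expPartial s n ℚ.+ expTerm s n

-- For s ≥ 0 rational:  exp(s) ≤ N  (equivalently s ≤ ln N),
-- since the partial sums increase to exp(s).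
ExpLe : ℚ → ℕ → Set
ExpLe s N = (n : ℕ) → expPartial s n ℚ.≤ (+ N / 1)

-- For N ≥ 3, c > 0 and rational X:
--   LogTermLe c N X  means  c · ln N / ln ln N ≤ X.
-- Derivation (ln ln N > 0 since N ≥ 3): the inequality forces X > 0, and
-- with r = X / c = p / q (p = ∣num X∣·den c, q = den X·∣num c∣) it reads
--   ln N ≤ r · ln ln N  ⇔  N ≤ (ln N)^r  ⇔  N^{1/r} ≤ ln N
--   ⇔  ∀ rational s ≥ 0, s < N^{1/r} → s ≤ ln N
--   ⇔  ∀ rational s ≥ 0, s^p < N^q → exp(s) ≤ N.
LogTermLe : ℚ → ℕ → ℚ → Set
LogTermLe c N X =
  0ℚ ℚ.< X ×
  ((s : ℚ) → 0ℚ ℚ.≤ s →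
     s ^ℚ (ℤ.∣ ↥ X ∣ ℕ.* ↧ₙ c) ℚ.< (+ (N ℕ.^ (↧ₙ X ℕ.* ℤ.∣ ↥ c ∣)) / 1) →
     ExpLe s N)

toℚ : ℕ → ℚ
toℚ n = + n / 1

-- n / d as a rational (only used with d ≥ 1; the d = 0 case is a dummy)
fracℕ : ℕ → ℕ → ℚ
fracℕ n zero = 0ℚ
fracℕ n (suc d) = + n / suc d

{-# OPTIONS --safe #-}
module Submission where

-- Let Ω₊ = (1/12, 5/12] and Ω₋ = (7/12, 11/12] modulo 1, and count the a ∈ A with a x ∈ Ω±. If one of the
-- counts at x is at least N/3 + B, then pulling Ω± back under multiplication by 2l splits these a into 2l
-- arcs, each of them (5l, l)-sum-free, and the largest one has at least N/(6l) + B/(2l) elements.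
-- If all counts are at most N/3 + B, then they are within O(B) of N/3 on average. A suitable combination
-- of dilated counts (wfun) has its k-th Fourier coefficient proportional to the sum of k0 (k/a) over a ∈ A,
-- where k0 n is essentially χ₃(n)/n on n ≡ 1 mod 4. A sieve over the primes up to P = (log N)^O(1), which
-- costs only a factor ∏ (1 + 1/p) = O(log P), removes the n with small prime factors; the remaining
-- coefficients are close to the indicator of A in mean square, because the multiplicative energy of A
-- along P-rough ratios is small (split A by prime powers). Testing against a McGehee–Pigno–Smith function
-- built on geometrically growing blocks of A gives log N = O(B log log N).
-- Everything takes place over ℚ: e(x) is replaced by powers of a rational point z of the unit circle close
-- to 1, the circle by the Q steps of one turn of z, and orthogonality by an exact quadrature.

open import Data.Nat as ℕ using (ℕ; zero; suc; z≤n; s≤s; _!) renaming (_+_ to _+'_; _*_ to _*'_; _≤_ to _≤'_; _<_ to _<'_; _^_ to _^'_; _∸_ to _∸'_)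
open import Data.Rational as ℚ using (ℚ; 0ℚ; 1ℚ)
open import Data.Product using (Σ; _×_; _,_; ∃) renaming (proj₁ to fst; proj₂ to snd)
open import Data.Sum using (_⊎_; inj₁; inj₂)
open import Data.Empty using (⊥; ⊥-elim)
open import Data.List using (List; []; _∷_; _++_; map; length; concatMap; filter)
open import Data.List.Relation.Unary.Any using (Any; here; there)
open import Data.List.Relation.Unary.All as All using (All; []; _∷_)
open import Data.List.Membership.Propositional using (_∈_; lose) renaming (find to find∈)
open import Relation.Nullary using (¬_; Dec; yes; no)
open import Relation.Nullary.Decidable using (True; toWitness; from-no; from-yes; _×-dec_; ¬?; _⊎-dec_)
open import Level using (0ℓ)
open import Data.Maybe using (Maybe; just; nothing)
open import Algebra.Bundles using (CommutativeRing; RawRing)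
open import Algebra.Structures using (IsCommutativeRing)
open import Data.List.Membership.Propositional.Properties using (∈-++⁻; ∈-map⁻; ∈-++⁺ˡ; ∈-++⁺ʳ; ∈-map⁺; ∈-filter⁺; ∈-filter⁻; ∈-concatMap⁺)
open import Data.List.Relation.Unary.Unique.Propositional using (Unique)
open import Data.List.Relation.Unary.AllPairs using ([]; _∷_)
open import Data.Nat.DivMod using (_/_; _%_; m≡m%n+[m/n]*n; m%n<n; %-distribˡ-*; m%n%n≡m%n; [m+kn]%n≡m%n; m<n⇒m%n≡m; %-distribˡ-+; m*n%n≡0; m/n*n≡m; m<n*o⇒m/o<n; m/n*n≤m; m/n≤m)
open import Data.Nat.Divisibility using (_∣_; divides; m%n≡0⇒n∣m; _∣?_)
open import Data.Bool using (Bool; true; false; not)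
open import Data.Nat.Primality using (Prime; prime?; prime⇒nonZero; prime⇒irreducible; euclidsLemma; prime⇒nonTrivial)
open import Data.Nat.Primality.Factorisation using (factorise; PrimeFactorisation)
open import Data.Nat.Properties using (_!≢0; _!*_!≢0)
open import Data.Nat.Combinatorics using (nCk≡n!/k![n-k]!; nCk+nC[k+1]≡[n+1]C[k+1]; k![n∸k]!∣n!) renaming (_C_ to _choose_)
open import Data.Nat.ListAction using (product)
open import Data.Nat.GCD using (gcd; gcd[m,n]∣m; gcd[m,n]∣n; gcd[m,n]≢0)
open import Data.Nat.Coprimality using (Coprime; coprime-/gcd; coprime-divisor)
open import Data.Nat.ListAction.Properties using (∈⇒∣product; product≢0)
open import Data.Vec as Vec using (Vec)
open import Defs
import Data.Nat.Properties as N
open import Data.Integer as ℤ using (ℤ) renaming (+_ to pos; -[1+_] to negsuc)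
import Data.Integer.Properties as ℤP
import Data.Rational.Properties as ℚP
open import Relation.Binary.PropositionalEquality hiding (J) renaming (trans to tr; cong₂ to cong2)
import Data.Nat.Coprimality as Cop
import Data.Nat.Solver as NS
import Data.Rational.Unnormalised as ℚᵘ
import Data.Rational.Unnormalised.Properties as ℚᵘP
import Algebra.Solver.Ring as RS
import Algebra.Solver.Ring.AlmostCommutativeRing as ACR
import Data.List.Relation.Unary.All.Properties as AllP
import Data.Nat.Divisibility as Dv
import Data.List.Relation.Unary.Unique.Propositional.Properties as UP
import Data.List.Properties as LP
import Data.List.Relation.Unary.Any as AnyM
import Data.Vec.Relation.Unary.All as VAll

-- The weight has to tell `a` from `-a`. Every correction step of the test function pushes its
-- spectrum to negative frequencies, about as far as the current block reaches to the right, and the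
-- tested coefficients must have small energy there. A kernel living on all n prime to 6 would have
-- a second spike at n = -1 and reproduce A at the frequencies -a. The class n ≡ 1 mod 4 excludes n
-- = -1; as a real weight has conjugate coefficients at k and -k, the weight must be complex. The
-- tail left by the sieve lives on n > P. Up to frequency M P it therefore involves only the
-- elements of A up to M, and one energy bound of order n (log N)³ / P for n elements serves every
-- stage. The test function reaches down to about -2 J M, with J of order log N blocks, so P must be
-- at least 2 J; the energy bound asks for a large multiple of (log N)³. The O(log P) paid for the
-- sieve is the only loss, and this is where log log N comes from. The numbers π and √3 never occur.
-- Rational sequences stand for them and enter through one factor common to all coefficients, of
-- which it matters only that it is bounded below.

infix 9 #_
#_ : ℕ → ℚ
# n = pos n ℚ./ 1

case-dec : {P C : Set} → Dec P → (P → C) → (¬ P → C) → C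
case-dec (yes p) f g = f p
case-dec (no n) f g = g n

-- An opaque ordered field.

infixl 6 _+_ _-_
infixl 7 _*_
infix 8 -_
infix 4 _≤_

opaque
 -- A copy of ℚ behind an opaque barrier: conversion checking never normalises fractions, and only
 -- the exported order and ring facts are visible.
 F : Set
 F = ℚ

 _+_ _*_ : F → F → F
 _+_ = ℚ._+_
 _*_ = ℚ._*_

 -_ : F → F
 -_ = ℚ.-_

 _≤_ : F → F → Set
 _≤_ = ℚ._≤_

 ι : ℚ → F
 ι q = q

0F 1F : F
0F = ι 0ℚ
1F = ι 1ℚ

_-_ : F → F → F
a - b = a + (- b)

opaque
 unfolding F _+_ _*_ -_ _≤_ ι

 F-ring : IsCommutativeRing _≡_ _+_ _*_ -_ 0F 1F
 F-ring = ℚP.+-*-isCommutativeRing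

 ι-+ : ∀ p q → ι (p ℚ.+ q) ≡ ι p + ι q
 ι-+ p q = refl
 ι-* : ∀ p q → ι (p ℚ.* q) ≡ ι p * ι q
 ι-* p q = refl
 ι-neg : ∀ p → ι (ℚ.- p) ≡ - ι p
 ι-neg p = refl
 ι-≤ : ∀ {p q} → p ℚ.≤ q → ι p ≤ ι q
 ι-≤ h = h
 ι-≤⁻ : ∀ {p q} → ι p ≤ ι q → p ℚ.≤ q
 ι-≤⁻ h = h
 ≤-refl : ∀ {a} → a ≤ a
 ≤-refl = ℚP.≤-refl
 tr≤ : ∀ {a b c} → a ≤ b → b ≤ c → a ≤ c
 tr≤ = ℚP.≤-trans
 ≤-antisym : ∀ {a b} → a ≤ b → b ≤ a → a ≡ b
 ≤-antisym = ℚP.≤-antisym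
 ≤-total : ∀ a b → (a ≤ b) ⊎ (b ≤ a)
 ≤-total = ℚP.≤-total
 _≤?_ : ∀ a b → Dec (a ≤ b)
 _≤?_ = ℚ._≤?_
 _≟F_ : (a b : F) → Dec (a ≡ b)
 _≟F_ = ℚ._≟_
 +-mono : ∀ {a b c d} → a ≤ b → c ≤ d → a + c ≤ b + d
 +-mono = ℚP.+-mono-≤
 0≤* : ∀ {a b} → 0F ≤ a → 0F ≤ b → 0F ≤ a * b
 0≤* {a} {b} p q = subst (ℚ._≤ (a ℚ.* b)) (ℚP.*-zeroʳ a)
  (ℚP.*-monoˡ-≤-nonNeg a {{ℚ.nonNegative p}} q)
 -- Total, with value 0 at 0, so that terms carry no proofs of nonvanishing; these are needed only
 -- when an inverse is cancelled.
 inv : F → F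
 inv x with ℚ._≟_ x 0ℚ
 ... | yes _ = 0ℚ
 ... | no h = ℚ.1/_ x {{ℚ.≢-nonZero h}}
 inv-r : ∀ {x} → x ≢ 0F → x * inv x ≡ 1F
 inv-r {x} h with ℚ._≟_ x 0ℚ
 ... | yes e = ⊥-elim (h e)
 ... | no h' = ℚP.*-inverseʳ x {{ℚ.≢-nonZero h'}}
 1≰0 : ¬ (1F ≤ 0F)
 1≰0 = from-no (1ℚ ℚ.≤? 0ℚ)

Fring : CommutativeRing 0ℓ 0ℓ
Fring = record { isCommutativeRing = F-ring }

private
 ℚraw : RawRing 0ℓ 0ℓ
 ℚraw = CommutativeRing.rawRing ℚP.+-*-commutativeRing
 Facr = ACR.fromCommutativeRing Fring
 mor : ℚraw ACR.-Raw-AlmostCommutative⟶ Facr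
 mor = record
  { ⟦_⟧ = ι
  ; +-homo = ι-+ ; *-homo = ι-* ; -‿homo = ι-neg ; 0-homo = refl ; 1-homo = refl }
 cdec : (p q : ℚ) → Maybe (ι p ≡ ι q)
 cdec p q with p ℚ.≟ q
 ... | yes e = just (cong ι e)
 ... | no _ = nothing

open RS ℚraw Facr mor cdec public using (solve; Polynomial; con; :-_; _:+_; _:*_; _:-_; _:=_)

:0 :1 :2 : ∀ {n} → Polynomial n
:0 = con 0ℚ
:1 = con 1ℚ
:2 = con (1ℚ ℚ.+ 1ℚ)

open NS.+-*-Solver public using () renaming (solve to solveN; con to con'; _:+_ to _:+'_; _:*_ to _:*'_; _:=_ to _:='_)

open CommutativeRing Fring public using (+-assoc; +-comm; *-assoc; *-comm; zeroˡ; zeroʳ; distribˡ; distribʳ; -‿inverseˡ; -‿inverseʳ) renaming (+-identityˡ to 0+; +-identityʳ to +0; *-identityˡ to 1*; *-identityʳ to *1)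

≡⇒≤ : ∀ {a b} → a ≡ b → a ≤ b
≡⇒≤ refl = ≤-refl

≡≤ : ∀ {a b c} → a ≡ b → b ≤ c → a ≤ c
≡≤ refl h = h

≤≡ : ∀ {a b c} → a ≤ b → b ≡ c → a ≤ c
≤≡ h refl = h

≤-by : ∀ {a b} d → 0F ≤ d → a + d ≡ b → a ≤ b
≤-by {a} {b} d h e = subst₂ _≤_ (+0 a) e (+-mono ≤-refl h)

0≤- : ∀ {a b} → a ≤ b → 0F ≤ b - a
0≤- {a} {b} h = subst₂ _≤_ (-‿inverseʳ a) refl (+-mono h (≤-refl { - a}))

-≤0 : ∀ {a b} → 0F ≤ b - a → a ≤ b
-≤0 {a} {b} h = ≤-by (b - a) h (solve 2 (λ a b → a :+ (b :- a) := b) refl a b)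

neg-mono : ∀ {a b} → a ≤ b → - b ≤ - a
neg-mono {a} {b} h = ≤-by (b - a) (0≤- h) (solve 2 (λ a b → :- b :+ (b :- a) := :- a) refl a b)

0≤+ : ∀ {a b} → 0F ≤ a → 0F ≤ b → 0F ≤ a + b
0≤+ p q = ≡≤ (sym (0+ 0F)) (+-mono p q)

*-monoˡ : ∀ {a b} c → 0F ≤ c → a ≤ b → c * a ≤ c * b
*-monoˡ {a} {b} c hc h = ≤-by (c * (b - a)) (0≤* hc (0≤- h)) (solve 3 (λ a b c → c :* a :+ c :* (b :- a) := c :* b) refl a b c)

*-monoʳ : ∀ {a b} c → 0F ≤ c → a ≤ b → a * c ≤ b * c
*-monoʳ {a} {b} c hc h = subst₂ _≤_ (*-comm c a) (*-comm c b) (*-monoˡ c hc h)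

*-mono : ∀ {a b c d} → 0F ≤ a → 0F ≤ c → a ≤ b → c ≤ d → a * c ≤ b * d
*-mono {a} {b} {c} ha hc h k = tr≤ (*-monoʳ c hc h) (*-monoˡ b (tr≤ ha h) k)

neg≥0 : ∀ {a} → a ≤ 0F → 0F ≤ - a
neg≥0 {a} h = subst (_≤ - a) (solve 0 (:- :0 := :0) refl) (neg-mono h)

0≤sq : ∀ a → 0F ≤ a * a
0≤sq a with ≤-total 0F a
... | inj₁ h = 0≤* h h
... | inj₂ h = subst (0F ≤_) (solve 1 (λ a → (:- a) :* (:- a) := a :* a) refl a) (0≤* (neg≥0 h) (neg≥0 h))

0≤ι : ∀ {q} → 0ℚ ℚ.≤ q → 0F ≤ ι q
0≤ι = ι-≤

ι≥0 : ∀ q {_ : True (0ℚ ℚ.≤? q)} → 0F ≤ ι q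
ι≥0 q {h} = 0≤ι (toWitness h)

0≤1 : 0F ≤ 1F
0≤1 = ι-≤ (from-yes (0ℚ ℚ.≤? 1ℚ))

opaque
 abs : F → F
 abs a with ≤-total 0F a
 ... | inj₁ _ = a
 ... | inj₂ _ = - a

 ∣∣-cases : ∀ a → (0F ≤ a × (abs a) ≡ a) ⊎ (a ≤ 0F × (abs a) ≡ - a)
 ∣∣-cases a with ≤-total 0F a
 ... | inj₁ h = inj₁ (h , refl)
 ... | inj₂ h = inj₂ (h , refl)

∣∣≥0 : ∀ a → 0F ≤ (abs a)
∣∣≥0 a with ∣∣-cases a
... | inj₁ (h , e) = subst (0F ≤_) (sym e) h
... | inj₂ (h , e) = subst (0F ≤_) (sym e) (neg≥0 h)

≤∣∣ : ∀ a → a ≤ abs a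
≤∣∣ a with ∣∣-cases a
... | inj₁ (h , e) = ≡⇒≤ (sym e)
... | inj₂ (h , e) = tr≤ h (∣∣≥0 a)

neg≤∣∣ : ∀ a → - a ≤ abs a
neg≤∣∣ a with ∣∣-cases a
... | inj₂ (h , e) = ≡⇒≤ (sym e)
... | inj₁ (h , e) = tr≤ (subst (- a ≤_) (solve 0 (:- :0 := :0) refl) (neg-mono h)) (∣∣≥0 a)

∣∣-≤ : ∀ {a b} → a ≤ b → - a ≤ b → (abs a) ≤ b
∣∣-≤ {a} p q with ∣∣-cases a
... | inj₁ (h , e) = subst (_≤ _) (sym e) p
... | inj₂ (h , e) = subst (_≤ _) (sym e) q

∣∣-sq : ∀ a → (abs a) * (abs a) ≡ a * a
∣∣-sq a with ∣∣-cases a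
... | inj₁ (h , e) = cong2 _*_ e e
... | inj₂ (h , e) = tr (cong2 _*_ e e) (solve 1 (λ a → (:- a) :* (:- a) := a :* a) refl a)

∣∣-+ : ∀ a b → (abs (a + b)) ≤ (abs a) + (abs b)
∣∣-+ a b = ∣∣-≤ (+-mono (≤∣∣ a) (≤∣∣ b))
 (≡≤ (solve 2 (λ a b → :- (a :+ b) := (:- a) :+ (:- b)) refl a b) (+-mono (neg≤∣∣ a) (neg≤∣∣ b)))

∣∣-* : ∀ a b → (abs (a * b)) ≤ (abs a) * (abs b)
∣∣-* a b with ∣∣-cases a | ∣∣-cases b
... | inj₁ (h , e) | inj₁ (k , f) rewrite e | f = ∣∣-≤ ≤-refl (tr≤ (neg-nonpos (0≤* h k)) (0≤* h k))
 where
  neg-nonpos : ∀ {x} → 0F ≤ x → - x ≤ 0F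
  neg-nonpos {x} p = subst (- x ≤_) (solve 0 (:- :0 := :0) refl) (neg-mono p)
... | inj₁ (h , e) | inj₂ (k , f) rewrite e | f = ∣∣-≤ (≤-by (ι 2ℚ' * (a * - b)) (0≤* (ι≥0 2ℚ') (0≤* h (neg≥0 k))) (solve 2 (λ a b → a :* b :+ con 2ℚ' :* (a :* :- b) := a :* :- b) refl a b)) (≡⇒≤ (solve 2 (λ a b → :- (a :* b) := a :* :- b) refl a b))
 where 2ℚ' = 1ℚ ℚ.+ 1ℚ
... | inj₂ (h , e) | inj₁ (k , f) rewrite e | f = ∣∣-≤ (≤-by (ι 2ℚ' * (- a * b)) (0≤* (ι≥0 2ℚ') (0≤* (neg≥0 h) k)) (solve 2 (λ a b → a :* b :+ con 2ℚ' :* (:- a :* b) := :- a :* b) refl a b)) (≡⇒≤ (solve 2 (λ a b → :- (a :* b) := :- a :* b) refl a b))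
 where 2ℚ' = 1ℚ ℚ.+ 1ℚ
... | inj₂ (h , e) | inj₂ (k , f) rewrite e | f = ∣∣-≤ (≡⇒≤ (solve 2 (λ a b → a :* b := :- a :* :- b) refl a b)) (≤-by (ι 2ℚ' * (- a * - b)) (0≤* (ι≥0 2ℚ') (0≤* (neg≥0 h) (neg≥0 k))) (solve 2 (λ a b → :- (a :* b) :+ con 2ℚ' :* (:- a :* :- b) := :- a :* :- b) refl a b))
 where 2ℚ' = 1ℚ ℚ.+ 1ℚ

-- Strict positivity is phrased through `≤`, the only order that leaves the opaque block;
-- monotonicity is then just transitivity.
Pos : F → Set
Pos a = ¬ (a ≤ 0F)

pos⇒0≤ : ∀ {a} → Pos a → 0F ≤ a
pos⇒0≤ {a} p with ≤-total 0F a
... | inj₁ h = h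
... | inj₂ h = ⊥-elim (p h)

pos⇒≢0 : ∀ {a} → Pos a → a ≢ 0F
pos⇒≢0 p refl = p ≤-refl

*-inv : ∀ {a} → Pos a → a * inv a ≡ 1F
*-inv p = inv-r (pos⇒≢0 p)

Pos-≤ : ∀ {a b} → Pos a → a ≤ b → Pos b
Pos-≤ p h k = p (tr≤ h k)

Pos-1 : Pos 1F
Pos-1 = 1≰0

inv≥0 : ∀ {a} → Pos a → 0F ≤ inv a
inv≥0 {a} p with ≤-total 0F (inv a)
... | inj₁ h = h
... | inj₂ h = ⊥-elim (1≰0 (subst₂ _≤_ (*-inv p) (zeroʳ a) (*-monoˡ a (pos⇒0≤ p) h)))

Pos-inv : ∀ {a} → Pos a → Pos (inv a)
Pos-inv {a} p h = 1≰0 (subst₂ _≤_ (*-inv p) (zeroʳ a) (*-monoˡ a (pos⇒0≤ p) h))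

*-cancel-≤ : ∀ {a b} c → Pos c → c * a ≤ c * b → a ≤ b
*-cancel-≤ {a} {b} c p h = subst₂ _≤_ (k a) (k b) (*-monoˡ (inv c) (inv≥0 p) h)
 where
  k : ∀ x → inv c * (c * x) ≡ x
  k x = tr (solve 3 (λ i c x → i :* (c :* x) := (c :* i) :* x) refl (inv c) c x) (tr (cong (_* x) (*-inv p)) (1* x))

Pos-* : ∀ {a b} → Pos a → Pos b → Pos (a * b)
Pos-* {a} {b} p q h = q (*-cancel-≤ a p (subst (a * b ≤_) (sym (zeroʳ a)) h))

-- Takes the place of square roots. If b < a, then a - b and a + b are positive, and so is their
-- product a² - b².
sq-cancel : ∀ {a b} → 0F ≤ b → a * a ≤ b * b → a ≤ b
sq-cancel {a} {b} hb h with a ≤? b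
... | yes k = k
... | no nk with ≤-total a b
... | inj₁ k = k
... | inj₂ k = ⊥-elim (Pos-* {a - b} {a + b} pa pb (subst (_≤ 0F) (solve 2 (λ a b → a :* a :- b :* b := (a :- b) :* (a :+ b)) refl a b) le))
 where
  pa : Pos (a - b)
  pa q = nk (-≤0 (subst (0F ≤_) (solve 2 (λ a b → :- (a :- b) := b :- a) refl a b) (neg≥0 q)))
  pb : Pos (a + b)
  pb = Pos-≤ pa (≤-by (b + b) (0≤+ hb hb) (solve 2 (λ a b → (a :- b) :+ (b :+ b) := a :+ b) refl a b))
  le : a * a - b * b ≤ 0F
  le = subst (a * a - b * b ≤_) (-‿inverseʳ (b * b)) (+-mono h ≤-refl)

opaque
 -- A unary embedding of ℕ, made for induction; `«»-ι` connects it with the numerals that rational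
 -- arithmetic can evaluate.
 «_» : ℕ → F
 « zero » = 0F
 « suc n » = 1F + « n »

 «0» : « 0 » ≡ 0F
 «0» = refl
 «suc» : ∀ n → « suc n » ≡ 1F + « n »
 «suc» n = refl

«1» : « 1 » ≡ 1F
«1» = tr («suc» 0) (tr (cong (1F +_) «0») (+0 1F))

«+» : ∀ m n → « m +' n » ≡ « m » + « n »
«+» zero n = sym (tr (cong (_+ « n ») «0») (0+ _))
«+» (suc m) n = tr («suc» _) (tr (cong (1F +_) («+» m n)) (tr (sym (+-assoc 1F « m » « n »)) (cong (_+ « n ») (sym («suc» m)))))

«*» : ∀ m n → « m *' n » ≡ « m » * « n »
«*» zero n = tr «0» (sym (tr (cong (_* « n ») «0») (zeroˡ _)))
«*» (suc m) n = tr («+» n (m *' n)) (tr (cong (« n » +_) («*» m n)) (tr (solve 2 (λ m n → n :+ m :* n := (:1 :+ m) :* n) refl « m » « n ») (cong (_* « n ») (sym («suc» m)))))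

«»≥0 : ∀ n → 0F ≤ « n »
«»≥0 zero = ≡⇒≤ (sym «0»)
«»≥0 (suc n) = subst (0F ≤_) (sym («suc» n)) (0≤+ 0≤1 («»≥0 n))

«»-mono : ∀ {m n} → m ≤' n → « m » ≤ « n »
«»-mono {m} {n} h = ≤-by « n ∸' m » («»≥0 _) (tr (sym («+» m _)) (cong «_» (N.m+[n∸m]≡n h)))

«suc»-pos : ∀ n → Pos « suc n »
«suc»-pos n = Pos-≤ Pos-1 (subst (1F ≤_) (sym («suc» n)) (≤-by « n » («»≥0 n) refl))

«»-pos : ∀ {n} → 1 ≤' n → Pos « n »
«»-pos {suc n} _ = «suc»-pos n

«»-cancel : ∀ {m n} → « m » ≤ « n » → m ≤' n
«»-cancel {m} {n} h with m ℕ.≤? n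
... | yes k = k
... | no k = ⊥-elim (1≰0 (subst₂ _≤_ (solve 2 (λ n x → (:1 :+ n) :- n := :1) refl « n » 0F) (-‿inverseʳ « n »)
 (+-mono (tr≤ (subst (_≤ « m ») («suc» n) («»-mono (N.≰⇒> k))) h) (≤-refl { - « n »}))))

-- Finite sums.

∑ : {A : Set} → List A → (A → F) → F
∑ [] f = 0F
∑ (x ∷ xs) f = f x + ∑ xs f

∑-cong∈ : {A : Set} (xs : List A) {f g : A → F} → (∀ {x} → x ∈ xs → f x ≡ g x) → ∑ xs f ≡ ∑ xs g
∑-cong∈ [] h = refl
∑-cong∈ (x ∷ xs) h = cong2 _+_ (h (here refl)) (∑-cong∈ xs (λ m → h (there m)))

∑-cong : {A : Set} (xs : List A) {f g : A → F} → (∀ x → f x ≡ g x) → ∑ xs f ≡ ∑ xs g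
∑-cong xs h = ∑-cong∈ xs (λ {x} _ → h x)

∑-mono∈ : {A : Set} (xs : List A) {f g : A → F} → (∀ {x} → x ∈ xs → f x ≤ g x) → ∑ xs f ≤ ∑ xs g
∑-mono∈ [] h = ≤-refl
∑-mono∈ (x ∷ xs) h = +-mono (h (here refl)) (∑-mono∈ xs (λ m → h (there m)))

∑-mono : {A : Set} (xs : List A) {f g : A → F} → (∀ x → f x ≤ g x) → ∑ xs f ≤ ∑ xs g
∑-mono xs h = ∑-mono∈ xs (λ {x} _ → h x)

∑≥0∈ : {A : Set} (xs : List A) {f : A → F} → (∀ {x} → x ∈ xs → 0F ≤ f x) → 0F ≤ ∑ xs f
∑≥0∈ [] h = ≤-refl
∑≥0∈ (x ∷ xs) h = 0≤+ (h (here refl)) (∑≥0∈ xs (λ m → h (there m)))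

∑≥0 : {A : Set} (xs : List A) {f : A → F} → (∀ x → 0F ≤ f x) → 0F ≤ ∑ xs f
∑≥0 xs h = ∑≥0∈ xs (λ {x} _ → h x)

∑-0 : {A : Set} (xs : List A) → ∑ xs (λ _ → 0F) ≡ 0F
∑-0 [] = refl
∑-0 (x ∷ xs) = tr (0+ _) (∑-0 xs)

∑-zero∈ : {A : Set} (xs : List A) {f : A → F} → (∀ {x} → x ∈ xs → f x ≡ 0F) → ∑ xs f ≡ 0F
∑-zero∈ xs h = tr (∑-cong∈ xs h) (∑-0 xs)

∑-+ : {A : Set} (xs : List A) (f g : A → F) → ∑ xs (λ x → f x + g x) ≡ ∑ xs f + ∑ xs g
∑-+ [] f g = sym (0+ 0F)
∑-+ (x ∷ xs) f g = tr (cong (f x + g x +_) (∑-+ xs f g)) (solve 4 (λ a b c d → a :+ b :+ (c :+ d) := a :+ c :+ (b :+ d)) refl (f x) (g x) (∑ xs f) (∑ xs g))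

∑-* : {A : Set} (xs : List A) (c : F) (f : A → F) → ∑ xs (λ x → c * f x) ≡ c * ∑ xs f
∑-* [] c f = sym (zeroʳ c)
∑-* (x ∷ xs) c f = tr (cong (c * f x +_) (∑-* xs c f)) (sym (distribˡ c (f x) (∑ xs f)))

∑-*ʳ : {A : Set} (xs : List A) (c : F) (f : A → F) → ∑ xs (λ x → f x * c) ≡ ∑ xs f * c
∑-*ʳ xs c f = tr (∑-cong xs (λ x → *-comm (f x) c)) (tr (∑-* xs c f) (*-comm c _))

∑-neg : {A : Set} (xs : List A) (f : A → F) → ∑ xs (λ x → - f x) ≡ - ∑ xs f
∑-neg [] f = solve 0 (:0 := :- :0) refl
∑-neg (x ∷ xs) f = tr (cong (- f x +_) (∑-neg xs f)) (solve 2 (λ a b → :- a :+ :- b := :- (a :+ b)) refl (f x) (∑ xs f))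

∑-- : {A : Set} (xs : List A) (f g : A → F) → ∑ xs (λ x → f x - g x) ≡ ∑ xs f - ∑ xs g
∑-- xs f g = tr (∑-+ xs f (λ x → - g x)) (cong (∑ xs f +_) (∑-neg xs g))

∑-++ : {A : Set} (xs ys : List A) (f : A → F) → ∑ (xs ++ ys) f ≡ ∑ xs f + ∑ ys f
∑-++ [] ys f = sym (0+ _)
∑-++ (x ∷ xs) ys f = tr (cong (f x +_) (∑-++ xs ys f)) (sym (+-assoc (f x) (∑ xs f) (∑ ys f)))

∑-map : {A B : Set} (h : A → B) (xs : List A) (f : B → F) → ∑ (map h xs) f ≡ ∑ xs (λ x → f (h x))
∑-map h [] f = refl
∑-map h (x ∷ xs) f = cong (f (h x) +_) (∑-map h xs f)

∑-concatMap : {A B : Set} (h : A → List B) (xs : List A) (f : B → F) → ∑ (concatMap h xs) f ≡ ∑ xs (λ x → ∑ (h x) f)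
∑-concatMap h [] f = refl
∑-concatMap h (x ∷ xs) f = tr (∑-++ (h x) (concatMap h xs) f) (cong (∑ (h x) f +_) (∑-concatMap h xs f))

∑-swap : {A B : Set} (xs : List A) (ys : List B) (f : A → B → F) → ∑ xs (λ x → ∑ ys (f x)) ≡ ∑ ys (λ y → ∑ xs (λ x → f x y))
∑-swap [] ys f = sym (∑-0 ys)
∑-swap (x ∷ xs) ys f = tr (cong (∑ ys (f x) +_) (∑-swap xs ys f)) (sym (∑-+ ys (f x) (λ y → ∑ xs (λ x → f x y))))

∑-const : {A : Set} (xs : List A) (c : F) → ∑ xs (λ _ → c) ≡ « length xs » * c
∑-const [] c = sym (tr (cong (_* c) «0») (zeroˡ c))
∑-const (x ∷ xs) c = tr (cong (c +_) (∑-const xs c)) (tr (solve 2 (λ n c → c :+ n :* c := (:1 :+ n) :* c) refl « length xs » c) (cong (_* c) (sym («suc» _))))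

∑-∣∣ : {A : Set} (xs : List A) (f : A → F) → abs (∑ xs f) ≤ ∑ xs (λ x → abs (f x))
∑-∣∣ [] f = ∣∣-≤ ≤-refl (≡⇒≤ (solve 0 (:- :0 := :0) refl))
∑-∣∣ (x ∷ xs) f = tr≤ (∣∣-+ (f x) (∑ xs f)) (+-mono ≤-refl (∑-∣∣ xs f))

∑-term : {A : Set} {xs : List A} {f : A → F} → (∀ x → 0F ≤ f x) → ∀ {x} → x ∈ xs → f x ≤ ∑ xs f
∑-term {xs = y ∷ xs} {f} h (here refl) = ≤-by (∑ xs f) (∑≥0 xs h) refl
∑-term {xs = y ∷ xs} {f} h (there m) = tr≤ (∑-term h m) (≤-by (f y) (h y) (+-comm _ (f y)))

-- n-1 ∷ … ∷ 0
rng : ℕ → List ℕ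
rng zero = []
rng (suc n) = n ∷ rng n

∈rng : ∀ {n k} → k ∈ rng n → k <' n
∈rng {suc n} (here refl) = N.≤-refl
∈rng {suc n} (there m) = N.m<n⇒m<1+n (∈rng m)

rng∈ : ∀ {n k} → k <' n → k ∈ rng n
rng∈ {suc n} {k} (s≤s h) with k ℕ.≟ n
... | yes refl = here refl
... | no ne = there (rng∈ (N.≤∧≢⇒< h ne))

length-rng : ∀ n → length (rng n) ≡ n
length-rng zero = refl
length-rng (suc n) = cong suc (length-rng n)

opaque
 unfolding F _+_ _*_ -_ _≤_ ι «_»

 «»-ι : ∀ n → « n » ≡ ι (pos n ℚ./ 1)
 «»-ι zero = refl
 «»-ι (suc n) = tr (cong (1ℚ ℚ.+_) (tr («»-ι n) (sym (ℚP.↥p/↧p≡p (pos n ℚ./ 1))))) lem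
  where
   open ≡-Reasoning
   e : pos n ℚ./ 1 ≡ ℚ.mkℚ (pos n) 0 (Cop.sym (Cop.1-coprimeTo n))
   e = ℚP.normalize-coprime (Cop.sym (Cop.1-coprimeTo n))
   lem : 1ℚ ℚ.+ (ℚ.↥ (pos n ℚ./ 1) ℚ./ ℚ.↧ₙ (pos n ℚ./ 1)) ≡ pos (suc n) ℚ./ 1
   lem rewrite ℚP.↥p/↧p≡p (pos n ℚ./ 1) | e = cong (λ k → k ℚ./ 1) (cong (λ k → pos 1 ℤ.+ k) (ℤP.*-identityʳ (pos n)))

opaque
 unfolding F _+_ _*_ -_ _≤_ ι

 -- A fraction is at most the absolute value of its numerator, as its denominator is at least 1.
 arch : ∀ x → Σ ℕ λ n → x ≤ « n »
 arch x = ℤ.∣ ℚ.↥ x ∣ , subst (x ℚ.≤_) (sym («»-ι ℤ.∣ ℚ.↥ x ∣)) (subst (ℚ._≤ (pos ℤ.∣ ℚ.↥ x ∣ ℚ./ 1)) (ℚP.↥p/↧p≡p x) (le (ℚ.↥ x) (ℚ.↧ₙ x)))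
  where
   le : ∀ k d .{{_ : ℕ.NonZero d}} → k ℚ./ d ℚ.≤ pos ℤ.∣ k ∣ ℚ./ 1
   le k d@(suc d') = ℚP.toℚᵘ-cancel-≤ (ℚᵘP.≤-respˡ-≃ (ℚᵘP.≃-sym (ℚP.toℚᵘ-fromℚᵘ (k ℚᵘ./ d))) (ℚᵘP.≤-respʳ-≃ (ℚᵘP.≃-sym (ℚP.toℚᵘ-fromℚᵘ (pos ℤ.∣ k ∣ ℚᵘ./ 1))) (ℚᵘ.*≤* (ineq k))))
    where
     ineq : ∀ k → k ℤ.* pos 1 ℤ.≤ pos ℤ.∣ k ∣ ℤ.* pos (suc d')
     ineq (pos n) = subst₂ ℤ._≤_ (ℤP.pos-* n 1) (ℤP.pos-* n (suc d')) (ℤ.+≤+ (N.*-monoʳ-≤ n (s≤s z≤n)))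
     ineq (negsuc n) = ℤ.-≤+

-- Complex numbers, squared modulus and an ℓ¹ norm.

infix 5 _⊹_
record ℂ : Set where
 constructor _⊹_
 field
  re : F
  im : F
open ℂ public

infixl 6 _+C_ _∸C_
infixl 7 _*C_
infix 8 -C_

_+C_ _*C_ : ℂ → ℂ → ℂ
a +C b = (re a + re b) ⊹ (im a + im b)
a *C b = (re a * re b - im a * im b) ⊹ (re a * im b + im a * re b)

-C_ : ℂ → ℂ
-C a = (- re a) ⊹ (- im a)

_∸C_ : ℂ → ℂ → ℂ
a ∸C b = a +C (-C b)

real : F → ℂ
real r = r ⊹ 0F

0C 1C iC : ℂ
0C = real 0F
1C = real 1F
iC = 0F ⊹ 1F

conj : ℂ → ℂ
conj a = re a ⊹ (- im a)

private
 C-assoc : ∀ a b c → (a *C b) *C c ≡ a *C (b *C c)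
 C-assoc (a ⊹ a') (b ⊹ b') (c ⊹ c') = cong2 _⊹_
  (solve 6 (λ a a' b b' c c' → (a :* b :- a' :* b') :* c :- (a :* b' :+ a' :* b) :* c' := a :* (b :* c :- b' :* c') :- a' :* (b :* c' :+ b' :* c)) refl a a' b b' c c')
  (solve 6 (λ a a' b b' c c' → (a :* b :- a' :* b') :* c' :+ (a :* b' :+ a' :* b) :* c := a :* (b :* c' :+ b' :* c) :+ a' :* (b :* c :- b' :* c')) refl a a' b b' c c')
 C-comm : ∀ a b → a *C b ≡ b *C a
 C-comm (a ⊹ a') (b ⊹ b') = cong2 _⊹_
  (solve 4 (λ a a' b b' → a :* b :- a' :* b' := b :* a :- b' :* a') refl a a' b b')
  (solve 4 (λ a a' b b' → a :* b' :+ a' :* b := b :* a' :+ b' :* a) refl a a' b b')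
 C-dist : ∀ a b c → a *C (b +C c) ≡ a *C b +C a *C c
 C-dist (a ⊹ a') (b ⊹ b') (c ⊹ c') = cong2 _⊹_
  (solve 6 (λ a a' b b' c c' → a :* (b :+ c) :- a' :* (b' :+ c') := (a :* b :- a' :* b') :+ (a :* c :- a' :* c')) refl a a' b b' c c')
  (solve 6 (λ a a' b b' c c' → a :* (b' :+ c') :+ a' :* (b :+ c) := (a :* b' :+ a' :* b) :+ (a :* c' :+ a' :* c)) refl a a' b b' c c')
 C-idˡ : ∀ a → 1C *C a ≡ a
 C-idˡ (a ⊹ a') = cong2 _⊹_
  (solve 2 (λ a a' → :1 :* a :- :0 :* a' := a) refl a a')
  (solve 2 (λ a a' → :1 :* a' :+ :0 :* a := a') refl a a')

C-ring : IsCommutativeRing _≡_ _+C_ _*C_ -C_ 0C 1C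
C-ring = record
 { isRing = record
  { +-isAbelianGroup = record
   { isGroup = record
    { isMonoid = record
     { isSemigroup = record
      { isMagma = record { isEquivalence = isEquivalence ; ∙-cong = cong2 _+C_ }
      ; assoc = λ a b c → cong2 _⊹_ (+-assoc _ _ _) (+-assoc _ _ _) }
     ; identity = (λ a → cong2 _⊹_ (0+ _) (0+ _)) , (λ a → cong2 _⊹_ (+0 _) (+0 _)) }
    ; inverse = (λ a → cong2 _⊹_ (-‿inverseˡ _) (-‿inverseˡ _)) , (λ a → cong2 _⊹_ (-‿inverseʳ _) (-‿inverseʳ _))
    ; ⁻¹-cong = cong -C_ }
   ; comm = λ a b → cong2 _⊹_ (+-comm _ _) (+-comm _ _) }
  ; *-cong = cong2 _*C_
  ; *-assoc = C-assoc
  ; *-identity = C-idˡ , (λ a → tr (C-comm a 1C) (C-idˡ a))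
  ; distrib = C-dist , (λ a b c → tr (C-comm (b +C c) a) (tr (C-dist a b c) (cong2 _+C_ (C-comm a b) (C-comm a c))))
  }
 ; *-comm = C-comm }

Cring : CommutativeRing 0ℓ 0ℓ
Cring = record { isCommutativeRing = C-ring }

private
 ℚrawᶜ : RawRing 0ℓ 0ℓ
 ℚrawᶜ = CommutativeRing.rawRing ℚP.+-*-commutativeRing
 Cacr = ACR.fromCommutativeRing Cring
 morᶜ : ℚrawᶜ ACR.-Raw-AlmostCommutative⟶ Cacr
 morᶜ = record
  { ⟦_⟧ = λ q → real (ι q)
  ; +-homo = λ p q → cong2 _⊹_ (ι-+ p q) (sym (0+ 0F))
  ; *-homo = λ p q → cong2 _⊹_ (tr (ι-* p q) (solve 1 (λ x → x := x :- :0 :* :0) refl (ι p * ι q))) (solve 2 (λ x y → :0 := x :* :0 :+ :0 :* y) refl (ι p) (ι q))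
  ; -‿homo = λ p → cong2 _⊹_ (ι-neg p) (solve 0 (:0 := :- :0) refl)
  ; 0-homo = refl ; 1-homo = refl }
 cdecᶜ : (p q : ℚ) → Maybe (real (ι p) ≡ real (ι q))
 cdecᶜ p q with p ℚ.≟ q
 ... | yes e = just (cong (λ q → real (ι q)) e)
 ... | no _ = nothing

open RS ℚrawᶜ Cacr morᶜ cdecᶜ public using () renaming (solve to solveC; con to conC; :-_ to ⊝_; _:+_ to _∔_; _:*_ to _⨯_; _:-_ to _⊟_; _:=_ to _≔_)

open CommutativeRing Cring public using () renaming (+-assoc to +C-assoc; +-comm to +C-comm; *-assoc to *C-assoc; *-comm to *C-comm; +-identityˡ to +C-identityˡ; +-identityʳ to +C-identityʳ; *-identityˡ to *C-identityˡ; *-identityʳ to *C-identityʳ; zeroˡ to zeroCˡ; zeroʳ to zeroCʳ; distribˡ to distribCˡ; distribʳ to distribCʳ)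

nrm : ℂ → F
nrm a = re a * re a + im a * im a

nrm≥0 : ∀ a → 0F ≤ nrm a
nrm≥0 a = 0≤+ (0≤sq (re a)) (0≤sq (im a))

nrm-* : ∀ a b → nrm (a *C b) ≡ nrm a * nrm b
nrm-* (a ⊹ a') (b ⊹ b') = solve 4 (λ a a' b b' → (a :* b :- a' :* b') :* (a :* b :- a' :* b') :+ (a :* b' :+ a' :* b) :* (a :* b' :+ a' :* b) := (a :* a :+ a' :* a') :* (b :* b :+ b' :* b')) refl a a' b b'

nrm-conj : ∀ a → nrm (conj a) ≡ nrm a
nrm-conj (a ⊹ b) = solve 2 (λ a b → a :* a :+ (:- b) :* (:- b) := a :* a :+ b :* b) refl a b

conj-* : ∀ a b → conj (a *C b) ≡ conj a *C conj b
conj-* (a ⊹ a') (b ⊹ b') = cong2 _⊹_ (solve 4 (λ a a' b b' → a :* b :- a' :* b' := a :* b :- (:- a') :* (:- b')) refl a a' b b') (solve 4 (λ a a' b b' → :- (a :* b' :+ a' :* b) := a :* (:- b') :+ (:- a') :* b) refl a a' b b')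

conj-+ : ∀ a b → conj (a +C b) ≡ conj a +C conj b
conj-+ a b = cong2 _⊹_ refl (solve 2 (λ a b → :- (a :+ b) := :- a :+ :- b) refl (im a) (im b))

conj-neg : ∀ a → conj (-C a) ≡ -C conj a
conj-neg a = refl

conj-real : ∀ r → conj (real r) ≡ real r
conj-real r = cong (r ⊹_) (solve 0 (:- :0 := :0) refl)

conj-conj : ∀ a → conj (conj a) ≡ a
conj-conj a = cong (re a ⊹_) (solve 1 (λ a → :- (:- a) := a) refl (im a))

*C-conj : ∀ a → a *C conj a ≡ real (nrm a)
*C-conj (a ⊹ b) = cong2 _⊹_ (solve 2 (λ a b → a :* a :- b :* (:- b) := a :* a :+ b :* b) refl a b) (solve 2 (λ a b → a :* (:- b) :+ b :* a := :0) refl a b)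

re-real-* : ∀ r a → re (real r *C a) ≡ r * re a
re-real-* r a = solve 3 (λ r a b → r :* a :- :0 :* b := r :* a) refl r (re a) (im a)

im-real-* : ∀ r a → im (real r *C a) ≡ r * im a
im-real-* r a = solve 3 (λ r a b → r :* b :+ :0 :* a := r :* b) refl r (re a) (im a)

nrm-real : ∀ r → nrm (real r) ≡ r * r
nrm-real r = solve 1 (λ r → r :* r :+ :0 :* :0 := r :* r) refl r

real-+ : ∀ a b → real (a + b) ≡ real a +C real b
real-+ a b = cong2 _⊹_ refl (sym (0+ 0F))

real-* : ∀ a b → real (a * b) ≡ real a *C real b
real-* a b = cong2 _⊹_ (solve 2 (λ a b → a :* b := a :* b :- :0 :* :0) refl a b) (solve 2 (λ a b → :0 := a :* :0 :+ :0 :* b) refl a b)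

-- Stand-in for the modulus, which would need square roots: |a| ≤ `N1 a` ≤ √2 |a|.
N1 : ℂ → F
N1 a = (abs (re a)) + (abs (im a))

N1≥0 : ∀ a → 0F ≤ N1 a
N1≥0 a = 0≤+ (∣∣≥0 _) (∣∣≥0 _)

N1-+ : ∀ a b → N1 (a +C b) ≤ N1 a + N1 b
N1-+ a b = ≤≡ (+-mono (∣∣-+ (re a) (re b)) (∣∣-+ (im a) (im b))) (solve 4 (λ a b c d → a :+ b :+ (c :+ d) := a :+ c :+ (b :+ d)) refl _ _ _ _)

∣∣-neg : ∀ a → (abs (- a)) ≡ (abs a)
∣∣-neg a = ≤-antisym (∣∣-≤ (neg≤∣∣ a) (≡≤ (solve 1 (λ a → :- (:- a) := a) refl a) (≤∣∣ a)))
 (∣∣-≤ (≡≤ (solve 1 (λ a → a := :- (:- a)) refl a) (neg≤∣∣ (- a))) (≤∣∣ (- a)))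

N1-neg : ∀ a → N1 (-C a) ≡ N1 a
N1-neg a = cong2 _+_ (∣∣-neg _) (∣∣-neg _)

N1-conj : ∀ a → N1 (conj a) ≡ N1 a
N1-conj a = cong ((abs (re a)) +_) (∣∣-neg _)

N1-* : ∀ a b → N1 (a *C b) ≤ N1 a * N1 b
N1-* (a ⊹ a') (b ⊹ b') = ≤≡ (+-mono
 (tr≤ (∣∣-+ (a * b) (- (a' * b'))) (+-mono (∣∣-* a b) (≡≤ (∣∣-neg _) (∣∣-* a' b'))))
 (tr≤ (∣∣-+ (a * b') (a' * b)) (+-mono (∣∣-* a b') (∣∣-* a' b))))
 (solve 4 (λ a a' b b' → a :* b :+ a' :* b' :+ (a :* b' :+ a' :* b) := (a :+ a') :* (b :+ b')) refl (abs a) (abs a') (abs b) (abs b'))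

∣∣-real : ∀ {r} → 0F ≤ r → (abs r) ≡ r
∣∣-real {r} h = ≤-antisym (∣∣-≤ ≤-refl (tr≤ (≤≡ (neg-mono h) (solve 0 (:- :0 := :0) refl)) h)) (≤∣∣ r)

N1-real : ∀ {r} → 0F ≤ r → N1 (real r) ≡ r
N1-real {r} h = tr (cong2 _+_ (∣∣-real h) (∣∣-real ≤-refl)) (+0 r)

nrm≤N1² : ∀ a → nrm a ≤ N1 a * N1 a
nrm≤N1² (a ⊹ b) = ≡≤ (cong2 _+_ (sym (∣∣-sq a)) (sym (∣∣-sq b))) (≤-by (ι (1ℚ ℚ.+ 1ℚ) * ((abs a) * (abs b))) (0≤* (ι≥0 (1ℚ ℚ.+ 1ℚ)) (0≤* (∣∣≥0 a) (∣∣≥0 b)))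
 (solve 2 (λ a b → a :* a :+ b :* b :+ con (1ℚ ℚ.+ 1ℚ) :* (a :* b) := (a :+ b) :* (a :+ b)) refl (abs a) (abs b)))

N1²≤2nrm : ∀ a → N1 a * N1 a ≤ ι (1ℚ ℚ.+ 1ℚ) * nrm a
N1²≤2nrm (a ⊹ b) = ≤≡ (≤-by (((abs a) - (abs b)) * ((abs a) - (abs b))) (0≤sq _)
 (solve 2 (λ a b → (a :+ b) :* (a :+ b) :+ (a :- b) :* (a :- b) := con (1ℚ ℚ.+ 1ℚ) :* (a :* a :+ b :* b)) refl (abs a) (abs b)))
 (cong (ι (1ℚ ℚ.+ 1ℚ) *_) (cong2 _+_ (∣∣-sq a) (∣∣-sq b)))

∣re∣≤1 : ∀ {a} → nrm a ≤ 1F → (abs (re a)) ≤ 1F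
∣re∣≤1 {a} h = sq-cancel 0≤1 (≤≡ (tr≤ (≡≤ (∣∣-sq _) (≤-by (im a * im a) (0≤sq _) refl)) h) (sym (1* 1F)))

∣im∣≤1 : ∀ {a} → nrm a ≤ 1F → (abs (im a)) ≤ 1F
∣im∣≤1 {a} h = sq-cancel 0≤1 (≤≡ (tr≤ (≡≤ (∣∣-sq _) (≤-by (re a * re a) (0≤sq _) (+-comm _ _))) h) (sym (1* 1F)))

N1≤2 : ∀ {a} → nrm a ≤ 1F → N1 a ≤ ι (1ℚ ℚ.+ 1ℚ)
N1≤2 h = ≤≡ (+-mono (∣re∣≤1 h) (∣im∣≤1 h)) (sym (ι-+ 1ℚ 1ℚ))

∑C : {A : Set} → List A → (A → ℂ) → ℂ
∑C xs f = ∑ xs (λ x → re (f x)) ⊹ ∑ xs (λ x → im (f x))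

∑C-cong∈ : {A : Set} (xs : List A) {f g : A → ℂ} → (∀ {x} → x ∈ xs → f x ≡ g x) → ∑C xs f ≡ ∑C xs g
∑C-cong∈ xs h = cong2 _⊹_ (∑-cong∈ xs (λ m → cong re (h m))) (∑-cong∈ xs (λ m → cong im (h m)))

∑C-cong : {A : Set} (xs : List A) {f g : A → ℂ} → (∀ x → f x ≡ g x) → ∑C xs f ≡ ∑C xs g
∑C-cong xs h = ∑C-cong∈ xs (λ {x} _ → h x)

∑C-0 : {A : Set} (xs : List A) → ∑C xs (λ _ → 0C) ≡ 0C
∑C-0 xs = cong2 _⊹_ (∑-0 xs) (∑-0 xs)

∑C-zero∈ : {A : Set} (xs : List A) {f : A → ℂ} → (∀ {x} → x ∈ xs → f x ≡ 0C) → ∑C xs f ≡ 0C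
∑C-zero∈ xs h = tr (∑C-cong∈ xs h) (∑C-0 xs)

∑C-+ : {A : Set} (xs : List A) (f g : A → ℂ) → ∑C xs (λ x → f x +C g x) ≡ ∑C xs f +C ∑C xs g
∑C-+ xs f g = cong2 _⊹_ (∑-+ xs _ _) (∑-+ xs _ _)

∑C-* : {A : Set} (xs : List A) (c : ℂ) (f : A → ℂ) → ∑C xs (λ x → c *C f x) ≡ c *C ∑C xs f
∑C-* xs c f = cong2 _⊹_
 (tr (∑-- xs _ _) (cong2 _-_ (∑-* xs (re c) _) (∑-* xs (im c) _)))
 (tr (∑-+ xs _ _) (cong2 _+_ (∑-* xs (re c) _) (∑-* xs (im c) _)))

∑C-*ʳ : {A : Set} (xs : List A) (c : ℂ) (f : A → ℂ) → ∑C xs (λ x → f x *C c) ≡ ∑C xs f *C c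
∑C-*ʳ xs c f = tr (∑C-cong xs (λ x → *C-comm (f x) c)) (tr (∑C-* xs c f) (*C-comm c _))

∑C-++ : {A : Set} (xs ys : List A) (f : A → ℂ) → ∑C (xs ++ ys) f ≡ ∑C xs f +C ∑C ys f
∑C-++ xs ys f = cong2 _⊹_ (∑-++ xs ys _) (∑-++ xs ys _)

∑C-map : {A B : Set} (h : A → B) (xs : List A) (f : B → ℂ) → ∑C (map h xs) f ≡ ∑C xs (λ x → f (h x))
∑C-map h xs f = cong2 _⊹_ (∑-map h xs _) (∑-map h xs _)

∑C-concatMap : {A B : Set} (h : A → List B) (xs : List A) (f : B → ℂ) → ∑C (concatMap h xs) f ≡ ∑C xs (λ x → ∑C (h x) f)
∑C-concatMap h xs f = cong2 _⊹_ (∑-concatMap h xs _) (∑-concatMap h xs _)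

∑C-swap : {A B : Set} (xs : List A) (ys : List B) (f : A → B → ℂ) → ∑C xs (λ x → ∑C ys (f x)) ≡ ∑C ys (λ y → ∑C xs (λ x → f x y))
∑C-swap xs ys f = cong2 _⊹_ (∑-swap xs ys _) (∑-swap xs ys _)

∑C-conj : {A : Set} (xs : List A) (f : A → ℂ) → conj (∑C xs f) ≡ ∑C xs (λ x → conj (f x))
∑C-conj xs f = cong2 _⊹_ refl (sym (∑-neg xs _))

∑C-real : {A : Set} (xs : List A) (f : A → F) → ∑C xs (λ x → real (f x)) ≡ real (∑ xs f)
∑C-real xs f = cong2 _⊹_ refl (∑-0 xs)

∑C-N1 : {A : Set} (xs : List A) (f : A → ℂ) → N1 (∑C xs f) ≤ ∑ xs (λ x → N1 (f x))
∑C-N1 xs f = ≤≡ (+-mono (∑-∣∣ xs _) (∑-∣∣ xs _)) (sym (∑-+ xs _ _))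

-- Powers and characters of a point of the unit circle.

infixr 8 _^C_
_^C_ : ℂ → ℕ → ℂ
z ^C zero = 1C
z ^C suc n = z *C z ^C n

^C-+ : ∀ z m n → z ^C (m +' n) ≡ z ^C m *C z ^C n
^C-+ z zero n = sym (*C-identityˡ _)
^C-+ z (suc m) n = tr (cong (z *C_) (^C-+ z m n)) (sym (*C-assoc z _ _))

^C-* : ∀ z m n → z ^C (m *' n) ≡ (z ^C n) ^C m
^C-* z zero n = refl
^C-* z (suc m) n = tr (^C-+ z n (m *' n)) (cong (z ^C n *C_) (^C-* z m n))

conj-^C : ∀ z n → conj (z ^C n) ≡ conj z ^C n
conj-^C z zero = conj-real 1F
conj-^C z (suc n) = tr (conj-* z (z ^C n)) (cong (conj z *C_) (conj-^C z n))

^C-distrib : ∀ z w n → (z *C w) ^C n ≡ z ^C n *C w ^C n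
^C-distrib z w zero = sym (*C-identityˡ 1C)
^C-distrib z w (suc n) = tr (cong (z *C w *C_) (^C-distrib z w n)) (solveC 4 (λ z w a b → (z ⨯ w) ⨯ (a ⨯ b) ≔ (z ⨯ a) ⨯ (w ⨯ b)) refl z w (z ^C n) (w ^C n))

1^C : ∀ n → 1C ^C n ≡ 1C
1^C zero = refl
1^C (suc n) = tr (*C-identityˡ _) (1^C n)

nrm-^C : ∀ z → nrm z ≡ 1F → ∀ n → nrm (z ^C n) ≡ 1F
nrm-^C z h zero = tr (nrm-real 1F) (1* 1F)
nrm-^C z h (suc n) = tr (nrm-* z (z ^C n)) (tr (cong2 _*_ h (nrm-^C z h n)) (1* 1F))

module Char (z : ℂ) (unit : nrm z ≡ 1F) where

 e : ℤ → ℂ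
 e (pos n) = z ^C n
 e (negsuc n) = conj z ^C suc n

 zz̄ : z *C conj z ≡ 1C
 zz̄ = tr (*C-conj z) (cong real unit)

 e-⊖ : ∀ m n → e (m ℤ.⊖ n) ≡ z ^C m *C conj z ^C n
 e-⊖ m zero = sym (*C-identityʳ _)
 e-⊖ zero (suc n) = tr (cong e (ℤP.⊖-< {0} {suc n} (s≤s z≤n))) (sym (*C-identityˡ _))
 e-⊖ (suc m) (suc n) = tr (cong e (ℤP.[1+m]⊖[1+n]≡m⊖n m n)) (tr (e-⊖ m n)
  (tr (sym (*C-identityˡ _)) (tr (cong (_*C (z ^C m *C conj z ^C n)) (sym zz̄))
   (solveC 4 (λ a b c d → (a ⨯ b) ⨯ (c ⨯ d) ≔ (a ⨯ c) ⨯ (b ⨯ d)) refl z (conj z) (z ^C m) (conj z ^C n)))))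

 e-+ : ∀ j k → e (j ℤ.+ k) ≡ e j *C e k
 e-+ (pos m) (pos n) = ^C-+ z m n
 e-+ (pos m) (negsuc n) = e-⊖ m (suc n)
 e-+ (negsuc m) (pos n) = tr (e-⊖ n (suc m)) (*C-comm _ _)
 e-+ (negsuc m) (negsuc n) = tr (cong (λ k → conj z ^C suc k) (sym (N.+-suc m n))) (^C-+ (conj z) (suc m) (suc n))

 e-neg : ∀ k → e (ℤ.- k) ≡ conj (e k)
 e-neg (pos zero) = sym (conj-real 1F)
 e-neg (pos (suc n)) = sym (conj-^C z (suc n))
 e-neg (negsuc n) = sym (tr (conj-^C (conj z) (suc n)) (cong (_^C suc n) (conj-conj z)))

 nrm-e : ∀ k → nrm (e k) ≡ 1F
 nrm-e (pos n) = nrm-^C z unit n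
 nrm-e (negsuc n) = nrm-^C (conj z) (tr (nrm-conj z) unit) (suc n)

 ch : ℤ → ℕ → ℂ
 ch k x = e (k ℤ.* pos x)

 ch-+ : ∀ j k x → ch (j ℤ.+ k) x ≡ ch j x *C ch k x
 ch-+ j k x = tr (cong e (ℤP.*-distribʳ-+ (pos x) j k)) (e-+ (j ℤ.* pos x) (k ℤ.* pos x))

 ch-neg : ∀ k x → ch (ℤ.- k) x ≡ conj (ch k x)
 ch-neg k x = tr (cong e (sym (ℤP.neg-distribˡ-* k (pos x)))) (e-neg (k ℤ.* pos x))

 ch-- : ∀ j k x → ch (j ℤ.- k) x ≡ ch j x *C conj (ch k x)
 ch-- j k x = tr (ch-+ j (ℤ.- k) x) (cong (ch j x *C_) (ch-neg k x))

 nrm-ch : ∀ k x → nrm (ch k x) ≡ 1F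
 nrm-ch k x = nrm-e (k ℤ.* pos x)

-- Indicators, exact quadrature, Fourier coefficients.

2ℚ : ℚ
2ℚ = 1ℚ ℚ.+ 1ℚ

opaque
 iv : {P : Set} → Dec P → F
 iv (yes _) = 1F
 iv (no _) = 0F

 iv-yes : {P : Set} (d : Dec P) → P → iv d ≡ 1F
 iv-yes (yes _) _ = refl
 iv-yes (no h) p = ⊥-elim (h p)

 iv-no : {P : Set} (d : Dec P) → ¬ P → iv d ≡ 0F
 iv-no (no _) _ = refl
 iv-no (yes p) h = ⊥-elim (h p)

 iv≥0 : {P : Set} (d : Dec P) → 0F ≤ iv d
 iv≥0 (yes _) = 0≤1
 iv≥0 (no _) = ≤-refl

∑-rng-trunc : ∀ n m (f : ℕ → F) → m ≤' n → (∀ j → m ≤' j → j <' n → f j ≡ 0F) → ∑ (rng n) f ≡ ∑ (rng m) f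
∑-rng-trunc zero zero f h k = refl
∑-rng-trunc (suc n) m f h k with m ℕ.≟ suc n
... | yes refl = refl
... | no ne = tr (cong2 _+_ (k n (N.≤-pred (N.≤∧≢⇒< h ne)) N.≤-refl) refl) (tr (0+ _) (∑-rng-trunc n m f (N.≤-pred (N.≤∧≢⇒< h ne)) (λ j a b → k j a (N.m<n⇒m<1+n b))))

∑C-rng-trunc : ∀ n m (f : ℕ → ℂ) → m ≤' n → (∀ j → m ≤' j → j <' n → f j ≡ 0C) → ∑C (rng n) f ≡ ∑C (rng m) f
∑C-rng-trunc n m f h k = cong2 _⊹_ (∑-rng-trunc n m _ h (λ j l l' → cong re (k j l l'))) (∑-rng-trunc n m _ h (λ j l l' → cong im (k j l l')))

-- Diagonal plus twice the lower triangle; this turns a two-sided Fourier sum into the real part of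
-- its one-sided completion (`re-hp`).
∑-sym : ∀ n (r : ℕ → ℕ → F) → (∀ i j → r i j ≡ r j i) →
 ∑ (rng n) (λ i → ∑ (rng n) (r i)) ≡ ∑ (rng n) (λ i → r i i + (∑ (rng i) (r i) + ∑ (rng i) (r i)))
∑-sym zero r s = refl
∑-sym (suc n) r s = tr (cong2 _+_ refl (tr (∑-+ (rng n) (λ i → r i n) (λ i → ∑ (rng n) (r i))) (cong2 _+_ (∑-cong (rng n) (λ i → s i n)) (∑-sym n r s))))
 (solve 3 (λ a b c → (a :+ b) :+ (b :+ c) := (a :+ (b :+ b)) :+ c) refl (r n n) (∑ (rng n) (r n)) (∑ (rng n) (λ i → r i i + (∑ (rng i) (r i) + ∑ (rng i) (r i)))))

-- A finite probability measure that integrates all characters up to frequency W exactly. It plays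
-- the part of Haar measure, so orthogonality holds without error terms.
record Quadrature (z : ℂ) (unit : nrm z ≡ 1F) (W : ℕ) : Set where
 open Char z unit
 field
  pts : List (F × ℕ)
  w≥0 : ∀ {p} → p ∈ pts → 0F ≤ fst p
  tot : ∑ pts fst ≡ 1F
  orth : ∀ k → k ≢ pos 0 → ℤ.∣ k ∣ ≤' W → ∑C pts (λ p → real (fst p) *C ch k (snd p)) ≡ 0C

module Mean (z : ℂ) (unit : nrm z ≡ 1F) (W D : ℕ) (D≤W : D +' D ≤' W) (Q : Quadrature z unit W) where
 open Char z unit public
 open Quadrature Q

 𝔼 : (ℕ → F) → F
 𝔼 f = ∑ pts (λ p → fst p * f (snd p))

 𝔼C : (ℕ → ℂ) → ℂ
 𝔼C f = 𝔼 (λ y → re (f y)) ⊹ 𝔼 (λ y → im (f y))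

 𝔼-cong : ∀ {f g} → (∀ y → f y ≡ g y) → 𝔼 f ≡ 𝔼 g
 𝔼-cong h = ∑-cong pts (λ p → cong (fst p *_) (h (snd p)))

 𝔼-mono : ∀ {f g} → (∀ y → f y ≤ g y) → 𝔼 f ≤ 𝔼 g
 𝔼-mono h = ∑-mono∈ pts (λ {p} m → *-monoˡ (fst p) (w≥0 m) (h (snd p)))

 𝔼-const : ∀ c → 𝔼 (λ _ → c) ≡ c
 𝔼-const c = tr (∑-*ʳ pts c fst) (tr (cong (_* c) tot) (1* c))

 𝔼≥0 : ∀ {f} → (∀ y → 0F ≤ f y) → 0F ≤ 𝔼 f
 𝔼≥0 h = ≡≤ (sym (𝔼-const 0F)) (𝔼-mono h)

 𝔼-+ : ∀ f g → 𝔼 (λ y → f y + g y) ≡ 𝔼 f + 𝔼 g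
 𝔼-+ f g = tr (∑-cong pts (λ p → distribˡ (fst p) (f (snd p)) (g (snd p)))) (∑-+ pts _ _)

 𝔼-* : ∀ c f → 𝔼 (λ y → c * f y) ≡ c * 𝔼 f
 𝔼-* c f = tr (∑-cong pts (λ p → solve 3 (λ w c f → w :* (c :* f) := c :* (w :* f)) refl (fst p) c (f (snd p)))) (∑-* pts c _)

 𝔼-neg : ∀ f → 𝔼 (λ y → - f y) ≡ - 𝔼 f
 𝔼-neg f = tr (∑-cong pts (λ p → solve 2 (λ w f → w :* (:- f) := :- (w :* f)) refl (fst p) (f (snd p)))) (∑-neg pts _)

 𝔼-- : ∀ f g → 𝔼 (λ y → f y - g y) ≡ 𝔼 f - 𝔼 g
 𝔼-- f g = tr (𝔼-+ f (λ y → - g y)) (cong (𝔼 f +_) (𝔼-neg g))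

 𝔼-∑ : {A : Set} (xs : List A) (f : A → ℕ → F) → 𝔼 (λ y → ∑ xs (λ a → f a y)) ≡ ∑ xs (λ a → 𝔼 (f a))
 𝔼-∑ xs f = tr (∑-cong pts (λ p → sym (∑-* xs (fst p) (λ a → f a (snd p))))) (∑-swap pts xs _)

 𝔼-swap : (f : ℕ → ℕ → F) → 𝔼 (λ x → 𝔼 (f x)) ≡ 𝔼 (λ y → 𝔼 (λ x → f x y))
 𝔼-swap f = tr (𝔼-∑ pts (λ p x → fst p * f x (snd p))) (∑-cong pts (λ p → 𝔼-* (fst p) (λ x → f x (snd p))))

 𝔼C-cong : ∀ {f g} → (∀ y → f y ≡ g y) → 𝔼C f ≡ 𝔼C g
 𝔼C-cong h = cong2 _⊹_ (𝔼-cong (λ y → cong re (h y))) (𝔼-cong (λ y → cong im (h y)))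

 𝔼C-+ : ∀ f g → 𝔼C (λ y → f y +C g y) ≡ 𝔼C f +C 𝔼C g
 𝔼C-+ f g = cong2 _⊹_ (𝔼-+ _ _) (𝔼-+ _ _)

 𝔼C-* : ∀ c f → 𝔼C (λ y → c *C f y) ≡ c *C 𝔼C f
 𝔼C-* c f = cong2 _⊹_ (tr (𝔼-- _ _) (cong2 _-_ (𝔼-* _ _) (𝔼-* _ _))) (tr (𝔼-+ _ _) (cong2 _+_ (𝔼-* _ _) (𝔼-* _ _)))

 𝔼C-∑ : {A : Set} (xs : List A) (f : A → ℕ → ℂ) → 𝔼C (λ y → ∑C xs (λ a → f a y)) ≡ ∑C xs (λ a → 𝔼C (f a))
 𝔼C-∑ xs f = cong2 _⊹_ (𝔼-∑ xs _) (𝔼-∑ xs _)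

 𝔼C-const : ∀ c → 𝔼C (λ _ → c) ≡ c
 𝔼C-const c = cong2 _⊹_ (𝔼-const _) (𝔼-const _)

 -- The variance of `f` under the probability density `k` is nonnegative.
 jensen : (k : ℕ → F) → (∀ y → 0F ≤ k y) → 𝔼 k ≡ 1F → (f : ℕ → F) →
  𝔼 (λ y → k y * f y) * 𝔼 (λ y → k y * f y) ≤ 𝔼 (λ y → k y * (f y * f y))
 jensen k k≥0 k1 f = -≤0 (≤≡ (𝔼≥0 (λ y → 0≤* (k≥0 y) (0≤sq (f y - c)))) eq)
  where
   c = 𝔼 (λ y → k y * f y)
   eq : 𝔼 (λ y → k y * ((f y - c) * (f y - c))) ≡ 𝔼 (λ y → k y * (f y * f y)) - c * c
   eq = tr (𝔼-cong (λ y → solve 3 (λ k f c → k :* ((f :- c) :* (f :- c)) := k :* (f :* f) :+ ((:- (c :+ c)) :* (k :* f) :+ (c :* c) :* k)) refl (k y) (f y) c))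
    (tr (𝔼-+ _ _) (tr (cong (𝔼 (λ y → k y * (f y * f y)) +_) (tr (𝔼-+ _ _) (cong2 _+_ (𝔼-* _ _) (tr (𝔼-* _ _) (cong ((c * c) *_) k1)))))
     (solve 2 (λ a c → a :+ ((:- (c :+ c)) :* c :+ (c :* c) :* :1) := a :- c :* c) refl (𝔼 (λ y → k y * (f y * f y))) c)))

 𝔼-ch : ∀ k → ℤ.∣ k ∣ ≤' W → 𝔼C (ch k) ≡ real (iv (k ℤ.≟ pos 0))
 𝔼-ch k h with k ℤ.≟ pos 0
 ... | yes refl = tr (𝔼C-const 1C) (cong real (sym (iv-yes _ refl)))
 ... | no ne = tr (cong2 _⊹_ (∑-cong pts (λ p → sym (re-real-* _ _))) (∑-cong pts (λ p → sym (im-real-* _ _)))) (tr (orth k ne h) (cong real (sym (iv-no _ ne))))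

 -- As D + D ≤ W, the difference of two such frequencies is still resolved by the quadrature.
 Small : ℤ → Set
 Small k = (ℤ.- pos D ℤ.≤ k) × (k ℤ.≤ pos D)

 Small-abs : ∀ {k} → Small k → ℤ.∣ k ∣ ≤' D
 Small-abs {pos n} (p , q) = ℤP.drop‿+≤+ q
 Small-abs {negsuc n} (p , q) = ℤP.drop‿+≤+ (subst (pos (suc n) ℤ.≤_) (ℤP.neg-involutive (pos D)) (ℤP.neg-mono-≤ p))

 Small-- : ∀ {j k} → Small j → Small k → ℤ.∣ j ℤ.- k ∣ ≤' W
 Small-- {j} {k} p q = N.≤-trans (ℤP.∣i-j∣≤∣i∣+∣j∣ j k) (N.≤-trans (N.+-mono-≤ (Small-abs p) (Small-abs q)) D≤W)

 coef : ℤ → (ℕ → ℂ) → ℂ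
 coef k f = 𝔼C (λ y → f y *C conj (ch k y))

 coef-ch : ∀ j k → Small j → Small k → coef k (ch j) ≡ real (iv (j ℤ.≟ k))
 coef-ch j k p q = tr (𝔼C-cong (λ y → sym (ch-- j k y))) (tr (𝔼-ch (j ℤ.- k) (Small-- {j} {k} p q)) (cong real lem))
  where
   lem : iv ((j ℤ.- k) ℤ.≟ pos 0) ≡ iv (j ℤ.≟ k)
   lem with j ℤ.≟ k
   ... | yes refl = tr (iv-yes _ (ℤP.i≡j⇒i-j≡0 {j} {j} refl)) (sym (iv-yes _ refl))
   ... | no ne = tr (iv-no _ (λ e → ne (ℤP.i-j≡0⇒i≡j j k e))) (sym (iv-no _ ne))

 coef-cong : ∀ k {f g} → (∀ y → f y ≡ g y) → coef k f ≡ coef k g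
 coef-cong k h = 𝔼C-cong (λ y → cong (_*C conj (ch k y)) (h y))

 coef-∑ : {A : Set} (k : ℤ) (xs : List A) (c : A → ℂ) (f : A → ℕ → ℂ) → coef k (λ y → ∑C xs (λ a → c a *C f a y)) ≡ ∑C xs (λ a → c a *C coef k (f a))
 coef-∑ k xs c f = tr (𝔼C-cong (λ y → tr (sym (∑C-*ʳ xs (conj (ch k y)) _)) (∑C-cong xs (λ a → *C-assoc (c a) (f a y) (conj (ch k y))))))
  (tr (𝔼C-∑ xs _) (∑C-cong xs (λ a → 𝔼C-* (c a) _)))

 -- trigonometric polynomials with frequencies in [lo, hi] and ℓ¹-norm of the coefficients at most ℓ
 record TP (lo hi : ℤ) (ℓ : F) (f : ℕ → ℂ) : Set where
  field
   L : List (ℂ × ℤ)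
   freq : ∀ {t} → t ∈ L → (lo ℤ.≤ snd t) × (snd t ℤ.≤ hi)
   ℓ1 : ∑ L (λ t → N1 (fst t)) ≤ ℓ
   ev : ∀ x → f x ≡ ∑C L (λ t → fst t *C ch (snd t) x)
 open TP public

 TP-cong : ∀ {lo hi ℓ f g} → (∀ x → g x ≡ f x) → TP lo hi ℓ f → TP lo hi ℓ g
 TP-cong h P = record { L = L P ; freq = freq P ; ℓ1 = ℓ1 P ; ev = λ x → tr (h x) (ev P x) }

 TP-weaken : ∀ {lo hi lo' hi' ℓ f} → lo' ℤ.≤ lo → hi ℤ.≤ hi' → TP lo hi ℓ f → TP lo' hi' ℓ f
 TP-weaken p q P = record { L = L P ; freq = λ m → ℤP.≤-trans p (fst (freq P m)) , ℤP.≤-trans (snd (freq P m)) q ; ℓ1 = ℓ1 P ; ev = ev P }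

 TP-+ : ∀ {lo hi ℓ ℓ' f g} → TP lo hi ℓ f → TP lo hi ℓ' g → TP lo hi (ℓ + ℓ') (λ x → f x +C g x)
 TP-+ P Q = record
  { L = L P ++ L Q
  ; freq = fr
  ; ℓ1 = ≡≤ (∑-++ (L P) (L Q) _) (+-mono (ℓ1 P) (ℓ1 Q))
  ; ev = λ x → tr (cong2 _+C_ (ev P x) (ev Q x)) (sym (∑C-++ (L P) (L Q) _)) }
  where
   fr : ∀ {t} → t ∈ L P ++ L Q → _
   fr m with ∈-++⁻ (L P) m
   ... | inj₁ q = freq P q
   ... | inj₂ q = freq Q q

 TP-mono : ∀ {lo hi k ℓ} (c : ℂ) → lo ℤ.≤ k → k ℤ.≤ hi → N1 c ≤ ℓ → TP lo hi ℓ (λ x → c *C ch k x)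
 TP-mono {k = k} c p q n = record
  { L = (c , k) ∷ []
  ; freq = λ { (here refl) → p , q }
  ; ℓ1 = ≡≤ (+0 _) n
  ; ev = λ x → sym (+C-identityʳ _) }

 TP-const : ∀ {lo hi} (c : ℂ) → lo ℤ.≤ pos 0 → pos 0 ℤ.≤ hi → TP lo hi (N1 c) (λ _ → c)
 TP-const c p q = TP-cong (λ x → sym (*C-identityʳ c)) (TP-mono c p q ≤-refl)

 TP-∑ : {A : Set} (xs : List A) (c : A → ℂ) (k : A → ℤ) {lo hi : ℤ} {ℓ : F} →
  (∀ {a} → a ∈ xs → (lo ℤ.≤ k a) × (k a ℤ.≤ hi)) → ∑ xs (λ a → N1 (c a)) ≤ ℓ → TP lo hi ℓ (λ x → ∑C xs (λ a → c a *C ch (k a) x))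
 TP-∑ xs c k h n = record
  { L = map (λ a → c a , k a) xs
  ; freq = λ m → let (a , m' , e) = ∈-map⁻ _ m in subst (λ t → (_ ℤ.≤ snd t) × (snd t ℤ.≤ _)) (sym e) (h m')
  ; ℓ1 = ≡≤ (∑-map _ xs _) n
  ; ev = λ x → sym (∑C-map _ xs _) }

 TP-* : ∀ {lo hi lo' hi' ℓ ℓ' f g} → 0F ≤ ℓ → TP lo hi ℓ f → TP lo' hi' ℓ' g → TP (lo ℤ.+ lo') (hi ℤ.+ hi') (ℓ * ℓ') (λ x → f x *C g x)
 TP-* {ℓ = ℓ} {ℓ'} {f} {g} ℓ≥0 P Q = record
  { L = concatMap row (L P)
  ; freq = fr
  ; ℓ1 = ≡≤ (∑-concatMap row (L P) _) (tr≤ (∑-mono (L P) (λ s → ≡≤ (∑-map _ (L Q) _) (tr≤ (∑-mono (L Q) (λ t → N1-* (fst s) (fst t))) (≡≤ (∑-* (L Q) (N1 (fst s)) _) ≤-refl))))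
   (≡≤ (∑-*ʳ (L P) _ _) (*-mono (∑≥0 (L P) (λ t → N1≥0 _)) (∑≥0 (L Q) (λ t → N1≥0 _)) (ℓ1 P) (ℓ1 Q))))
  ; ev = λ x → tr (cong2 _*C_ (ev P x) (ev Q x)) (sym (tr (∑C-concatMap row (L P) _) (tr (∑C-cong (L P) (λ s → tr (∑C-map _ (L Q) _) (tr (∑C-cong (L Q) (λ t → tr (cong (fst s *C fst t *C_) (ch-+ (snd s) (snd t) x)) (solveC 4 (λ a b c d → (a ⨯ b) ⨯ (c ⨯ d) ≔ (a ⨯ c) ⨯ (b ⨯ d)) refl (fst s) (fst t) (ch (snd s) x) (ch (snd t) x)))) (∑C-* (L Q) _ _)))) (∑C-*ʳ (L P) _ _))))
  }
  where
   row : ℂ × ℤ → List (ℂ × ℤ)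
   row s = map (λ t → (fst s *C fst t , snd s ℤ.+ snd t)) (L Q)
   go : ∀ (xs : List (ℂ × ℤ)) {t} → t ∈ concatMap row xs → Σ (ℂ × ℤ) λ s → s ∈ xs × t ∈ row s
   go (s ∷ xs) m with ∈-++⁻ (row s) m
   ... | inj₁ q = s , here refl , q
   ... | inj₂ q = let (s' , m' , r) = go xs q in s' , there m' , r
   fr : ∀ {t} → t ∈ concatMap row (L P) → _
   fr m with go (L P) m
   ... | s , ms , mt with ∈-map⁻ _ mt
   ... | t , mt' , refl = ℤP.+-mono-≤ (fst (freq P ms)) (fst (freq Q mt')) , ℤP.+-mono-≤ (snd (freq P ms)) (snd (freq Q mt'))

 TP-coef : ∀ {lo hi ℓ f} k → Small lo → Small hi → Small k → (¬ (lo ℤ.≤ k) ⊎ ¬ (k ℤ.≤ hi)) → TP lo hi ℓ f → coef k f ≡ 0C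
 TP-coef {lo} {hi} k sl sh sk out P = tr (coef-cong k (ev P)) (tr (coef-∑ k (L P) fst (λ t → ch (snd t)))
  (∑C-zero∈ (L P) (λ {t} m → tr (cong (fst t *C_) (tr (coef-ch (snd t) k (between (freq P m)) sk) (cong real (iv-no _ (λ e → no' out (subst (λ j → (lo ℤ.≤ j) × (j ℤ.≤ hi)) e (freq P m))))))) (zeroCʳ _))))
  where
   between : ∀ {j} → (lo ℤ.≤ j) × (j ℤ.≤ hi) → Small j
   between (p , q) = ℤP.≤-trans (fst sl) p , ℤP.≤-trans q (snd sh)
   no' : (¬ (lo ℤ.≤ k) ⊎ ¬ (k ℤ.≤ hi)) → (lo ℤ.≤ k) × (k ℤ.≤ hi) → ⊥
   no' (inj₁ h) (p , q) = h p
   no' (inj₂ h) (p , q) = h q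

∑-rng-mono : ∀ m n (f : ℕ → F) → (∀ j → 0F ≤ f j) → m ≤' n → ∑ (rng m) f ≤ ∑ (rng n) f
∑-rng-mono m zero f h z≤n = ≤-refl
∑-rng-mono m (suc n) f h k with m ℕ.≟ suc n
... | yes refl = ≤-refl
... | no ne = tr≤ (∑-rng-mono m n f h (N.≤-pred (N.≤∧≢⇒< k ne))) (≤-by (f n) (h n) (+-comm _ _))

∑C-single : ∀ n i (g : ℕ → ℂ) → i <' n → (∀ j → j ≢ i → g j ≡ 0C) → ∑C (rng n) g ≡ g i
∑C-single n i g h z = tr (∑C-rng-trunc n (suc i) g h (λ j l _ → z j (λ e → N.<-irrefl (sym e) l)))
 (tr (cong (g i +C_) (∑C-zero∈ (rng i) (λ {j} m → z j (λ e → N.<-irrefl e (∈rng m))))) (+C-identityʳ _))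

half : ℚ
half = ℚ.½

-- Fejér kernels.

module Kernel (z : ℂ) (unit : nrm z ≡ 1F) (W D : ℕ) (D≤W : D +' D ≤' W) (Q : Quadrature z unit W) where
 open Mean z unit W D D≤W Q public

 module Fejer (X : ℕ) (X≥1 : 1 ≤' X) (X≤D : X ≤' D) where

  iX : F
  iX = inv « X »

  iX≥0 : 0F ≤ iX
  iX≥0 = inv≥0 («»-pos X≥1)

  XiX : « X » * iX ≡ 1F
  XiX = *-inv («»-pos X≥1)

  dif : ℕ → ℕ → ℤ
  dif i j = pos i ℤ.- pos j

  dif-small : ∀ {i j} → i <' X → j <' X → Small (dif i j)
  dif-small {i} {j} p q =
   ℤP.≤-trans (ℤP.neg-mono-≤ (ℤ.+≤+ (N.≤-trans (N.<⇒≤ q) X≤D))) (subst (ℤ._≤ dif i j) (ℤP.+-identityˡ _) (ℤP.+-monoˡ-≤ (ℤ.- pos j) (ℤ.+≤+ (z≤n {i})))) ,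
   ℤP.≤-trans (subst (dif i j ℤ.≤_) (ℤP.+-identityʳ _) (ℤP.+-monoʳ-≤ (pos i) (ℤP.neg-mono-≤ {pos 0} {pos j} (ℤ.+≤+ z≤n)))) (ℤ.+≤+ (N.≤-trans (N.<⇒≤ p) X≤D))

  Dk : ℕ → ℕ → ℂ
  Dk x y = ∑C (rng X) (λ j → ch (pos j) x *C conj (ch (pos j) y))

  -- The Fejér kernel as a normalised squared modulus of a Dirichlet sum, which makes positivity
  -- free.
  Ker : ℕ → ℕ → F
  Ker x y = iX * nrm (Dk x y)

  Ker≥0 : ∀ x y → 0F ≤ Ker x y
  Ker≥0 x y = 0≤* iX≥0 (nrm≥0 _)

  Ker-sym : ∀ x y → Ker x y ≡ Ker y x
  Ker-sym x y = cong (iX *_) (tr (sym (nrm-conj (Dk x y))) (cong nrm (tr (∑C-conj (rng X) _) (∑C-cong (rng X) (λ j → tr (conj-* (ch (pos j) x) (conj (ch (pos j) y))) (tr (cong (conj (ch (pos j) x) *C_) (conj-conj _)) (*C-comm _ _)))))))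

  cc : ℕ → ℕ → ℕ → ℕ → ℂ
  cc x y i j = ch (dif i j) x *C conj (ch (dif i j) y)

  Ker-form : ∀ x y → real (Ker x y) ≡ real iX *C ∑C (rng X) (λ i → ∑C (rng X) (cc x y i))
  Ker-form x y = tr (real-* iX _) (cong (real iX *C_) (tr (sym (*C-conj (Dk x y))) (tr (cong (Dk x y *C_) (∑C-conj (rng X) _))
   (tr (sym (∑C-*ʳ (rng X) _ _)) (∑C-cong (rng X) (λ i → tr (sym (∑C-* (rng X) _ _)) (∑C-cong (rng X) (λ j → term i j))))))))
   where
    term : ∀ i j → (ch (pos i) x *C conj (ch (pos i) y)) *C conj (ch (pos j) x *C conj (ch (pos j) y)) ≡ cc x y i j
    term i j = tr (cong (ch (pos i) x *C conj (ch (pos i) y) *C_) (tr (conj-* (ch (pos j) x) (conj (ch (pos j) y))) (cong (conj (ch (pos j) x) *C_) (conj-conj _))))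
     (tr (solveC 4 (λ a b c d → (a ⨯ b) ⨯ (c ⨯ d) ≔ (a ⨯ c) ⨯ (b ⨯ d)) refl (ch (pos i) x) (conj (ch (pos i) y)) (conj (ch (pos j) x)) (ch (pos j) y))
      (cong2 _*C_ (sym (ch-- (pos i) (pos j) x)) (sym (tr (cong conj (ch-- (pos i) (pos j) y)) (tr (conj-* (ch (pos i) y) (conj (ch (pos j) y))) (cong (conj (ch (pos i) y) *C_) (conj-conj _)))))))

  K : (ℕ → ℂ) → ℕ → ℂ
  K G x = 𝔼C (λ y → real (Ker x y) *C G y)

  K-form : ∀ G x → K G x ≡ real iX *C ∑C (rng X) (λ i → ∑C (rng X) (λ j → ch (dif i j) x *C coef (dif i j) G))
  K-form G x = tr (𝔼C-cong (λ y → tr (cong (_*C G y) (Ker-form x y)) (*C-assoc (real iX) _ (G y))))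
   (tr (𝔼C-* (real iX) _) (cong (real iX *C_) (tr (𝔼C-cong (λ y → tr (sym (∑C-*ʳ (rng X) (G y) _)) (∑C-cong (rng X) (λ i → sym (∑C-*ʳ (rng X) (G y) _)))))
    (tr (𝔼C-∑ (rng X) _) (∑C-cong (rng X) (λ i → tr (𝔼C-∑ (rng X) _) (∑C-cong (rng X) (λ j → tr (𝔼C-cong (λ y → solveC 3 (λ a b g → (a ⨯ b) ⨯ g ≔ a ⨯ (g ⨯ b)) refl (ch (dif i j) x) (conj (ch (dif i j) y)) (G y))) (𝔼C-* (ch (dif i j) x) _)))))))))

  K-cong : ∀ {f g} x → (∀ y → f y ≡ g y) → K f x ≡ K g x
  K-cong x h = 𝔼C-cong (λ y → cong (real (Ker x y) *C_) (h y))

  K-ch : ∀ a → Small (pos a) → ∀ x → K (ch (pos a)) x ≡ real (iX * ∑ (rng X) (λ i → ∑ (rng X) (λ j → iv (pos a ℤ.≟ dif i j)))) *C ch (pos a) x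
  K-ch a sa x = tr (K-form (ch (pos a)) x) (tr (cong (real iX *C_) (tr (∑C-cong∈ (rng X) (λ {i} mi → tr (∑C-cong∈ (rng X) (λ {j} mj → term (∈rng mi) (∈rng mj))) (tr (∑C-*ʳ (rng X) _ _) (cong (_*C ch (pos a) x) (∑C-real (rng X) _))))) (tr (∑C-*ʳ (rng X) _ _) (cong (_*C ch (pos a) x) (∑C-real (rng X) _)))))
   (tr (sym (*C-assoc (real iX) _ _)) (cong (_*C ch (pos a) x) (sym (real-* iX _)))))
   where
    term : ∀ {i j} → i <' X → j <' X → ch (dif i j) x *C coef (dif i j) (ch (pos a)) ≡ real (iv (pos a ℤ.≟ dif i j)) *C ch (pos a) x
    term {i} {j} p q = tr (cong (ch (dif i j) x *C_) (coef-ch (pos a) (dif i j) sa (dif-small p q))) (lem (pos a ℤ.≟ dif i j))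
     where
      lem : (d : Dec (pos a ≡ dif i j)) → ch (dif i j) x *C real (iv d) ≡ real (iv d) *C ch (pos a) x
      lem (yes e) = tr (*C-comm _ _) (cong (λ k → real (iv (yes e)) *C ch k x) (sym e))
      lem (no ne) = tr (cong (λ t → ch (dif i j) x *C real t) (iv-no (no ne) ne)) (tr (zeroCʳ _) (sym (tr (cong (λ t → real t *C ch (pos a) x) (iv-no (no ne) ne)) (zeroCˡ _))))

  -- The Fejér weight 1 - a/X, obtained by counting the pairs (i, j) with i - j = a.
  wt : ℕ → F
  wt a = iX * ∑ (rng X) (λ i → ∑ (rng X) (λ j → iv (pos a ℤ.≟ dif i j)))

  wt≥½ : ∀ a → a +' a ≤' X → ι half ≤ wt a
  wt≥½ a h = *-cancel-≤ « X » («»-pos X≥1) (≤≡ (tr≤ step (∑-count)) (sym (tr (sym (*-assoc « X » iX _)) (tr (cong (_* S) XiX) (1* S)))))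
   where
    S = ∑ (rng X) (λ i → ∑ (rng X) (λ j → iv (pos a ℤ.≟ dif i j)))
    a≤X : a ≤' X
    a≤X = N.≤-trans (N.m≤m+n a a) h
    step : « X » * ι half ≤ « X ∸' a »
    step = tr≤ (≡≤ (cong (λ t → « t » * ι half) (sym (N.m∸n+n≡m a≤X))) (≡≤ (cong (_* ι half) («+» (X ∸' a) a))
     (≤≡ (*-monoʳ (ι half) (ι≥0 half) (+-mono ≤-refl («»-mono {a} {X ∸' a} (N.m+n≤o⇒m≤o∸n a h)))) (solve 1 (λ t → (t :+ t) :* con half := t) refl « X ∸' a »)))) ≤-refl
    ∑-count : « X ∸' a » ≤ S
    ∑-count = tr≤ (≡≤ (tr (sym (*1 _)) (tr (cong (λ t → « t » * 1F) (sym (length-rng (X ∸' a)))) (sym (∑-const (rng (X ∸' a)) 1F))))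
     (∑-mono∈ (rng (X ∸' a)) (λ {j} m → one j (∈rng m))))
     (≤≡ (∑-rng-mono (X ∸' a) X (λ j → ∑ (rng X) (λ i → iv (pos a ℤ.≟ dif i j))) (λ j → ∑≥0 (rng X) (λ i → iv≥0 _)) (N.m∸n≤m X a))
      (∑-swap (rng X) (rng X) (λ j i → iv (pos a ℤ.≟ dif i j))))
     where
      one : ∀ j → j <' X ∸' a → 1F ≤ ∑ (rng X) (λ i → iv (pos a ℤ.≟ dif i j))
      one j l = ≡≤ (sym (iv-yes (pos a ℤ.≟ dif (a +' j) j) (sym (tr (cong (ℤ._- pos j) (ℤP.pos-+ a j)) (tr (ℤP.+-assoc (pos a) (pos j) (ℤ.- pos j)) (tr (cong (λ t → pos a ℤ.+ t) (ℤP.+-inverseʳ (pos j))) (ℤP.+-identityʳ (pos a))))))))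
       (∑-term {f = λ i → iv (pos a ℤ.≟ dif i j)} (λ i → iv≥0 _) (rng∈ (subst (a +' j <'_) (N.m+[n∸m]≡n a≤X) (N.+-monoʳ-< a l))))

  Ker-mass : ∀ x → 𝔼 (Ker x) ≡ 1F
  Ker-mass x = tr (cong re (tr (𝔼C-cong {λ y → real (Ker x y)} {λ y → real (Ker x y) *C 1C} (λ y → sym (*C-identityʳ _))) (tr (K-ch 0 (ℤP.neg-mono-≤ {pos 0} {pos D} (ℤ.+≤+ z≤n) , ℤ.+≤+ z≤n) x) (*C-identityʳ _)))) eq
   where
    eq : iX * ∑ (rng X) (λ i → ∑ (rng X) (λ j → iv (pos 0 ℤ.≟ dif i j))) ≡ 1F
    eq = tr (cong (iX *_) (tr (∑-cong∈ (rng X) (λ {i} m → cong re (tr (∑C-single X i (λ j → real (iv (pos 0 ℤ.≟ dif i j))) (∈rng m) (λ j ne → cong real (iv-no (pos 0 ℤ.≟ dif i j) (λ e → ne (ℤP.+-injective (sym (ℤP.i-j≡0⇒i≡j (pos i) (pos j) (sym e)))))))) (cong real (iv-yes (pos 0 ℤ.≟ dif i i) (sym (ℤP.+-inverseʳ (pos i)))))))) (tr (∑-const (rng X) 1F) (tr (*1 _) (cong «_» (length-rng X)))))) (tr (*-comm iX _) XiX)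

  K-N1 : ∀ G x → N1 (K G x) ≤ 𝔼 (λ y → Ker x y * N1 (G y))
  K-N1 G x = ≤≡ (∑C-N1' (λ y → real (Ker x y) *C G y)) (𝔼-cong (λ y → tr (cong2 _+_ (abs-scale (re-real-* (Ker x y) (G y))) (abs-scale (im-real-* (Ker x y) (G y)))) (sym (distribˡ (Ker x y) _ _))))
   where
    abs-𝔼 : ∀ f → abs (𝔼 f) ≤ 𝔼 (λ y → abs (f y))
    abs-𝔼 f = ∣∣-≤ (𝔼-mono (λ y → ≤∣∣ (f y))) (≡≤ (sym (𝔼-neg f)) (𝔼-mono (λ y → neg≤∣∣ (f y))))
    ∑C-N1' : ∀ f → N1 (𝔼C f) ≤ 𝔼 (λ y → N1 (f y))
    ∑C-N1' f = ≤≡ (+-mono (abs-𝔼 _) (abs-𝔼 _)) (sym (𝔼-+ _ _))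
    abs-scale : ∀ {y a b} → a ≡ Ker x y * b → abs a ≡ Ker x y * abs b
    abs-scale {y} {a} {b} refl = ≤-antisym (≤≡ (∣∣-* (Ker x y) b) (cong (_* abs b) (∣∣-real (Ker≥0 x y)))) (back (∣∣-cases b))
     where
      back : (0F ≤ b × abs b ≡ b) ⊎ (b ≤ 0F × abs b ≡ - b) → Ker x y * abs b ≤ abs (Ker x y * b)
      back (inj₁ (_ , e)) = ≡≤ (cong (Ker x y *_) e) (≤∣∣ _)
      back (inj₂ (_ , e)) = ≡≤ (tr (cong (Ker x y *_) e) (solve 2 (λ k b → k :* (:- b) := :- (k :* b)) refl (Ker x y) b)) (neg≤∣∣ _)

  K-nrm : ∀ G x → nrm (K G x) ≤ 𝔼 (λ y → Ker x y * nrm (G y))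
  K-nrm G x = ≤≡ (+-mono (part (λ y → re (G y)) (λ y → re-real-* (Ker x y) (G y))) (part (λ y → im (G y)) (λ y → im-real-* (Ker x y) (G y))))
   (tr (sym (𝔼-+ _ _)) (𝔼-cong (λ y → sym (distribˡ (Ker x y) _ _))))
   where
    part : ∀ (g : ℕ → F) {h : ℕ → F} → (∀ y → h y ≡ Ker x y * g y) → 𝔼 h * 𝔼 h ≤ 𝔼 (λ y → Ker x y * (g y * g y))
    part g e = ≡≤ (cong2 _*_ (𝔼-cong e) (𝔼-cong e)) (jensen (Ker x) (Ker≥0 x) (Ker-mass x) g)

  K-L2 : ∀ (g : ℕ → F) → 𝔼 (λ x → 𝔼 (λ y → Ker x y * g y)) ≡ 𝔼 g
  K-L2 g = tr (𝔼-swap (λ x y → Ker x y * g y)) (𝔼-cong (λ y → tr (𝔼-cong (λ x → tr (cong (_* g y) (Ker-sym x y)) (*-comm _ _))) (tr (𝔼-* (g y) (Ker y)) (tr (cong (g y *_) (Ker-mass y)) (*1 (g y))))))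

  K-mono : ∀ {f g : ℕ → F} x → (∀ y → f y ≤ g y) → 𝔼 (λ y → Ker x y * f y) ≤ 𝔼 (λ y → Ker x y * g y)
  K-mono x h = 𝔼-mono (λ y → *-monoˡ (Ker x y) (Ker≥0 x y) (h y))

  K-≤ : ∀ {f : ℕ → F} {c} x → (∀ y → f y ≤ c) → 𝔼 (λ y → Ker x y * f y) ≤ c
  K-≤ {f} {c} x h = ≤≡ (K-mono x h) (tr (𝔼-cong (λ y → *-comm (Ker x y) c)) (tr (𝔼-* c (Ker x)) (tr (cong (c *_) (Ker-mass x)) (*1 c))))

-- Real powers and geometric sums.

infixr 8 _^F_
_^F_ : F → ℕ → F
a ^F zero = 1F
a ^F suc n = a * a ^F n

^F≥0 : ∀ {a} n → 0F ≤ a → 0F ≤ a ^F n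
^F≥0 zero h = 0≤1
^F≥0 (suc n) h = 0≤* h (^F≥0 n h)

^F-mono : ∀ {a b} n → 0F ≤ a → a ≤ b → a ^F n ≤ b ^F n
^F-mono zero h k = ≤-refl
^F-mono (suc n) h k = *-mono h (^F≥0 n h) k (^F-mono n h k)

^F-≤1 : ∀ {a} n → 0F ≤ a → a ≤ 1F → a ^F n ≤ 1F
^F-≤1 {a} n h k = ≤≡ (^F-mono n h k) (one n)
 where
  one : ∀ n → 1F ^F n ≡ 1F
  one zero = refl
  one (suc n) = tr (1* _) (one n)

^F-* : ∀ a b n → (a * b) ^F n ≡ a ^F n * b ^F n
^F-* a b zero = sym (1* 1F)
^F-* a b (suc n) = tr (cong (a * b *_) (^F-* a b n)) (solve 4 (λ a b c d → (a :* b) :* (c :* d) := (a :* c) :* (b :* d)) refl a b (a ^F n) (b ^F n))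

bernoulli : ∀ {y} n → 0F ≤ y → 1F + « n » * y ≤ (1F + y) ^F n
bernoulli {y} zero h = ≡⇒≤ (tr (cong (λ t → 1F + t * y) «0») (solve 1 (λ y → :1 :+ :0 :* y := :1) refl y))
bernoulli {y} (suc n) h = tr≤ (≡≤ (cong (λ t → 1F + t * y) («suc» n)) (≤-by (« n » * (y * y)) (0≤* («»≥0 n) (0≤sq y)) (solve 2 (λ n y → :1 :+ (:1 :+ n) :* y :+ n :* (y :* y) := (:1 :+ y) :* (:1 :+ n :* y)) refl « n » y)))
 (*-monoˡ (1F + y) (0≤+ 0≤1 h) (bernoulli n h))

-- (1 - y)ⁿ (1 + y)ⁿ = (1 - y²)ⁿ ≤ 1, with Bernoulli's inequality for the second factor. This
-- replaces exp(-t) ≤ 1/(1 + t).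
decay : ∀ {y} n → 0F ≤ y → y ≤ 1F → (1F - y) ^F n * (1F + « n » * y) ≤ 1F
decay {y} n h k = tr≤ (*-monoˡ _ (^F≥0 n (0≤- k)) (bernoulli n h))
 (≡≤ (sym (^F-* (1F - y) (1F + y) n)) (^F-≤1 n (≤≡ (0≤* (0≤- k) (0≤+ 0≤1 h)) refl)
  (≤-by (y * y) (0≤sq y) (solve 1 (λ y → (:1 :- y) :* (:1 :+ y) :+ y :* y := :1) refl y))))

nrm-^ : ∀ a n → nrm (a ^C n) ≡ nrm a ^F n
nrm-^ a zero = tr (nrm-real 1F) (1* 1F)
nrm-^ a (suc n) = tr (nrm-* a (a ^C n)) (cong (nrm a *_) (nrm-^ a n))

nrm-+≤ : ∀ a b → nrm (a +C b) ≤ ι 2ℚ * (nrm a + nrm b)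
nrm-+≤ (a ⊹ a') (b ⊹ b') = ≤-by ((a - b) * (a - b) + (a' - b') * (a' - b')) (0≤+ (0≤sq _) (0≤sq _))
 (solve 4 (λ a a' b b' → ((a :+ b) :* (a :+ b) :+ (a' :+ b') :* (a' :+ b')) :+ ((a :- b) :* (a :- b) :+ (a' :- b') :* (a' :- b')) := :2 :* ((a :* a :+ a' :* a') :+ (b :* b :+ b' :* b'))) refl a a' b b')

nrm-geom : ∀ q n → nrm q ≤ 1F → nrm (∑C (rng n) (λ k → q ^C k)) ≤ « n » * « n »
nrm-geom q zero h = ≡⇒≤ (tr (nrm-real 0F) (sym (cong2 _*_ «0» «0»)))
nrm-geom q (suc n) h = ≤≡ (tri (q ^C n) (∑C (rng n) (λ k → q ^C k)) 1F « n » 0≤1 («»≥0 n) (≡≤ (nrm-^ q n) (≤≡ (^F-≤1 n (nrm≥0 q) h) (sym (1* 1F)))) (nrm-geom q n h))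
 (cong2 _*_ (sym («suc» n)) (sym («suc» n)))
 where
  -- The triangle inequality for squared moduli; `cs` is Cauchy-Schwarz, read off from Lagrange's
  -- identity.
  tri : ∀ u v a b → 0F ≤ a → 0F ≤ b → nrm u ≤ a * a → nrm v ≤ b * b → nrm (u +C v) ≤ (a + b) * (a + b)
  tri (u ⊹ u') (v ⊹ v') a b ha hb p q = ≤≡ (≡≤ (solve 4 (λ u u' v v' → (u :+ v) :* (u :+ v) :+ (u' :+ v') :* (u' :+ v') := (u :* u :+ u' :* u') :+ (v :* v :+ v' :* v') :+ :2 :* (u :* v :+ u' :* v')) refl u u' v v')
   (+-mono (+-mono p q) (*-monoˡ (ι 2ℚ) (ι≥0 2ℚ) cs)))
   (solve 2 (λ a b → a :* a :+ b :* b :+ :2 :* (a :* b) := (a :+ b) :* (a :+ b)) refl a b)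
   where
    cs : u * v + u' * v' ≤ a * b
    cs = sq-cancel (0≤* ha hb) (tr≤ (≤-by ((u * v' - u' * v) * (u * v' - u' * v)) (0≤sq _) (solve 4 (λ u u' v v' → (u :* v :+ u' :* v') :* (u :* v :+ u' :* v') :+ (u :* v' :- u' :* v) :* (u :* v' :- u' :* v) := (u :* u :+ u' :* u') :* (v :* v :+ v' :* v')) refl u u' v v'))
     (≤≡ (*-mono (nrm≥0 (u ⊹ u')) (nrm≥0 (v ⊹ v')) p q) (solve 2 (λ a b → (a :* a) :* (b :* b) := (a :* b) :* (a :* b)) refl a b)))

geom : ∀ q n → (1C +C (-C q)) *C ∑C (rng n) (λ k → q ^C k) ≡ 1C +C (-C (q ^C n))
geom q zero = solveC 1 (λ q → (conC 1ℚ ∔ ⊝ q) ⨯ conC 0ℚ ≔ conC 1ℚ ∔ ⊝ conC 1ℚ) refl q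
geom q (suc n) = tr (distribCˡ _ (q ^C n) _) (tr (cong ((1C +C (-C q)) *C q ^C n +C_) (geom q n)) (solveC 2 (λ q r → (conC 1ℚ ∔ ⊝ q) ⨯ r ∔ (conC 1ℚ ∔ ⊝ r) ≔ conC 1ℚ ∔ ⊝ (q ⨯ r)) refl q (q ^C n)))

∑-pick : {A : Set} (_≟_ : (a b : A) → Dec (a ≡ b)) (xs : List A) (c : A → F) → Unique xs → ∀ {a} → a ∈ xs → (d : ∀ b → Dec (b ≡ a)) → ∑ xs (λ b → c b * iv (d b)) ≡ c a
∑-pick eq (x ∷ xs) c (nx ∷ u) (here refl) d = tr (cong2 _+_ (tr (cong (c x *_) (iv-yes (d x) refl)) (*1 _)) (∑-zero∈ xs (λ {b} m → tr (cong (c b *_) (iv-no (d b) (λ e → All.lookup nx m (sym e)))) (zeroʳ _)))) (+0 _)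
∑-pick eq (x ∷ xs) c (nx ∷ u) {a} (there m) d = tr (cong2 _+_ (tr (cong (c x *_) (iv-no (d x) (All.lookup nx m))) (zeroʳ _)) (∑-pick eq xs c u m d)) (0+ _)

-- Parseval's identity and one-sided polynomials.

module Trig (z : ℂ) (unit : nrm z ≡ 1F) (W D : ℕ) (D≤W : D +' D ≤' W) (Q : Quadrature z unit W) where
 open Kernel z unit W D D≤W Q public

 TP-scale : ∀ {lo hi ℓ f} c → TP lo hi ℓ f → TP lo hi (N1 c * ℓ) (λ x → c *C f x)
 TP-scale {ℓ = ℓ} c P = record
  { L = map (λ t → c *C fst t , snd t) (L P)
  ; freq = λ m → let (t , m' , e) = ∈-map⁻ _ m in subst (λ t → (_ ℤ.≤ snd t) × (snd t ℤ.≤ _)) (sym e) (freq P m')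
  ; ℓ1 = ≡≤ (∑-map _ (L P) _) (tr≤ (∑-mono (L P) (λ t → N1-* c (fst t))) (≡≤ (∑-* (L P) (N1 c) _) (*-monoˡ (N1 c) (N1≥0 c) (ℓ1 P))))
  ; ev = λ x → tr (cong (c *C_) (ev P x)) (tr (sym (∑C-* (L P) c _)) (tr (∑C-cong (L P) (λ t → sym (*C-assoc c (fst t) (ch (snd t) x)))) (sym (∑C-map _ (L P) _)))) }

 TP-ℓ : ∀ {lo hi ℓ ℓ' f} → ℓ ≤ ℓ' → TP lo hi ℓ f → TP lo hi ℓ' f
 TP-ℓ h P = record { L = L P ; freq = freq P ; ℓ1 = tr≤ (ℓ1 P) h ; ev = ev P }

 TP-sum : {A : Set} (xs : List A) {lo hi : ℤ} (ℓ : A → F) (f : A → ℕ → ℂ) → (∀ {a} → a ∈ xs → TP lo hi (ℓ a) (f a)) → TP lo hi (∑ xs ℓ) (λ x → ∑C xs (λ a → f a x))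
 TP-sum [] ℓ f h = record { L = [] ; freq = λ () ; ℓ1 = ≤-refl ; ev = λ x → refl }
 TP-sum (a ∷ xs) ℓ f h = TP-+ (h (here refl)) (TP-sum xs ℓ f (λ m → h (there m)))

 TP-^ : ∀ {lo ℓ f} n → 0F ≤ ℓ → TP lo (pos 0) ℓ f → TP (pos n ℤ.* lo) (pos 0) (N1 1C * ℓ ^F n) (λ x → f x ^C n)
 TP-^ {lo} {ℓ} {f} zero h P = TP-ℓ (≡⇒≤ (sym (*1 _))) (TP-const 1C (ℤP.≤-reflexive (ℤP.*-zeroˡ lo)) ℤP.≤-refl)
 TP-^ {lo} {ℓ} {f} (suc n) h P = TP-ℓ (≡⇒≤ (solve 3 (λ a b c → a :* (b :* c) := b :* (a :* c)) refl ℓ (N1 1C) (ℓ ^F n)))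
  (TP-weaken (ℤP.≤-reflexive (tr (cong (ℤ._* lo) (ℤP.pos-+ 1 n)) (tr (ℤP.*-distribʳ-+ lo (pos 1) (pos n)) (cong (ℤ._+ pos n ℤ.* lo) (ℤP.*-identityˡ lo))))) ℤP.≤-refl (TP-* h P (TP-^ n h P)))

 parseval : (ks : List ℤ) (c : ℤ → F) → Unique ks → (∀ {k} → k ∈ ks → Small k) →
  𝔼 (λ x → nrm (∑C ks (λ k → real (c k) *C ch k x))) ≡ ∑ ks (λ k → c k * c k)
 parseval ks c u sm = tr (𝔼-cong (λ x → cong re (sym (*C-conj (S x)))))
  (tr (cong re (tr (𝔼C-cong (λ x → tr (cong (S x *C_) (∑C-conj ks _)) (sym (∑C-* ks (S x) _)))) (𝔼C-∑ ks _)))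
   (∑-cong∈ ks (λ {k} m → tr (cong re (tr (𝔼C-cong (λ x → tr (cong (S x *C_) (tr (conj-* (real (c k)) (ch k x)) (cong (_*C conj (ch k x)) (conj-real (c k))))) (solveC 3 (λ s r b → s ⨯ (r ⨯ b) ≔ r ⨯ (s ⨯ b)) refl (S x) (real (c k)) (conj (ch k x))))) (tr (𝔼C-* (real (c k)) _) (cong (real (c k) *C_) (cf m))))) (re-real-* (c k) (real (c k))))))
  where
   S : ℕ → ℂ
   S x = ∑C ks (λ k → real (c k) *C ch k x)
   cf : ∀ {k} → k ∈ ks → coef k S ≡ real (c k)
   cf {k} m = tr (coef-∑ k ks (λ j → real (c j)) ch) (tr (∑C-cong∈ ks (λ {j} mj → tr (cong (real (c j) *C_) (coef-ch j k (sm mj) (sm m))) (sym (real-* (c j) _)))) (tr (∑C-real ks _) (cong real (∑-pick ℤ._≟_ ks c u m (λ j → j ℤ.≟ k)))))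

 -- Two nonpositive frequencies add up to 0 only if both are 0, so the mean of the square sees
 -- nothing but the constant terms.
 one-sided-square : ∀ {lo ℓ f} → Small lo → TP lo (pos 0) ℓ f → 𝔼C (λ x → f x *C f x) ≡ 𝔼C f *C 𝔼C f
 one-sided-square {lo} {ℓ} {f} sl P = tr (𝔼C-cong (λ x → tr (cong2 _*C_ (ev P x) (ev P x)) (tr (sym (∑C-*ʳ (L P) _ _)) (∑C-cong (L P) (λ s → sym (∑C-* (L P) _ _))))))
  (tr (𝔼C-∑ (L P) _) (tr (∑C-cong∈ (L P) (λ {s} ms → tr (𝔼C-∑ (L P) _) (∑C-cong∈ (L P) (λ {t} mt → term ms mt)))) (sym (tr (cong2 _*C_ m0 m0) (tr (sym (∑C-*ʳ (L P) _ _)) (∑C-cong (L P) (λ s → sym (∑C-* (L P) _ _))))))))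
  where
   z0 : ∀ {t} → t ∈ L P → Small (snd t)
   z0 m = ℤP.≤-trans (fst sl) (fst (freq P m)) , ℤP.≤-trans (snd (freq P m)) (ℤ.+≤+ z≤n)
   w : ℂ × ℤ → ℂ
   w t = fst t *C real (iv (snd t ℤ.≟ pos 0))
   m0 : 𝔼C f ≡ ∑C (L P) w
   m0 = tr (𝔼C-cong (ev P)) (tr (𝔼C-∑ (L P) _) (∑C-cong∈ (L P) (λ {t} m → tr (𝔼C-* (fst t) _) (cong (fst t *C_) (𝔼-ch (snd t) (N.≤-trans (Small-abs (z0 m)) (N.≤-trans (N.m≤m+n D D) D≤W)))))))
   ivv : ∀ j k → j ℤ.≤ pos 0 → k ℤ.≤ pos 0 → iv ((j ℤ.+ k) ℤ.≟ pos 0) ≡ iv (j ℤ.≟ pos 0) * iv (k ℤ.≟ pos 0)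
   ivv j k p q with j ℤ.≟ pos 0 | k ℤ.≟ pos 0
   ... | yes refl | yes refl = tr (iv-yes _ refl) (sym (tr (cong2 _*_ (iv-yes _ refl) (iv-yes _ refl)) (1* 1F)))
   ... | no nj | dk = tr (iv-no _ (λ e → nj (ℤP.≤-antisym p (subst (ℤ._≤ j) e (subst (j ℤ.+ k ℤ.≤_) (ℤP.+-identityʳ j) (ℤP.+-monoʳ-≤ j q)))))) (sym (tr (cong (_* iv dk) (iv-no _ nj)) (zeroˡ _)))
   ... | yes refl | no nk = tr (iv-no _ (λ e → nk (tr (sym (ℤP.+-identityˡ k)) e))) (sym (tr (cong (iv (yes refl) *_) (iv-no _ nk)) (zeroʳ _)))
   term : ∀ {s t} → s ∈ L P → t ∈ L P → 𝔼C (λ x → (fst s *C ch (snd s) x) *C (fst t *C ch (snd t) x)) ≡ w s *C w t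
   term {s} {t} ms mt = tr (𝔼C-cong (λ x → tr (solveC 4 (λ a b c d → (a ⨯ b) ⨯ (c ⨯ d) ≔ (a ⨯ c) ⨯ (b ⨯ d)) refl (fst s) (ch (snd s) x) (fst t) (ch (snd t) x)) (cong (fst s *C fst t *C_) (sym (ch-+ (snd s) (snd t) x)))))
    (tr (𝔼C-* _ _) (tr (cong (fst s *C fst t *C_) (tr (𝔼-ch (snd s ℤ.+ snd t) (N.≤-trans (ℤP.∣i+j∣≤∣i∣+∣j∣ (snd s) (snd t)) (N.≤-trans (N.+-mono-≤ (Small-abs (z0 ms)) (Small-abs (z0 mt))) D≤W))) (tr (cong real (ivv (snd s) (snd t) (snd (freq P ms)) (snd (freq P mt)))) (real-* _ _))))
     (solveC 4 (λ a b c d → (a ⨯ b) ⨯ (c ⨯ d) ≔ (a ⨯ c) ⨯ (b ⨯ d)) refl (fst s) (fst t) (real (iv (snd s ℤ.≟ pos 0))) (real (iv (snd t ℤ.≟ pos 0))))))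

 abs-𝔼 : ∀ f → abs (𝔼 f) ≤ 𝔼 (λ y → abs (f y))
 abs-𝔼 f = ∣∣-≤ (𝔼-mono (λ y → ≤∣∣ (f y))) (≡≤ (sym (𝔼-neg f)) (𝔼-mono (λ y → neg≤∣∣ (f y))))

 N1-𝔼 : ∀ f → N1 (𝔼C f) ≤ 𝔼 (λ y → N1 (f y))
 N1-𝔼 f = ≤≡ (+-mono (abs-𝔼 _) (abs-𝔼 _)) (sym (𝔼-+ _ _))

-- The multiplier attached to one block.

q17 q32 q16 q4 q8 q64 q8194 q4096 q130 q4097 : ℚ
q4097 = (pos 4097) ℚ./ 1
q17 = (pos 2) ℚ./ 17
q32 = (pos 32) ℚ./ 1
q16 = (pos 16) ℚ./ 1
q4 = (pos 4) ℚ./ 1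
q8 = (pos 8) ℚ./ 1
q64 = (pos 64) ℚ./ 1
q8194 = (pos 8194) ℚ./ 1
q4096 = (pos 4096) ℚ./ 1
q130 = (pos 130) ℚ./ 1

0≤2 : 0F ≤ ι 2ℚ
0≤2 = ι≥0 2ℚ

1≤«» : ∀ {n} → 1 ≤' n → 1F ≤ « n »
1≤«» {n} h = ≡≤ (sym «1») («»-mono h)

opaque
 c₀ : ℕ
 c₀ = 4097

 c₀-ι : « c₀ » ≡ ι q4097
 c₀-ι = «»-ι 4097

c₀≥1 : 1 ≤' c₀
c₀≥1 = «»-cancel (≡≤ «1» (≤≡ (ι-≤ (from-yes (1ℚ ℚ.≤? q4097))) (sym c₀-ι)))

-- The exponent n in (1 - h/n)ⁿ. Since |h|² ≤ 8194 X² (`nrm-h`), the choice n = 4097 X² b brings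
-- |h|²/n down to 2/b.
mdeg : ℕ → ℕ → ℕ
mdeg X b = c₀ *' (X *' X *' b)

module Multiplier (z : ℂ) (unit : nrm z ≡ 1F) (W D : ℕ) (D≤W : D +' D ≤' W) (Q : Quadrature z unit W)
 (B : List ℕ) (M : ℕ) (uB : Unique B) (B≤M : ∀ {a} → a ∈ B → a ≤' M) (B≥1 : 1 ≤' length B) (M≥1 : 1 ≤' M)
 (deg : mdeg (M +' M) (length B) *' (M +' M) ≤' D) where
 open Trig z unit W D D≤W Q

 X b n : ℕ
 X = M +' M
 b = length B
 n = mdeg X b

 X≥1 : 1 ≤' X
 X≥1 = N.≤-trans M≥1 (N.m≤m+n M M)

 n≥1 : 1 ≤' n
 n≥1 = N.*-mono-≤ {1} {c₀} {1} {X *' X *' b} c₀≥1 (N.*-mono-≤ {1} {X *' X} {1} {b} (N.*-mono-≤ X≥1 X≥1) B≥1)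

 X≤D : X ≤' D
 X≤D = N.≤-trans (subst (_≤' n *' X) (N.*-identityˡ X) (N.*-monoˡ-≤ X n≥1)) deg

 open Fejer X X≥1 X≤D

 ib in' : F
 ib = inv « b »
 in' = inv « n »

 ib≥0 : 0F ≤ ib
 ib≥0 = inv≥0 («»-pos B≥1)
 in≥0 : 0F ≤ in'
 in≥0 = inv≥0 («»-pos n≥1)
 bib : « b » * ib ≡ 1F
 bib = *-inv («»-pos B≥1)
 nin : « n » * in' ≡ 1F
 nin = *-inv («»-pos n≥1)

 ib≤1 : ib ≤ 1F
 ib≤1 = ≤≡ (≡≤ (sym (1* ib)) (*-monoʳ ib ib≥0 (1≤«» B≥1))) bib

 f : ℕ → ℂ
 f x = ∑C B (λ a → real ib *C ch (pos a) x)

 posSmall : ∀ {a} → a ∈ B → Small (pos a)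
 posSmall m = ℤP.≤-trans (ℤP.neg-mono-≤ {pos 0} {pos D} (ℤ.+≤+ z≤n)) (ℤ.+≤+ z≤n) , ℤ.+≤+ (N.≤-trans (B≤M m) (N.≤-trans (N.m≤m+n M M) X≤D))

 wt-pos : ∀ {a} → a ∈ B → Pos (wt a)
 wt-pos {a} m = Pos-≤ (λ h → from-no (half ℚ.≤? 0ℚ) (ι-≤⁻ h)) (wt≥½ a (N.+-mono-≤ (B≤M m) (B≤M m)))

 iw : ℕ → F
 iw a = inv (wt a)

 wiw : ∀ {a} → a ∈ B → wt a * iw a ≡ 1F
 wiw m = *-inv (wt-pos m)

 iw≥0 : ∀ {a} → a ∈ B → 0F ≤ iw a
 iw≥0 m = inv≥0 (wt-pos m)

 iw≤2 : ∀ {a} → a ∈ B → iw a ≤ ι 2ℚ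
 iw≤2 {a} m = ≤≡ (≡≤ (solve 1 (λ i → i := :2 :* (con half :* i)) refl (iw a)) (*-monoˡ (ι 2ℚ) 0≤2 (*-monoʳ (iw a) (iw≥0 m) (wt≥½ a (N.+-mono-≤ (B≤M m) (B≤M m))))))
  (tr (cong (ι 2ℚ *_) (wiw m)) (*1 _))

 K-lin : (c : ℕ → F) → ∀ x → K (λ y → ∑C B (λ a → real (c a) *C ch (pos a) y)) x ≡ ∑C B (λ a → real (c a * wt a) *C ch (pos a) x)
 K-lin c x = tr (𝔼C-cong (λ y → tr (sym (∑C-* B (real (Ker x y)) _)) (∑C-cong B (λ a → solveC 3 (λ k c e → k ⨯ (c ⨯ e) ≔ c ⨯ (k ⨯ e)) refl (real (Ker x y)) (real (c a)) (ch (pos a) y)))))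
  (tr (𝔼C-∑ B _) (∑C-cong∈ B (λ {a} m → tr (𝔼C-* (real (c a)) _) (tr (cong (real (c a) *C_) (K-ch a (posSmall m) x)) (tr (sym (*C-assoc (real (c a)) (real (wt a)) _)) (cong (_*C ch (pos a) x) (sym (real-* (c a) (wt a)))))))))

 -- Division by the square of the Fejér weight, so that two smoothings give back `f` (`KKft`). With
 -- X = 2 M the weights are at least 1/2, and this costs only a factor 4.
 cf : ℕ → F
 cf a = ib * (iw a * iw a)

 ft : ℕ → ℂ
 ft y = ∑C B (λ a → real (cf a) *C ch (pos a) y)

 KKft : ∀ x → K (K ft) x ≡ f x
 KKft x = tr (K-cong x (K-lin cf)) (tr (K-lin (λ a → cf a * wt a) x) (∑C-cong∈ B (λ {a} m → cong (λ t → real t *C ch (pos a) x)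
  (tr (solve 3 (λ b w i → b :* (i :* i) :* w :* w := b :* ((w :* i) :* (w :* i))) refl ib (wt a) (iw a)) (tr (cong (λ t → ib * (t * t)) (wiw m)) (solve 1 (λ b → b :* (:1 :* :1) := b) refl ib))))))

 g : ℕ → F
 g y = N1 (ft y)

 g≥0 : ∀ y → 0F ≤ g y
 g≥0 y = N1≥0 _

 cf≥0 : ∀ {a} → a ∈ B → 0F ≤ cf a
 cf≥0 m = 0≤* ib≥0 (0≤* (iw≥0 m) (iw≥0 m))

 cf≤ : ∀ {a} → a ∈ B → cf a ≤ ι q4 * ib
 cf≤ m = ≤≡ (*-monoˡ ib ib≥0 (*-mono (iw≥0 m) (iw≥0 m) (iw≤2 m) (iw≤2 m))) (solve 1 (λ b → b :* (:2 :* :2) := con q4 :* b) refl ib)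

 g≤8 : ∀ y → g y ≤ ι q8
 g≤8 y = tr≤ (∑C-N1 B _) (≤≡ (∑-mono∈ B {g = λ _ → ι q8 * ib} (λ {a} m → tr≤ (N1-* (real (cf a)) (ch (pos a) y)) (≤≡ (*-mono (N1≥0 (real (cf a))) (N1≥0 _) (≡≤ (N1-real (cf≥0 m)) (cf≤ m)) (N1≤2 (≡⇒≤ (nrm-ch (pos a) y)))) (solve 1 (λ b → con q4 :* b :* :2 := con q8 :* b) refl ib))))
  (tr (∑-const B (ι q8 * ib)) (tr (solve 2 (λ n b → n :* (con q8 :* b) := con q8 :* (n :* b)) refl « b » ib) (tr (cong (ι q8 *_) bib) (*1 _)))))

 𝔼g² : 𝔼 (λ y → g y * g y) ≤ ι q32 * ib
 𝔼g² = tr≤ (𝔼-mono (λ y → N1²≤2nrm (ft y))) (≡≤ (𝔼-* (ι 2ℚ) _) (≤≡ (*-monoˡ (ι 2ℚ) 0≤2 (≡≤ pars (∑-mono∈ B {g = λ _ → ι q16 * (ib * ib)} (λ m → ≤≡ (*-mono (cf≥0 m) (cf≥0 m) (cf≤ m) (cf≤ m)) (solve 1 (λ b → (con q4 :* b) :* (con q4 :* b) := con q16 :* (b :* b)) refl ib)))))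
  (tr (cong (ι 2ℚ *_) (∑-const B _)) (tr (solve 2 (λ n b → :2 :* (n :* (con q16 :* (b :* b))) := con q32 :* ((n :* b) :* b)) refl « b » ib) (tr (cong (λ t → ι q32 * (t * ib)) bib) (cong (ι q32 *_) (1* ib)))))))
  where
   ci : ℤ → F
   ci k = cf ℤ.∣ k ∣
   pars : 𝔼 (λ y → nrm (ft y)) ≡ ∑ B (λ a → cf a * cf a)
   pars = tr (𝔼-cong (λ y → cong nrm (sym (∑C-map pos B (λ k → real (ci k) *C ch k y))))) (tr (parseval (map pos B) ci (UP.map⁺ ℤP.+-injective uB) sm) (∑-map pos B _))
    where
     sm : ∀ {k} → k ∈ map pos B → Small k
     sm m with ∈-map⁻ pos m
     ... | a , ma , refl = posSmall ma

 -- Two smoothings are needed: `H0` is a trigonometric polynomial and can be completed to the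
 -- one-sided `hp`, while `H1` majorises `f` and is what remains of `H0` when `p` is smoothed to
 -- `m`.
 H0 H1 : ℕ → F
 H0 x = 𝔼 (λ y → Ker x y * g y)
 H1 x = 𝔼 (λ y → Ker x y * H0 y)

 H0≥0 : ∀ x → 0F ≤ H0 x
 H0≥0 x = 𝔼≥0 (λ y → 0≤* (Ker≥0 x y) (g≥0 y))
 H1≥0 : ∀ x → 0F ≤ H1 x
 H1≥0 x = 𝔼≥0 (λ y → 0≤* (Ker≥0 x y) (H0≥0 y))
 H0≤8 : ∀ x → H0 x ≤ ι q8
 H0≤8 x = K-≤ x g≤8
 H1≤8 : ∀ x → H1 x ≤ ι q8
 H1≤8 x = K-≤ x H0≤8

 f≤H1 : ∀ x → N1 (f x) ≤ H1 x
 f≤H1 x = ≡≤ (cong N1 (sym (KKft x))) (tr≤ (K-N1 (K ft) x) (K-mono x (λ y → K-N1 ft y)))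

 gC : ℕ → ℂ
 gC y = real (g y)

 t : ℕ → ℕ → ℕ → ℂ
 t i j x = ch (dif j i) x *C coef (dif j i) gC

 -- Analytic completion of `H0`: positive frequencies dropped, negative ones doubled, so that the
 -- real part stays `H0`.
 hp : ℕ → ℂ
 hp x = real iX *C ∑C (rng X) (λ i → t i i x +C (∑C (rng i) (λ j → t i j x) +C ∑C (rng i) (λ j → t i j x)))

 dif-swap : ∀ i j → dif i j ≡ ℤ.- dif j i
 dif-swap i j = sym (tr (ℤP.neg-distrib-+ (pos j) (ℤ.- pos i)) (tr (cong (λ w → ℤ.- pos j ℤ.+ w) (ℤP.neg-involutive (pos i))) (ℤP.+-comm (ℤ.- pos j) (pos i))))

 re-hp : ∀ x → re (hp x) ≡ H0 x
 re-hp x = tr (re-real-* iX _) (tr (cong (iX *_) (sym (tr (∑-swap (rng X) (rng X) (λ i j → re (t j i x))) (∑-sym X (λ i j → re (t i j x)) sy))))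
  (sym (tr (cong re kf) (re-real-* iX _))))
  where
   kf : real (H0 x) ≡ real iX *C ∑C (rng X) (λ i → ∑C (rng X) (λ j → ch (dif i j) x *C coef (dif i j) gC))
   kf = tr (tr (cong2 _⊹_ refl (sym (tr (𝔼-cong (λ y → tr (im-real-* (Ker x y) (gC y)) (zeroʳ _))) (𝔼-const 0F)))) (cong2 _⊹_ (𝔼-cong (λ y → sym (re-real-* (Ker x y) (gC y)))) refl)) (K-form gC x)
   sy : ∀ i j → re (t i j x) ≡ re (t j i x)
   sy i j = cong re (tr (cong2 _*C_ (tr (cong (λ k → ch k x) (dif-swap j i)) (ch-neg (dif i j) x)) (tr (𝔼C-cong (λ y → tr (cong (λ w → gC y *C conj w) (tr (cong (λ k → ch k y) (dif-swap j i)) (ch-neg (dif i j) y))) (tr (cong (_*C conj (conj (ch (dif i j) y))) (sym (conj-real (g y)))) (sym (conj-* (gC y) (conj (ch (dif i j) y))))))) (cong2 _⊹_ refl (𝔼-neg _)))) (sym (conj-* (ch (dif i j) x) (coef (dif i j) gC))))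

 N1-coef-gC : ∀ k → N1 (coef k gC) ≤ ι q16
 N1-coef-gC k = tr≤ (N1-𝔼 _) (≤≡ (𝔼-mono {g = λ _ → ι q16} (λ y → tr≤ (N1-* (gC y) (conj (ch k y))) (≤≡ (*-mono (N1≥0 (gC y)) (N1≥0 _) (≡≤ (N1-real (g≥0 y)) (g≤8 y)) (≡≤ (N1-conj _) (N1≤2 (≡⇒≤ (nrm-ch k y))))) (solve 0 (con q8 :* :2 := con q16) refl)))) (𝔼-const _))

 N1-t : ∀ i j x → N1 (t i j x) ≤ ι q32
 N1-t i j x = tr≤ (N1-* (ch (dif j i) x) (coef (dif j i) gC)) (≤≡ (*-mono (N1≥0 _) (N1≥0 _) (N1≤2 (≡⇒≤ (nrm-ch (dif j i) x))) (N1-coef-gC (dif j i))) (solve 0 (:2 :* con q16 := con q32) refl))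

 nrm-hp : ∀ x → nrm (hp x) ≤ ι q4096 * (« X » * « X »)
 nrm-hp x = tr≤ (nrm≤N1² (hp x)) (≤≡ (*-mono (N1≥0 _) (N1≥0 _) N N) (solve 1 (λ X → (con q64 :* X) :* (con q64 :* X) := con q4096 :* (X :* X)) refl « X »))
  where
   row : ∀ {i} → i ∈ rng X → N1 (t i i x +C (∑C (rng i) (λ j → t i j x) +C ∑C (rng i) (λ j → t i j x))) ≤ ι q64 * « X »
   row {i} m = tr≤ (N1-+ _ _) (tr≤ (+-mono (N1-t i i x) (tr≤ (N1-+ _ _) (+-mono part part))) (tr≤ (≤-by (ι q32) (ι≥0 q32) (solve 1 (λ i → (con q32 :+ (i :* con q32 :+ i :* con q32)) :+ con q32 := con q64 :* (:1 :+ i)) refl « i »)) (*-monoˡ (ι q64) (ι≥0 q64) (≡≤ (sym («suc» i)) («»-mono (∈rng m))))))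
    where
     part : N1 (∑C (rng i) (λ j → t i j x)) ≤ « i » * ι q32
     part = tr≤ (∑C-N1 (rng i) _) (≤≡ (∑-mono (rng i) (λ j → N1-t i j x)) (tr (∑-const (rng i) (ι q32)) (cong (λ k → « k » * ι q32) (length-rng i))))
   N : N1 (hp x) ≤ ι q64 * « X »
   N = tr≤ (N1-* (real iX) _) (≤≡ (*-mono (N1≥0 (real iX)) (N1≥0 _) (≡⇒≤ (N1-real iX≥0)) (tr≤ (∑C-N1 (rng X) _) (≤≡ (∑-mono∈ (rng X) row) (tr (∑-const (rng X) _) (cong (λ k → « k » * (ι q64 * « X »)) (length-rng X))))))
    (tr (solve 3 (λ i X c → i :* (X :* (c :* X)) := (X :* i) :* (c :* X)) refl iX « X » (ι q64)) (tr (cong (_* (ι q64 * « X »)) XiX) (1* _))))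

 difle : ∀ {i j} → j ≤' i → i <' X → (ℤ.- pos X ℤ.≤ dif j i) × (dif j i ℤ.≤ pos 0)
 difle {i} {j} p q = ℤP.≤-trans (ℤP.neg-mono-≤ (ℤ.+≤+ (N.<⇒≤ q))) (subst (ℤ._≤ dif j i) (ℤP.+-identityˡ _) (ℤP.+-monoˡ-≤ (ℤ.- pos i) (ℤ.+≤+ (z≤n {j})))) ,
  ℤP.≤-trans (ℤP.+-monoˡ-≤ (ℤ.- pos i) (ℤ.+≤+ p)) (ℤP.≤-reflexive (ℤP.+-inverseʳ (pos i)))

 hpTP : Σ F λ ℓ → (0F ≤ ℓ) × TP (ℤ.- pos X) (pos 0) ℓ hp
 hpTP = _ , 0≤* (N1≥0 _) (∑≥0 (rng X) (λ i → 0≤+ (N1≥0 _) (0≤+ (∑≥0 (rng i) (λ j → N1≥0 _)) (∑≥0 (rng i) (λ j → N1≥0 _))))) ,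
  TP-scale (real iX) (TP-sum (rng X) (λ i → N1 (coef (dif i i) gC) + (∑ (rng i) (λ j → N1 (coef (dif j i) gC)) + ∑ (rng i) (λ j → N1 (coef (dif j i) gC)))) _ (λ {i} mi →
   TP-+ (one i i (difle N.≤-refl (∈rng mi))) (TP-+ (TP-sum (rng i) _ _ (λ {j} mj → one i j (difle (N.<⇒≤ (∈rng mj)) (∈rng mi)))) (TP-sum (rng i) _ _ (λ {j} mj → one i j (difle (N.<⇒≤ (∈rng mj)) (∈rng mi)))))))
  where
   one : ∀ i j → (ℤ.- pos X ℤ.≤ dif j i) × (dif j i ℤ.≤ pos 0) → TP (ℤ.- pos X) (pos 0) (N1 (coef (dif j i) gC)) (t i j)
   one i j (p , q) = TP-cong (λ x → *C-comm _ _) (TP-mono (coef (dif j i) gC) p q ≤-refl)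

 XSmall : Small (ℤ.- pos X)
 XSmall = ℤP.neg-mono-≤ (ℤ.+≤+ X≤D) , ℤP.≤-trans (ℤP.neg-mono-≤ {pos 0} {pos X} (ℤ.+≤+ z≤n)) (ℤ.+≤+ z≤n)

 mean-hp : 𝔼C hp ≡ real (re (𝔼C hp))
 mean-hp = cong2 _⊹_ refl (tr (cong im (tr (𝔼C-* (real iX) _) (cong (real iX *C_) (tr (𝔼C-∑ (rng X) _) (tr (∑C-cong∈ (rng X) row) (∑C-real (rng X) (λ _ → 𝔼 g))))))) (tr (im-real-* iX _) (zeroʳ iX)))
  where
   ET : ∀ i j → i <' X → j ≤' i → 𝔼C (t i j) ≡ real (iv (dif j i ℤ.≟ pos 0)) *C coef (dif j i) gC
   ET i j p q = tr (𝔼C-cong (λ x → *C-comm _ _)) (tr (𝔼C-* _ _) (tr (*C-comm _ _) (cong (_*C coef (dif j i) gC) (𝔼-ch (dif j i) (N.≤-trans (Small-abs (ℤP.≤-trans (fst XSmall) (fst (difle q p)) , ℤP.≤-trans (snd (difle q p)) (ℤ.+≤+ z≤n))) (N.≤-trans (N.m≤m+n D D) D≤W))))))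
   off : ∀ i j → i <' X → j <' i → 𝔼C (t i j) ≡ 0C
   off i j p q = tr (ET i j p (N.<⇒≤ q)) (tr (cong (λ w → real w *C coef (dif j i) gC) (iv-no _ (λ e → N.<-irrefl (ℤP.+-injective (ℤP.i-j≡0⇒i≡j (pos j) (pos i) e)) q))) (zeroCˡ _))
   row : ∀ {i} → i ∈ rng X → 𝔼C (λ x → t i i x +C (∑C (rng i) (λ j → t i j x) +C ∑C (rng i) (λ j → t i j x))) ≡ real (𝔼 g)
   row {i} m = tr (𝔼C-+ _ _) (tr (cong2 _+C_ dg (tr (𝔼C-+ _ _) (tr (cong2 _+C_ sm sm) (+C-identityˡ 0C)))) (+C-identityʳ _))
    where
     sm : 𝔼C (λ x → ∑C (rng i) (λ j → t i j x)) ≡ 0C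
     sm = tr (𝔼C-∑ (rng i) _) (∑C-zero∈ (rng i) (λ {j} mj → off i j (∈rng m) (∈rng mj)))
     d0 : dif i i ≡ pos 0
     d0 = ℤP.+-inverseʳ (pos i)
     dg : 𝔼C (t i i) ≡ real (𝔼 g)
     dg = tr (ET i i (∈rng m) N.≤-refl) (tr (cong2 _*C_ (cong real (iv-yes _ d0)) (cong (λ k → coef k gC) d0)) (tr (*C-identityˡ _) (tr (𝔼C-cong (λ y → tr (cong (gC y *C_) (conj-real 1F)) (*C-identityʳ (gC y)))) (cong2 _⊹_ refl (𝔼-const 0F)))))

 -- By `one-sided-square` the mean of hp² is the square of a real number, so the imaginary part has
 -- at most the mean square of the real part. That real part is `H0`, and Jensen compares it with
 -- `g`.
 𝔼nrm-hp : 𝔼 (λ x → nrm (hp x)) ≤ ι q64 * ib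
 𝔼nrm-hp = tr≤ (≡≤ (𝔼-+ _ _) (tr≤ (+-mono ≤-refl im≤re) ≤-refl)) (≤≡ (+-mono re≤ re≤) (solve 1 (λ b → con q32 :* b :+ con q32 :* b := con q64 :* b) refl ib))
  where
   sqr : 𝔼 (λ x → re (hp x) * re (hp x)) - 𝔼 (λ x → im (hp x) * im (hp x)) ≡ re (𝔼C hp) * re (𝔼C hp)
   sqr = tr (sym (𝔼-- _ _)) (tr (cong re (one-sided-square XSmall (snd (snd hpTP)))) (tr (cong re (cong2 _*C_ mean-hp mean-hp)) (re-real-* _ _)))
   im≤re : 𝔼 (λ x → im (hp x) * im (hp x)) ≤ 𝔼 (λ x → re (hp x) * re (hp x))
   im≤re = -≤0 (≤≡ (0≤sq (re (𝔼C hp))) (sym sqr))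
   re≤ : 𝔼 (λ x → re (hp x) * re (hp x)) ≤ ι q32 * ib
   re≤ = ≡≤ (𝔼-cong (λ x → cong2 _*_ (re-hp x) (re-hp x))) (tr≤ (𝔼-mono (λ x → jensen (Ker x) (Ker≥0 x) (Ker-mass x) g)) (≡≤ (K-L2 (λ y → g y * g y)) 𝔼g²))

 -- `p` is (1 - h/n)ⁿ in place of exp(-h). It has no positive frequencies but degree n X, which the
 -- smoothing `m` of `p` cuts down to X. The constant `ib` inside `h` pays for the second-order term
 -- in `nrm-q`.
 h q p m : ℕ → ℂ
 h x = real ib +C hp x
 q x = 1C +C (-C (real in' *C h x))
 p x = q x ^C n
 m x = K p x

 re-h : ∀ x → re (h x) ≡ ib + H0 x
 re-h x = cong (ib +_) (re-hp x)

 «n» : « n » ≡ ι q4097 * (« X » * « X » * « b »)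
 «n» = tr («*» c₀ (X *' X *' b)) (cong2 _*_ c₀-ι (tr («*» (X *' X) b) (cong (_* « b ») («*» X X))))

 1≤X² : 1F ≤ « X » * « X »
 1≤X² = ≡≤ (sym (1* 1F)) (*-mono 0≤1 0≤1 (1≤«» X≥1) (1≤«» X≥1))

 nrm-h : ∀ x → nrm (h x) ≤ ι q8194 * (« X » * « X »)
 nrm-h x = tr≤ (nrm-+≤ (real ib) (hp x)) (≤≡ (*-monoˡ (ι 2ℚ) 0≤2 (+-mono (≡≤ (nrm-real ib) (tr≤ (*-mono ib≥0 ib≥0 ib≤1 ib≤1) (≡≤ (1* 1F) 1≤X²))) (nrm-hp x)))
  (solve 1 (λ s → :2 :* (s :+ con q4096 :* s) := con q8194 :* s) refl (« X » * « X »)))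

 in-nrm-h : ∀ x → in' * nrm (h x) ≤ ι 2ℚ * ib
 in-nrm-h x = *-cancel-≤ « n » («»-pos n≥1) (≡≤ (tr (sym (*-assoc « n » in' _)) (tr (cong (_* nrm (h x)) nin) (1* _)))
  (≤≡ (nrm-h x) (sym (tr (cong (_* (ι 2ℚ * ib)) «n») (tr (solve 3 (λ s b i → con q4097 :* (s :* b) :* (:2 :* i) := con q8194 :* s :* (b :* i)) refl (« X » * « X ») « b » ib) (tr (cong (ι q8194 * (« X » * « X ») *_) bib) (*1 _)))))))

 y : ℕ → F
 y x = ι 2ℚ * (in' * H0 x)

 y≥0 : ∀ x → 0F ≤ y x
 y≥0 x = 0≤* 0≤2 (0≤* in≥0 (H0≥0 x))

 y≤1 : ∀ x → y x ≤ 1F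
 y≤1 x = *-cancel-≤ « n » («»-pos n≥1) (≡≤ (tr (solve 3 (λ n i h → n :* (:2 :* (i :* h)) := :2 :* ((n :* i) :* h)) refl « n » in' (H0 x)) (tr (cong (λ w → ι 2ℚ * (w * H0 x)) nin) (cong (ι 2ℚ *_) (1* _))))
  (tr≤ (*-monoˡ (ι 2ℚ) 0≤2 (H0≤8 x)) (≤≡ (tr≤ (≡≤ (sym (ι-* 2ℚ q8)) (≤≡ (ι-≤ (from-yes (2ℚ ℚ.* q8 ℚ.≤? q4097))) (sym c₀-ι))) («»-mono c₀≤n)) (sym (*1 _)))))
  where
   c₀≤n : c₀ ≤' n
   c₀≤n = subst (_≤' n) (N.*-identityʳ c₀) (N.*-monoʳ-≤ c₀ {1} (N.*-mono-≤ {1} {X *' X} {1} {b} (N.*-mono-≤ X≥1 X≥1) B≥1))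

 nrm-q : ∀ x → nrm (q x) ≤ 1F - y x
 nrm-q x = ≡≤ (solve 3 (λ i a c → (:1 :+ (:- (i :* a :- :0 :* c))) :* (:1 :+ (:- (i :* a :- :0 :* c))) :+ (:0 :+ (:- (i :* c :+ :0 :* a))) :* (:0 :+ (:- (i :* c :+ :0 :* a))) := :1 :- :2 :* (i :* a) :+ i :* (i :* (a :* a :+ c :* c))) refl in' (re (h x)) (im (h x)))
  (≤≡ (+-mono ≤-refl (*-monoˡ in' in≥0 (in-nrm-h x))) (tr (cong (λ w → 1F - ι 2ℚ * (in' * w) + in' * (ι 2ℚ * ib)) (re-h x)) (solve 3 (λ i b H → :1 :- :2 :* (i :* (b :+ H)) :+ i :* (:2 :* b) := :1 :- :2 :* (i :* H)) refl in' ib (H0 x))))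

 nrm-q≤1 : ∀ x → nrm (q x) ≤ 1F
 nrm-q≤1 x = tr≤ (nrm-q x) (≤-by (y x) (y≥0 x) (solve 1 (λ y → :1 :- y :+ y := :1) refl (y x)))

 -- `decay` gives 1/(1 + 2 H0), and on 0 ≤ H ≤ 8 the convex function 1/(1 + 2 H) lies below its
 -- chord 1 - 2 H/17.
 nrm-p : ∀ x → nrm (p x) ≤ 1F - ι q17 * H0 x
 nrm-p x = tr≤ (≤-by (P * (ι q17 * H0 x * (ι q8 - H0 x) * ι 2ℚ)) (0≤* (nrm≥0 (p x)) (0≤* (0≤* (0≤* (ι≥0 q17) (H0≥0 x)) (0≤- (H0≤8 x))) 0≤2))
  (solve 2 (λ P H → P :+ P :* (con q17 :* H :* (con q8 :- H) :* :2) := (P :* (:1 :+ :2 :* H)) :* (:1 :- con q17 :* H)) refl P (H0 x)))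
  (≤≡ (*-monoʳ (1F - ι q17 * H0 x) c≥0 dec) (1* _))
  where
   P = nrm (p x)
   c≥0 : 0F ≤ 1F - ι q17 * H0 x
   c≥0 = 0≤- (tr≤ (*-monoˡ (ι q17) (ι≥0 q17) (H0≤8 x)) (≡≤ (sym (ι-* q17 q8)) (ι-≤ (from-yes (q17 ℚ.* q8 ℚ.≤? 1ℚ)))))
   dec : P * (1F + ι 2ℚ * H0 x) ≤ 1F
   dec = tr≤ (*-mono (nrm≥0 (p x)) (0≤+ 0≤1 (0≤* 0≤2 (H0≥0 x))) (≡≤ (nrm-^ (q x) n) (^F-mono n (nrm≥0 (q x)) (nrm-q x))) (≡⇒≤ (cong (1F +_) (sym (tr (solve 3 (λ n i h → n :* (:2 :* (i :* h)) := :2 :* ((n :* i) :* h)) refl « n » in' (H0 x)) (tr (cong (λ w → ι 2ℚ * (w * H0 x)) nin) (cong (ι 2ℚ *_) (1* _))))))))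
    (decay n (y≥0 x) (y≤1 x))

 nrm-p≤1 : ∀ x → nrm (p x) ≤ 1F
 nrm-p≤1 x = ≡≤ (nrm-^ (q x) n) (^F-≤1 n (nrm≥0 (q x)) (nrm-q≤1 x))

 -- 1 - qⁿ is (1 - q) = h/n times a geometric sum of n terms of modulus at most 1.
 nrm-1-p : ∀ x → nrm (1C +C (-C (p x))) ≤ nrm (h x)
 nrm-1-p x = ≡≤ (tr (cong nrm (tr (sym (geom (q x) n)) (cong (_*C ∑C (rng n) (λ k → q x ^C k)) (solveC 1 (λ w → conC 1ℚ ∔ ⊝ (conC 1ℚ ∔ ⊝ w) ≔ w) refl (real in' *C h x))))) (nrm-* _ _))
  (≤≡ (*-monoˡ _ (nrm≥0 (real in' *C h x)) (nrm-geom (q x) n (nrm-q≤1 x))) (tr (cong (_* (« n » * « n »)) (tr (nrm-* (real in') (h x)) (cong (_* nrm (h x)) (nrm-real in')))) (tr (solve 3 (λ i H n → (i :* i) :* H :* (n :* n) := ((n :* i) :* (n :* i)) :* H) refl in' (nrm (h x)) « n ») (tr (cong (λ w → (w * w) * nrm (h x)) nin) (solve 1 (λ H → (:1 :* :1) :* H := H) refl (nrm (h x)))))))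

 nrm-m : ∀ x → nrm (m x) ≤ 1F - ι q17 * H1 x
 nrm-m x = tr≤ (K-nrm p x) (≤≡ (K-mono x nrm-p) (tr (𝔼-cong (λ w → solve 2 (λ k H → k :* (:1 :- con q17 :* H) := k :- con q17 :* (k :* H)) refl (Ker x w) (H0 w))) (tr (𝔼-- _ _) (cong2 _-_ (Ker-mass x) (𝔼-* (ι q17) _)))))

 L2-m : 𝔼 (λ x → nrm (1C +C (-C (m x)))) ≤ ι q130 * ib
 L2-m = tr≤ (𝔼-mono (λ x → ≡≤ (cong nrm (k1 x)) (tr≤ (K-nrm (λ w → 1C +C (-C (p w))) x) (K-mono x nrm-1-p))))
  (≡≤ (K-L2 (λ w → nrm (h w))) (tr≤ (𝔼-mono (λ x → nrm-+≤ (real ib) (hp x))) (≡≤ (tr (𝔼-* (ι 2ℚ) _) (cong (ι 2ℚ *_) (tr (𝔼-+ _ _) (cong (_+ 𝔼 (λ x → nrm (hp x))) (𝔼-const _))))) (≤≡ (*-monoˡ (ι 2ℚ) 0≤2 (+-mono (≡≤ (nrm-real ib) (≤≡ (*-monoˡ ib ib≥0 ib≤1) (*1 ib))) 𝔼nrm-hp)) (solve 1 (λ b → :2 :* (b :+ con q64 :* b) := con q130 :* b) refl ib)))))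
  where
   k1 : ∀ x → 1C +C (-C (m x)) ≡ K (λ w → 1C +C (-C (p w))) x
   k1 x = sym (tr (𝔼C-cong (λ w → solveC 2 (λ k p → k ⨯ (conC 1ℚ ∔ ⊝ p) ≔ k ∔ ⊝ conC 1ℚ ⨯ (k ⨯ p)) refl (real (Ker x w)) (p w))) (tr (𝔼C-+ _ _) (cong2 _+C_ (cong2 _⊹_ (Ker-mass x) (𝔼-const 0F)) (tr (𝔼C-* (-C 1C) _) (solveC 1 (λ m → ⊝ conC 1ℚ ⨯ m ≔ ⊝ m) refl (m x))))))

 pTP : Σ F λ ℓ → TP (pos n ℤ.* ℤ.- pos X) (pos 0) ℓ p
 pTP = _ , TP-^ n (0≤+ (N1≥0 _) (0≤* (N1≥0 _) (0≤+ (N1≥0 _) (fst (snd hpTP)))))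
  (TP-cong (λ x → cong (1C +C_) (solveC 2 (λ i h → ⊝ (i ⨯ h) ≔ (⊝ i) ⨯ h) refl (real in') (h x))) (TP-+ (TP-const 1C lo≤0 ℤP.≤-refl) (TP-scale (-C (real in')) (TP-+ (TP-const (real ib) lo≤0 ℤP.≤-refl) (snd (snd hpTP))))))
  where
   lo≤0 : ℤ.- pos X ℤ.≤ pos 0
   lo≤0 = ℤP.neg-mono-≤ {pos 0} {pos X} (ℤ.+≤+ z≤n)

 pSmall : Small (pos n ℤ.* ℤ.- pos X)
 pSmall = subst Small (tr (cong ℤ.-_ (ℤP.pos-* n X)) (ℤP.neg-distribʳ-* (pos n) (pos X))) (ℤP.neg-mono-≤ (ℤ.+≤+ deg) , ℤP.≤-trans (ℤP.neg-mono-≤ {pos 0} {pos (n *' X)} (ℤ.+≤+ z≤n)) (ℤ.+≤+ z≤n))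

 coef-p-pos : ∀ {i j} → i <' X → j <' i → coef (dif i j) p ≡ 0C
 coef-p-pos {i} {j} a c = TP-coef (dif i j) pSmall (ℤP.neg-mono-≤ {pos 0} {pos D} (ℤ.+≤+ z≤n) , ℤ.+≤+ z≤n) (dif-small a (N.<-trans c a)) (inj₂ (λ le → N.<⇒≱ c (ℤP.drop‿+≤+ (ℤP.i-j≤0⇒i≤j {pos i} {pos j} le)))) (snd pTP)

 N1-coef-p : ∀ k → N1 (coef k p) ≤ ι 2ℚ
 N1-coef-p k = tr≤ (N1-𝔼 _) (≤≡ (𝔼-mono {g = λ _ → ι 2ℚ} (λ w → N1≤2 (≡≤ (tr (nrm-* (p w) (conj (ch k w))) (tr (cong (nrm (p w) *_) (tr (nrm-conj _) (nrm-ch k w))) (*1 _))) (nrm-p≤1 w)))) (𝔼-const _))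

 -- The kernel lets only frequencies of absolute value below X through, and `p` has no positive
 -- ones. The coefficients of `p` are bounded because |p| ≤ 1.
 mTP : TP (ℤ.- pos X) (pos 0) (ι 2ℚ * « X ») m
 mTP = TP-ℓ bnd (TP-cong form (TP-sum (rng X) (λ j → ∑ (rng (suc j)) (λ i → N1 (real iX *C coef (dif i j) p))) (λ j x → ∑C (rng (suc j)) (λ i → (real iX *C coef (dif i j) p) *C ch (dif i j) x)) (λ {j} mj → TP-∑ (rng (suc j)) (λ i → real iX *C coef (dif i j) p) (λ i → dif i j) (λ {i} mi → difle (N.≤-pred (∈rng mi)) (∈rng mj)) ≤-refl)))
  where
   form : ∀ x → m x ≡ ∑C (rng X) (λ j → ∑C (rng (suc j)) (λ i → (real iX *C coef (dif i j) p) *C ch (dif i j) x))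
   form x = tr (K-form p x) (tr (cong (real iX *C_) (∑C-swap (rng X) (rng X) (λ i j → ch (dif i j) x *C coef (dif i j) p))) (tr (sym (∑C-* (rng X) (real iX) _)) (∑C-cong∈ (rng X) (λ {j} mj → tr (cong (real iX *C_) (trn (∈rng mj))) (tr (sym (∑C-* (rng (suc j)) (real iX) _)) (∑C-cong (rng (suc j)) (λ i → solveC 3 (λ r c e → r ⨯ (e ⨯ c) ≔ (r ⨯ c) ⨯ e) refl (real iX) (coef (dif i j) p) (ch (dif i j) x))))))))
    where
     trn : ∀ {j} → j <' X → ∑C (rng X) (λ i → ch (dif i j) x *C coef (dif i j) p) ≡ ∑C (rng (suc j)) (λ i → ch (dif i j) x *C coef (dif i j) p)
     trn {j} l = ∑C-rng-trunc X (suc j) _ l (λ i a c → tr (cong (ch (dif i j) x *C_) (coef-p-pos c a)) (zeroCʳ _))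
   bnd : ∑ (rng X) (λ j → ∑ (rng (suc j)) (λ i → N1 (real iX *C coef (dif i j) p))) ≤ ι 2ℚ * « X »
   bnd = ≤≡ (∑-mono∈ (rng X) {g = λ _ → ι 2ℚ} (λ {j} mj → tr≤ (∑-mono (rng (suc j)) {g = λ _ → iX * ι 2ℚ} (λ i → tr≤ (N1-* (real iX) (coef (dif i j) p)) (*-mono (N1≥0 (real iX)) (N1≥0 _) (≡⇒≤ (N1-real iX≥0)) (N1-coef-p (dif i j)))))
    (≡≤ (tr (∑-const (rng (suc j)) (iX * ι 2ℚ)) (cong (λ k → « k » * (iX * ι 2ℚ)) (length-rng (suc j)))) (≤≡ (*-monoʳ (iX * ι 2ℚ) (0≤* iX≥0 0≤2) («»-mono (∈rng mj))) (tr (sym (*-assoc « X » iX (ι 2ℚ))) (tr (cong (_* ι 2ℚ) XiX) (1* _)))))))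
    (tr (∑-const (rng X) (ι 2ℚ)) (tr (cong (λ k → « k » * ι 2ℚ) (length-rng X)) (*-comm _ _)))

-- Pairing with a finitely supported sequence.

iv-⇔ : {P P' : Set} (d : Dec P) (d' : Dec P') → (P → P') → (P' → P) → iv d ≡ iv d'
iv-⇔ (yes p) d' f g = tr (iv-yes (yes p) p) (sym (iv-yes d' (f p)))
iv-⇔ (no h) d' f g = tr (iv-no (no h) h) (sym (iv-no d' (λ p → h (g p))))

rng-unique : ∀ n → Unique (rng n)
rng-unique zero = []
rng-unique (suc n) = All.tabulate (λ m e → N.<-irrefl (sym e) (∈rng m)) ∷ rng-unique n

zs : ℕ → List ℤ
zs R = map pos (rng (suc R)) ++ map negsuc (rng R)

zs-unique : ∀ R → Unique (zs R)
zs-unique R = UP.++⁺ (UP.map⁺ ℤP.+-injective (rng-unique (suc R))) (UP.map⁺ ℤP.-[1+-injective (rng-unique R)) disj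
 where
  disj : ∀ {k} → k ∈ map pos (rng (suc R)) × k ∈ map negsuc (rng R) → ⊥
  disj (a , b) with ∈-map⁻ pos a | ∈-map⁻ negsuc b
  ... | _ , _ , refl | _ , _ , ()

zs-abs : ∀ {R k} → k ∈ zs R → ℤ.∣ k ∣ ≤' R
zs-abs {R} m with ∈-++⁻ (map pos (rng (suc R))) m
... | inj₁ a with ∈-map⁻ pos a
... | n , b , refl = N.≤-pred (∈rng b)
zs-abs {R} m | inj₂ a with ∈-map⁻ negsuc a
... | n , b , refl = ∈rng b

∈zs : ∀ {R} k → ℤ.∣ k ∣ ≤' R → k ∈ zs R
∈zs {R} (pos n) h = ∈-++⁺ˡ (∈-map⁺ pos (rng∈ (s≤s h)))
∈zs {R} (negsuc n) h = ∈-++⁺ʳ (map pos (rng (suc R))) (∈-map⁺ negsuc (rng∈ h))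

abs≤ : ∀ {R} k → ℤ.- pos R ℤ.≤ k → k ℤ.≤ pos R → ℤ.∣ k ∣ ≤' R
abs≤ (pos n) p q = ℤP.drop‿+≤+ q
abs≤ {R} (negsuc n) p q = ℤP.drop‿+≤+ (subst (pos (suc n) ℤ.≤_) (ℤP.neg-involutive (pos R)) (ℤP.neg-mono-≤ p))

≤abs : ∀ {R} k → ℤ.∣ k ∣ ≤' R → (ℤ.- pos R ℤ.≤ k) × (k ℤ.≤ pos R)
≤abs {R} (pos n) h = ℤP.≤-trans (ℤP.neg-mono-≤ {pos 0} {pos R} (ℤ.+≤+ z≤n)) (ℤ.+≤+ z≤n) , ℤ.+≤+ h
≤abs {R} (negsuc n) h = ℤP.neg-mono-≤ {pos (suc n)} {pos R} (ℤ.+≤+ h) , ℤ.-≤+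

q25 q60 q34 qM qτ qτ' : ℚ
q25 = pos 1 ℚ./ 25
q60 = pos 1 ℚ./ 60
q34 = pos 3 ℚ./ 4
qM = pos 1 ℚ./ 1000000
qτ = pos 1 ℚ./ 6500
qτ' = # 6500

En : (ℤ → F) → ℕ → ℤ → ℤ → F
En G R lo hi = ∑ (zs R) (λ k → iv (lo ℤ.≤? k) * iv (k ℤ.≤? hi) * (G k * G k))

module Functional (z : ℂ) (unit : nrm z ≡ 1F) (W D : ℕ) (D≤W : D +' D ≤' W) (Q : Quadrature z unit W)
 (G : ℤ → F) (R : ℕ) (R≤D : R ≤' D) where
 open Trig z unit W D D≤W Q

 smallR : ∀ {k} → ℤ.∣ k ∣ ≤' R → Small k
 smallR {k} h = ≤abs k (N.≤-trans h R≤D)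

 Lf : (ℕ → ℂ) → F
 Lf φ = ∑ (zs R) (λ k → G k * re (coef k φ))

 Lf-cong : ∀ {φ ψ} → (∀ x → φ x ≡ ψ x) → Lf φ ≡ Lf ψ
 Lf-cong h = ∑-cong (zs R) (λ k → cong (λ w → G k * re w) (coef-cong k h))

 Lf-+ : ∀ φ ψ → Lf (λ x → φ x +C ψ x) ≡ Lf φ + Lf ψ
 Lf-+ φ ψ = tr (∑-cong (zs R) (λ k → tr (cong (λ w → G k * re w) (tr (𝔼C-cong (λ y → distribCʳ (conj (ch k y)) (φ y) (ψ y))) (𝔼C-+ _ _))) (distribˡ (G k) _ _))) (∑-+ (zs R) _ _)

 Lf-TP : ∀ {lo hi ℓ φ} (P : TP lo hi ℓ φ) → ℤ.∣ lo ∣ ≤' R → ℤ.∣ hi ∣ ≤' R → Lf φ ≡ ∑ (L P) (λ t → G (snd t) * re (fst t))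
 Lf-TP {lo} {hi} {ℓ} {φ} P a b = tr (∑-cong∈ (zs R) (λ {k} m → tr (cong (λ w → G k * re w) (tr (coef-cong k (ev P)) (tr (coef-∑ k (L P) fst (λ t → ch (snd t))) (∑C-cong∈ (L P) (λ {t} mt → cong (fst t *C_) (coef-ch (snd t) k (smallR (inR mt)) (smallR (zs-abs m)))))))) (tr (sym (∑-* (L P) (G k) _)) (∑-cong (L P) (λ t → tr (cong (G k *_) (tr (cong re (*C-comm (fst t) _)) (re-real-* _ (fst t)))) (tr (cong (λ w → G k * (w * re (fst t))) (iv-⇔ (snd t ℤ.≟ k) (k ℤ.≟ snd t) sym sym)) (solve 3 (λ g i c → g :* (i :* c) := c :* (g :* i)) refl (G k) (iv (k ℤ.≟ snd t)) (re (fst t)))))))))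
  (tr (∑-swap (zs R) (L P) _) (∑-cong∈ (L P) (λ {t} mt → tr (∑-* (zs R) (re (fst t)) _) (tr (cong (re (fst t) *_) (∑-pick ℤ._≟_ (zs R) G (zs-unique R) (∈zs (snd t) (inR mt)) (λ k → k ℤ.≟ snd t))) (*-comm _ _)))))
  where
   inR : ∀ {t} → t ∈ L P → ℤ.∣ snd t ∣ ≤' R
   inR {t} m = abs≤ (snd t) (ℤP.≤-trans (fst (≤abs lo a)) (fst (freq P m))) (ℤP.≤-trans (snd (freq P m)) (snd (≤abs hi b)))

 -- Cauchy–Schwarz, in the arithmetic–geometric form
 Lf-CS : ∀ {lo hi ℓ ψ} τ → 0F ≤ τ → Pos τ → TP lo hi ℓ ψ → ℤ.∣ lo ∣ ≤' R → ℤ.∣ hi ∣ ≤' R →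
  Lf ψ ≤ ι half * (τ * 𝔼 (λ x → nrm (ψ x)) + inv τ * En G R lo hi)
 Lf-CS {lo} {hi} {ℓ} {ψ} τ τ≥0 τp P a b = ≡≤ main (≤≡ (𝔼-mono pt) (tr (𝔼-* (ι half) _) (cong (ι half *_) (tr (𝔼-+ _ _) (cong2 _+_ (𝔼-* τ _) (tr (𝔼-* (inv τ) _) (cong (inv τ *_) pars)))))))
  where
   win : ℤ → F
   win k = iv (lo ℤ.≤? k) * iv (k ℤ.≤? hi)
   win² : ∀ k → win k * win k ≡ win k
   win² k = tr (solve 2 (λ x y → (x :* y) :* (x :* y) := (x :* x) :* (y :* y)) refl (iv (lo ℤ.≤? k)) (iv (k ℤ.≤? hi))) (cong2 _*_ (idem (lo ℤ.≤? k)) (idem (k ℤ.≤? hi)))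
    where
     idem : {P : Set} (d : Dec P) → iv d * iv d ≡ iv d
     idem (yes p) = tr (cong (_* iv (yes p)) (iv-yes (yes p) p)) (1* _)
     idem (no h) = tr (cong (_* iv (no h)) (iv-no (no h) h)) (tr (zeroˡ _) (sym (iv-no (no h) h)))
   g' : ℤ → F
   g' k = win k * G k
   S : ℕ → ℂ
   S x = ∑C (zs R) (λ k → real (g' k) *C ch k x)
   pars : 𝔼 (λ x → nrm (S x)) ≡ En G R lo hi
   pars = tr (parseval (zs R) g' (zs-unique R) (λ m → smallR (zs-abs m))) (∑-cong (zs R) (λ k → tr (solve 2 (λ w g → (w :* g) :* (w :* g) := (w :* w) :* (g :* g)) refl (win k) (G k)) (cong (_* (G k * G k)) (win² k))))
   wc : ∀ {k} → k ∈ zs R → G k * re (coef k ψ) ≡ g' k * re (coef k ψ)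
   wc {k} m = go (lo ℤ.≤? k) (k ℤ.≤? hi)
    where
     zer : (¬ (lo ℤ.≤ k) ⊎ ¬ (k ℤ.≤ hi)) → re (coef k ψ) ≡ 0F
     zer o = cong re (TP-coef k (smallR a) (smallR b) (smallR (zs-abs m)) o P)
     both0 : re (coef k ψ) ≡ 0F → G k * re (coef k ψ) ≡ g' k * re (coef k ψ)
     both0 e = tr (cong (G k *_) e) (tr (zeroʳ _) (sym (tr (cong (g' k *_) e) (zeroʳ _))))
     go : Dec (lo ℤ.≤ k) → Dec (k ℤ.≤ hi) → G k * re (coef k ψ) ≡ g' k * re (coef k ψ)
     go (yes p) (yes q) = cong (_* re (coef k ψ)) (sym (tr (cong (_* G k) (tr (cong2 _*_ (iv-yes _ p) (iv-yes _ q)) (1* 1F))) (1* _)))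
     go (no h) _ = both0 (zer (inj₁ h))
     go (yes _) (no h) = both0 (zer (inj₂ h))
   main : Lf ψ ≡ 𝔼 (λ x → re (ψ x *C conj (S x)))
   main = tr (∑-cong∈ (zs R) wc) (sym (tr (𝔼-cong (λ x → cong re (tr (cong (ψ x *C_) (tr (∑C-conj (zs R) _) (∑C-cong (zs R) (λ k → tr (conj-* (real (g' k)) (ch k x)) (cong (_*C conj (ch k x)) (conj-real _)))))) (tr (sym (∑C-* (zs R) (ψ x) _)) (∑C-cong (zs R) (λ k → solveC 3 (λ s r b → s ⨯ (r ⨯ b) ≔ r ⨯ (s ⨯ b)) refl (ψ x) (real (g' k)) (conj (ch k x)))))))) (tr (cong re (tr (𝔼C-∑ (zs R) _) (∑C-cong (zs R) (λ k → 𝔼C-* (real (g' k)) _)))) (∑-cong (zs R) (λ k → re-real-* (g' k) _)))))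
   pt : ∀ x → re (ψ x *C conj (S x)) ≤ ι half * (τ * nrm (ψ x) + inv τ * nrm (S x))
   pt x = ≤-by (ι half * (inv τ * nrm (real τ *C ψ x +C (-C (S x))))) (0≤* (ι≥0 half) (0≤* (inv≥0 τp) (nrm≥0 _)))
    (tr (cong (re (ψ x *C conj (S x)) +_) (solve 6 (λ t i a b c d → con half :* (i :* ((t :* a :- :0 :* b :+ (:- c)) :* (t :* a :- :0 :* b :+ (:- c)) :+ (t :* b :+ :0 :* a :+ (:- d)) :* (t :* b :+ :0 :* a :+ (:- d)))) := con half :* ((t :* i) :* t :* (a :* a :+ b :* b) :+ i :* (c :* c :+ d :* d)) :- (t :* i) :* (a :* c :+ b :* d)) refl τ (inv τ) (re (ψ x)) (im (ψ x)) (re (S x)) (im (S x))))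
     (tr (cong (λ w → re (ψ x *C conj (S x)) + (ι half * (w * τ * nrm (ψ x) + inv τ * nrm (S x)) - w * (re (ψ x) * re (S x) + im (ψ x) * im (S x)))) (*-inv τp))
      (solve 7 (λ t i a b c d n → (a :* c :- b :* (:- d)) :+ (con half :* (:1 :* t :* (a :* a :+ b :* b) :+ i :* n) :- :1 :* (a :* c :+ b :* d)) := con half :* (t :* (a :* a :+ b :* b) :+ i :* n)) refl τ (inv τ) (re (ψ x)) (im (ψ x)) (re (S x)) (im (S x)) (nrm (S x)))))

-- The test function, block by block.

Yseq : (ℕ → ℕ) → ℕ → ℕ
Yseq M zero = 0
Yseq M (suc i) = Yseq M i +' (M (suc i) +' M (suc i))

-- Bound for the ℓ¹ norm of the coefficients at each stage. It may be huge: it enters only the final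
-- choice of precision, when everything else is fixed.
Λseq : (ℕ → ℕ) → ℕ → F
Λseq M zero = 0F
Λseq M (suc i) = Λseq M i * (ι 2ℚ * « M (suc i) +' M (suc i) ») + 1F

Λseq≥0 : ∀ M i → 0F ≤ Λseq M i
Λseq≥0 M zero = ≤-refl
Λseq≥0 M (suc i) = 0≤+ (0≤* (Λseq≥0 M i) (0≤* 0≤2 («»≥0 _))) 0≤1

-- The multiplier leaves room 2 H/17 in the squared modulus; adding v/25 costs at most H²/625 + 2
-- H/25, which is less since H ≤ 8.
nrm-step : ∀ u v H → nrm u ≤ 1F - ι q17 * H → nrm v ≤ H * H → 0F ≤ H → H ≤ ι q8 → nrm (u +C real (ι q25) *C v) ≤ 1F
nrm-step (a ⊹ b) (c ⊹ d) H hu hv H0 H8 = tr≤ (≡≤ (solve 4 (λ a b c d → (a :+ (con q25 :* c :- :0 :* d)) :* (a :+ (con q25 :* c :- :0 :* d)) :+ (b :+ (con q25 :* d :+ :0 :* c)) :* (b :+ (con q25 :* d :+ :0 :* c)) := (a :* a :+ b :* b) :+ (con (q25 ℚ.* q25) :* (c :* c :+ d :* d) :+ con (2ℚ ℚ.* q25) :* (a :* c :+ b :* d))) refl a b c d)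
 (+-mono hu (+-mono (*-monoˡ (ι (q25 ℚ.* q25)) (ι≥0 (q25 ℚ.* q25)) (tr≤ hv (*-monoʳ H H0 H8))) (*-monoˡ (ι (2ℚ ℚ.* q25)) (ι≥0 (2ℚ ℚ.* q25)) cs))))
 (≤-by (ι (q17 ℚ.- (q25 ℚ.* q25 ℚ.* q8 ℚ.+ 2ℚ ℚ.* q25)) * H) (0≤* (ι≥0 (q17 ℚ.- (q25 ℚ.* q25 ℚ.* q8 ℚ.+ 2ℚ ℚ.* q25))) H0)
  (solve 1 (λ H → :1 :- con q17 :* H :+ (con (q25 ℚ.* q25) :* (con q8 :* H) :+ con (2ℚ ℚ.* q25) :* H) :+ con (q17 ℚ.- (q25 ℚ.* q25 ℚ.* q8 ℚ.+ 2ℚ ℚ.* q25)) :* H := :1) refl H))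
 where
  cs : a * c + b * d ≤ H
  cs = sq-cancel H0 (tr≤ (≤-by ((a * d - b * c) * (a * d - b * c)) (0≤sq _) (solve 4 (λ a b c d → (a :* c :+ b :* d) :* (a :* c :+ b :* d) :+ (a :* d :- b :* c) :* (a :* d :- b :* c) := (a :* a :+ b :* b) :* (c :* c :+ d :* d)) refl a b c d))
   (≤≡ (*-mono (nrm≥0 (a ⊹ b)) (nrm≥0 (c ⊹ d)) (tr≤ hu (≤-by (ι q17 * H) (0≤* (ι≥0 q17) H0) (solve 1 (λ h → :1 :- con q17 :* h :+ con q17 :* h := :1) refl H))) hv) (1* _)))

module Littlewood (z : ℂ) (unit : nrm z ≡ 1F) (W D : ℕ) (D≤W : D +' D ≤' W) (Q : Quadrature z unit W)
 (G : ℤ → F) (R : ℕ) (R≤D : R ≤' D) (J : ℕ) (M : ℕ → ℕ) (B : ℕ → List ℕ)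
 (M-mono : ∀ i → i <' J → M i ≤' M (suc i))
 (uB : ∀ i → i <' J → Unique (B i))
 (B≤M : ∀ i → i <' J → ∀ {a} → a ∈ B i → a ≤' M (suc i))
 (B≥1 : ∀ i → i <' J → 1 ≤' length (B i))
 (M≥1 : ∀ i → i <' J → 1 ≤' M (suc i))
 (deg : ∀ i → i <' J → mdeg (M (suc i) +' M (suc i)) (length (B i)) *' (M (suc i) +' M (suc i)) ≤' D)
 (Y≤R : ∀ i → i ≤' J → Yseq M i ≤' R) (M≤R : ∀ i → i ≤' J → M i ≤' R)
 (energy : ∀ i → i <' J → En G R (ℤ.- pos (Yseq M (suc i))) (pos (M i)) ≤ ι qM * « length (B i) »)
 (mass : ∀ i → i <' J → ι q34 * « length (B i) » ≤ ∑ (B i) (λ a → G (pos a))) where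
 open Trig z unit W D D≤W Q
 open Functional z unit W D D≤W Q G R R≤D

 record Stage (i : ℕ) : Set where
  field
   φ : ℕ → ℂ
   φTP : TP (ℤ.- pos (Yseq M i)) (pos (M i)) (Λseq M i) φ
   φ≤1 : ∀ x → nrm (φ x) ≤ 1F
   φL : ι q60 * « i » ≤ Lf φ

 stage0 : Stage 0
 stage0 = record
  { φ = λ _ → 0C
  ; φTP = record { L = [] ; freq = λ () ; ℓ1 = ≤-refl ; ev = λ _ → refl }
  ; φ≤1 = λ _ → ≡≤ (tr (nrm-real 0F) (zeroˡ 0F)) 0≤1
  ; φL = ≡⇒≤ (tr (cong (ι q60 *_) «0») (tr (zeroʳ _) (sym (∑-zero∈ (zs R) (λ {k} _ → tr (cong (λ w → G k * re w) (tr (𝔼C-cong (λ y → zeroCˡ (conj (ch k y)))) (𝔼C-const 0C))) (zeroʳ _)))))) }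

 -- The correction ψ = φ (1 - m) has frequencies from `lo'` to `M i`, where `G` has little energy,
 -- and mean square O(1/b). So passing from φ to φ m loses at most 1/75, while f/25 gains 3/100; and
 -- 3/100 - 1/75 = 1/60.
 step : ∀ i → i <' J → Stage i → Stage (suc i)
 step i l St = record
  { φ = φ'
  ; φTP = φ'TP
  ; φ≤1 = λ x → nrm-step (φ x *C m x) (f x) (H1 x) (≡≤ (nrm-* (φ x) (m x)) (tr≤ (*-monoʳ (nrm (m x)) (nrm≥0 (m x)) (φ≤1 x)) (≡≤ (1* _) (nrm-m x)))) (tr≤ (nrm≤N1² (f x)) (*-mono (N1≥0 (f x)) (N1≥0 (f x)) (f≤H1 x) (f≤H1 x))) (H1≥0 x) (H1≤8 x)
  ; φL = gain }
  where
   open Stage St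
   open Multiplier z unit W D D≤W Q (B i) (M (suc i)) (uB i l) (B≤M i l) (B≥1 i l) (M≥1 i l) (deg i l)
   φ' : ℕ → ℂ
   φ' x = φ x *C m x +C real (ι q25) *C f x
   lo' : ℤ
   lo' = ℤ.- pos (Yseq M (suc i))
   loeq : lo' ≡ ℤ.- pos (Yseq M i) ℤ.+ ℤ.- pos X
   loeq = tr (cong ℤ.-_ (ℤP.pos-+ (Yseq M i) X)) (ℤP.neg-distrib-+ (pos (Yseq M i)) (pos X))
   lo'≤0 : lo' ℤ.≤ pos 0
   lo'≤0 = ℤP.neg-mono-≤ {pos 0} {pos (Yseq M (suc i))} (ℤ.+≤+ z≤n)
   φmTP : TP lo' (pos (M i)) (Λseq M i * (ι 2ℚ * « X »)) (λ x → φ x *C m x)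
   φmTP = TP-weaken (ℤP.≤-reflexive loeq) (ℤP.≤-reflexive (ℤP.+-identityʳ _)) (TP-* (Λseq≥0 M i) φTP mTP)
   fTP : TP lo' (pos (M (suc i))) 1F f
   fTP = TP-∑ (B i) (λ _ → real ib) pos (λ {a} ma → ℤP.≤-trans lo'≤0 (ℤ.+≤+ z≤n) , ℤ.+≤+ (B≤M i l ma)) (≡⇒≤ (tr (∑-cong (B i) (λ _ → N1-real ib≥0)) (tr (∑-const (B i) ib) bib)))
   φ'TP : TP lo' (pos (M (suc i))) (Λseq M (suc i)) φ'
   φ'TP = TP-+ (TP-weaken ℤP.≤-refl (ℤ.+≤+ (M-mono i l)) φmTP) (TP-ℓ (≡≤ (*1 _) (≡≤ (N1-real (ι≥0 q25)) (ι-≤ (from-yes (q25 ℚ.≤? 1ℚ))))) (TP-scale (real (ι q25)) fTP))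
   ψ : ℕ → ℂ
   ψ x = φ x *C (1C +C (-C (m x)))
   ψTP : Σ F λ ℓ → TP lo' (pos (M i)) ℓ ψ
   ψTP = _ , TP-weaken (ℤP.≤-reflexive loeq) (ℤP.≤-reflexive (ℤP.+-identityʳ _)) (TP-* (Λseq≥0 M i) φTP (TP-+ (TP-const 1C (ℤP.neg-mono-≤ {pos 0} {pos X} (ℤ.+≤+ z≤n)) ℤP.≤-refl) (TP-cong (λ x → solveC 1 (λ m → ⊝ m ≔ (⊝ conC 1ℚ) ⨯ m) refl (m x)) (TP-scale (-C 1C) mTP))))
   𝔼ψ : 𝔼 (λ x → nrm (ψ x)) ≤ ι q130 * ib
   𝔼ψ = tr≤ (𝔼-mono (λ x → ≡≤ (nrm-* (φ x) _) (≤≡ (*-monoʳ _ (nrm≥0 _) (φ≤1 x)) (1* _)))) L2-m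
   absY : ℤ.∣ lo' ∣ ≤' R
   absY = subst (_≤' R) (sym (ℤP.∣-i∣≡∣i∣ (pos (Yseq M (suc i))))) (Y≤R (suc i) l)
   -- Balances 130 τ/b against b/(10⁶ τ): at τ = b/6500 half of their sum is 0.01325, just below
   -- 1/75.
   τ : F
   τ = ι qτ * « b »
   τp : Pos τ
   τp = Pos-* (λ w → from-no (qτ ℚ.≤? 0ℚ) (ι-≤⁻ w)) («»-pos (B≥1 i l))
   invτ : inv τ ≡ ι qτ' * ib
   invτ = tr (sym (*1 (inv τ))) (tr (cong (inv τ *_) (sym τe)) (tr (sym (*-assoc (inv τ) τ _)) (tr (cong (_* (ι qτ' * ib)) (tr (*-comm (inv τ) τ) (*-inv τp))) (1* _))))
    where
     τe : τ * (ι qτ' * ib) ≡ 1F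
     τe = tr (solve 2 (λ b i → (con qτ :* b) :* (con qτ' :* i) := b :* i) refl « b » ib) bib
   Lψ : Lf ψ ≤ ι (pos 1 ℚ./ 75)
   Lψ = tr≤ (Lf-CS τ (pos⇒0≤ τp) τp (snd ψTP) absY (M≤R i (N.<⇒≤ l)))
    (tr≤ (*-monoˡ (ι half) (ι≥0 half) (+-mono (*-monoˡ τ (pos⇒0≤ τp) 𝔼ψ) (*-monoˡ (inv τ) (inv≥0 τp) (energy i l))))
     (≡≤ (tr (cong (λ w → ι half * (τ * (ι q130 * ib) + w * (ι qM * « b »))) invτ) (tr (solve 2 (λ b i → con half :* ((con qτ :* b) :* (con q130 :* i) :+ (con qτ' :* i) :* (con qM :* b)) := con (half ℚ.* (qτ ℚ.* q130 ℚ.+ qτ' ℚ.* qM)) :* (b :* i)) refl « b » ib) (tr (cong (ι (half ℚ.* (qτ ℚ.* q130 ℚ.+ qτ' ℚ.* qM)) *_) bib) (*1 _))))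
      (ι-≤ (from-yes (half ℚ.* (qτ ℚ.* q130 ℚ.+ qτ' ℚ.* qM) ℚ.≤? pos 1 ℚ./ 75)))))
   Lφ : Lf (λ x → φ x *C m x) + Lf ψ ≡ Lf φ
   Lφ = tr (sym (Lf-+ _ _)) (Lf-cong (λ x → solveC 2 (λ p m → p ⨯ m ∔ p ⨯ (conC 1ℚ ∔ ⊝ m) ≔ p) refl (φ x) (m x)))
   Lff : ι (q25 ℚ.* q34) ≤ Lf (λ x → real (ι q25) *C f x)
   Lff = ≤≡ (≡≤ (sym (tr (solve 2 (λ b i → con q25 :* (i :* (con q34 :* b)) := con (q25 ℚ.* q34) :* (b :* i)) refl « b » ib) (tr (cong (ι (q25 ℚ.* q34) *_) bib) (*1 _)))) (*-monoˡ (ι q25) (ι≥0 q25) (*-monoˡ ib ib≥0 (mass i l))))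
    (sym (tr (Lf-TP (TP-scale (real (ι q25)) fTP) absY (M≤R (suc i) l)) (tr (∑-map _ (map (λ a → real ib , pos a) (B i)) _) (tr (∑-map _ (B i) _) (tr (∑-cong (B i) (λ a → tr (cong (G (pos a) *_) (re-real-* (ι q25) (real ib))) (solve 3 (λ g c i → g :* (c :* i) := c :* (i :* g)) refl (G (pos a)) (ι q25) ib))) (tr (∑-* (B i) (ι q25) _) (cong (ι q25 *_) (∑-* (B i) ib _))))))))
   gain : ι q60 * « suc i » ≤ Lf φ'
   gain = tr≤ (≡≤ (tr (cong (ι q60 *_) («suc» i)) (solve 1 (λ n → con q60 :* (:1 :+ n) := con q60 :* n :+ con q60) refl « i »)) (+-mono φL (ι-≤ (from-yes (q60 ℚ.≤? q25 ℚ.* q34 ℚ.- pos 1 ℚ./ 75)))))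
    (≤≡ (≤-by ((ι (pos 1 ℚ./ 75) - Lf ψ) + (Lf (λ x → real (ι q25) *C f x) - ι (q25 ℚ.* q34))) (0≤+ (0≤- Lψ) (0≤- Lff))
     (tr (cong (λ w → w + ι (q25 ℚ.* q34 ℚ.- pos 1 ℚ./ 75) + ((ι (pos 1 ℚ./ 75) - Lf ψ) + (Lf (λ x → real (ι q25) *C f x) - ι (q25 ℚ.* q34)))) (sym Lφ))
      (solve 3 (λ u v w → u :+ v :+ con (q25 ℚ.* q34 ℚ.- pos 1 ℚ./ 75) :+ ((con (pos 1 ℚ./ 75) :- v) :+ (w :- con (q25 ℚ.* q34))) := u :+ w) refl (Lf (λ x → φ x *C m x)) (Lf ψ) (Lf (λ x → real (ι q25) *C f x)))))
     (sym (Lf-+ _ _)))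

 stages : ∀ i → i ≤' J → Stage i
 stages zero _ = stage0
 stages (suc i) l = step i l (stages i (N.<⇒≤ l))

 result : Σ (ℕ → ℂ) λ φ → TP (ℤ.- pos (Yseq M J)) (pos (M J)) (Λseq M J) φ × (∀ x → nrm (φ x) ≤ 1F) × (ι q60 * « J » ≤ Lf φ)
 result = φ , φTP , φ≤1 , φL
  where open Stage (stages J N.≤-refl)

-- Construction of the quadrature.

nonpos-power : ∀ n d u → nrm u ≡ 1F → 0F ≤ d → d ≤ 1F - re u → 1F ≤ (1F - re u) + « n » * d → Σ ℕ λ j → (1 ≤' j) × (re (u ^C j) ≤ 0F)
nonpos-power zero d u nu d0 hd h = 1 , s≤s z≤n , ≡≤ (cong re (*C-identityʳ u)) (-≤0 (≤≡ (0≤- h) (tr (cong (λ w → (1F - re u) + w * d - 1F) «0») (solve 2 (λ c d → (:1 :- c) :+ :0 :* d :- :1 := :0 :- c) refl (re u) d))))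
nonpos-power (suc n) d u nu d0 hd h with ≤-total (re u) 0F
... | inj₁ le = 1 , s≤s z≤n , ≡≤ (cong re (*C-identityʳ u)) le
... | inj₂ ge = let (j , j1 , r) = nonpos-power n d (u *C u) (tr (nrm-* u u) (tr (cong2 _*_ nu nu) (1* 1F))) d0 (tr≤ hd (tr≤ (≤-by d d0 refl) grow)) big
 in j +' j , N.≤-trans j1 (N.m≤m+n j j) , ≡≤ (cong re (tr (^C-+ u j j) (sym (^C-distrib u u j)))) r
 where
  c s : F
  c = re u
  s = im u
  sq : c * c - s * s ≡ c * c + c * c - 1F
  sq = tr (solve 2 (λ c s → c :* c :- s :* s := c :* c :+ c :* c :- (c :* c :+ s :* s)) refl c s) (cong (λ w → c * c + c * c - w) nu)
  c≤1 : 0F ≤ 1F - c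
  c≤1 = tr≤ d0 hd
  -- For c ≥ 0 one squaring increases 1 - Re u by at least d, because 1 - (2 c² - 1) = 2 (1 - c)(1 +
  -- c) and d ≤ 1 - c. The fuel n counts the squarings that may be needed.
  grow : (1F - c) + d ≤ 1F - re (u *C u)
  grow = ≤≡ (≤-by ((1F - c - d) + (c + c) * (1F - c)) (0≤+ (0≤- hd) (0≤* (0≤+ ge ge) c≤1)) (solve 2 (λ c d → (:1 :- c) :+ d :+ ((:1 :- c :- d) :+ (c :+ c) :* (:1 :- c)) := :1 :- (c :* c :+ c :* c :- :1)) refl c d)) (cong (λ w → 1F - w) (sym sq))
  big : 1F ≤ (1F - re (u *C u)) + « n » * d
  big = tr≤ h (≡≤ (tr (cong (λ w → (1F - c) + w * d) («suc» n)) (solve 3 (λ c d n → (:1 :- c) :+ (:1 :+ n) :* d := ((:1 :- c) :+ d) :+ n :* d) refl c d « n »)) (+-mono grow ≤-refl))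

nonpos : ∀ u → nrm u ≡ 1F → u ≢ 1C → Σ ℕ λ j → (1 ≤' j) × (re (u ^C j) ≤ 0F)
nonpos u nu ne = nonpos-power (fst (arch (inv d))) d u nu (pos⇒0≤ dp) ≤-refl
 (tr≤ (≡≤ (sym (tr (*-comm (inv d) d) (*-inv dp))) (*-monoʳ d (pos⇒0≤ dp) (snd (arch (inv d))))) (≤-by d (pos⇒0≤ dp) (+-comm _ _)))
 where
  d : F
  d = 1F - re u
  sq0 : ∀ a → a * a ≡ 0F → a ≡ 0F
  sq0 a q = ≤-antisym (sq-cancel ≤-refl (≡⇒≤ (tr q (sym (zeroˡ 0F)))))
   (≤≡ (neg≥0 { - a} (sq-cancel ≤-refl (≡⇒≤ (tr (solve 1 (λ a → (:- a) :* (:- a) := a :* a) refl a) (tr q (sym (zeroˡ 0F))))))) (solve 1 (λ a → :- (:- a) := a) refl a))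
  dp : Pos d
  dp h = ne (cong2 _⊹_ e1 (sq0 (im u) (tr (solve 2 (λ a b → b :* b := (a :* a :+ b :* b) :- a :* a) refl (re u) (im u)) (tr (cong2 (λ p q → p - q * q) nu e1) (solve 0 (:1 :- :1 :* :1 := :0) refl)))))
   where
    re≤1 : re u ≤ 1F
    re≤1 = tr≤ (≤∣∣ (re u)) (∣re∣≤1 {u} (≡⇒≤ nu))
    e1 : re u ≡ 1F
    e1 = ≤-antisym re≤1 (-≤0 (≤≡ (neg≥0 h) (solve 1 (λ a → :- (:1 :- a) := a :- :1) refl (re u))))

-- v = uʲ is a root of T² − 2 (Re v) T + 1, whose coefficients are nonnegative when Re v ≤ 0
balance : ∀ u → nrm u ≡ 1F → ∀ j → re (u ^C j) ≤ 0F →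
 Σ (List (F × ℕ)) λ P → All (λ p → 0F ≤ fst p) P × (∑ P fst ≡ 1F) × (∑C P (λ p → real (fst p) *C u ^C snd p) ≡ 0C)
balance u nu j c≤0 = (s , 0) ∷ (s * (- c + - c) , j) ∷ (s , j +' j) ∷ [] , (s≥0 ∷ 0≤* s≥0 (0≤+ (neg≥0 c≤0) (neg≥0 c≤0)) ∷ s≥0 ∷ []) ,
 tr (solve 2 (λ s c → s :+ (s :* (:- c :+ :- c) :+ (s :+ :0)) := (:1 :+ :1 :- c :- c) :* s) refl s c) (*-inv tp) ,
 fin s (u ^C j) (u ^C (j +' j)) (nrm-^C u nu j) (^C-+ u j j)
 where
  c s : F
  c = re (u ^C j)
  s = inv (1F + 1F - c - c)
  tp : Pos (1F + 1F - c - c)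
  tp = Pos-≤ Pos-1 (≤-by (1F + (- c + - c)) (0≤+ 0≤1 (0≤+ (neg≥0 c≤0) (neg≥0 c≤0))) (solve 1 (λ c → :1 :+ (:1 :+ (:- c :+ :- c)) := :1 :+ :1 :- c :- c) refl c))
  s≥0 : 0F ≤ s
  s≥0 = inv≥0 tp
  fin : ∀ s v w → nrm v ≡ 1F → w ≡ v *C v → real s *C 1C +C (real (s * (- re v + - re v)) *C v +C (real s *C w +C 0C)) ≡ 0C
  fin s (c ⊹ d) w nv refl = cong2 _⊹_
   (tr (solve 3 (λ s c d → (s :* :1 :- :0 :* :0) :+ ((s :* (:- c :+ :- c) :* c :- :0 :* d) :+ ((s :* (c :* c :- d :* d) :- :0 :* (c :* d :+ d :* c)) :+ :0)) := s :* (:1 :- (c :* c :+ d :* d))) refl s c d) (tr (cong (λ n → s * (1F - n)) nv) (solve 1 (λ s → s :* (:1 :- :1) := :0) refl s)))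
   (solve 3 (λ s c d → (s :* :0 :+ :0 :* :1) :+ ((s :* (:- c :+ :- c) :* d :+ :0 :* c) :+ ((s :* (c :* d :+ d :* c) :+ :0 :* (c :* c :- d :* d)) :+ :0)) := :0) refl s c d)

module Build (z : ℂ) (unit : nrm z ≡ 1F) where
 open Char z unit

 cs : List (F × ℕ) → ℤ → ℂ
 cs P k = ∑C P (λ p → real (fst p) *C ch k (snd p))

 mass : List (F × ℕ) → F
 mass P = ∑ P fst

 -- Convolution of measures multiplies their transforms, so a frequency once killed stays killed,
 -- and the frequencies 1, ..., W can be treated one at a time.
 conv : List (F × ℕ) → List (F × ℕ) → List (F × ℕ)
 conv P Q = concatMap (λ p → map (λ q → fst p * fst q , snd p +' snd q) Q) P

 ch-pt : ∀ k x y → ch k (x +' y) ≡ ch k x *C ch k y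
 ch-pt k x y = tr (cong e (tr (cong (k ℤ.*_) (ℤP.pos-+ x y)) (ℤP.*-distribˡ-+ k (pos x) (pos y)))) (e-+ (k ℤ.* pos x) (k ℤ.* pos y))

 cs-conv : ∀ P Q k → cs (conv P Q) k ≡ cs P k *C cs Q k
 cs-conv P Q k = tr (∑C-concatMap _ P _) (tr (∑C-cong P (λ p → tr (∑C-map _ Q _) (tr (∑C-cong Q (λ q → tr (cong2 _*C_ (real-* (fst p) (fst q)) (ch-pt k (snd p) (snd q))) (solveC 4 (λ a b c d → (a ⨯ b) ⨯ (c ⨯ d) ≔ (a ⨯ c) ⨯ (b ⨯ d)) refl (real (fst p)) (real (fst q)) (ch k (snd p)) (ch k (snd q))))) (∑C-* Q _ _)))) (∑C-*ʳ P _ _))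

 mass-conv : ∀ P Q → mass (conv P Q) ≡ mass P * mass Q
 mass-conv P Q = tr (∑-concatMap _ P _) (tr (∑-cong P (λ p → tr (∑-map _ Q _) (∑-* Q (fst p) _))) (∑-*ʳ P _ _))

 nonneg-conv : ∀ P Q → All (λ p → 0F ≤ fst p) P → All (λ p → 0F ≤ fst p) Q → All (λ p → 0F ≤ fst p) (conv P Q)
 nonneg-conv [] Q [] b = []
 nonneg-conv (p ∷ P) Q (a ∷ as) b = AllP.++⁺ (AllP.map⁺ (All.map (λ h → 0≤* a h) b)) (nonneg-conv P Q as b)

 record Pre (W : ℕ) : Set where
  field
   P : List (F × ℕ)
   P≥0 : All (λ p → 0F ≤ fst p) P
   P1 : mass P ≡ 1F
   P⊥ : ∀ k → 1 ≤' k → k ≤' W → cs P (pos k) ≡ 0C × cs P (ℤ.- pos k) ≡ 0C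

 ch-pos : ∀ k x → ch (pos k) x ≡ (z ^C k) ^C x
 ch-pos k x = tr (cong e (sym (ℤP.pos-* k x))) (tr (cong (z ^C_) (N.*-comm k x)) (^C-* z x k))

 cs-neg : ∀ P k → cs P (ℤ.- k) ≡ conj (cs P k)
 cs-neg P k = sym (tr (∑C-conj P _) (∑C-cong P (λ p → tr (conj-* (real (fst p)) (ch k (snd p))) (cong2 _*C_ (conj-real _) (sym (ch-neg k (snd p)))))))

 atom : ∀ k → z ^C k ≢ 1C → Σ (List (F × ℕ)) λ P → All (λ p → 0F ≤ fst p) P × (mass P ≡ 1F) × (cs P (pos k) ≡ 0C)
 atom k ne = from (nonpos (z ^C k) (nrm-^C z unit k) ne)
  where
   wrap : (Σ (List (F × ℕ)) λ P → All (λ p → 0F ≤ fst p) P × (∑ P fst ≡ 1F) × (∑C P (λ p → real (fst p) *C (z ^C k) ^C snd p) ≡ 0C)) → Σ (List (F × ℕ)) λ P → All (λ p → 0F ≤ fst p) P × (mass P ≡ 1F) × (cs P (pos k) ≡ 0C)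
   wrap (P , a , m , o) = P , a , m , tr (∑C-cong P (λ p → cong (real (fst p) *C_) (ch-pos k (snd p)))) o
   from : (Σ ℕ λ j → (1 ≤' j) × (re ((z ^C k) ^C j) ≤ 0F)) → _
   from (j , _ , c≤0) = wrap (balance (z ^C k) (nrm-^C z unit k) j c≤0)

 extend : ∀ W → Pre W → (Σ (List (F × ℕ)) λ A → All (λ p → 0F ≤ fst p) A × (mass A ≡ 1F) × (cs A (pos (suc W)) ≡ 0C)) → Pre (suc W)
 extend W pr (A , A≥0 , A1 , A⊥) = record
  { P = conv P A ; P≥0 = nonneg-conv P A P≥0 A≥0
  ; P1 = tr (mass-conv P A) (tr (cong2 _*_ P1 A1) (1* 1F))
  ; P⊥ = orth }
  where
   open Pre pr
   conj0 : conj 0C ≡ 0C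
   conj0 = conj-real 0F
   orth : ∀ k → 1 ≤' k → k ≤' suc W → cs (conv P A) (pos k) ≡ 0C × cs (conv P A) (ℤ.- pos k) ≡ 0C
   orth k a b = go (k ℕ.≟ suc W)
    where
     go : Dec (k ≡ suc W) → cs (conv P A) (pos k) ≡ 0C × cs (conv P A) (ℤ.- pos k) ≡ 0C
     go (yes refl) = tr (cs-conv P A (pos k)) (tr (cong (cs P (pos k) *C_) A⊥) (zeroCʳ _)) ,
      tr (cs-conv P A (ℤ.- pos k)) (tr (cong (cs P (ℤ.- pos k) *C_) (tr (cs-neg A (pos k)) (tr (cong conj A⊥) conj0))) (zeroCʳ _))
     go (no ne) = let (o1 , o2) = P⊥ k a (N.≤-pred (N.≤∧≢⇒< b ne)) in
      tr (cs-conv P A (pos k)) (tr (cong (_*C cs A (pos k)) o1) (zeroCˡ _)) ,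
      tr (cs-conv P A (ℤ.- pos k)) (tr (cong (_*C cs A (ℤ.- pos k)) o2) (zeroCˡ _))

 pre : ∀ W → (∀ k → 1 ≤' k → k ≤' W → z ^C k ≢ 1C) → Pre W
 pre zero h = record { P = (1F , 0) ∷ [] ; P≥0 = 0≤1 ∷ [] ; P1 = +0 1F ; P⊥ = λ { (suc k) _ () } }
 pre (suc W) h = extend W (pre W (λ k a b → h k a (N.m≤n⇒m≤1+n b))) (atom (suc W) (h (suc W) (s≤s z≤n) N.≤-refl))

 quadrature : ∀ W → (∀ k → 1 ≤' k → k ≤' W → z ^C k ≢ 1C) → Quadrature z unit W
 quadrature W h = record { pts = P ; w≥0 = λ m → All.lookup P≥0 m ; tot = P1 ; orth = o }
  where
   open Pre (pre W h)
   o : ∀ k → k ≢ pos 0 → ℤ.∣ k ∣ ≤' W → cs P k ≡ 0C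
   o (pos zero) ne l = ⊥-elim (ne refl)
   o (pos (suc k)) ne l = fst (P⊥ (suc k) (s≤s z≤n) l)
   o (negsuc k) ne l = snd (P⊥ (suc k) (s≤s z≤n) l)

-- Discrete cosine and sine on a rational rotation.

-- the rational point of the unit circle with tan (θ / 2) = 1 / S, S = n + 1
module Unit (n : ℕ) where
 S ε iS : F
 S = « suc n »
 ε = inv S
 iS = inv (S * S + 1F)

 S≥1 : 1F ≤ S
 S≥1 = ≡≤ (sym «1») («»-mono (s≤s z≤n))
 S≥0 : 0F ≤ S
 S≥0 = «»≥0 _
 ε≥0 : 0F ≤ ε
 ε≥0 = inv≥0 («suc»-pos n)
 Sε : S * ε ≡ 1F
 Sε = *-inv («suc»-pos n)

 q+ : Pos (S * S + 1F)
 q+ = Pos-≤ Pos-1 (≤-by (S * S) (0≤sq S) (+-comm 1F (S * S)))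
 iS≥0 : 0F ≤ iS
 iS≥0 = inv≥0 q+
 qiS : (S * S + 1F) * iS ≡ 1F
 qiS = *-inv q+

 z : ℂ
 z = ((S * S - 1F) * iS) ⊹ ((S + S) * iS)

 unit : nrm z ≡ 1F
 unit = tr (solve 2 (λ s i → ((s :* s :- :1) :* i) :* ((s :* s :- :1) :* i) :+ ((s :+ s) :* i) :* ((s :+ s) :* i) := ((s :* s :+ :1) :* i) :* ((s :* s :+ :1) :* i)) refl S iS) (tr (cong2 _*_ qiS qiS) (1* 1F))

 c s : ℕ → F
 c t = re (z ^C t)
 s t = im (z ^C t)

 -- Exact because tan (θ/2) = 1/S. Together with `ds` this is the discrete form of cos' = -sin and
 -- sin' = cos.
 dc : ∀ t → S * (c t - c (suc t)) ≡ s t + s (suc t)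
 dc t = fromz (z ^C t)
  where
   fromz : ∀ v → S * (re v - re (z *C v)) ≡ im v + im (z *C v)
   fromz (a ⊹ b) = tr (solve 4 (λ s i a b → s :* (a :- ((s :* s :- :1) :* i :* a :- (s :+ s) :* i :* b)) := s :* a :- s :* a :* ((s :* s :+ :1) :* i) :+ (s :+ s) :* i :* a :+ (((s :* s :+ :1) :* i) :* b :+ ((s :* s :- :1) :* i) :* b)) refl S iS a b)
    (tr (cong (λ w → S * a - S * a * w + (S + S) * iS * a + (w * b + ((S * S - 1F) * iS) * b)) qiS) (solve 4 (λ s i a b → s :* a :- s :* a :* :1 :+ (s :+ s) :* i :* a :+ (:1 :* b :+ ((s :* s :- :1) :* i) :* b) := b :+ ((s :* s :- :1) :* i :* b :+ (s :+ s) :* i :* a)) refl S iS a b))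

 ds : ∀ t → S * (s (suc t) - s t) ≡ c t + c (suc t)
 ds t = fromz (z ^C t)
  where
   fromz : ∀ v → S * (im (z *C v) - im v) ≡ re v + re (z *C v)
   fromz (a ⊹ b) = tr (solve 4 (λ s i a b → s :* (((s :* s :- :1) :* i :* b :+ (s :+ s) :* i :* a) :- b) := (((s :* s :+ :1) :* i) :* a :+ ((s :* s :- :1) :* i) :* a) :+ s :* b :* ((s :* s :+ :1) :* i) :- (s :+ s) :* i :* b :- s :* b) refl S iS a b)
    (tr (cong (λ w → (w * a + ((S * S - 1F) * iS) * a) + S * b * w - (S + S) * iS * b - S * b) qiS) (solve 4 (λ s i a b → (:1 :* a :+ ((s :* s :- :1) :* i) :* a) :+ s :* b :* :1 :- (s :+ s) :* i :* b :- s :* b := a :+ ((s :* s :- :1) :* i :* a :- (s :+ s) :* i :* b)) refl S iS a b))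

 cs1 : ∀ t → c t * c t + s t * s t ≡ 1F
 cs1 t = nrm-^C z unit t

 c≤1 : ∀ t → c t ≤ 1F
 c≤1 t = tr≤ (≤∣∣ (c t)) (∣re∣≤1 {z ^C t} (≡⇒≤ (cs1 t)))
 s≤1 : ∀ t → s t ≤ 1F
 s≤1 t = tr≤ (≤∣∣ (s t)) (∣im∣≤1 {z ^C t} (≡⇒≤ (cs1 t)))

 c0 : c 0 ≡ 1F
 c0 = refl
 s0 : s 0 ≡ 0F
 s0 = refl

 AllPos : ℕ → Set
 AllPos t = ∀ j → j <' t → Pos (c j)

 S-cancel : ∀ {a b} → S * a ≤ S * b → a ≤ b
 S-cancel = *-cancel-≤ S («suc»-pos n)

 s-mono : ∀ t → 0F ≤ c t → 0F ≤ c (suc t) → s t ≤ s (suc t)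
 s-mono t p q = -≤0 (S-cancel (≡≤ (zeroʳ S) (≤≡ (0≤+ p q) (sym (ds t)))))

 s≥0 : ∀ t → AllPos t → 0F ≤ s t
 s≥0 zero h = ≤-refl
 s≥0 (suc zero) h = ≤≡ (0≤* (0≤+ S≥0 S≥0) iS≥0) (sym (cong im (*C-identityʳ z)))
 s≥0 (suc (suc t)) h = ≤≡ (0≤+ (0≤* re≥0 (s≥0 (suc t) (λ j l → h j (N.m<n⇒m<1+n l)))) (0≤* (0≤* (0≤+ S≥0 S≥0) iS≥0) (pos⇒0≤ (h (suc t) N.≤-refl)))) refl
  where
   re≥0 : 0F ≤ re z
   re≥0 = 0≤* (0≤- (tr≤ S≥1 (≡≤ (sym (*1 S)) (*-monoˡ S S≥0 S≥1)))) iS≥0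

 c+s≥1 : ∀ t → 0F ≤ c t → 0F ≤ s t → 1F ≤ c t + s t
 c+s≥1 t p q = sq-cancel (0≤+ p q) (≡≤ (tr (1* 1F) (sym (cs1 t))) (≤-by (ι 2ℚ * (c t * s t)) (0≤* (ι≥0 2ℚ) (0≤* p q)) (solve 2 (λ c s → c :* c :+ s :* s :+ :2 :* (c :* s) := (c :+ s) :* (c :+ s)) refl (c t) (s t))))

 -- While the cosines are positive, c + s ≥ 1 at both ends of a step, so S (s - c + 1) grows by at
 -- least 2. At t = S this forces c ≤ 0: a quarter turn takes at most S steps.
 drift : ∀ t → AllPos (suc t) → ι 2ℚ * « t » ≤ S * (s t - c t + 1F)
 drift zero h = ≡⇒≤ (tr (cong (ι 2ℚ *_) «0») (solve 1 (λ s → :2 :* :0 := s :* (:0 :- :1 :+ :1)) refl S))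
 drift (suc t) h = ≡≤ (tr (cong (ι 2ℚ *_) («suc» t)) (solve 1 (λ t → :2 :* (:1 :+ t) := :2 :* t :+ (:1 :+ :1)) refl « t »))
  (≤≡ (+-mono (drift t h') (+-mono (c+s≥1 t ct (s≥0 t (λ j l → h' j (N.m<n⇒m<1+n l)))) (c+s≥1 (suc t) ct' (s≥0 (suc t) h'))))
   (tr (solve 5 (λ S a b a' b' → S :* (b :- a :+ :1) :+ ((a :+ b) :+ (a' :+ b')) := S :* (b :- a :+ :1) :+ ((a :+ a') :+ (b :+ b'))) refl S (c t) (s t) (c (suc t)) (s (suc t)))
    (tr (cong2 (λ p q → S * (s t - c t + 1F) + (p + q)) (sym (ds t)) (sym (dc t))) (solve 5 (λ S a b a' b' → S :* (b :- a :+ :1) :+ (S :* (b' :- b) :+ S :* (a :- a')) := S :* (b' :- a' :+ :1)) refl S (c t) (s t) (c (suc t)) (s (suc t))))))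
  where
   h' : AllPos (suc t)
   h' j l = h j (N.m<n⇒m<1+n l)
   ct = pos⇒0≤ (h' t N.≤-refl)
   ct' = pos⇒0≤ (h (suc t) N.≤-refl)

 find : ∀ fuel t → t +' fuel ≡ suc (suc n) → AllPos t → Σ ℕ λ T → (T ≤' suc n) × (c T ≤ 0F) × AllPos T
 find zero t e h = ⊥-elim (h (suc n) lt (-≤0 (S-cancel (≡≤ (zeroʳ S) (≤≡ (0≤- dr) (solve 2 (λ S c → S :* (:2 :- c) :- :2 :* S := S :* (:0 :- c)) refl S (c (suc n))))))))
  where
   lt : suc n <' t
   lt = N.≤-reflexive (sym (tr (sym (N.+-identityʳ t)) e))
   dr : ι 2ℚ * S ≤ S * (ι 2ℚ - c (suc n))
   dr = tr≤ (drift (suc n) (λ j l → h j (N.<-≤-trans l lt))) (*-monoˡ S S≥0 (≤-by (1F - s (suc n)) (0≤- (s≤1 (suc n))) (solve 2 (λ c s → s :- c :+ :1 :+ (:1 :- s) := :2 :- c) refl (c (suc n)) (s (suc n)))))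
 find (suc fuel) t e h with c t ≤? 0F
 ... | yes p = t , N.≤-pred (subst (suc t ≤'_) e (N.≤-trans (N.m≤m+n (suc t) fuel) (N.≤-reflexive (sym (N.+-suc t fuel))))) , p , h
 ... | no np = find fuel (suc t) (tr (sym (N.+-suc t fuel)) e) (λ j l → lem j (N.m<1+n⇒m<n∨m≡n l))
  where
   lem : ∀ j → (j <' t) ⊎ (j ≡ t) → Pos (c j)
   lem j (inj₁ l) = h j l
   lem j (inj₂ refl) = np

opaque
 -- The length of a quarter turn, as the first t at which the cosine is no longer positive. Opaque,
 -- so that the search is never run.
 T4 : ℕ → ℕ
 T4 n = fst (Unit.find n (suc (suc n)) 0 refl (λ j ()))

 T4≤S : ∀ n → T4 n ≤' suc n
 T4≤S n = fst (snd (Unit.find n (suc (suc n)) 0 refl (λ j ())))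

 T4-c : ∀ n → Unit.c n (T4 n) ≤ 0F
 T4-c n = fst (snd (snd (Unit.find n (suc (suc n)) 0 refl (λ j ()))))

 T4-pos : ∀ n → Unit.AllPos n (T4 n)
 T4-pos n = snd (snd (snd (Unit.find n (suc (suc n)) 0 refl (λ j ()))))

module Quarter (n : ℕ) where
 open Unit n

 T : ℕ
 T = T4 n

 sT≥0 : 0F ≤ s T
 sT≥0 = s≥0 T (T4-pos n)

 s-small : ∀ t → s t ≤ ι 2ℚ * « t » * ε
 s-small zero = ≡⇒≤ (sym (tr (cong (λ w → ι 2ℚ * w * ε) «0») (solve 1 (λ e → :2 :* :0 :* e := :0) refl ε)))
 s-small (suc t) = tr≤ (≤-by (ε * (ι 2ℚ - (c t + c (suc t)))) (0≤* ε≥0 (≤≡ (0≤+ (0≤- (c≤1 t)) (0≤- (c≤1 (suc t)))) (solve 2 (λ a b → (:1 :- a) :+ (:1 :- b) := :2 :- (a :+ b)) refl (c t) (c (suc t)))))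
  (tr (cong (λ w → s (suc t) + ε * (ι 2ℚ - w)) (sym (ds t))) (tr (solve 4 (λ S e a b → b :+ e :* (:2 :- S :* (b :- a)) := b :+ :2 :* e :- (S :* e) :* (b :- a)) refl S ε (s t) (s (suc t))) (tr (cong (λ w → s (suc t) + ι 2ℚ * ε - w * (s (suc t) - s t)) Sε) (solve 3 (λ e a b → b :+ :2 :* e :- :1 :* (b :- a) := a :+ :2 :* e) refl ε (s t) (s (suc t)))))))
  (≤≡ (+-mono (s-small t) ≤-refl) (tr (solve 2 (λ t e → :2 :* t :* e :+ :2 :* e := :2 :* (:1 :+ t) :* e) refl « t » ε) (cong (λ w → ι 2ℚ * w * ε) (sym («suc» t)))))

 cT-small : - c T ≤ ι 2ℚ * ε
 cT-small = go T (T4-c n) (T4-pos n)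
  where
   go : ∀ T → c T ≤ 0F → AllPos T → - c T ≤ ι 2ℚ * ε
   go zero h a = ⊥-elim (1≰0 h)
   go (suc t) h a = tr≤ (≤-by (c t) (pos⇒0≤ (a t N.≤-refl)) (+-comm _ _)) (S-cancel (≡≤ (dc t) (≤≡ (+-mono (s≤1 t) (s≤1 (suc t))) (sym (tr (solve 2 (λ S e → S :* (:2 :* e) := (:1 :+ :1) :* (S :* e)) refl S ε) (tr (cong ((1F + 1F) *_) Sε) (*1 _)))))))

 ε≤1 : ε ≤ 1F
 ε≤1 = S-cancel (≡≤ Sε (≤≡ S≥1 (sym (*1 S))))

 1-sT : 1F - s T ≤ ι (# 4) * ε
 1-sT = tr≤ (≤-by ((1F - s T) * s T) (0≤* (0≤- (s≤1 T)) sT≥0) (solve 1 (λ s → (:1 :- s) :+ (:1 :- s) :* s := :1 :- s :* s) refl (s T)))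
  (≡≤ (tr (cong (_- s T * s T) (sym (cs1 T))) (solve 2 (λ c s → c :* c :+ s :* s :- s :* s := (:- c) :* (:- c)) refl (c T) (s T)))
   (tr≤ (*-mono (neg≥0 (T4-c n)) (neg≥0 (T4-c n)) cT-small cT-small) (≡≤ (solve 1 (λ e → (:2 :* e) :* (:2 :* e) := con (# 4) :* e :* e) refl ε) (≤≡ (*-monoˡ _ (0≤* (ι≥0 (# 4)) ε≥0) ε≤1) (*1 _)))))

 -- The sine is positive strictly inside the first quarter turn. This is the input that the
 -- quadrature needs once its bandwidth lies below `T`.
 z^≢1 : ∀ k → 1 ≤' k → k <' T → z ^C k ≢ 1C
 z^≢1 (suc k) _ l e = Pos-s (s≤0 (cong im e))
  where
   s≤0 : s (suc k) ≡ 0F → s (suc k) ≤ 0F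
   s≤0 = ≡⇒≤
   s1 : Pos (s 1)
   s1 = λ h → Pos-* {S + S} {iS} (Pos-≤ («suc»-pos n) (≤-by S S≥0 refl)) (Pos-inv q+) (≡≤ (sym (cong im (*C-identityʳ z))) h)
   mono : ∀ k → suc k <' T → s 1 ≤ s (suc k)
   mono zero l = ≤-refl
   mono (suc k) l = tr≤ (mono k (N.<-trans N.≤-refl l)) (s-mono (suc k) (pos⇒0≤ (T4-pos n (suc k) (N.<-trans N.≤-refl l))) (pos⇒0≤ (T4-pos n (suc (suc k)) l)))
   Pos-s : Pos (s (suc k))
   Pos-s = Pos-≤ s1 (mono k l)

ϵ : ℕ → F
ϵ n = inv « suc n »

ϵ≤1 : ∀ n → ϵ n ≤ 1F
ϵ≤1 n = *-cancel-≤ « suc n » («suc»-pos n) (≡≤ (*-inv («suc»-pos n)) (≤≡ (≡≤ (sym «1») («»-mono (s≤s z≤n))) (sym (*1 _))))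

-- Asymptotic calculus for shrinking steps.

infix 4 _≐_

-- equality up to O(1/n)
record _≐_ (a b : ℕ → ℂ) : Set where
 constructor mk
 field
  n₀ : ℕ
  C : F
  C≥0 : 0F ≤ C
  bd : ∀ n → n₀ ≤' n → N1 (a n +C (-C b n)) ≤ C * ϵ n
open _≐_ public

record Bdd (a : ℕ → ℂ) : Set where
 constructor mkB
 field
  n₁ : ℕ
  K : F
  K≥0 : 0F ≤ K
  bdd : ∀ n → n₁ ≤' n → N1 (a n) ≤ K
open Bdd public

N1-0 : N1 0C ≡ 0F
N1-0 = N1-real ≤-refl

≐-≡ : ∀ {a b} → (∀ n → a n ≡ b n) → a ≐ b
≐-≡ {a} {b} h = mk 0 0F ≤-refl (λ n _ → ≡⇒≤ (tr (cong N1 (tr (cong (λ w → w +C (-C b n)) (h n)) (solveC 1 (λ b → b ∔ ⊝ b ≔ conC 0ℚ) refl (b n)))) (tr N1-0 (sym (zeroˡ _)))))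

≐-refl : ∀ {a} → a ≐ a
≐-refl = ≐-≡ (λ _ → refl)

≐-sym : ∀ {a b} → a ≐ b → b ≐ a
≐-sym {a} {b} p = mk (n₀ p) (C p) (C≥0 p) (λ n l → ≡≤ (tr (cong N1 (solveC 2 (λ a b → b ∔ ⊝ a ≔ ⊝ (a ∔ ⊝ b)) refl (a n) (b n))) (N1-neg _)) (bd p n l))

≐-trans : ∀ {a b c} → a ≐ b → b ≐ c → a ≐ c
≐-trans {a} {b} {c} p q = mk (n₀ p +' n₀ q) (C p + C q) (0≤+ (C≥0 p) (C≥0 q)) (λ n l → tr≤ (≡≤ (cong N1 (solveC 3 (λ a b c → a ∔ ⊝ c ≔ (a ∔ ⊝ b) ∔ (b ∔ ⊝ c)) refl (a n) (b n) (c n))) (N1-+ _ _))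
 (≤≡ (+-mono (bd p n (N.m+n≤o⇒m≤o (n₀ p) l)) (bd q n (N.m+n≤o⇒n≤o (n₀ p) l))) (sym (distribʳ (ϵ n) (C p) (C q)))))

≐-+ : ∀ {a b c d} → a ≐ b → c ≐ d → (λ n → a n +C c n) ≐ (λ n → b n +C d n)
≐-+ {a} {b} {c} {d} p q = mk (n₀ p +' n₀ q) (C p + C q) (0≤+ (C≥0 p) (C≥0 q)) (λ n l → tr≤ (≡≤ (cong N1 (solveC 4 (λ a b c d → (a ∔ c) ∔ ⊝ (b ∔ d) ≔ (a ∔ ⊝ b) ∔ (c ∔ ⊝ d)) refl (a n) (b n) (c n) (d n))) (N1-+ _ _))
 (≤≡ (+-mono (bd p n (N.m+n≤o⇒m≤o (n₀ p) l)) (bd q n (N.m+n≤o⇒n≤o (n₀ p) l))) (sym (distribʳ (ϵ n) (C p) (C q)))))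

≐-neg : ∀ {a b} → a ≐ b → (λ n → -C a n) ≐ (λ n → -C b n)
≐-neg {a} {b} p = mk (n₀ p) (C p) (C≥0 p) (λ n l → ≡≤ (tr (cong N1 (solveC 2 (λ a b → ⊝ a ∔ ⊝ (⊝ b) ≔ ⊝ (a ∔ ⊝ b)) refl (a n) (b n))) (N1-neg _)) (bd p n l))

≐-conj : ∀ {a b} → a ≐ b → (λ n → conj (a n)) ≐ (λ n → conj (b n))
≐-conj {a} {b} p = mk (n₀ p) (C p) (C≥0 p) (λ n l → ≡≤ (tr (cong N1 (sym (conj-+ (a n) (-C b n)))) (N1-conj _)) (bd p n l))

Bdd-≐ : ∀ {a b} → a ≐ b → Bdd b → Bdd a
Bdd-≐ {a} {b} p B = mkB (n₀ p +' n₁ B) (C p + K B) (0≤+ (C≥0 p) (K≥0 B)) (λ n l → tr≤ (≡≤ (cong N1 (solveC 2 (λ a b → a ≔ (a ∔ ⊝ b) ∔ b) refl (a n) (b n))) (N1-+ _ _)) (+-mono (tr≤ (bd p n (N.m+n≤o⇒m≤o (n₀ p) l)) (≤≡ (*-monoˡ (C p) (C≥0 p) (ϵ≤1 n)) (*1 _))) (bdd B n (N.m+n≤o⇒n≤o (n₀ p) l))))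

≐-* : ∀ {a b c d} → Bdd b → Bdd c → a ≐ b → c ≐ d → (λ n → a n *C c n) ≐ (λ n → b n *C d n)
≐-* {a} {b} {c} {d} B B' p q = mk ((n₀ p +' n₀ q) +' (n₁ B +' n₁ B')) (C p * K B' + K B * C q) (0≤+ (0≤* (C≥0 p) (K≥0 B')) (0≤* (K≥0 B) (C≥0 q)))
 (λ n l → let l1 = N.m+n≤o⇒m≤o (n₀ p +' n₀ q) l ; l2 = N.m+n≤o⇒n≤o (n₀ p +' n₀ q) l in
  tr≤ (≡≤ (cong N1 (solveC 4 (λ a b c d → a ⨯ c ∔ ⊝ (b ⨯ d) ≔ (a ∔ ⊝ b) ⨯ c ∔ b ⨯ (c ∔ ⊝ d)) refl (a n) (b n) (c n) (d n))) (N1-+ _ _))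
  (≤≡ (+-mono (tr≤ (N1-* _ _) (*-mono (N1≥0 _) (N1≥0 _) (bd p n (N.m+n≤o⇒m≤o (n₀ p) l1)) (bdd B' n (N.m+n≤o⇒n≤o (n₁ B) l2)))) (tr≤ (N1-* _ _) (*-mono (N1≥0 _) (N1≥0 _) (bdd B n (N.m+n≤o⇒m≤o (n₁ B) l2)) (bd q n (N.m+n≤o⇒n≤o (n₀ p) l1)))))
   (solve 5 (λ c k k' c' e → (c :* e) :* k' :+ k :* (c' :* e) := (c :* k' :+ k :* c') :* e) refl (C p) (K B) (K B') (C q) (ϵ n))))

Bdd-* : ∀ {a b} → Bdd a → Bdd b → Bdd (λ n → a n *C b n)
Bdd-* A B = mkB (n₁ A +' n₁ B) (K A * K B) (0≤* (K≥0 A) (K≥0 B)) (λ n l → tr≤ (N1-* _ _) (*-mono (N1≥0 _) (N1≥0 _) (bdd A n (N.m+n≤o⇒m≤o (n₁ A) l)) (bdd B n (N.m+n≤o⇒n≤o (n₁ A) l))))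

Bdd-+ : ∀ {a b} → Bdd a → Bdd b → Bdd (λ n → a n +C b n)
Bdd-+ A B = mkB (n₁ A +' n₁ B) (K A + K B) (0≤+ (K≥0 A) (K≥0 B)) (λ n l → tr≤ (N1-+ _ _) (+-mono (bdd A n (N.m+n≤o⇒m≤o (n₁ A) l)) (bdd B n (N.m+n≤o⇒n≤o (n₁ A) l))))

Bdd-const : ∀ c → Bdd (λ _ → c)
Bdd-const c = mkB 0 (N1 c) (N1≥0 c) (λ _ _ → ≤-refl)

Bdd-unit : ∀ {a} → (∀ n → nrm (a n) ≤ 1F) → Bdd a
Bdd-unit h = mkB 0 (ι 2ℚ) (ι≥0 2ℚ) (λ n _ → N1≤2 (h n))

≐-*ˡ : ∀ {a b} c → Bdd c → a ≐ b → (λ n → c n *C a n) ≐ (λ n → c n *C b n)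
≐-*ˡ {a} {b} c B p = mk (n₁ B +' n₀ p) (K B * C p) (0≤* (K≥0 B) (C≥0 p)) (λ n l → tr≤ (≡≤ (cong N1 (solveC 3 (λ c a b → c ⨯ a ∔ ⊝ (c ⨯ b) ≔ c ⨯ (a ∔ ⊝ b)) refl (c n) (a n) (b n))) (N1-* _ _)) (≤≡ (*-mono (N1≥0 _) (N1≥0 _) (bdd B n (N.m+n≤o⇒m≤o (n₁ B) l)) (bd p n (N.m+n≤o⇒n≤o (n₁ B) l))) (sym (*-assoc (K B) (C p) (ϵ n)))))

≐-∑ : {A : Set} (xs : List A) {a b : A → ℕ → ℂ} → (∀ {x} → x ∈ xs → a x ≐ b x) → (λ n → ∑C xs (λ x → a x n)) ≐ (λ n → ∑C xs (λ x → b x n))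
≐-∑ [] h = ≐-refl
≐-∑ (x ∷ xs) h = ≐-+ (h (here refl)) (≐-∑ xs (λ m → h (there m)))

≐-^ : ∀ {a b} k → (∀ n → nrm (a n) ≤ 1F) → Bdd b → a ≐ b → (λ n → a n ^C k) ≐ (λ n → b n ^C k)
≐-^ zero u B p = ≐-refl
≐-^ {a} {b} (suc k) u B p = ≐-* B (Bdd-unit (λ n → nrm-pow n k)) p (≐-^ k u B p)
 where
  nrm-pow : ∀ n k → nrm (a n ^C k) ≤ 1F
  nrm-pow n zero = ≡⇒≤ (tr (nrm-real 1F) (1* 1F))
  nrm-pow n (suc k) = ≡≤ (nrm-* (a n) _) (≤≡ (*-mono (nrm≥0 _) (nrm≥0 _) (u n) (nrm-pow n k)) (1* 1F))

≐-abs : ∀ {a b : ℕ → ℂ} n₀ C → 0F ≤ C → (∀ n → n₀ ≤' n → abs (re (a n) - re (b n)) ≤ C * ϵ n) → (∀ n → n₀ ≤' n → abs (im (a n) - im (b n)) ≤ C * ϵ n) → a ≐ b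
≐-abs n₀ C h p q = mk n₀ (C + C) (0≤+ h h) (λ n l → ≤≡ (+-mono (p n l) (q n l)) (sym (distribʳ (ϵ n) C C)))

≐-re : ∀ {a b} → (p : a ≐ b) → ∀ n → n₀ p ≤' n → abs (re (a n) - re (b n)) ≤ C p * ϵ n
≐-re p n l = tr≤ (≤-by _ (∣∣≥0 _) refl) (bd p n l)

≐-from : ∀ {a b a' b'} → (∀ n → a' n ≡ a n) → (∀ n → b' n ≡ b n) → a ≐ b → a' ≐ b'
≐-from p q r = ≐-trans (≐-≡ p) (≐-trans r (≐-≡ (λ n → sym (q n))))

≐-from-eventually : ∀ {a a' b} m → (∀ n → m ≤' n → a' n ≡ a n) → a ≐ b → a' ≐ b
≐-from-eventually {a} {a'} {b} m h p = mk (m +' n₀ p) (C p) (C≥0 p) (λ n l → ≡≤ (cong (λ w → N1 (w +C (-C b n))) (h n (N.m+n≤o⇒m≤o m l))) (bd p n (N.m+n≤o⇒n≤o m l)))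

N1-1-z : ∀ z → nrm z ≡ 1F → ∀ {η} → N1 (1C +C (-C z)) ≤ η → ∀ k → N1 (1C +C (-C (z ^C k))) ≤ ι 2ℚ * « k » * η
N1-1-z z u {η} h zero = ≡⇒≤ (tr (cong N1 (solveC 0 (conC 1ℚ ∔ ⊝ conC 1ℚ ≔ conC 0ℚ) refl)) (tr N1-0 (sym (tr (cong (λ w → ι 2ℚ * w * η) «0») (solve 1 (λ e → :2 :* :0 :* e := :0) refl η)))))
N1-1-z z u {η} h (suc k) = tr≤ (≡≤ (cong N1 (solveC 2 (λ z w → conC 1ℚ ∔ ⊝ (z ⨯ w) ≔ (conC 1ℚ ∔ ⊝ w) ∔ w ⨯ (conC 1ℚ ∔ ⊝ z)) refl z (z ^C k))) (N1-+ _ _))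
 (≤≡ (+-mono (N1-1-z z u h k) (tr≤ (N1-* _ _) (*-mono (N1≥0 _) (N1≥0 _) (N1≤2 (≡⇒≤ (nrm-^C z u k))) h))) (tr (solve 2 (λ k e → :2 :* k :* e :+ :2 :* e := :2 :* (:1 :+ k) :* e) refl « k » η) (cong (λ w → ι 2ℚ * w * η) (sym («suc» k)))))

q4' : ℚ
q4' = # 4

module Near (n : ℕ) where
 open Unit n
 open Quarter n

 N1-1-z0 : N1 (1C +C (-C z)) ≤ ι q4' * ε
 N1-1-z0 = ≤≡ (+-mono (∣∣-≤ (≡≤ re1 iS2) (tr≤ (neg-le (≤≡ (0≤* 0≤2' iS≥0) (sym re1))) (0≤* 0≤2' ε≥0))) (≡≤ (tr (cong abs (0+ _)) (∣∣-neg _)) (∣∣-≤ im2 (tr≤ (neg-le (0≤* (0≤+ S≥0 S≥0) iS≥0)) (0≤* 0≤2' ε≥0)))))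
  (solve 1 (λ e → :2 :* e :+ :2 :* e := con q4' :* e) refl ε)
  where
   0≤2' : 0F ≤ ι 2ℚ
   0≤2' = ι≥0 2ℚ
   neg-le : ∀ {a} → 0F ≤ a → - a ≤ 0F
   neg-le h = ≤≡ (neg-mono h) (solve 0 (:- :0 := :0) refl)
   re1 : 1F + (- ((S * S - 1F) * iS)) ≡ ι 2ℚ * iS
   re1 = tr (cong (_+ (- ((S * S - 1F) * iS))) (sym qiS)) (solve 2 (λ s i → (s :* s :+ :1) :* i :+ (:- ((s :* s :- :1) :* i)) := :2 :* i) refl S iS)
   SiS : S * iS ≤ ε
   SiS = S-cancel (≤≡ (≤-by iS iS≥0 (solve 2 (λ s i → s :* (s :* i) :+ i := (s :* s :+ :1) :* i) refl S iS)) (tr qiS (sym Sε)))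
   iS2 : ι 2ℚ * iS ≤ ι 2ℚ * ε
   iS2 = *-monoˡ (ι 2ℚ) 0≤2' (tr≤ (≡≤ (sym (1* iS)) (*-monoʳ iS iS≥0 S≥1)) SiS)
   im2 : (S + S) * iS ≤ ι 2ℚ * ε
   im2 = ≡≤ (solve 2 (λ s i → (s :+ s) :* i := :2 :* (s :* i)) refl S iS) (*-monoˡ (ι 2ℚ) 0≤2' SiS)

 -- The sine gains at most 2/S per step and ends within 4/S of 1. So the quarter turn has at least
 -- about S/2 steps, which makes all precisions O(1/S) comparable with the grid.
 S≤2T+4 : suc n ≤' 2 *' T +' 4
 S≤2T+4 = «»-cancel (≤≡ (≡≤ (sym (*1 S)) (*-monoˡ S S≥0 (≡≤ (solve 1 (λ s → :1 := (:1 :- s) :+ s) refl (s T)) (+-mono 1-sT (s-small T)))))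
  (tr (solve 3 (λ S e T → S :* (con q4' :* e :+ :2 :* T :* e) := (:2 :* T :+ con q4') :* (S :* e)) refl S ε « T ») (tr (cong ((ι 2ℚ * « T » + ι q4') *_) Sε) (tr (*1 _) (sym (tr («+» (2 *' T) 4) (cong2 _+_ (tr («*» 2 T) (cong (_* « T ») («»-ι 2))) («»-ι 4))))))))

zz : ℕ → ℂ
zz n = Unit.z n

uu : ∀ n → nrm (zz n) ≡ 1F
uu n = Unit.unit n

zpow-unit : (k : ℕ → ℕ) → ∀ n → nrm (zz n ^C k n) ≤ 1F
zpow-unit k n = ≡⇒≤ (nrm-^C (zz n) (uu n) (k n))

zpow-near : ∀ n k → N1 (1C +C (-C (zz n ^C k))) ≤ ι 2ℚ * « k » * (ι q4' * inv « suc n »)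
zpow-near n k = N1-1-z (zz n) (uu n) (Near.N1-1-z0 n) k

zpow≐1 : (k : ℕ → ℕ) (B : ℕ) → (∀ n → k n ≤' B) → (λ n → zz n ^C k n) ≐ (λ _ → 1C)
zpow≐1 k B h = ≐-sym (mk 0 (ι 2ℚ * « B » * ι q4') (0≤* (0≤* (ι≥0 2ℚ) («»≥0 B)) (ι≥0 q4')) (λ n _ → tr≤ (zpow-near n (k n)) (≤≡ (*-monoʳ (ι q4' * inv « suc n ») (0≤* (ι≥0 q4') (inv≥0 («suc»-pos n))) (*-monoˡ (ι 2ℚ) (ι≥0 2ℚ) («»-mono (h n)))) (sym (*-assoc _ _ _)))))

zT≐i : (λ n → zz n ^C T4 n) ≐ (λ _ → iC)
zT≐i = ≐-abs 0 (ι q4') (ι≥0 q4') (λ n _ → cpart n) (λ n _ → spart n)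
 where
  cpart : ∀ n → abs (re (zz n ^C T4 n) - 0F) ≤ ι q4' * inv « suc n »
  cpart n = ∣∣-≤ (≡≤ (solve 1 (λ c → c :- :0 := c) refl (Unit.c n (T4 n))) (tr≤ (T4-c n) (0≤* (ι≥0 q4') (Unit.ε≥0 n))))
   (≡≤ (solve 1 (λ c → :- (c :- :0) := :- c) refl (Unit.c n (T4 n))) (tr≤ (Quarter.cT-small n) (*-monoʳ _ (Unit.ε≥0 n) (ι-≤ (from-yes (2ℚ ℚ.≤? q4'))))))
  spart : ∀ n → abs (im (zz n ^C T4 n) - 1F) ≤ ι q4' * inv « suc n »
  spart n = ∣∣-≤ (tr≤ (≤≡ (+-mono (Unit.s≤1 n (T4 n)) ≤-refl) (-‿inverseʳ 1F)) (0≤* (ι≥0 q4') (Unit.ε≥0 n)))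
   (≡≤ (solve 1 (λ s → :- (s :- :1) := :1 :- s) refl (Unit.s n (T4 n))) (Quarter.1-sT n))

iC⁴ : iC ^C 4 ≡ 1C
iC⁴ = cong2 _⊹_ (tr (cong re e) refl) (cong im e)
 where
  i2 : iC *C iC ≡ -C 1C
  i2 = cong2 _⊹_ (solve 0 (:0 :* :0 :- :1 :* :1 := :- :1) refl) (solve 0 (:0 :* :1 :+ :1 :* :0 := :- :0) refl)
  e : iC ^C 4 ≡ 1C
  e = tr (solveC 1 (λ i → i ⨯ (i ⨯ (i ⨯ (i ⨯ conC 1ℚ))) ≔ (i ⨯ i) ⨯ (i ⨯ i)) refl iC) (tr (cong2 _*C_ i2 i2) (solveC 0 ((⊝ conC 1ℚ) ⨯ (⊝ conC 1ℚ) ≔ conC 1ℚ) refl))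

Bdd-z : (k : ℕ → ℕ) → Bdd (λ n → zz n ^C k n)
Bdd-z k = Bdd-unit (zpow-unit k)

-- Twelfth roots of unity on the grid.

module Grid (l' : ℕ) where
 l0 : ℕ
 l0 = suc l'

 opaque
  -- Q = 12 l0 τ0 is the multiple of 12 l0 just below the number of steps of a full turn
  τ0 : ℕ → ℕ
  τ0 n = T4 n / (3 *' l0)

  τ0-lo : ∀ n → 3 *' (l0 *' τ0 n) ≤' T4 n
  τ0-lo n = N.≤-trans (N.≤-reflexive (tr (sym (N.*-assoc 3 l0 (τ0 n))) (N.*-comm (3 *' l0) (τ0 n)))) (N.≤-trans (N.m≤n+m _ _) (N.≤-reflexive (sym (m≡m%n+[m/n]*n (T4 n) (3 *' l0)))))

  τ0-hi : ∀ n → T4 n ≤' 3 *' (l0 *' τ0 n) +' 3 *' l0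
  τ0-hi n = N.≤-trans (N.≤-reflexive (tr (m≡m%n+[m/n]*n (T4 n) (3 *' l0)) (N.+-comm _ (τ0 n *' (3 *' l0))))) (N.+-mono-≤ (N.≤-reflexive (tr (N.*-comm (τ0 n) (3 *' l0)) (N.*-assoc 3 l0 (τ0 n)))) (N.<⇒≤ (m%n<n (T4 n) (3 *' l0))))

 t12 Q : ℕ → ℕ
 t12 n = l0 *' τ0 n
 Q n = 12 *' t12 n

 N₀ : ℕ
 N₀ = 12 *' l0 +' 8

 S≤Q : ∀ n → N₀ ≤' n → suc n ≤' Q n
 S≤Q n h = N.+-cancelʳ-≤ (suc n) (suc n) (Q n) (N.≤-trans (N.+-mono-≤ (Near.S≤2T+4 n) (Near.S≤2T+4 n))
  (N.≤-trans (N.+-mono-≤ a a) (N.≤-trans (N.≤-reflexive (solveN 2 (λ t l → (con' 2 :*' (con' 3 :*' t :+' con' 3 :*' l) :+' con' 4) :+' (con' 2 :*' (con' 3 :*' t :+' con' 3 :*' l) :+' con' 4) :=' con' 12 :*' t :+' (con' 12 :*' l :+' con' 8)) refl (t12 n) l0)) (N.+-monoʳ-≤ (Q n) (N.≤-trans h (N.n≤1+n n))))))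
  where
   a : 2 *' T4 n +' 4 ≤' 2 *' (3 *' t12 n +' 3 *' l0) +' 4
   a = N.+-monoˡ-≤ 4 (N.*-monoʳ-≤ 2 (τ0-hi n))

 t12≥1 : ∀ n → N₀ ≤' n → 1 ≤' t12 n
 t12≥1 n h = go (t12 n) (N.≤-trans (s≤s z≤n) (S≤Q n h))
  where
   go : ∀ t → 1 ≤' 12 *' t → 1 ≤' t
   go (suc t) _ = s≤s z≤n

 Q≤4S : ∀ n → Q n ≤' 4 *' suc n
 Q≤4S n = N.≤-trans (N.≤-reflexive (N.*-assoc 4 3 (t12 n))) (N.*-monoʳ-≤ 4 (N.≤-trans (τ0-lo n) (T4≤S n)))

 zQ4≐i : (λ n → zz n ^C (3 *' t12 n)) ≐ (λ _ → iC)
 zQ4≐i = ≐-trans (≐-sym (≐-from eq (λ n → sym (*C-identityʳ _)) (≐-*ˡ (λ n → zz n ^C (3 *' t12 n)) (Bdd-z (λ n → 3 *' t12 n)) (zpow≐1 (λ n → T4 n ∸' 3 *' t12 n) (3 *' l0) (λ n → N.m≤n+o⇒m∸n≤o (T4 n) (3 *' t12 n) (τ0-hi n)))))) zT≐i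
  where
   eq : ∀ n → zz n ^C T4 n ≡ zz n ^C (3 *' t12 n) *C zz n ^C (T4 n ∸' 3 *' t12 n)
   eq n = tr (cong (zz n ^C_) (sym (N.m+[n∸m]≡n (τ0-lo n)))) (^C-+ (zz n) (3 *' t12 n) _)

 zQ≐1 : (λ n → zz n ^C Q n) ≐ (λ _ → 1C)
 zQ≐1 = ≐-from (λ n → tr (cong (zz n ^C_) (N.*-assoc 4 3 (t12 n))) (^C-* (zz n) 4 (3 *' t12 n))) (λ _ → sym iC⁴) (≐-^ 4 (zpow-unit (λ n → 3 *' t12 n)) (Bdd-const iC) zQ4≐i)

 ω : ℕ → ℂ
 ω n = zz n ^C t12 n

 -- Tends to √3/2, which is irrational and is therefore kept as a symbol; of its size only ρ ≥ 1/2
 -- is used.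
 ρ : ℕ → F
 ρ n = re (ω n)

 ω³≐i : (λ n → ω n ^C 3) ≐ (λ _ → iC)
 ω³≐i = ≐-from (λ n → sym (^C-* (zz n) 3 (t12 n))) (λ _ → refl) zQ4≐i

 ω-unit : ∀ n → nrm (ω n) ≡ 1F
 ω-unit n = nrm-^C (zz n) (uu n) (t12 n)

 Bdd-ω : Bdd ω
 Bdd-ω = Bdd-unit (λ n → ≡⇒≤ (ω-unit n))

 -- Twice the angle still comes before the end of the quarter turn, so cos² ≥ sin² and hence cos² ≥
 -- 1/2 ≥ 1/4.
 ρ-lo : ∀ n → N₀ ≤' n → ι ℚ.½ ≤ ρ n
 ρ-lo n h = sq-cancel (pos⇒0≤ cp) (tr≤ (≡≤ (sym (ι-* ℚ.½ ℚ.½)) (ι-≤ (from-yes (ℚ.½ ℚ.* ℚ.½ ℚ.≤? ℚ.½)))) sq)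
  where
   lt1 : t12 n +' t12 n <' T4 n
   lt1 = N.<-≤-trans (N.m<n+m (t12 n +' t12 n) (t12≥1 n h)) (N.≤-trans (N.≤-reflexive (cong (λ w → t12 n +' (t12 n +' w)) (sym (N.+-identityʳ (t12 n))))) (τ0-lo n))
   cp : Pos (ρ n)
   cp = T4-pos n (t12 n) (N.≤-<-trans (N.m≤m+n _ _) lt1)
   c2 : 0F ≤ ρ n * ρ n - im (ω n) * im (ω n)
   c2 = ≤≡ (pos⇒0≤ (T4-pos n (t12 n +' t12 n) lt1)) (cong re (^C-+ (zz n) (t12 n) (t12 n)))
   sq : ι ℚ.½ ≤ ρ n * ρ n
   sq = tr≤ (≤-by (ι ℚ.½ * (ρ n * ρ n - im (ω n) * im (ω n))) (0≤* (ι≥0 ℚ.½) c2) (tr (cong (λ w → w + ι ℚ.½ * (ρ n * ρ n - im (ω n) * im (ω n))) (tr (sym (*1 (ι ℚ.½))) (cong (ι ℚ.½ *_) (sym (ω-unit n))))) (solve 2 (λ c s → con ℚ.½ :* (c :* c :+ s :* s) :+ con ℚ.½ :* (c :* c :- s :* s) := c :* c) refl (ρ n) (im (ω n))))) ≤-refl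

 ω-im≥0 : ∀ n → 0F ≤ im (ω n)
 ω-im≥0 n = Unit.s≥0 n (t12 n) (λ j l → T4-pos n j (N.<-≤-trans l (N.≤-trans (N.m≤n*m (t12 n) 3) (τ0-lo n))))

 -- Re ω³ = c (4c² - 3) is small, hence c² is close to 3/4 and s to 1/2
 ω-im : ∀ n → N₀ +' n₀ ω³≐i ≤' n → abs (im (ω n) - ι ℚ.½) ≤ C ω³≐i * inv « suc n »
 ω-im n l = main (re (ω n)) (im (ω n)) (ω-unit n) (ω-im≥0 n) (ρ-lo n (N.m+n≤o⇒m≤o N₀ l)) (≡≤ (cong abs (tr (solve 1 (λ c → c := c :- :0) refl _) refl)) (≐-re ω³≐i n (N.m+n≤o⇒n≤o N₀ l)))
  where
   E = C ω³≐i * inv « suc n »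
   main : ∀ c s → c * c + s * s ≡ 1F → 0F ≤ s → ι ℚ.½ ≤ c → abs (re ((c ⊹ s) ^C 3)) ≤ E → abs (s - ι ℚ.½) ≤ E
   main c s u s0 hc h = tr≤ (sq-cancel (∣∣≥0 R) (≡≤ (∣∣-sq _) (≤≡ big (sym (∣∣-sq R))))) h
    where
     R = re ((c ⊹ s) ^C 3)
     Re : R ≡ c * (c * c - ι (# 3) * (s * s))
     Re = solve 2 (λ c s → c :* (c :* (c :* :1 :- s :* :0) :- s :* (c :* :0 :+ s :* :1)) :- s :* (c :* (c :* :0 :+ s :* :1) :+ s :* (c :* :1 :- s :* :0)) := c :* (c :* c :- con (# 3) :* (s :* s))) refl c s
     R2 : R ≡ ι q4' * c * ((ι ℚ.½ + s) * (ι ℚ.½ - s))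
     R2 = tr Re (tr (cong (λ w → c * (w - ι (# 3) * (s * s))) (tr (solve 2 (λ c s → c :* c := (c :* c :+ s :* s) :- s :* s) refl c s) (cong (_- s * s) u))) (solve 2 (λ c s → c :* (:1 :- s :* s :- con (# 3) :* (s :* s)) := con q4' :* c :* ((con ℚ.½ :+ s) :* (con ℚ.½ :- s))) refl c s))
     fac : 1F ≤ ι q4' * c * (ι ℚ.½ + s)
     fac = tr≤ (≤≡ (ι-≤ (from-yes (1ℚ ℚ.≤? q4' ℚ.* ℚ.½ ℚ.* ℚ.½))) (tr (ι-* _ _) (cong (_* ι ℚ.½) (ι-* _ _)))) (*-mono (0≤* (ι≥0 q4') (ι≥0 ℚ.½)) (ι≥0 ℚ.½) (*-monoˡ (ι q4') (ι≥0 q4') hc) (≤-by s s0 refl))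
     big : (s - ι ℚ.½) * (s - ι ℚ.½) ≤ R * R
     big = ≤≡ (≡≤ (sym (1* _)) (*-monoʳ _ (0≤sq (s - ι ℚ.½)) (≡≤ (sym (1* 1F)) (*-mono 0≤1 0≤1 fac fac))))
      (tr (solve 2 (λ c s → (con q4' :* c :* (con ℚ.½ :+ s)) :* (con q4' :* c :* (con ℚ.½ :+ s)) :* ((s :- con ℚ.½) :* (s :- con ℚ.½)) := (con q4' :* c :* ((con ℚ.½ :+ s) :* (con ℚ.½ :- s))) :* (con q4' :* c :* ((con ℚ.½ :+ s) :* (con ℚ.½ :- s)))) refl c s) (cong2 _*_ (sym R2) (sym R2)))

½ : ℚ
½ = ℚ.½

-- The twelfth roots of unity with `r` in place of √3/2. No relation for `r` is built in, so the
-- identities `tU-val` and `tG-val` are linear in a free variable.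
tbl : F → ℕ → ℂ
tbl r 0 = 1C
tbl r 1 = r ⊹ ι ½
tbl r 2 = ι ½ ⊹ r
tbl r 3 = iC
tbl r 4 = (- ι ½) ⊹ r
tbl r 5 = (- r) ⊹ ι ½
tbl r 6 = (- 1F) ⊹ 0F
tbl r 7 = (- r) ⊹ (- ι ½)
tbl r 8 = (- ι ½) ⊹ (- r)
tbl r 9 = 0F ⊹ (- 1F)
tbl r 10 = ι ½ ⊹ (- r)
tbl r 11 = r ⊹ (- ι ½)
tbl r _ = 0C

case12 : (P : ℕ → Set) → P 0 → P 1 → P 2 → P 3 → P 4 → P 5 → P 6 → P 7 → P 8 → P 9 → P 10 → P 11 → ∀ n → P (n % 12)
case12 P p0 p1 p2 p3 p4 p5 p6 p7 p8 p9 p10 p11 n = go (n % 12) (m%n<n n 12)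
 where
  go : ∀ r → r <' 12 → P r
  go 0 _ = p0
  go 1 _ = p1
  go 2 _ = p2
  go 3 _ = p3
  go 4 _ = p4
  go 5 _ = p5
  go 6 _ = p6
  go 7 _ = p7
  go 8 _ = p8
  go 9 _ = p9
  go 10 _ = p10
  go 11 _ = p11
  go (suc (suc (suc (suc (suc (suc (suc (suc (suc (suc (suc (suc r)))))))))))) (s≤s (s≤s (s≤s (s≤s (s≤s (s≤s (s≤s (s≤s (s≤s (s≤s (s≤s (s≤s ()))))))))))))

-- n ↦ χ₁₂(n) and n ↦ (2/√3) sin (π n / 6) on even n
χt ψt : ℕ → ℚ
χt 1 = 1ℚ
χt 5 = ℚ.- 1ℚ
χt 7 = ℚ.- 1ℚ
χt 11 = 1ℚ
χt _ = 0ℚ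
ψt 2 = 1ℚ
ψt 4 = 1ℚ
ψt 8 = ℚ.- 1ℚ
ψt 10 = ℚ.- 1ℚ
ψt _ = 0ℚ

-- Signed sums over the endpoints 1, 5, 7, 11 (in twelfths) of the two arcs: up to a factor, and
-- conjugation, the Fourier coefficients of the difference and of the sum of the arcs.
tU tG : F → ℕ → ℂ
tU r n = (tbl r (n % 12) +C (-C tbl r ((5 *' n) % 12))) +C (-C (tbl r ((7 *' n) % 12) +C (-C tbl r ((11 *' n) % 12))))
tG r n = (tbl r (n % 12) +C (-C tbl r ((5 *' n) % 12))) +C (tbl r ((7 *' n) % 12) +C (-C tbl r ((11 *' n) % 12)))

private
 red : ∀ c n → (c *' n) % 12 ≡ (c *' (n % 12)) % 12
 red c n = tr (%-distribˡ-* c n 12) (tr (cong (λ w → ((c % 12) *' w) % 12) (sym (m%n%n≡m%n n 12))) (sym (%-distribˡ-* c (n % 12) 12)))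

tU-val : ∀ r n → tU r n ≡ real (ι q4' * r * ι (χt (n % 12)))
tU-val r n = tr (cong2 (λ p q → (tbl r (n % 12) +C (-C tbl r p)) +C (-C q)) (red 5 n) (cong2 (λ p q → tbl r p +C (-C tbl r q)) (red 7 n) (red 11 n)))
 (case12 (λ k → (tbl r k +C (-C tbl r ((5 *' k) % 12))) +C (-C (tbl r ((7 *' k) % 12) +C (-C tbl r ((11 *' k) % 12)))) ≡ real (ι q4' * r * ι (χt k)))
  (cong2 _⊹_ (solve 1 (λ r → (:1 :+ :- :1) :+ :- (:1 :+ :- :1) := con q4' :* r :* :0) refl r) (solve 0 ((:0 :+ :- :0) :+ :- (:0 :+ :- :0) := :0) refl))
  (cong2 _⊹_ (solve 1 (λ r → (r :+ :- (:- r)) :+ :- ((:- r) :+ :- r) := con q4' :* r :* :1) refl r) (solve 0 ((con ½ :+ :- con ½) :+ :- ((:- con ½) :+ :- (:- con ½)) := :0) refl))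
  (cong2 _⊹_ (solve 1 (λ r → (con ½ :+ :- con ½) :+ :- (con ½ :+ :- con ½) := con q4' :* r :* :0) refl r) (solve 1 (λ r → (r :+ :- (:- r)) :+ :- (r :+ :- (:- r)) := :0) refl r))
  (cong2 _⊹_ (solve 1 (λ r → (:0 :+ :- :0) :+ :- (:0 :+ :- :0) := con q4' :* r :* :0) refl r) (solve 0 ((:1 :+ :- :1) :+ :- ((:- :1) :+ :- (:- :1)) := :0) refl))
  (cong2 _⊹_ (solve 1 (λ r → ((:- con ½) :+ :- (:- con ½)) :+ :- ((:- con ½) :+ :- (:- con ½)) := con q4' :* r :* :0) refl r) (solve 1 (λ r → (r :+ :- (:- r)) :+ :- (r :+ :- (:- r)) := :0) refl r))
  (cong2 _⊹_ (solve 1 (λ r → ((:- r) :+ :- r) :+ :- (r :+ :- (:- r)) := con q4' :* r :* con (ℚ.- 1ℚ)) refl r) (solve 0 ((con ½ :+ :- con ½) :+ :- ((:- con ½) :+ :- (:- con ½)) := :0) refl))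
  (cong2 _⊹_ (solve 1 (λ r → ((:- :1) :+ :- (:- :1)) :+ :- ((:- :1) :+ :- (:- :1)) := con q4' :* r :* :0) refl r) (solve 0 ((:0 :+ :- :0) :+ :- (:0 :+ :- :0) := :0) refl))
  (cong2 _⊹_ (solve 1 (λ r → ((:- r) :+ :- r) :+ :- (r :+ :- (:- r)) := con q4' :* r :* con (ℚ.- 1ℚ)) refl r) (solve 0 (((:- con ½) :+ :- (:- con ½)) :+ :- (con ½ :+ :- con ½) := :0) refl))
  (cong2 _⊹_ (solve 1 (λ r → ((:- con ½) :+ :- (:- con ½)) :+ :- ((:- con ½) :+ :- (:- con ½)) := con q4' :* r :* :0) refl r) (solve 1 (λ r → ((:- r) :+ :- r) :+ :- ((:- r) :+ :- r) := :0) refl r))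
  (cong2 _⊹_ (solve 1 (λ r → (:0 :+ :- :0) :+ :- (:0 :+ :- :0) := con q4' :* r :* :0) refl r) (solve 0 (((:- :1) :+ :- (:- :1)) :+ :- (:1 :+ :- :1) := :0) refl))
  (cong2 _⊹_ (solve 1 (λ r → (con ½ :+ :- con ½) :+ :- (con ½ :+ :- con ½) := con q4' :* r :* :0) refl r) (solve 1 (λ r → ((:- r) :+ :- r) :+ :- ((:- r) :+ :- r) := :0) refl r))
  (cong2 _⊹_ (solve 1 (λ r → (r :+ :- (:- r)) :+ :- ((:- r) :+ :- r) := con q4' :* r :* :1) refl r) (solve 0 (((:- con ½) :+ :- (:- con ½)) :+ :- (con ½ :+ :- con ½) := :0) refl))
  n)

tG-val : ∀ r n → tG r n ≡ 0F ⊹ (ι q4' * r * ι (ψt (n % 12)))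
tG-val r n = tr (cong2 (λ p q → (tbl r (n % 12) +C (-C tbl r p)) +C q) (red 5 n) (cong2 (λ p q → tbl r p +C (-C tbl r q)) (red 7 n) (red 11 n)))
 (case12 (λ k → (tbl r k +C (-C tbl r ((5 *' k) % 12))) +C (tbl r ((7 *' k) % 12) +C (-C tbl r ((11 *' k) % 12))) ≡ 0F ⊹ (ι q4' * r * ι (ψt k)))
  (cong2 _⊹_ (solve 0 ((:1 :+ :- :1) :+ (:1 :+ :- :1) := :0) refl) (solve 1 (λ r → (:0 :+ :- :0) :+ (:0 :+ :- :0) := con q4' :* r :* :0) refl r))
  (cong2 _⊹_ (solve 1 (λ r → (r :+ :- (:- r)) :+ ((:- r) :+ :- r) := :0) refl r) (solve 1 (λ r → (con ½ :+ :- con ½) :+ ((:- con ½) :+ :- (:- con ½)) := con q4' :* r :* :0) refl r))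
  (cong2 _⊹_ (solve 0 ((con ½ :+ :- con ½) :+ (con ½ :+ :- con ½) := :0) refl) (solve 1 (λ r → (r :+ :- (:- r)) :+ (r :+ :- (:- r)) := con q4' :* r :* :1) refl r))
  (cong2 _⊹_ (solve 0 ((:0 :+ :- :0) :+ (:0 :+ :- :0) := :0) refl) (solve 1 (λ r → (:1 :+ :- :1) :+ ((:- :1) :+ :- (:- :1)) := con q4' :* r :* :0) refl r))
  (cong2 _⊹_ (solve 0 (((:- con ½) :+ :- (:- con ½)) :+ ((:- con ½) :+ :- (:- con ½)) := :0) refl) (solve 1 (λ r → (r :+ :- (:- r)) :+ (r :+ :- (:- r)) := con q4' :* r :* :1) refl r))
  (cong2 _⊹_ (solve 1 (λ r → ((:- r) :+ :- r) :+ (r :+ :- (:- r)) := :0) refl r) (solve 1 (λ r → (con ½ :+ :- con ½) :+ ((:- con ½) :+ :- (:- con ½)) := con q4' :* r :* :0) refl r))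
  (cong2 _⊹_ (solve 0 (((:- :1) :+ :- (:- :1)) :+ ((:- :1) :+ :- (:- :1)) := :0) refl) (solve 1 (λ r → (:0 :+ :- :0) :+ (:0 :+ :- :0) := con q4' :* r :* :0) refl r))
  (cong2 _⊹_ (solve 1 (λ r → ((:- r) :+ :- r) :+ (r :+ :- (:- r)) := :0) refl r) (solve 1 (λ r → ((:- con ½) :+ :- (:- con ½)) :+ (con ½ :+ :- con ½) := con q4' :* r :* :0) refl r))
  (cong2 _⊹_ (solve 0 (((:- con ½) :+ :- (:- con ½)) :+ ((:- con ½) :+ :- (:- con ½)) := :0) refl) (solve 1 (λ r → ((:- r) :+ :- r) :+ ((:- r) :+ :- r) := con q4' :* r :* con (ℚ.- 1ℚ)) refl r))
  (cong2 _⊹_ (solve 0 ((:0 :+ :- :0) :+ (:0 :+ :- :0) := :0) refl) (solve 1 (λ r → ((:- :1) :+ :- (:- :1)) :+ (:1 :+ :- :1) := con q4' :* r :* :0) refl r))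
  (cong2 _⊹_ (solve 0 ((con ½ :+ :- con ½) :+ (con ½ :+ :- con ½) := :0) refl) (solve 1 (λ r → ((:- r) :+ :- r) :+ ((:- r) :+ :- r) := con q4' :* r :* con (ℚ.- 1ℚ)) refl r))
  (cong2 _⊹_ (solve 1 (λ r → (r :+ :- (:- r)) :+ ((:- r) :+ :- r) := :0) refl r) (solve 1 (λ r → ((:- con ½) :+ :- (:- con ½)) :+ (con ½ :+ :- con ½) := con q4' :* r :* :0) refl r))
  n)

module Roots (l' : ℕ) where
 open Grid l' public

 p1 : ω ≐ (λ n → tbl (ρ n) 1)
 p1 = ≐-abs (N₀ +' n₀ ω³≐i) (C ω³≐i) (C≥0 ω³≐i) (λ n _ → ≡≤ (tr (cong abs (-‿inverseʳ (ρ n))) (∣∣-real ≤-refl)) (0≤* (C≥0 ω³≐i) (inv≥0 («suc»-pos n)))) ω-im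

 private
  it : ∀ r j → j <' 9 → tbl r j *C iC ≡ tbl r (3 +' j)
  it r 0 _ = *C-identityˡ iC
  it r 1 _ = cong2 _⊹_ (solve 1 (λ r → r :* :0 :- con ½ :* :1 := :- con ½) refl r) (solve 1 (λ r → r :* :1 :+ con ½ :* :0 := r) refl r)
  it r 2 _ = cong2 _⊹_ (solve 1 (λ r → con ½ :* :0 :- r :* :1 := :- r) refl r) (solve 1 (λ r → con ½ :* :1 :+ r :* :0 := con ½) refl r)
  it r 3 _ = cong2 _⊹_ (solve 0 (:0 :* :0 :- :1 :* :1 := :- :1) refl) (solve 0 (:0 :* :1 :+ :1 :* :0 := :0) refl)
  it r 4 _ = cong2 _⊹_ (solve 1 (λ r → (:- con ½) :* :0 :- r :* :1 := :- r) refl r) (solve 1 (λ r → (:- con ½) :* :1 :+ r :* :0 := :- con ½) refl r)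
  it r 5 _ = cong2 _⊹_ (solve 1 (λ r → (:- r) :* :0 :- con ½ :* :1 := :- con ½) refl r) (solve 1 (λ r → (:- r) :* :1 :+ con ½ :* :0 := :- r) refl r)
  it r 6 _ = cong2 _⊹_ (solve 0 ((:- :1) :* :0 :- :0 :* :1 := :0) refl) (solve 0 ((:- :1) :* :1 :+ :0 :* :0 := :- :1) refl)
  it r 7 _ = cong2 _⊹_ (solve 1 (λ r → (:- r) :* :0 :- (:- con ½) :* :1 := con ½) refl r) (solve 1 (λ r → (:- r) :* :1 :+ (:- con ½) :* :0 := :- r) refl r)
  it r 8 _ = cong2 _⊹_ (solve 1 (λ r → (:- con ½) :* :0 :- (:- r) :* :1 := r) refl r) (solve 1 (λ r → (:- con ½) :* :1 :+ (:- r) :* :0 := :- con ½) refl r)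
  it r (suc (suc (suc (suc (suc (suc (suc (suc (suc j))))))))) (s≤s (s≤s (s≤s (s≤s (s≤s (s≤s (s≤s (s≤s (s≤s ())))))))))

 ωpow-unit : ∀ j n → nrm (ω n ^C j) ≤ 1F
 ωpow-unit j n = ≡⇒≤ (nrm-^C (ω n) (ω-unit n) j)

 Btbl : ∀ j → (λ n → ω n ^C j) ≐ (λ n → tbl (ρ n) j) → Bdd (λ n → tbl (ρ n) j)
 Btbl j p = Bdd-≐ (≐-sym p) (Bdd-unit (ωpow-unit j))

 pw0 : (λ n → ω n ^C 0) ≐ (λ n → tbl (ρ n) 0)
 pw0 = ≐-refl
 pw1 : (λ n → ω n ^C 1) ≐ (λ n → tbl (ρ n) 1)
 pw1 = ≐-from (λ n → *C-identityʳ (ω n)) (λ _ → refl) p1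
 pw2 : (λ n → ω n ^C 2) ≐ (λ n → tbl (ρ n) 2)
 pw2 = ≐-trans (≐-from (λ n → solveC 1 (λ w → w ⨯ (w ⨯ conC 1ℚ) ≔ w ⨯ w) refl (ω n)) (λ _ → refl) (≐-* (Btbl 1 pw1) Bdd-ω p1 p1)) sq
  where
   -- ρ² = 1 - s² and s is close to 1/2
   sq : (λ n → tbl (ρ n) 1 *C tbl (ρ n) 1) ≐ (λ n → tbl (ρ n) 2)
   sq = ≐-abs (N₀ +' n₀ ω³≐i) (ι 2ℚ * C ω³≐i) (0≤* (ι≥0 2ℚ) (C≥0 ω³≐i))
    (λ n l → ≡≤ (cong abs (rr n)) (tr≤ (∣∣-* _ _) (≤≡ (*-mono (∣∣≥0 _) (∣∣≥0 _) (≡≤ (∣∣-neg _) (≡≤ (∣∣-real (0≤+ (ω-im≥0 n) (ι≥0 ½))) (≤≡ (+-mono (Unit.s≤1 n (t12 n)) (ι-≤ (from-yes (½ ℚ.≤? 1ℚ)))) (sym (ι-+ 1ℚ 1ℚ))))) (ω-im n l)) (sym (*-assoc _ _ _)))))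
    (λ n l → ≡≤ (tr (cong abs (solve 1 (λ r → r :* con ½ :+ con ½ :* r :- r := :0) refl (ρ n))) (∣∣-real ≤-refl)) (0≤* (0≤* (ι≥0 2ℚ) (C≥0 ω³≐i)) (inv≥0 («suc»-pos n))))
    where
     rr : ∀ n → ρ n * ρ n - ι ½ * ι ½ - ι ½ ≡ (- (im (ω n) + ι ½)) * (im (ω n) - ι ½)
     rr n = tr (cong (λ w → w - ι ½ * ι ½ - ι ½) (tr (solve 2 (λ c s → c :* c := (c :* c :+ s :* s) :- s :* s) refl (ρ n) (im (ω n))) (cong (_- im (ω n) * im (ω n)) (ω-unit n)))) (solve 1 (λ s → :1 :- s :* s :- con ½ :* con ½ :- con ½ := (:- (s :+ con ½)) :* (s :- con ½)) refl (im (ω n)))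

 pw+3 : ∀ j → j <' 9 → (λ n → ω n ^C j) ≐ (λ n → tbl (ρ n) j) → (λ n → ω n ^C (3 +' j)) ≐ (λ n → tbl (ρ n) (3 +' j))
 pw+3 j l p = ≐-from (λ n → tr (^C-+ (ω n) 3 j) (*C-comm _ _)) (λ n → sym (it (ρ n) j l)) (≐-* (Btbl j p) (Bdd-unit (ωpow-unit 3)) p ω³≐i)

 pw3 = pw+3 0 (s≤s z≤n) pw0
 pw4 = pw+3 1 (s≤s (s≤s z≤n)) pw1
 pw5 = pw+3 2 (s≤s (s≤s (s≤s z≤n))) pw2
 pw6 = pw+3 3 (N.m≤m+n 4 5) pw3
 pw7 = pw+3 4 (N.m≤m+n 5 4) pw4
 pw8 = pw+3 5 (N.m≤m+n 6 3) pw5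
 pw9 = pw+3 6 (N.m≤m+n 7 2) pw6
 pw10 = pw+3 7 (N.m≤m+n 8 1) pw7
 pw11 = pw+3 8 (N.m≤m+n 9 0) pw8

 ω¹²≐1 : (λ n → ω n ^C 12) ≐ (λ _ → 1C)
 ω¹²≐1 = ≐-from (λ n → ^C-* (ω n) 4 3) (λ _ → sym iC⁴) (≐-^ 4 (ωpow-unit 3) (Bdd-const iC) ω³≐i)

 ω-tbl : ∀ k → (λ n → ω n ^C k) ≐ (λ n → tbl (ρ n) (k % 12))
 ω-tbl k = ≐-from eq (λ n → sym (*C-identityʳ _)) (≐-* (Btbl (k % 12) small) (Bdd-unit (λ n → ≡⇒≤ (nrm-^C (ω n ^C 12) (nrm-^C (ω n) (ω-unit n) 12) (k / 12)))) small big)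
  where
   small : (λ n → ω n ^C (k % 12)) ≐ (λ n → tbl (ρ n) (k % 12))
   small = case12 (λ j → (λ n → ω n ^C j) ≐ (λ n → tbl (ρ n) j)) pw0 pw1 pw2 pw3 pw4 pw5 pw6 pw7 pw8 pw9 pw10 pw11 k
   big : (λ n → (ω n ^C 12) ^C (k / 12)) ≐ (λ _ → 1C)
   big = ≐-from (λ _ → refl) (λ _ → sym (1^C (k / 12))) (≐-^ (k / 12) (ωpow-unit 12) (Bdd-const 1C) ω¹²≐1)
   eq : ∀ n → ω n ^C k ≡ ω n ^C (k % 12) *C (ω n ^C 12) ^C (k / 12)
   eq n = tr (cong (ω n ^C_) (m≡m%n+[m/n]*n k 12)) (tr (^C-+ (ω n) (k % 12) _) (cong (ω n ^C (k % 12) *C_) (^C-* (ω n) (k / 12) 12)))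

-- Fourier coefficients of a dilated arc.

∑C-rng-+ : ∀ a b (f : ℕ → ℂ) → ∑C (rng (a +' b)) f ≡ ∑C (rng a) (λ j → f (b +' j)) +C ∑C (rng b) f
∑C-rng-+ zero b f = sym (+C-identityˡ _)
∑C-rng-+ (suc a) b f = tr (cong2 _+C_ (cong f (N.+-comm a b)) (∑C-rng-+ a b f)) (sym (+C-assoc (f (b +' a)) _ _))

∑C-rng-* : ∀ m n (f : ℕ → ℂ) → ∑C (rng (m *' n)) f ≡ ∑C (rng m) (λ i → ∑C (rng n) (λ j → f (i *' n +' j)))
∑C-rng-* zero n f = refl
∑C-rng-* (suc m) n f = tr (∑C-rng-+ n (m *' n) f) (cong (∑C (rng n) (λ j → f (m *' n +' j)) +C_) (∑C-rng-* m n f))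

∑C-select : ∀ N a b (g : ℕ → ℂ) → a ≤' b → b <' N → ∑C (rng N) (λ x → real (iv (a ℕ.<? x) * iv (x ℕ.≤? b)) *C g x) ≡ ∑C (rng (b ∸' a)) (λ y → g (suc a +' y))
∑C-select N a b g ab bN = tr (cong (λ w → ∑C (rng w) h) eN) (tr (∑C-rng-+ (N ∸' suc b) (suc b) h) (tr (cong2 _+C_ (∑C-zero∈ (rng (N ∸' suc b)) (λ {j} _ → hi j)) (tr (cong (λ w → ∑C (rng w) h) eb) (tr (∑C-rng-+ (b ∸' a) (suc a) h) (cong2 _+C_ (∑C-cong∈ (rng (b ∸' a)) (λ {y} m → mid y (∈rng m))) (∑C-zero∈ (rng (suc a)) (λ {x} m → lo x (∈rng m))))))) (tr (+C-identityˡ _) (+C-identityʳ _))))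
 where
  h : ℕ → ℂ
  h x = real (iv (a ℕ.<? x) * iv (x ℕ.≤? b)) *C g x
  eN : N ≡ (N ∸' suc b) +' suc b
  eN = sym (N.m∸n+n≡m bN)
  eb : suc b ≡ (b ∸' a) +' suc a
  eb = sym (tr (N.+-suc (b ∸' a) a) (cong suc (N.m∸n+n≡m ab)))
  hi : ∀ j → h (suc b +' j) ≡ 0C
  hi j = tr (cong (λ w → real w *C g (suc b +' j)) (tr (cong (iv (a ℕ.<? suc b +' j) *_) (iv-no _ (λ l → N.<⇒≱ (N.m≤m+n (suc b) j) l))) (zeroʳ _))) (zeroCˡ _)
  lo : ∀ x → x <' suc a → h x ≡ 0C
  lo x l = tr (cong (λ w → real w *C g x) (tr (cong (_* iv (x ℕ.≤? b)) (iv-no _ (λ l' → N.<⇒≱ l' (N.≤-pred l)))) (zeroˡ _))) (zeroCˡ _)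
  mid : ∀ y → y <' b ∸' a → h (suc a +' y) ≡ g (suc a +' y)
  mid y l = tr (cong (λ w → real w *C g (suc a +' y)) (tr (cong2 _*_ (iv-yes _ (N.m≤m+n (suc a) y)) (iv-yes _ (subst (suc a +' y ≤'_) (N.m+[n∸m]≡n ab) (subst (_≤' a +' (b ∸' a)) (N.+-suc a y) (N.+-monoʳ-≤ a l))))) (1* 1F))) (*C-identityˡ _)

md : ℕ → ℕ → ℕ
md x zero = x
md x (suc q) = x % suc q

-- Membership of r/Q in the arc (α/12, β/12], cleared of denominators.
Ind : ℕ → ℕ → ℕ → ℕ → F
Ind α β Q r = iv (α *' Q ℕ.<? 12 *' r) * iv (12 *' r ℕ.≤? β *' Q)

md-+ : ∀ Q r i → r <' Q → md (r +' i *' Q) Q ≡ r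
md-+ (suc Q) r i l = tr ([m+kn]%n≡m%n r i (suc Q)) (m<n⇒m%n≡m l)

module _ (q τ : ℕ) (q≥1 : 1 ≤' q) where

 Ind-red : ∀ α β x → Ind α β (12 *' (q *' τ)) (q *' x) ≡ iv (α *' τ ℕ.<? x) * iv (x ℕ.≤? β *' τ)
 Ind-red α β x = cong2 _*_ (iv-⇔ _ _ (λ l → N.*-cancelˡ-< (12 *' q) _ _ (subst₂ _<'_ (e1 α) e2 l)) (λ l → subst₂ _<'_ (sym (e1 α)) (sym e2) (N.*-monoʳ-< (12 *' q) {{nz}} l)))
  (iv-⇔ _ _ (λ l → N.*-cancelˡ-≤ (12 *' q) {{nz}} (subst₂ _≤'_ e2 (e1 β) l)) (λ l → subst₂ _≤'_ (sym e2) (sym (e1 β)) (N.*-monoʳ-≤ (12 *' q) l)))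
  where
   nz : ℕ.NonZero (12 *' q)
   nz = ℕ.>-nonZero (N.≤-trans q≥1 (N.m≤n*m q 12))
   e1 : ∀ α → α *' (12 *' (q *' τ)) ≡ (12 *' q) *' (α *' τ)
   e1 α = solveN 3 (λ a q t → a :*' (con' 12 :*' (q :*' t)) :=' (con' 12 :*' q) :*' (a :*' t)) refl α q τ
   e2 : 12 *' (q *' x) ≡ (12 *' q) *' x
   e2 = sym (N.*-assoc 12 q x)

 -- As x runs through the grid, q x goes round q times, and in each round it meets the arc for the
 -- same run of consecutive x.
 decomp : ∀ α β (f : ℕ → ℂ) → α ≤' β → β <' 12 → 1 ≤' τ →
  ∑C (rng (12 *' (q *' τ))) (λ x → real (Ind α β (12 *' (q *' τ)) (md (q *' x) (12 *' (q *' τ)))) *C f x)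
  ≡ ∑C (rng q) (λ i → ∑C (rng (β *' τ ∸' α *' τ)) (λ y → f (i *' (12 *' τ) +' (suc (α *' τ) +' y))))
 decomp α β f ab b12 t1 = tr (cong (λ w → ∑C (rng w) h) eQ) (tr (∑C-rng-* q (12 *' τ) h) (∑C-cong (rng q) (λ i →
  tr (∑C-cong∈ (rng (12 *' τ)) (λ {x} m → cong (λ w → real w *C f (i *' (12 *' τ) +' x)) (tr (cong (Ind α β Q) (mm i x (∈rng m))) (Ind-red α β x))))
   (∑C-select (12 *' τ) (α *' τ) (β *' τ) (λ x → f (i *' (12 *' τ) +' x)) (N.*-monoˡ-≤ τ ab) (N.*-monoˡ-< τ {{ℕ.>-nonZero t1}} b12)))))
  where
   Q = 12 *' (q *' τ)
   h : ℕ → ℂ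
   h x = real (Ind α β Q (md (q *' x) Q)) *C f x
   eQ : Q ≡ q *' (12 *' τ)
   eQ = solveN 2 (λ q t → con' 12 :*' (q :*' t) :=' q :*' (con' 12 :*' t)) refl q τ
   mm : ∀ i x → x <' 12 *' τ → md (q *' (i *' (12 *' τ) +' x)) Q ≡ q *' x
   mm i x l = tr (cong (λ w → md w Q) (solveN 4 (λ q i t x → q :*' (i :*' (con' 12 :*' t) :+' x) :=' q :*' x :+' i :*' (con' 12 :*' (q :*' t))) refl q i τ x)) (md-+ Q (q *' x) i (subst (q *' x <'_) (sym eQ) (N.*-monoʳ-< q {{ℕ.>-nonZero q≥1}} l)))

-- A quantitative form of e(k/q) ≠ 1: some power of it lies in the left half plane. If the residue r
-- is at most q/2, its first multiple to reach q/4 overshoots by at most r and stays below 3q/4;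
-- otherwise q - r is used and the result reflected.
middle : ∀ q k → 1 ≤' q → ¬ (q ∣ k) → Σ ℕ λ s → Σ ℕ λ a → Σ ℕ λ r → (1 ≤' s) × (s *' k ≡ a *' q +' r) × (q ≤' 4 *' r) × (4 *' r ≤' 3 *' q)
middle q@(suc _) k q≥1 nd = go (2 *' r0 ℕ.≤? q)
 where
  r0 = k % q
  k0 = k / q
  ek : k ≡ r0 +' k0 *' q
  ek = m≡m%n+[m/n]*n k q
  r0≥1 : 1 ≤' r0
  r0≥1 = N.n≢0⇒n>0 (λ e → nd (m%n≡0⇒n∣m k q e))
  r0<q : r0 <' q
  r0<q = m%n<n k q
  least : ∀ r → 1 ≤' r → ∀ fuel s → q ≤' 4 *' ((s +' fuel) *' r) → 4 *' (s *' r) <' q → Σ ℕ λ s → (1 ≤' s) × (q ≤' 4 *' (s *' r)) × (4 *' (s *' r) ≤' q +' 4 *' r)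
  least r r1 zero s a b = ⊥-elim (N.<⇒≱ b (subst (λ w → q ≤' 4 *' (w *' r)) (N.+-identityʳ s) a))
  least r r1 (suc fuel) s a b with q ℕ.≤? 4 *' (suc s *' r)
  ... | yes p = suc s , s≤s z≤n , p , N.≤-trans (N.≤-reflexive (solveN 2 (λ s r → con' 4 :*' (r :+' s :*' r) :=' con' 4 :*' (s :*' r) :+' con' 4 :*' r) refl s r)) (N.+-monoˡ-≤ (4 *' r) (N.<⇒≤ b))
  ... | no np = least r r1 fuel (suc s) (subst (λ w → q ≤' 4 *' (w *' r)) (N.+-suc s fuel) a) (N.≰⇒> np)
  lst : ∀ r → 1 ≤' r → Σ ℕ λ s → (1 ≤' s) × (q ≤' 4 *' (s *' r)) × (4 *' (s *' r) ≤' q +' 4 *' r)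
  lst r r1 = least r r1 q 0 (N.≤-trans (N.≤-trans (N.≤-reflexive (sym (N.*-identityʳ q))) (N.*-monoʳ-≤ q r1)) (N.m≤n*m (q *' r) 4)) (s≤s z≤n)
  q+2q : ∀ r → 2 *' r ≤' q → q +' 4 *' r ≤' 3 *' q
  q+2q r h = N.≤-trans (N.+-monoʳ-≤ q (N.≤-trans (N.≤-reflexive (N.*-assoc 2 2 r)) (N.*-monoʳ-≤ 2 h))) (N.≤-reflexive refl)
  go : Dec (2 *' r0 ≤' q) → _
  go (yes h) = let (s , s1 , lo , hi) = lst r0 r0≥1 in s , s *' k0 , s *' r0 , s1 , tr (cong (s *'_) ek) (solveN 4 (λ s r k q → s :*' (r :+' k :*' q) :=' (s :*' k) :*' q :+' s :*' r) refl s r0 k0 q) , lo , N.≤-trans hi (q+2q r0 h)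
  go (no h) = let (s , s1 , lo , hi) = lst r1 r1≥1 in fin s s1 lo (N.≤-trans hi (q+2q r1 h1))
   where
    r1 = q ∸' r0
    e1 : r0 +' r1 ≡ q
    e1 = N.m+[n∸m]≡n (N.<⇒≤ r0<q)
    r1≥1 : 1 ≤' r1
    r1≥1 = N.m<n⇒0<n∸m r0<q
    h1 : 2 *' r1 ≤' q
    h1 = N.+-cancelˡ-≤ (2 *' r0) _ _ (N.≤-trans (N.≤-reflexive (tr (sym (N.*-distribˡ-+ 2 r0 r1)) (cong (2 *'_) e1))) (N.+-mono-≤ (N.<⇒≤ (N.≰⇒> h)) (N.≤-reflexive (N.+-identityʳ q))))
    fin : ∀ s → 1 ≤' s → q ≤' 4 *' (s *' r1) → 4 *' (s *' r1) ≤' 3 *' q → _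
    fin (suc s) s1 lo hi = suc s , (suc s *' k0) +' s , q ∸' suc s *' r1 , s1 ,
     N.+-cancelʳ-≡ (suc s *' r1) (suc s *' k) (((suc s *' k0) +' s) *' q +' (q ∸' suc s *' r1)) (tr (tr (cong (λ w → suc s *' w +' suc s *' r1) ek) (tr (solveN 5 (λ s r k q t → s :*' (r :+' k :*' q) :+' s :*' t :=' s :*' (r :+' t) :+' (s :*' k) :*' q) refl (suc s) r0 k0 q r1) (cong (λ w → suc s *' w +' suc s *' k0 *' q) e1)))
      (sym (tr (N.+-assoc (((suc s *' k0) +' s) *' q) _ _) (tr (cong (((suc s *' k0) +' s) *' q +'_) (N.m∸n+n≡m le)) (solveN 3 (λ s k q → (k :+' s) :*' q :+' q :=' (q :+' s :*' q) :+' k :*' q) refl s (suc s *' k0) q))))) ,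
     N.+-cancelʳ-≤ (4 *' (suc s *' r1)) _ _ (N.≤-trans (N.+-monoʳ-≤ q hi) (N.≤-reflexive (sym four))) ,
     N.+-cancelʳ-≤ (4 *' (suc s *' r1)) _ _ (N.≤-trans (N.≤-reflexive four) (N.≤-trans (N.≤-reflexive (N.+-comm q (3 *' q))) (N.+-monoʳ-≤ (3 *' q) lo)))
     where
      le : suc s *' r1 ≤' q
      le = N.*-cancelˡ-≤ 4 (N.≤-trans hi (N.*-monoˡ-≤ q {3} {4} (s≤s (s≤s (s≤s z≤n)))))
      four : 4 *' (q ∸' suc s *' r1) +' 4 *' (suc s *' r1) ≡ 4 *' q
      four = tr (sym (N.*-distribˡ-+ 4 (q ∸' suc s *' r1) (suc s *' r1))) (cong (4 *'_) (N.m∸n+n≡m le))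

2≥0 : 0F ≤ ι 2ℚ
2≥0 = ι≥0 2ℚ

module Coef (l' q m' : ℕ) (q≥1 : 1 ≤' q) (el : suc l' ≡ q *' m') where
 open Roots l'

 τ : ℕ → ℕ
 τ n = m' *' τ0 n

 t12τ : ∀ n → t12 n ≡ q *' τ n
 t12τ n = tr (cong (_*' τ0 n) el) (N.*-assoc q m' (τ0 n))

 τ≥1 : ∀ n → N₀ ≤' n → 1 ≤' τ n
 τ≥1 n h = go (τ n) (subst (1 ≤'_) (t12τ n) (t12≥1 n h))
  where
   go : ∀ t → 1 ≤' q *' t → 1 ≤' t
   go zero l = ⊥-elim (N.<⇒≱ l (N.≤-reflexive (N.*-zeroʳ q)))
   go (suc t) _ = s≤s z≤n

 Av : ℕ → ℕ → ℕ → ℕ → ℂ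
 Av α β k n = real (inv « Q n ») *C ∑C (rng (Q n)) (λ x → real (Ind α β (Q n) (md (q *' x) (Q n))) *C conj (zz n) ^C (k *' x))

 v : ℕ → ℕ → ℂ
 v k n = conj (zz n) ^C k

 v-unit : ∀ k n → nrm (v k n) ≡ 1F
 v-unit k n = nrm-^C (conj (zz n)) (tr (nrm-conj _) (uu n)) k

 Z : ℕ → ℕ → ℂ
 Z k n = ∑C (rng q) (λ i → (v k n ^C (12 *' τ n)) ^C i)

 I : ℕ → ℕ → ℕ → ℕ → ℂ
 I α β k n = real (inv « Q n ») *C (v k n ^C suc (α *' τ n) *C ∑C (rng (β *' τ n ∸' α *' τ n)) (λ y → v k n ^C y))

 -- In `decomp` the exponent is the sum of a part from the round and a part from the position in it,
 -- so the double sum factors: `Z` detects divisibility by q, `I` is the coefficient of the arc.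
 Av-eq : ∀ α β k n → α ≤' β → β <' 12 → N₀ ≤' n → Av α β k n ≡ Z k n *C I α β k n
 Av-eq α β k n ab b12 h = tr (cong (real (inv « Q n ») *C_) (tr (tr (∑C-cong (rng (Q n)) (λ x → cong (real (Ind α β (Q n) (md (q *' x) (Q n))) *C_) (tr (cong (conj (zz n) ^C_) (N.*-comm k x)) (^C-* (conj (zz n)) x k)))) (tr (cong (λ w → ∑C (rng (12 *' w)) (λ x → real (Ind α β (12 *' w) (md (q *' x) (12 *' w))) *C v k n ^C x)) (t12τ n)) (decomp q (τ n) q≥1 α β (λ x → v k n ^C x) ab b12 (τ≥1 n h))))
  (tr (∑C-cong (rng q) (λ i → tr (∑C-cong (rng L) (λ y → tr (^C-+ (v k n) (i *' (12 *' τ n)) (suc (α *' τ n) +' y)) (cong2 _*C_ (^C-* (v k n) i (12 *' τ n)) (^C-+ (v k n) (suc (α *' τ n)) y)))) (tr (∑C-* (rng L) _ _) (cong ((v k n ^C (12 *' τ n)) ^C i *C_) (∑C-* (rng L) _ _))))) (∑C-*ʳ (rng q) _ _))))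
  (solveC 3 (λ r z w → r ⨯ (z ⨯ w) ≔ z ⨯ (r ⨯ w)) refl (real (inv « Q n »)) (Z k n) _)
  where L = β *' τ n ∸' α *' τ n

 Qpos : ∀ n → N₀ ≤' n → Pos « Q n »
 Qpos n h = «»-pos (N.≤-trans (s≤s z≤n) (S≤Q n h))

 I-Bdd : ∀ α β k → β ≤' 12 → Bdd (I α β k)
 I-Bdd α β k b12 = mkB N₀ (ι q4') (ι≥0 q4') bnd
  where
   bnd : ∀ n → N₀ ≤' n → N1 (I α β k n) ≤ ι q4'
   bnd n h = tr≤ (N1-* _ _) (≤≡ (*-mono (N1≥0 (real (inv « Q n »))) (N1≥0 _) (≡⇒≤ (N1-real (inv≥0 (Qpos n h)))) (tr≤ (N1-* _ _) (*-mono (N1≥0 _) (N1≥0 _) (N1≤2 (≡⇒≤ (nrm-^C (v k n) (v-unit k n) (suc (α *' τ n))))) (tr≤ (∑C-N1 (rng L) _) (tr≤ (∑-mono (rng L) (λ y → N1≤2 (≡⇒≤ (nrm-^C (v k n) (v-unit k n) y)))) (≡≤ (tr (∑-const (rng L) (ι 2ℚ)) (cong (λ w → « w » * ι 2ℚ) (length-rng L))) (*-monoʳ (ι 2ℚ) 2≥0 («»-mono L≤Q))))))))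
    (tr (solve 2 (λ i Q → i :* (:2 :* (Q :* :2)) := con q4' :* (Q :* i)) refl (inv « Q n ») « Q n ») (tr (cong (ι q4' *_) (*-inv (Qpos n h))) (*1 _))))
    where
     L = β *' τ n ∸' α *' τ n
     L≤Q : L ≤' Q n
     L≤Q = N.≤-trans (N.m∸n≤m _ (α *' τ n)) (N.*-mono-≤ b12 (subst (τ n ≤'_) (sym (t12τ n)) (subst (_≤' q *' τ n) (N.*-identityˡ (τ n)) (N.*-monoˡ-≤ (τ n) q≥1))))

 v12τ : ∀ k n → v k n ^C (12 *' τ n) ≡ conj (zz n ^C ((12 *' τ n) *' k))
 v12τ k n = sym (tr (conj-^C (zz n) _) (^C-* (conj (zz n)) (12 *' τ n) k))

 zQpow≐1 : ∀ a → (λ n → zz n ^C (a *' Q n)) ≐ (λ _ → 1C)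
 zQpow≐1 a = ≐-from (λ n → ^C-* (zz n) a (Q n)) (λ _ → sym (1^C a)) (≐-^ a (zpow-unit Q) (Bdd-const 1C) zQ≐1)

 1^≐ : ∀ {y : ℕ → ℂ} → (∀ n → nrm (y n) ≤ 1F) → y ≐ (λ _ → 1C) → ∀ i → (λ n → y n ^C i) ≐ (λ _ → 1C)
 1^≐ u p i = ≐-from (λ _ → refl) (λ _ → sym (1^C i)) (≐-^ i u (Bdd-const 1C) p)

 conj1 : conj 1C ≡ 1C
 conj1 = conj-real 1F

 Z-mult : ∀ m → Z (q *' m) ≐ (λ _ → real « q »)
 Z-mult m = ≐-trans (≐-∑ (rng q) (λ {i} _ → 1^≐ (λ n → ≡⇒≤ (nrm-^C (v (q *' m) n) (v-unit (q *' m) n) (12 *' τ n))) base i)) (≐-≡ (λ _ → cong2 _⊹_ (tr (∑-const (rng q) 1F) (tr (*1 _) (cong «_» (length-rng q)))) (∑-0 (rng q))))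
  where
   base : (λ n → v (q *' m) n ^C (12 *' τ n)) ≐ (λ _ → 1C)
   base = ≐-from (λ n → tr (v12τ (q *' m) n) (cong (λ w → conj (zz n ^C w)) (tr (solveN 3 (λ t q m → (con' 12 :*' t) :*' (q :*' m) :=' m :*' (con' 12 :*' (q :*' t))) refl (τ n) q m) (cong (λ w → m *' (12 *' w)) (sym (t12τ n)))))) (λ _ → sym conj1) (≐-conj (zQpow≐1 m))

 -- Tends to 1/(2π): for a step of angle θ, S is about 2/θ and Q θ about 2π.
 κ : ℕ → F
 κ n = « suc n » * inv (ι 2ℚ * « Q n »)

 κ-Bdd : Bdd (λ n → real (κ n))
 κ-Bdd = mkB N₀ 1F 0≤1 (λ n h → ≡≤ (N1-real (0≤* («»≥0 _) (inv≥0 (2Qpos n h)))) (*-cancel-≤ (ι 2ℚ * « Q n ») (2Qpos n h) (≡≤ (tr (solve 3 (λ a s i → a :* (s :* i) := s :* (a :* i)) refl (ι 2ℚ * « Q n ») « suc n » (inv (ι 2ℚ * « Q n »))) (tr (cong (« suc n » *_) (*-inv (2Qpos n h))) (*1 _))) (tr≤ («»-mono (S≤Q n h)) (≤-by « Q n » («»≥0 _) (solve 1 (λ Q → Q :+ Q := :2 :* Q :* :1) refl « Q n »))))))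
  where
   2Qpos : ∀ n → N₀ ≤' n → Pos (ι 2ℚ * « Q n »)
   2Qpos n h = Pos-* (λ w → from-no (2ℚ ℚ.≤? 0ℚ) (ι-≤⁻ w)) (Qpos n h)

 inv2 : ∀ x → Pos x → inv (ι 2ℚ * x) ≡ ι ½ * inv x
 inv2 x p = tr (sym (*1 _)) (tr (cong (inv (ι 2ℚ * x) *_) (sym (tr (solve 2 (λ x i → (:2 :* x) :* (con ½ :* i) := x :* i) refl x (inv x)) (*-inv p)))) (tr (sym (*-assoc _ (ι 2ℚ * x) _)) (tr (cong (_* (ι ½ * inv x)) (tr (*-comm _ _) (*-inv (Pos-* (λ w → from-no (2ℚ ℚ.≤? 0ℚ) (ι-≤⁻ w)) p)))) (1* _))))

 -- Rests on S (1 - z̄) = i (1 + z̄), exact because tan (θ/2) = 1/S. This produces the denominator k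
 -- of a Fourier coefficient algebraically.
 S1v : ∀ k n → real « suc n » *C (1C +C (-C v k n)) ≡ (iC *C (1C +C conj (zz n))) *C ∑C (rng k) (λ j → conj (zz n) ^C j)
 S1v k n = tr (cong (real « suc n » *C_) (sym (geom (conj (zz n)) k))) (tr (sym (*C-assoc _ _ _)) (cong (_*C ∑C (rng k) (λ j → conj (zz n) ^C j)) base))
  where
   open Unit n
   c1 : S * (1F - re z) ≡ im z
   c1 = tr (cong (λ w → S * (1F - w)) (cong re (sym (*C-identityʳ z)))) (tr (dc 0) (tr (0+ _) (cong im (*C-identityʳ z))))
   s1 : S * im z ≡ 1F + re z
   s1 = tr (cong (S *_) (tr (cong im (sym (*C-identityʳ z))) (solve 1 (λ x → x := x :- :0) refl _))) (tr (ds 0) (cong (1F +_) (cong re (*C-identityʳ z))))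
   base : real S *C (1C +C (-C conj z)) ≡ iC *C (1C +C conj z)
   base = cong2 _⊹_
    (tr (solve 3 (λ S a b → S :* (:1 :+ :- a) :- :0 :* (:0 :+ :- (:- b)) := S :* (:1 :- a)) refl S (re z) (im z)) (tr c1 (solve 2 (λ a b → b := :0 :* (:1 :+ a) :- :1 :* (:0 :+ (:- b))) refl (re z) (im z))))
    (tr (solve 3 (λ S a b → S :* (:0 :+ :- (:- b)) :+ :0 :* (:1 :+ :- a) := S :* b) refl S (re z) (im z)) (tr s1 (solve 2 (λ a b → :1 :+ a := :0 :* (:0 :+ (:- b)) :+ :1 :* (:1 :+ a)) refl (re z) (im z))))

 z̄≐1 : (λ n → conj (zz n)) ≐ (λ _ → 1C)
 z̄≐1 = ≐-from (λ n → cong conj (sym (*C-identityʳ (zz n)))) (λ _ → sym conj1) (≐-conj (zpow≐1 (λ _ → 1) 1 (λ _ → N.≤-refl)))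

 z̄-unit : ∀ n → nrm (conj (zz n)) ≤ 1F
 z̄-unit n = ≡⇒≤ (tr (nrm-conj _) (uu n))

 S1v≐ : ∀ k → (λ n → real « suc n » *C (1C +C (-C v k n))) ≐ (λ _ → (iC *C (1C +C 1C)) *C real « k »)
 S1v≐ k = ≐-from (S1v k) (λ _ → refl) (≐-* (Bdd-const _) (Bdd-≐ sm (Bdd-const _)) (≐-*ˡ (λ _ → iC) (Bdd-const iC) (≐-+ ≐-refl z̄≐1)) sm)
  where
   sm : (λ n → ∑C (rng k) (λ j → conj (zz n) ^C j)) ≐ (λ _ → real « k »)
   sm = ≐-trans (≐-∑ (rng k) (λ {j} _ → 1^≐ z̄-unit z̄≐1 j)) (≐-≡ (λ _ → cong2 _⊹_ (tr (∑-const (rng k) 1F) (tr (*1 _) (cong «_» (length-rng k)))) (∑-0 (rng k))))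

 vα : ∀ m α n → v (q *' m) n ^C (α *' τ n) ≡ conj (ω n ^C (α *' m))
 vα m α n = sym (tr (cong conj (tr (sym (^C-* (zz n) (α *' m) (t12 n))) (cong (zz n ^C_) (tr (cong ((α *' m) *'_) (t12τ n)) (solveN 4 (λ a m q t → (a :*' m) :*' (q :*' t) :=' (a :*' t) :*' (q :*' m)) refl α m q (τ n)))))) (tr (conj-^C (zz n) _) (^C-* (conj (zz n)) (α *' τ n) (q *' m))))

 SI : ∀ α β m n → α ≤' β → N₀ ≤' n → (real « suc n » *C (1C +C (-C v (q *' m) n))) *C I α β (q *' m) n ≡ (1C +C 1C) *C (real (κ n) *C (v (q *' m) n *C (conj (ω n ^C (α *' m)) +C (-C conj (ω n ^C (β *' m))))))
 SI α β m n ab h = tr (solveC 6 (λ S u i a w s → (S ⨯ (conC 1ℚ ∔ ⊝ u)) ⨯ (i ⨯ ((u ⨯ a) ⨯ s)) ≔ (S ⨯ i) ⨯ (u ⨯ (a ⨯ ((conC 1ℚ ∔ ⊝ u) ⨯ s)))) refl (real « suc n ») u (real (inv « Q n »)) (u ^C (α *' τ n)) 0C (∑C (rng L) (λ y → u ^C y)))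
  (tr (cong (λ w → (real « suc n » *C real (inv « Q n »)) *C (u *C (u ^C (α *' τ n) *C w))) (geom u L))
   (tr (cong2 (λ p w → p *C (u *C w)) (tr (sym (real-* _ _)) kk) (tr (solveC 2 (λ a b → a ⨯ (conC 1ℚ ∔ ⊝ b) ≔ a ∔ ⊝ (a ⨯ b)) refl (u ^C (α *' τ n)) (u ^C L)) (cong2 (λ p w → p +C (-C w)) (vα m α n) (tr (tr (sym (^C-+ u (α *' τ n) L)) (cong (u ^C_) (N.m+[n∸m]≡n (N.*-monoˡ-≤ (τ n) ab)))) (vα m β n)))))
    (*C-assoc _ _ _)))
  where
   L = β *' τ n ∸' α *' τ n
   u = v (q *' m) n
   kk : real (« suc n » * inv « Q n ») ≡ (1C +C 1C) *C real (κ n)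
   kk = sym (tr (cong (_*C real (κ n)) (sym (real-+ 1F 1F))) (tr (sym (real-* (1F + 1F) (κ n))) (cong real (tr (cong (λ w → (1F + 1F) * (« suc n » * w)) (inv2 « Q n » (Qpos n h))) (solve 2 (λ s i → (:1 :+ :1) :* (s :* (con ½ :* i)) := s :* i) refl « suc n » (inv « Q n »))))))

 cω : ∀ j → (λ n → conj (ω n ^C j)) ≐ (λ n → conj (tbl (ρ n) (j % 12)))
 cω j = ≐-conj (ω-tbl j)

 Bcω : ∀ j → Bdd (λ n → conj (ω n ^C j))
 Bcω j = Bdd-unit (λ n → ≡⇒≤ (tr (nrm-conj _) (nrm-^C (ω n) (ω-unit n) j)))

 v≐1 : ∀ k → v k ≐ (λ _ → 1C)
 v≐1 k = 1^≐ z̄-unit z̄≐1 k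

 tb : ℕ → ℕ → ℕ → ℕ → ℂ
 tb α β m n = conj (tbl (ρ n) ((α *' m) % 12)) +C (-C conj (tbl (ρ n) ((β *' m) % 12)))

 I-mult : ∀ α β m → 1 ≤' m → α ≤' β → β ≤' 12 → I α β (q *' m) ≐ (λ n → (0F ⊹ (- inv « q *' m »)) *C (real (κ n) *C tb α β m n))
 I-mult α β m m1 ab b12 = ≐-from (λ n → solve-back (I α β k n)) (λ n → solve-fwd (real (κ n) *C tb α β m n)) (≐-*ˡ (λ _ → g) (Bdd-const g) mid)
  where
   k = q *' m
   kp : Pos « k »
   kp = «»-pos (N.*-mono-≤ {1} {q} {1} {m} q≥1 m1)
   g : ℂ
   g = 0F ⊹ (- (ι ½ * inv « k »))
   R : ℕ → ℂ
   R n = (1C +C 1C) *C (real (κ n) *C (v k n *C (conj (ω n ^C (α *' m)) +C (-C conj (ω n ^C (β *' m))))))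
   mid : (λ n → ((iC *C (1C +C 1C)) *C real « k ») *C I α β k n) ≐ (λ n → (1C +C 1C) *C (real (κ n) *C tb α β m n))
   mid = ≐-trans (≐-sym (≐-from-eventually N₀ (λ n h → sym (SI α β m n ab h)) (≐-* (Bdd-const _) (I-Bdd α β k b12) (S1v≐ k) ≐-refl)))
    (≐-*ˡ (λ _ → 1C +C 1C) (Bdd-const _) (≐-*ˡ (λ n → real (κ n)) κ-Bdd (≐-from (λ _ → refl) (λ n → sym (*C-identityˡ _)) (≐-* (Bdd-const 1C) (Bdd-+ (Bcω (α *' m)) (Bdd-neg (Bcω (β *' m)))) (v≐1 k) (≐-+ (cω (α *' m)) (≐-neg (cω (β *' m))))))))
    where
     Bdd-neg : ∀ {a} → Bdd a → Bdd (λ n → -C a n)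
     Bdd-neg B = mkB (n₁ B) (K B) (K≥0 B) (λ n l → ≡≤ (N1-neg _) (bdd B n l))
   ki : « k » * inv « k » ≡ 1F
   ki = *-inv kp
   one : g *C ((iC *C (1C +C 1C)) *C real « k ») ≡ 1C
   one = cong2 _⊹_ (tr (solve 2 (λ i k → :0 :* ((:0 :* (:1 :+ :1) :- :1 :* (:0 :+ :0)) :* k :- (:0 :* (:0 :+ :0) :+ :1 :* (:1 :+ :1)) :* :0) :- (:- (con ½ :* i)) :* ((:0 :* (:1 :+ :1) :- :1 :* (:0 :+ :0)) :* :0 :+ (:0 :* (:0 :+ :0) :+ :1 :* (:1 :+ :1)) :* k) := k :* i) refl (inv « k ») « k ») ki)
    (solve 2 (λ i k → :0 :* ((:0 :* (:1 :+ :1) :- :1 :* (:0 :+ :0)) :* :0 :+ (:0 :* (:0 :+ :0) :+ :1 :* (:1 :+ :1)) :* k) :+ (:- (con ½ :* i)) :* ((:0 :* (:1 :+ :1) :- :1 :* (:0 :+ :0)) :* k :- (:0 :* (:0 :+ :0) :+ :1 :* (:1 :+ :1)) :* :0) := :0) refl (inv « k ») « k »)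
   solve-back : ∀ w → w ≡ g *C (((iC *C (1C +C 1C)) *C real « k ») *C w)
   solve-back w = sym (tr (sym (*C-assoc _ _ _)) (tr (cong (_*C w) one) (*C-identityˡ w)))
   solve-fwd : ∀ w → (0F ⊹ (- inv « k »)) *C w ≡ g *C ((1C +C 1C) *C w)
   solve-fwd w = sym (tr (sym (*C-assoc _ _ _)) (cong (_*C w) (cong2 _⊹_ (solve 1 (λ i → :0 :* (:1 :+ :1) :- (:- (con ½ :* i)) :* (:0 :+ :0) := :0) refl (inv « k »)) (solve 1 (λ i → :0 :* (:0 :+ :0) :+ (:- (con ½ :* i)) :* (:1 :+ :1) := :- i) refl (inv « k »)))))

 inv-qm : ∀ m → 1 ≤' m → « q » * inv « q *' m » ≡ inv « m »
 inv-qm m m1 = tr (tr (sym (*1 _)) (cong (« q » * inv « q *' m » *_) (sym (*-inv («»-pos m1))))) (tr (solve 4 (λ a b c d → (a :* b) :* (c :* d) := ((a :* c) :* b) :* d) refl « q » (inv « q *' m ») « m » (inv « m »)) (tr (cong (λ w → (w * inv « q *' m ») * inv « m ») (sym («*» q m))) (tr (cong (_* inv « m ») (*-inv («»-pos (N.*-mono-≤ {1} {q} {1} {m} q≥1 m1)))) (1* _))))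

 Av-mult : ∀ α β m → 1 ≤' m → α ≤' β → β <' 12 → Av α β (q *' m) ≐ (λ n → (0F ⊹ (- inv « m »)) *C (real (κ n) *C tb α β m n))
 Av-mult α β m m1 ab b12 = ≐-from-eventually N₀ (λ n h → Av-eq α β (q *' m) n ab b12 h) (≐-from (λ _ → refl) (λ n → tr (cong (_*C (real (κ n) *C tb α β m n)) (cong2 _⊹_ (solve 2 (λ a b → :0 := a :* :0 :- :0 :* b) refl « q » (- inv « q *' m »)) (tr (cong -_ (sym (inv-qm m m1))) (solve 2 (λ a b → :- (a :* b) := a :* (:- b) :+ :0 :* :0) refl « q » (inv « q *' m »))))) (*C-assoc _ _ _)) (≐-* (Bdd-const (real « q »)) (I-Bdd α β (q *' m) (N.<⇒≤ b12)) (Z-mult m) (I-mult α β m m1 ab (N.<⇒≤ b12))))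


 t12≤T : ∀ n → 3 *' t12 n ≤' T4 n
 t12≤T = τ0-lo

 s-nonneg : ∀ n t → t ≤' T4 n → 0F ≤ im (zz n ^C t)
 s-nonneg n t l = Unit.s≥0 n t (λ j m → T4-pos n j (N.<-≤-trans m l))

 c-lower : ∀ n t → t ≤' T4 n → - re (zz n ^C t) ≤ ι 2ℚ * inv « suc n »
 c-lower n t l = go (t ℕ.≟ T4 n)
  where
   go : Dec (t ≡ T4 n) → - re (zz n ^C t) ≤ ι 2ℚ * inv « suc n »
   go (yes refl) = Quarter.cT-small n
   go (no ne) = tr≤ (≤≡ (neg-mono (pos⇒0≤ (T4-pos n t (N.≤∧≢⇒< l ne)))) (solve 0 (:- :0 := :0) refl)) (0≤* 2≥0 (inv≥0 («suc»-pos n)))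

 -- One or two quarter turns are split off, each of them close to multiplication by i. What is left
 -- is an angle within the first quarter turn, where the sine is nonnegative and the cosine at least
 -- -O(1/S).
 re-upper : ∀ r → q ≤' 4 *' r → 4 *' r ≤' 3 *' q → Σ ℕ λ m₀ → Σ F λ E → (0F ≤ E) × (∀ n → m₀ ≤' n → re (zz n ^C (12 *' τ n *' r)) ≤ E * inv « suc n »)
 re-upper r lo hi = go (d ℕ.≤? q)
  where
   d = 4 *' r ∸' q
   ed : q +' d ≡ 4 *' r
   ed = N.m+[n∸m]≡n lo
   d≤2q : d ≤' q +' q
   d≤2q = N.+-cancelˡ-≤ q _ _ (N.≤-trans (N.≤-reflexive ed) (N.≤-trans hi (N.≤-reflexive (cong (λ w → q +' (q +' w)) (N.+-identityʳ q)))))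
   split : ∀ n → zz n ^C (12 *' τ n *' r) ≡ zz n ^C (3 *' t12 n) *C zz n ^C (3 *' τ n *' d)
   split n = tr (cong (zz n ^C_) (tr (tr (solveN 2 (λ t r → con' 12 :*' t :*' r :=' con' 3 :*' t :*' (con' 4 :*' r)) refl (τ n) r) (cong (3 *' τ n *'_) (sym ed))) (tr (N.*-distribˡ-+ (3 *' τ n) q d) (cong (_+' 3 *' τ n *' d) (tr (solveN 2 (λ t q → con' 3 :*' t :*' q :=' con' 3 :*' (q :*' t)) refl (τ n) q) (cong (3 *'_) (sym (t12τ n)))))))) (^C-+ (zz n) (3 *' t12 n) (3 *' τ n *' d))
   le : ∀ n d → d ≤' q → 3 *' τ n *' d ≤' T4 n
   le n d h = N.≤-trans (N.*-monoʳ-≤ (3 *' τ n) h) (N.≤-trans (N.≤-reflexive (tr (solveN 2 (λ t q → con' 3 :*' t :*' q :=' con' 3 :*' (q :*' t)) refl (τ n) q) (cong (3 *'_) (sym (t12τ n))))) (t12≤T n))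
   re-iw : ∀ w → re (iC *C w) ≡ - im w
   re-iw w = solve 2 (λ a b → :0 :* a :- :1 :* b := :- b) refl (re w) (im w)
   re-iiw : ∀ w → re (iC *C (iC *C w)) ≡ - re w
   re-iiw w = solve 2 (λ a b → :0 :* (:0 :* a :- :1 :* b) :- :1 :* (:0 :* b :+ :1 :* a) := :- a) refl (re w) (im w)
   from : ∀ {a b : ℕ → ℂ} → a ≐ b → ∀ E → 0F ≤ E → (∀ n → re (b n) ≤ E * inv « suc n ») → Σ ℕ λ m₀ → Σ F λ E → (0F ≤ E) × (∀ n → m₀ ≤' n → re (a n) ≤ E * inv « suc n »)
   from {a} {b} p E h k = n₀ p , C p + E , 0≤+ (C≥0 p) h , (λ n l → ≡≤ (solve 2 (λ a b → a := (a :- b) :+ b) refl (re (a n)) (re (b n))) (≤≡ (+-mono (tr≤ (≤∣∣ _) (≐-re p n l)) (k n)) (sym (distribʳ _ (C p) E))))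
   go : Dec (d ≤' q) → _
   go (yes h) = from (≐-from split (λ _ → refl) (≐-* (Bdd-const iC) (Bdd-z (λ n → 3 *' τ n *' d)) zQ4≐i ≐-refl)) 0F ≤-refl (λ n → ≡≤ (re-iw _) (≤≡ (≤≡ (neg-mono (s-nonneg n _ (le n d h))) (solve 0 (:- :0 := :0) refl)) (sym (zeroˡ _))))
   go (no h) = from (≐-from split2 (λ _ → refl) (≐-* (Bdd-const iC) (Bdd-* (Bdd-z (λ n → 3 *' t12 n)) (Bdd-z (λ n → 3 *' τ n *' d')) ) zQ4≐i (≐-* (Bdd-const iC) (Bdd-z (λ n → 3 *' τ n *' d')) zQ4≐i ≐-refl))) (ι 2ℚ) 2≥0 (λ n → ≡≤ (re-iiw _) (c-lower n _ (le n d' d'≤q)))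
    where
     d' = d ∸' q
     ed' : q +' d' ≡ d
     ed' = N.m+[n∸m]≡n (N.<⇒≤ (N.≰⇒> h))
     d'≤q : d' ≤' q
     d'≤q = N.+-cancelˡ-≤ q _ _ (N.≤-trans (N.≤-reflexive ed') d≤2q)
     split2 : ∀ n → zz n ^C (12 *' τ n *' r) ≡ zz n ^C (3 *' t12 n) *C (zz n ^C (3 *' t12 n) *C zz n ^C (3 *' τ n *' d'))
     split2 n = tr (split n) (cong (zz n ^C (3 *' t12 n) *C_) (tr (cong (zz n ^C_) (tr (cong (3 *' τ n *'_) (sym ed')) (tr (N.*-distribˡ-+ (3 *' τ n) q d') (cong (_+' 3 *' τ n *' d') (tr (solveN 2 (λ t q → con' 3 :*' t :*' q :=' con' 3 :*' (q :*' t)) refl (τ n) q) (cong (3 *'_) (sym (t12τ n)))))))) (^C-+ (zz n) (3 *' t12 n) (3 *' τ n *' d'))))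

 nrm-1- : ∀ w → nrm w ≡ 1F → nrm (1C +C (-C w)) ≡ ι 2ℚ - ι 2ℚ * re w
 nrm-1- w u = tr (solve 2 (λ a b → (:1 :+ :- a) :* (:1 :+ :- a) :+ (:0 :+ :- b) :* (:0 :+ :- b) := :1 :+ (a :* a :+ b :* b) :- :2 :* a) refl (re w) (im w)) (tr (cong (λ t → 1F + t - ι 2ℚ * re w) u) (cong (_- ι 2ℚ * re w) (sym (ι-+ 1ℚ 1ℚ))))

 -- With s from `middle`, the real part of wˢ is at most a small error, so 1 ≤ |1 - wˢ|² ≤ s² |1 -
 -- w|² by the geometric sum.
 apart : ∀ k → ¬ (q ∣ k) → Σ ℕ λ m₀ → Σ F λ c → Pos c × (∀ n → m₀ ≤' n → c ≤ nrm (1C +C (-C (zz n ^C (12 *' τ n *' k)))))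
 apart k nd = build (middle q k q≥1 nd)
  where
   build : (Σ ℕ λ s → Σ ℕ λ a → Σ ℕ λ r → (1 ≤' s) × (s *' k ≡ a *' q +' r) × (q ≤' 4 *' r) × (4 *' r ≤' 3 *' q)) → _
   build (s , a , r , s1 , e , lo , hi) = fin (re-upper r lo hi)
    where
     w : ℕ → ℂ
     w n = zz n ^C (12 *' τ n *' k)
     ws≐ : (λ n → w n ^C s) ≐ (λ n → zz n ^C (12 *' τ n *' r))
     ws≐ = ≐-from eq (λ n → sym (*C-identityˡ _)) (≐-* (Bdd-const 1C) (Bdd-z (λ n → 12 *' τ n *' r)) (zQpow≐1 a) ≐-refl)
      where
       eq : ∀ n → w n ^C s ≡ zz n ^C (a *' Q n) *C zz n ^C (12 *' τ n *' r)
       eq n = tr (sym (^C-* (zz n) s (12 *' τ n *' k))) (tr (cong (zz n ^C_) (tr (tr (solveN 3 (λ s t k → s :*' (con' 12 :*' t :*' k) :=' con' 12 :*' t :*' (s :*' k)) refl s (τ n) k) (cong (12 *' τ n *'_) e)) (tr (solveN 4 (λ t a q r → con' 12 :*' t :*' (a :*' q :+' r) :=' a :*' (con' 12 :*' (q :*' t)) :+' con' 12 :*' t :*' r) refl (τ n) a q r) (cong (λ x → a *' (12 *' x) +' 12 *' τ n *' r) (sym (t12τ n)))))) (^C-+ (zz n) (a *' Q n) (12 *' τ n *' r)))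
     sp : Pos (« s » * « s »)
     sp = Pos-* («»-pos s1) («»-pos s1)
     fin : (Σ ℕ λ m₀ → Σ F λ E → (0F ≤ E) × (∀ n → m₀ ≤' n → re (zz n ^C (12 *' τ n *' r)) ≤ E * inv « suc n »)) → Σ ℕ λ m₀ → Σ F λ c → Pos c × (∀ n → m₀ ≤' n → c ≤ nrm (1C +C (-C (w n))))
     fin (m₁ , E , E0 , up) = (m₁ +' n₀ ws≐) +' fst ar , inv (« s » * « s ») , Pos-inv sp , low
      where
       E' = C ws≐ + E
       ar = arch (ι 2ℚ * E')
       low : ∀ n → (m₁ +' n₀ ws≐) +' fst ar ≤' n → inv (« s » * « s ») ≤ nrm (1C +C (-C (w n)))
       low n l = *-cancel-≤ (« s » * « s ») sp (≡≤ (*-inv sp) (tr≤ one (≡≤ (tr (cong nrm (sym (geom (w n) s))) (nrm-* _ _)) (≤≡ (*-monoˡ _ (nrm≥0 _) (nrm-geom (w n) s (zpow-unit (λ n → 12 *' τ n *' k) n))) (*-comm _ _)))))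
        where
         l1 = N.m+n≤o⇒m≤o (m₁ +' n₀ ws≐) l
         ln = N.m+n≤o⇒n≤o (m₁ +' n₀ ws≐) l
         rw : re (w n ^C s) ≤ E' * inv « suc n »
         rw = ≡≤ (solve 2 (λ a b → a := (a :- b) :+ b) refl (re (w n ^C s)) (re (zz n ^C (12 *' τ n *' r)))) (≤≡ (+-mono (tr≤ (≤∣∣ _) (≐-re ws≐ n (N.m+n≤o⇒n≤o m₁ l1))) (up n (N.m+n≤o⇒m≤o m₁ l1))) (sym (distribʳ _ (C ws≐) E)))
         small : ι 2ℚ * re (w n ^C s) ≤ 1F
         small = tr≤ (*-monoˡ (ι 2ℚ) 2≥0 rw) (≡≤ (sym (*-assoc _ _ _)) (≤≡ (*-monoʳ _ (inv≥0 («suc»-pos n)) (tr≤ (snd ar) («»-mono (N.≤-trans ln (N.n≤1+n n))))) (*-inv («suc»-pos n))))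
         one : 1F ≤ nrm (1C +C (-C (w n ^C s)))
         one = ≤≡ (≡≤ (tr (solve 0 (:1 := :2 :- :1) refl) refl) (+-mono ≤-refl (neg-mono small))) (sym (nrm-1- (w n ^C s) (nrm-^C (w n) (nrm-^C (zz n) (uu n) (12 *' τ n *' k)) s)))

 -- (1 - y) Z = 1 - y^q tends to 0, while |1 - y| is bounded below by `apart`.
 Z-null : ∀ k → ¬ (q ∣ k) → Z k ≐ (λ _ → 0C)
 Z-null k nd = build (apart k nd)
  where
   y : ℕ → ℂ
   y n = v k n ^C (12 *' τ n)
   yq : (λ n → y n ^C q) ≐ (λ _ → 1C)
   yq = ≐-from yq-eq (λ _ → sym conj1) (≐-conj (zQpow≐1 k))
    where
     yq-eq : ∀ n → y n ^C q ≡ conj (zz n ^C (k *' Q n))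
     yq-eq n = tr (cong (_^C q) (v12τ k n)) (tr (sym (conj-^C (zz n ^C (12 *' τ n *' k)) q)) (cong conj (tr (sym (^C-* (zz n) q (12 *' τ n *' k))) (cong (zz n ^C_) (tr (solveN 3 (λ q t k → q :*' (con' 12 :*' t :*' k) :=' k :*' (con' 12 :*' (q :*' t))) refl q (τ n) k) (cong (λ x → k *' (12 *' x)) (sym (t12τ n))))))))
   yu : ∀ n → nrm (y n) ≡ 1F
   yu n = nrm-^C (v k n) (v-unit k n) (12 *' τ n)
   nrm-y : ∀ n → nrm (1C +C (-C y n)) ≡ nrm (1C +C (-C (zz n ^C (12 *' τ n *' k))))
   nrm-y n = tr (cong nrm (tr (cong (λ x → 1C +C (-C x)) (v12τ k n)) (tr (cong (_+C (-C conj (zz n ^C (12 *' τ n *' k)))) (sym conj1)) (sym (conj-+ 1C (-C (zz n ^C (12 *' τ n *' k)))))))) (nrm-conj _)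
   build : (Σ ℕ λ m₀ → Σ F λ c → Pos c × (∀ n → m₀ ≤' n → c ≤ nrm (1C +C (-C (zz n ^C (12 *' τ n *' k)))))) → Z k ≐ (λ _ → 0C)
   build (m₀ , c , cp , low) = ≐-from-eventually m₀ form (≐-from (λ _ → refl) (λ _ → sym (zeroCʳ 1C)) (≐-trans (≐-*ˡ g gB (≐-from (λ _ → refl) (λ _ → solveC 0 (conC 0ℚ ≔ conC 1ℚ ∔ ⊝ conC 1ℚ) refl) (≐-+ (≐-refl {λ _ → 1C}) (≐-neg yq)))) (≐-≡ (λ n → tr (zeroCʳ (g n)) (sym (zeroCʳ 1C))))))
    where
     g : ℕ → ℂ
     g n = real (inv (nrm (1C +C (-C y n)))) *C conj (1C +C (-C y n))
     np : ∀ n → m₀ ≤' n → Pos (nrm (1C +C (-C y n)))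
     np n l = Pos-≤ cp (≤≡ (low n l) (sym (nrm-y n)))
     gB : Bdd g
     gB = Bdd-* (mkB m₀ (inv c) (inv≥0 cp) (λ n l → ≡≤ (N1-real (inv≥0 (np n l))) (inv-anti cp (≤≡ (low n l) (sym (nrm-y n)))))) (Bdd-+' n)
      where
       n = 0
       inv-anti : ∀ {a b} → Pos a → a ≤ b → inv b ≤ inv a
       inv-anti {a} {b} pa h = *-cancel-≤ a pa (≤≡ (*-monoʳ (inv b) (inv≥0 (Pos-≤ pa h)) h) (tr (*-inv (Pos-≤ pa h)) (sym (*-inv pa))))
       Bdd-+' : ℕ → Bdd (λ n → conj (1C +C (-C y n)))
       Bdd-+' _ = mkB 0 (N1 1C + ι 2ℚ) (0≤+ (N1≥0 1C) 2≥0) (λ n _ → ≡≤ (N1-conj _) (tr≤ (N1-+ _ _) (+-mono ≤-refl (≡≤ (N1-neg _) (N1≤2 (≡⇒≤ (yu n)))))))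
     form : ∀ n → m₀ ≤' n → Z k n ≡ g n *C (1C +C (-C (y n ^C q)))
     form n l = sym (tr (cong (g n *C_) (sym (geom (y n) q))) (tr (solveC 4 (λ r c a s → (r ⨯ c) ⨯ (a ⨯ s) ≔ (r ⨯ (a ⨯ c)) ⨯ s) refl (real (inv (nrm (1C +C (-C y n))))) (conj (1C +C (-C y n))) (1C +C (-C y n)) (Z k n)) (tr (cong (_*C Z k n) (tr (cong (real (inv (nrm (1C +C (-C y n)))) *C_) (*C-conj (1C +C (-C y n)))) (tr (sym (real-* _ _)) (cong real (tr (*-comm _ _) (*-inv (np n l))))))) (*C-identityˡ _))))

 Av-null : ∀ α β k → ¬ (q ∣ k) → α ≤' β → β <' 12 → Av α β k ≐ (λ _ → 0C)
 Av-null α β k nd ab b12 = ≐-from-eventually N₀ (λ n h → tr (Av-eq α β k n ab b12 h) (*C-comm _ _)) (≐-trans (≐-*ˡ (I α β k) (I-Bdd α β k (N.<⇒≤ b12)) (Z-null k nd)) (≐-≡ (λ n → zeroCʳ _)))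

-- The arithmetic kernel and its dilates.

sel : {q k : ℕ} → Dec (q ∣ k) → (ℕ → F) → F
sel (yes (divides m _)) f = f m
sel (no _) f = 0F

opaque
 -- f (k / q), or 0 when q does not divide k
 at : ℕ → ℕ → (ℕ → F) → F
 at q k f = sel (q ∣? k) f

 at-mult : ∀ q m f → 1 ≤' q → at q (q *' m) f ≡ f m
 at-mult q m f q1 = go (q ∣? (q *' m))
  where
   go : (d : Dec (q ∣ q *' m)) → sel d f ≡ f m
   go (yes (divides m' e)) = cong f (N.*-cancelˡ-≡ m' m q {{ℕ.>-nonZero q1}} (tr (N.*-comm q m') (sym e)))
   go (no nd) = ⊥-elim (nd (divides m (N.*-comm q m)))

 at-null : ∀ q k f → ¬ (q ∣ k) → at q k f ≡ 0F
 at-null q k f nd = go (q ∣? k)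
  where
   go : (d : Dec (q ∣ k)) → sel d f ≡ 0F
   go (yes d) = ⊥-elim (nd d)
   go (no _) = refl

data At (q k : ℕ) : Set where
 mult : ∀ m → k ≡ q *' m → At q k
 null : ¬ (q ∣ k) → At q k

at? : ∀ q k → At q k
at? q k = go (q ∣? k)
 where
  go : Dec (q ∣ k) → At q k
  go (yes (divides m e)) = mult m (tr e (N.*-comm m q))
  go (no nd) = null nd

-- Booleans encode signs and `⊙` multiplies them. A kernel with sign `false` at m is to be read as
-- its value at -m, so that all arguments stay in ℕ.
sgq : Bool → ℚ
sgq true = 1ℚ
sgq false = ℚ.- 1ℚ

sg : Bool → F
sg σ = ι (sgq σ)

_⊙_ : Bool → Bool → Bool
true ⊙ b = b
false ⊙ b = not b

-- bt true is the odd-residue function 1 ↦ 1, 5 ↦ -1 modulo 12, and bt false n stands for - bt true (- n)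
bt : Bool → ℕ → ℚ
bt true 1 = 1ℚ
bt true 5 = ℚ.- 1ℚ
bt false 7 = 1ℚ
bt false 11 = ℚ.- 1ℚ
bt _ _ = 0ℚ

b0 : Bool → ℕ → F
b0 σ m = ι (bt σ (m % 12)) * inv « m »

-- Besides n ≡ 1 mod 4 the doubles 2n survive as well, with the value at n; hence the two spikes, at
-- 1 and 2, in `KT-bound`.
k0 : Bool → ℕ → F
k0 σ m = b0 σ m + at 2 m (b0 σ)

Xv Yv : ℕ → F
Xv m = ι (χt (m % 12)) * inv « m »
Yv m = ι (ψt (m % 12)) * inv « m »

red12 : ∀ c n → (c *' n) % 12 ≡ (c *' (n % 12)) % 12
red12 c n = tr (%-distribˡ-* c n 12) (tr (cong (λ w → ((c % 12) *' w) % 12) (sym (m%n%n≡m%n n 12))) (sym (%-distribˡ-* c (n % 12) 12)))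

inv-2* : ∀ r → 1 ≤' r → ∀ c → 1 ≤' c → inv « r » ≡ « c » * inv « c *' r »
inv-2* r r1 c c1 = sym (tr (sym (*1 _)) (tr (cong (« c » * inv « c *' r » *_) (sym (*-inv («»-pos r1)))) (tr (solve 4 (λ a b c d → (a :* b) :* (c :* d) := ((a :* c) :* b) :* d) refl « c » (inv « c *' r ») « r » (inv « r »)) (tr (cong (λ w → (w * inv « c *' r ») * inv « r ») (sym («*» c r))) (tr (cong (_* inv « r ») (*-inv («»-pos (N.*-mono-≤ {1} {c} {1} {r} c1 r1)))) (1* _))))))

private
 dbl : ℕ → ℕ
 dbl r = (2 *' r) % 12

 odd : ℕ → ℕ
 odd r = (1 +' 2 *' r) % 12

 even-id : ∀ σ r → sgq σ ℚ.* (χt (dbl (r % 12)) ℚ.+ 2ℚ ℚ.* χt (r % 12)) ℚ.+ (ψt (dbl (dbl (r % 12))) ℚ.+ ψt (dbl (r % 12))) ≡ 2ℚ ℚ.* (bt σ (dbl (r % 12)) ℚ.+ 2ℚ ℚ.* bt σ (r % 12))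
 even-id true = case12 (λ r → sgq true ℚ.* (χt (dbl r) ℚ.+ 2ℚ ℚ.* χt r) ℚ.+ (ψt (dbl (dbl r)) ℚ.+ ψt (dbl r)) ≡ 2ℚ ℚ.* (bt true (dbl r) ℚ.+ 2ℚ ℚ.* bt true r)) refl refl refl refl refl refl refl refl refl refl refl refl
 even-id false = case12 (λ r → sgq false ℚ.* (χt (dbl r) ℚ.+ 2ℚ ℚ.* χt r) ℚ.+ (ψt (dbl (dbl r)) ℚ.+ ψt (dbl r)) ≡ 2ℚ ℚ.* (bt false (dbl r) ℚ.+ 2ℚ ℚ.* bt false r)) refl refl refl refl refl refl refl refl refl refl refl refl

 odd-id : ∀ σ r → sgq σ ℚ.* χt (odd (r % 12)) ℚ.+ (ψt (dbl (odd (r % 12))) ℚ.+ ψt (odd (r % 12))) ≡ 2ℚ ℚ.* bt σ (odd (r % 12))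
 odd-id true = case12 (λ r → sgq true ℚ.* χt (odd r) ℚ.+ (ψt (dbl (odd r)) ℚ.+ ψt (odd r)) ≡ 2ℚ ℚ.* bt true (odd r)) refl refl refl refl refl refl refl refl refl refl refl refl
 odd-id false = case12 (λ r → sgq false ℚ.* χt (odd r) ℚ.+ (ψt (dbl (odd r)) ℚ.+ ψt (odd r)) ≡ 2ℚ ℚ.* bt false (odd r)) refl refl refl refl refl refl refl refl refl refl refl refl

 odd-ψ : ∀ r → ψt (odd (r % 12)) ≡ 0ℚ
 odd-ψ = case12 (λ r → ψt (odd r) ≡ 0ℚ) refl refl refl refl refl refl refl refl refl refl refl refl

 odd-red : ∀ r → (1 +' 2 *' r) % 12 ≡ odd (r % 12)
 odd-red r = tr (%-distribˡ-+ 1 (2 *' r) 12) (tr (cong (λ w → (1 +' w) % 12) (red12 2 r)) (sym (%-distribˡ-+ 1 (2 *' (r % 12)) 12)))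

data Parity : ℕ → Set where
 evn : ∀ r → Parity (2 *' r)
 od : ∀ r → Parity (1 +' 2 *' r)

parity : ∀ n → Parity n
parity zero = evn 0
parity (suc n) = go n (parity n)
 where
  go : ∀ n → Parity n → Parity (suc n)
  go _ (evn r) = od r
  go _ (od r) = subst Parity (solveN 1 (λ r → con' 2 :*' (con' 1 :+' r) :=' con' 2 :+' con' 2 :*' r) refl r) (evn (1 +' r))

2∤odd : ∀ r → ¬ (2 ∣ 1 +' 2 *' r)
2∤odd r (divides m e) = N.even≢odd m r (tr (N.*-comm 2 m) (sym e))

∣-cancelˡ : ∀ q {a b} → 1 ≤' q → q *' a ∣ q *' b → a ∣ b
∣-cancelˡ q q1 = Dv.*-cancelˡ-∣ q {{ℕ.>-nonZero q1}}

k0-odd : ∀ σ r → k0 σ (1 +' 2 *' r) ≡ b0 σ (1 +' 2 *' r)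
k0-odd σ r = tr (cong (b0 σ (1 +' 2 *' r) +_) (at-null 2 _ (b0 σ) (2∤odd r))) (+0 _)

k0-even : ∀ σ r → k0 σ (2 *' r) ≡ b0 σ (2 *' r) + b0 σ r
k0-even σ r = cong (b0 σ (2 *' r) +_) (at-mult 2 r (b0 σ) (s≤s z≤n))

-- On odd n, ψ(2n) is the character χ₃ modulo 3 and χ₁₂ is χ₃ times the character χ₄ modulo 4. So
-- ψ(2n) ± χ₁₂(n) is twice χ₃ on one class modulo 4, which is why the frequency is doubled. On n
-- divisible by 4 the two ψ terms cancel.
kernel : Bool → ℕ → ℕ → F
kernel σ q k = sg σ * (at (2 *' q) (2 *' k) Xv + at (4 *' q) (2 *' k) Xv) + (ι 2ℚ * at q (2 *' k) Yv + at (2 *' q) (2 *' k) Yv)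

kernel-id : ∀ σ q k → 1 ≤' q → 1 ≤' k → kernel σ q k ≡ ι 2ℚ * at q k (k0 σ)
kernel-id σ q k q1 k1 = go k (at? q k) k1
 where
  2q1 : 1 ≤' 2 *' q
  2q1 = N.≤-trans q1 (N.m≤n*m q 2)
  4q : 4 *' q ≡ 2 *' (2 *' q)
  4q = N.*-assoc 2 2 q
  combine : ∀ {x1 x2 y1 y2 r} k → at (2 *' q) (2 *' k) Xv ≡ x1 → at (4 *' q) (2 *' k) Xv ≡ x2 → at q (2 *' k) Yv ≡ y1 → at (2 *' q) (2 *' k) Yv ≡ y2 → at q k (k0 σ) ≡ r →
   sg σ * (x1 + x2) + (ι 2ℚ * y1 + y2) ≡ ι 2ℚ * r → kernel σ q k ≡ ι 2ℚ * at q k (k0 σ)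
  combine k refl refl refl refl refl e = e
  go : ∀ k → At q k → 1 ≤' k → kernel σ q k ≡ ι 2ℚ * at q k (k0 σ)
  go k (null nd) _ = combine k (at-null _ _ Xv n2) (at-null _ _ Xv (λ d → nd (Dv.∣-trans (Dv.n∣m*n 2) (∣-cancelˡ 2 (s≤s z≤n) (subst (_∣ 2 *' k) 4q d))))) (yz (at? q (2 *' k))) (at-null _ _ Yv n2) (at-null _ _ (k0 σ) nd)
   (solve 1 (λ s → s :* (:0 :+ :0) :+ (:2 :* :0 :+ :0) := :2 :* :0) refl (sg σ))
   where
    n2 : ¬ (2 *' q ∣ 2 *' k)
    n2 d = nd (∣-cancelˡ 2 (s≤s z≤n) d)
    yz : At q (2 *' k) → at q (2 *' k) Yv ≡ 0F
    yz (null nd') = at-null _ _ Yv nd'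
    yz (mult m e) = tr (cong (λ w → at q w Yv) e) (tr (at-mult q m Yv q1) (par m (parity m) e))
     where
      par : ∀ m → Parity m → 2 *' k ≡ q *' m → Yv m ≡ 0F
      par _ (evn r) e = ⊥-elim (nd (divides r (N.*-cancelˡ-≡ k (r *' q) 2 (tr e (solveN 2 (λ q r → q :*' (con' 2 :*' r) :=' con' 2 :*' (r :*' q)) refl q r)))))
      par _ (od r) _ = tr (cong (_* inv « 1 +' 2 *' r ») (tr (cong (λ w → ι (ψt w)) (odd-red r)) (cong ι (odd-ψ r)))) (zeroˡ _)
  go _ (mult m₀ refl) k1 = fin m₀ (parity m₀) k1
   where
    e2 : ∀ m → 2 *' (q *' m) ≡ (2 *' q) *' m
    e2 m = sym (N.*-assoc 2 q m)
    ey : ∀ m → 2 *' (q *' m) ≡ q *' (2 *' m)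
    ey m = solveN 2 (λ q m → con' 2 :*' (q :*' m) :=' q :*' (con' 2 :*' m)) refl q m
    x1 : ∀ m f → at (2 *' q) (2 *' (q *' m)) f ≡ f m
    x1 m f = tr (cong (λ w → at (2 *' q) w f) (e2 m)) (at-mult (2 *' q) m f 2q1)
    y1 : ∀ m → at q (2 *' (q *' m)) Yv ≡ Yv (2 *' m)
    y1 m = tr (cong (λ w → at q w Yv) (ey m)) (at-mult q (2 *' m) Yv q1)
    fin : ∀ m → Parity m → 1 ≤' q *' m → kernel σ q (q *' m) ≡ ι 2ℚ * at q (q *' m) (k0 σ)
    fin _ (od r) _ = combine (q *' m) (x1 m Xv) (at-null _ _ Xv (λ d → 2∤odd r (∣-cancelˡ (2 *' q) 2q1 (subst₂ _∣_ (tr 4q (tr (N.*-comm 2 (2 *' q)) refl)) (e2 m) d)))) (y1 m) (x1 m Yv) (tr (at-mult q m (k0 σ) q1) (k0-odd σ r))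
     (tr (cong (λ w → sg σ * (Xv m + 0F) + (ι 2ℚ * (ι (ψt ((2 *' m) % 12)) * w) + Yv m)) refl)
      (tr (cong (λ w → sg σ * (Xv m + 0F) + (ι 2ℚ * (ι (ψt w) * inv « 2 *' m ») + Yv m)) (red12 2 m))
      (tr (alg (ι (χt (m % 12))) (ι (ψt (dbl (m % 12)))) (ι (ψt (m % 12))) (inv « m ») (inv « 2 *' m ») (inv-2* m (s≤s z≤n) 2 (s≤s z≤n)))
       (tr (cong (_* inv « m ») (tr (sym (tr (ι-+ _ _) (cong2 _+_ (ι-* _ _) (ι-+ _ _)))) (tr (cong ι (subst (λ o → sgq σ ℚ.* χt o ℚ.+ (ψt (dbl o) ℚ.+ ψt o) ≡ 2ℚ ℚ.* bt σ o) (sym (odd-red r)) (odd-id σ r))) (ι-* _ _)))) (*-assoc _ _ _)))))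
     where
      m = 1 +' 2 *' r
      alg : ∀ x y y' i j → i ≡ « 2 » * j → sg σ * (x * i + 0F) + (ι 2ℚ * (y * j) + y' * i) ≡ (sg σ * x + (y + y')) * i
      alg x y y' i j e = tr (cong (λ w → sg σ * (x * w + 0F) + (ι 2ℚ * (y * j) + y' * w)) e) (tr (cong (λ w → sg σ * (x * (w * j) + 0F) + (ι 2ℚ * (y * j) + y' * (w * j))) two) (tr (solve 5 (λ s x y y' j → s :* (x :* (:2 :* j) :+ :0) :+ (:2 :* (y :* j) :+ y' :* (:2 :* j)) := (s :* x :+ (y :+ y')) :* (:2 :* j)) refl (sg σ) x y y' j) (cong ((sg σ * x + (y + y')) *_) (sym (tr e (cong (_* j) two))))))
       where
        two : « 2 » ≡ ι 2ℚ
        two = «»-ι 2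
    fin _ (evn r) k1 = combine (q *' m) (x1 m Xv) (tr (cong2 (λ u w → at u w Xv) 4q (tr (e2 m) (solveN 2 (λ q r → (con' 2 :*' q) :*' (con' 2 :*' r) :=' (con' 2 :*' (con' 2 :*' q)) :*' r) refl q r))) (at-mult (2 *' (2 *' q)) r Xv (N.≤-trans 2q1 (N.m≤n*m (2 *' q) 2)))) (y1 m) (x1 m Yv) (tr (at-mult q m (k0 σ) q1) (k0-even σ r))
     (tr (cong2 (λ u w → sg σ * (ι (χt u) * inv « m » + Xv r) + (ι 2ℚ * (ι (ψt w) * inv « 2 *' m ») + ι (ψt u) * inv « m »)) (red12 2 r) (tr (red12 2 m) (cong dbl (red12 2 r))))
      (tr (alg (ι (χt (dbl c))) (ι (χt c)) (ι (ψt (dbl (dbl c)))) (ι (ψt (dbl c))) (inv « r ») (inv « m ») (inv « 2 *' m ») (tr (inv-2* r r1 2 (s≤s z≤n)) (cong (_* inv « m ») two)) (tr (inv-2* m m1 2 (s≤s z≤n)) (cong (_* inv « 2 *' m ») two)))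
       (tr (cong (_* inv « m ») (tr (cong2 (λ u w → sg σ * u + w) (tr (cong (ι (χt (dbl c)) +_) (sym (ι-* 2ℚ (χt c)))) (sym (ι-+ (χt (dbl c)) (2ℚ ℚ.* χt c)))) (sym (ι-+ (ψt (dbl (dbl c))) (ψt (dbl c))))) (tr (sym (tr (ι-+ (sgq σ ℚ.* (χt (dbl c) ℚ.+ 2ℚ ℚ.* χt c)) (ψt (dbl (dbl c)) ℚ.+ ψt (dbl c))) (cong (_+ ι (ψt (dbl (dbl c)) ℚ.+ ψt (dbl c))) (ι-* (sgq σ) (χt (dbl c) ℚ.+ 2ℚ ℚ.* χt c))))) (tr (cong ι (even-id σ r)) (tr (ι-* 2ℚ (bt σ (dbl c) ℚ.+ 2ℚ ℚ.* bt σ c)) (cong (ι 2ℚ *_) (tr (ι-+ (bt σ (dbl c)) (2ℚ ℚ.* bt σ c)) (cong (ι (bt σ (dbl c)) +_) (ι-* 2ℚ (bt σ c))))))))))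
        (tr (solve 3 (λ b d j → (:2 :* (b :+ :2 :* d)) :* j := :2 :* (b :* j :+ d :* (:2 :* j))) refl (ι (bt σ (dbl c))) (ι (bt σ c)) (inv « m »)) (cong2 (λ u w → ι 2ℚ * (ι (bt σ u) * inv « m » + ι (bt σ c) * w)) (sym (red12 2 r)) (sym (tr (inv-2* r r1 2 (s≤s z≤n)) (cong (_* inv « m ») two))))))))
     where
      m = 2 *' r
      c = r % 12
      two : « 2 » ≡ ι 2ℚ
      two = «»-ι 2
      r1 : 1 ≤' r
      r1 = rr r k1
       where
        rr : ∀ r → 1 ≤' q *' (2 *' r) → 1 ≤' r
        rr zero l = ⊥-elim (N.<⇒≱ l (N.≤-reflexive (N.*-zeroʳ q)))
        rr (suc r) _ = s≤s z≤n
      m1 : 1 ≤' m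
      m1 = N.≤-trans r1 (N.m≤n*m r 2)
      alg : ∀ x x' y y' h i j → h ≡ ι 2ℚ * i → i ≡ ι 2ℚ * j → sg σ * (x * i + x' * h) + (ι 2ℚ * (y * j) + y' * i) ≡ (sg σ * (x + ι 2ℚ * x') + (y + y')) * i
      alg x x' y y' _ _ j refl refl = solve 6 (λ s x x' y y' j → s :* (x :* (:2 :* j) :+ x' :* (:2 :* (:2 :* j))) :+ (:2 :* (y :* j) :+ y' :* (:2 :* j)) := (s :* (x :+ :2 :* x') :+ (y :+ y')) :* (:2 :* j)) refl (sg σ) x x' y y' j

-- The complex weight and its coefficients.

q23 q13 : ℚ
q23 = pos 2 ℚ./ 3
q13 = pos 1 ℚ./ 3

hp hm : ℕ → ℕ → F
hp Q y = Ind 1 5 Q (md y Q)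
hm Q y = Ind 7 11 Q (md y Q)

du dg : ℕ → ℕ → F
du Q y = hp Q y - hm Q y
dg Q y = hp Q y + hm Q y - ι q23

-- The coefficients of the odd part `du` are imaginary; placed in the imaginary part they become
-- real and add to those of the even part `dg`, giving `kernel`. The sign `false` conjugates the
-- weight, which amounts to replacing x by -x.
wfun : Bool → ℕ → ℕ → ℕ → ℂ
wfun σ Q q x = (- (ι 2ℚ * dg Q (q *' x) + dg Q (2 *' q *' x))) ⊹ (sg σ * (du Q (2 *' q *' x) + du Q (4 *' q *' x)))

Ech : Bool → ℂ → ℕ → ℂ
Ech true z t = conj z ^C t
Ech false z t = z ^C t

module Avgs (l' : ℕ) where
 open Roots l' public

 Avg : ℕ → (ℕ → ℂ) → ℂ
 Avg n f = real (inv « Q n ») *C ∑C (rng (Q n)) f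

 Avg-cong : ∀ n {f g} → (∀ x → f x ≡ g x) → Avg n f ≡ Avg n g
 Avg-cong n h = cong (real (inv « Q n ») *C_) (∑C-cong (rng (Q n)) h)

 Avg-+ : ∀ n f g → Avg n (λ x → f x +C g x) ≡ Avg n f +C Avg n g
 Avg-+ n f g = tr (cong (real (inv « Q n ») *C_) (∑C-+ (rng (Q n)) f g)) (solveC 3 (λ a b c → a ⨯ (b ∔ c) ≔ a ⨯ b ∔ a ⨯ c) refl (real (inv « Q n »)) (∑C (rng (Q n)) f) (∑C (rng (Q n)) g))

 Avg-* : ∀ n c f → Avg n (λ x → c *C f x) ≡ c *C Avg n f
 Avg-* n c f = tr (cong (real (inv « Q n ») *C_) (∑C-* (rng (Q n)) c f)) (solveC 3 (λ a b c → a ⨯ (b ⨯ c) ≔ b ⨯ (a ⨯ c)) refl (real (inv « Q n »)) c (∑C (rng (Q n)) f))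

 Avg-∑ : {A : Set} (xs : List A) → ∀ n (f : A → ℕ → ℂ) → Avg n (λ x → ∑C xs (λ a → f a x)) ≡ ∑C xs (λ a → Avg n (f a))
 Avg-∑ xs n f = tr (cong (real (inv « Q n ») *C_) (∑C-swap (rng (Q n)) xs (λ x a → f a x))) (sym (∑C-* xs (real (inv « Q n »)) _))

 Avg-conj : ∀ n f → conj (Avg n f) ≡ Avg n (λ x → conj (f x))
 Avg-conj n f = tr (conj-* _ _) (cong2 _*C_ (conj-real _) (∑C-conj (rng (Q n)) f))

 κ s0 : ℕ → F
 κ n = « suc n » * inv (ι 2ℚ * « Q n »)
 s0 n = κ n * (ι q4' * ρ n)

 hat : (ℕ → ℕ → F) → Bool → ℕ → ℕ → ℂ
 hat r τ j n = Avg n (λ x → real (r n x) *C Ech τ (zz n) (j *' x))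

 hat-false : ∀ r j n → hat r false j n ≡ conj (hat r true j n)
 hat-false r j n = sym (tr (Avg-conj n _) (Avg-cong n (λ x → tr (conj-* _ _) (cong2 _*C_ (conj-real _) (tr (conj-^C (conj (zz n)) (j *' x)) (cong (_^C (j *' x)) (conj-conj (zz n))))))))

 module One (q m' : ℕ) (q≥1 : 1 ≤' q) (el : suc l' ≡ q *' m') where
  private
   e1 : suc l' ≡ 1 *' suc l'
   e1 = sym (N.*-identityˡ (suc l'))
   K-Av = Coef.Av l' q m' q≥1 el
   K-Av-mult = Coef.Av-mult l' q m' q≥1 el
   K-Av-null = Coef.Av-null l' q m' q≥1 el
   K-Qpos = Coef.Qpos l' q m' q≥1 el
   K-t12τ = Coef.t12τ l' q m' q≥1 el
   K-tb = Coef.tb l' q m' q≥1 el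
   K-κ = Coef.κ l' q m' q≥1 el
   K-τ = Coef.τ l' q m' q≥1 el
   K-τ≥1 = Coef.τ≥1 l' q m' q≥1 el
   K₁-I = Coef.I l' 1 (suc l') (s≤s z≤n) e1
   K₁-I-mult = Coef.I-mult l' 1 (suc l') (s≤s z≤n) e1
   K₁-v = Coef.v l' 1 (suc l') (s≤s z≤n) e1
   K₁-v-unit = Coef.v-unit l' 1 (suc l') (s≤s z≤n) e1
   K₁-κ = Coef.κ l' 1 (suc l') (s≤s z≤n) e1
   K₁-τ = Coef.τ l' 1 (suc l') (s≤s z≤n) e1

  u g : ℕ → ℕ → F
  u n x = du (Q n) (q *' x)
  g n x = dg (Q n) (q *' x)

  -- The full turn is treated as an arc with endpoints 0 and 12, where the table takes the same
  -- value.
  one-null : ∀ j → 1 ≤' j → (λ n → Avg n (λ x → conj (zz n) ^C (j *' x))) ≐ (λ _ → 0C)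
  one-null j j1 = ≐-from (λ n → back n) (λ n → sym (zeroCʳ (conj (K₁-v j n)))) (≐-*ˡ (λ n → conj (K₁-v j n)) (Bdd-unit (λ n → ≡⇒≤ (tr (nrm-conj _) (K₁-v-unit j n)))) J0)
   where
    J0 : K₁-I 0 12 j ≐ (λ _ → 0C)
    J0 = subst (λ w → K₁-I 0 12 w ≐ (λ _ → 0C)) (N.*-identityˡ j) (≐-trans (K₁-I-mult 0 12 j j1 z≤n N.≤-refl) (≐-≡ (λ n → tr (cong (λ w → (0F ⊹ (- inv « 1 *' j »)) *C (real (K₁-κ n) *C w)) (tr (cong (λ w → conj (tbl (ρ n) 0) +C (-C conj (tbl (ρ n) w))) (tr (cong (_% 12) (N.*-comm 12 j)) (m*n%n≡0 j 12))) (solveC 1 (λ a → a ∔ ⊝ a ≔ conC 0ℚ) refl (conj (tbl (ρ n) 0))))) (tr (cong ((0F ⊹ (- inv « 1 *' j »)) *C_) (zeroCʳ _)) (zeroCʳ _)))))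
    back : ∀ n → Avg n (λ x → conj (zz n) ^C (j *' x)) ≡ conj (K₁-v j n) *C K₁-I 0 12 j n
    back n = tr (cong (real (inv « Q n ») *C_) (∑C-cong (rng (Q n)) (λ x → tr (cong (conj (zz n) ^C_) (N.*-comm j x)) (^C-* (conj (zz n)) x j))))
     (sym (tr (solveC 4 (λ a b c d → a ⨯ (b ⨯ (c ⨯ d)) ≔ b ⨯ ((a ⨯ c) ⨯ d)) refl (conj (K₁-v j n)) (real (inv « Q n »)) (K₁-v j n ^C 1) (∑C (rng (12 *' K₁-τ n)) (λ y → K₁-v j n ^C y)))
      (cong (real (inv « Q n ») *C_) (tr (cong2 _*C_ (tr (cong (conj (K₁-v j n) *C_) (*C-identityʳ' (K₁-v j n))) (tr (*C-comm _ _) (tr (*C-conj (K₁-v j n)) (cong real (K₁-v-unit j n))))) refl) (*C-identityˡ _)))))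
     where
      *C-identityʳ' : ∀ a → a ^C 1 ≡ a
      *C-identityʳ' a = tr (*C-comm _ _) (*C-identityˡ a)

  split-u : ∀ j n → hat u true j n ≡ K-Av 1 5 j n +C (-C K-Av 7 11 j n)
  split-u j n = tr (Avg-cong n (λ x → tr (cong (_*C (conj (zz n) ^C (j *' x))) (tr (real-+ _ _) (cong (real (hp (Q n) (q *' x)) +C_) refl))) (solveC 3 (λ a b e → (a ∔ b) ⨯ e ≔ a ⨯ e ∔ b ⨯ e) refl (real (hp (Q n) (q *' x))) (real (- hm (Q n) (q *' x))) (conj (zz n) ^C (j *' x)))))
   (tr (Avg-+ n _ _) (cong (K-Av 1 5 j n +C_) (tr (Avg-cong n (λ x → tr (cong (_*C (conj (zz n) ^C (j *' x))) (rneg (hm (Q n) (q *' x)))) (solveC 2 (λ a e → (⊝ a) ⨯ e ≔ (⊝ conC 1ℚ) ⨯ (a ⨯ e)) refl (real (hm (Q n) (q *' x))) (conj (zz n) ^C (j *' x))))) (tr (Avg-* n (-C 1C) _) (solveC 1 (λ a → (⊝ conC 1ℚ) ⨯ a ≔ ⊝ a) refl (K-Av 7 11 j n))))))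
   where
    rneg : ∀ r → real (- r) ≡ -C real r
    rneg r = cong2 _⊹_ refl (solve 0 (:0 := :- :0) refl)

  split-g : ∀ j n → hat g true j n ≡ (K-Av 1 5 j n +C K-Av 7 11 j n) +C real (- ι q23) *C Avg n (λ x → conj (zz n) ^C (j *' x))
  split-g j n = tr (Avg-cong n (λ x → tr (cong (_*C (conj (zz n) ^C (j *' x))) (tr (real-+ _ _) (cong (_+C real (- ι q23)) (real-+ _ _)))) (solveC 4 (λ a b c e → ((a ∔ b) ∔ c) ⨯ e ≔ (a ⨯ e ∔ b ⨯ e) ∔ c ⨯ e) refl (real (hp (Q n) (q *' x))) (real (hm (Q n) (q *' x))) (real (- ι q23)) (conj (zz n) ^C (j *' x)))))
   (tr (Avg-+ n _ _) (cong2 _+C_ (Avg-+ n _ _) (Avg-* n (real (- ι q23)) _)))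

  tbU : ∀ m n → K-tb 1 5 m n +C (-C K-tb 7 11 m n) ≡ real (ι q4' * ρ n * ι (χt (m % 12)))
  tbU m n = tr (cong (λ w → (conj (tbl (ρ n) (w % 12)) +C (-C conj (tbl (ρ n) ((5 *' m) % 12)))) +C (-C K-tb 7 11 m n)) (N.*-identityˡ m)) (tr (sym (tr (conj-+ _ _) (cong2 _+C_ (tr (conj-+ _ _) (cong (conj (tbl (ρ n) (m % 12)) +C_) (conj-neg _))) (tr (conj-neg _) (cong -C_ (tr (conj-+ _ _) (cong (conj (tbl (ρ n) ((7 *' m) % 12)) +C_) (conj-neg _)))))))) (tr (cong conj (tU-val (ρ n) m)) (conj-real _)))

  tbG : ∀ m n → K-tb 1 5 m n +C K-tb 7 11 m n ≡ 0F ⊹ (- (ι q4' * ρ n * ι (ψt (m % 12))))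
  tbG m n = tr (cong (λ w → (conj (tbl (ρ n) (w % 12)) +C (-C conj (tbl (ρ n) ((5 *' m) % 12)))) +C (K-tb 7 11 m n)) (N.*-identityˡ m)) (tr (sym (tr (conj-+ _ _) (cong2 _+C_ (tr (conj-+ _ _) (cong (conj (tbl (ρ n) (m % 12)) +C_) (conj-neg _))) (tr (conj-+ _ _) (cong (conj (tbl (ρ n) ((7 *' m) % 12)) +C_) (conj-neg _)))))) (cong conj (tG-val (ρ n) m)))

  5≤ : 5 <' 12
  5≤ = from-yes (5 ℕ.<? 12)
  11≤ : 11 <' 12
  11≤ = from-yes (11 ℕ.<? 12)
  15≤ : 1 ≤' 5
  15≤ = from-yes (1 ℕ.≤? 5)
  711≤ : 7 ≤' 11
  711≤ = from-yes (7 ℕ.≤? 11)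

  û : ∀ j → 1 ≤' j → hat u true j ≐ (λ n → 0F ⊹ (- (s0 n * at q j Xv)))
  û j j1 = ≐-from (split-u j) (λ _ → refl) (go j (at? q j) j1)
   where
    go : ∀ j → At q j → 1 ≤' j → (λ n → K-Av 1 5 j n +C (-C K-Av 7 11 j n)) ≐ (λ n → 0F ⊹ (- (s0 n * at q j Xv)))
    go j (null nd) _ = ≐-trans (≐-+ (K-Av-null 1 5 j nd 15≤ 5≤) (≐-neg (K-Av-null 7 11 j nd 711≤ 11≤))) (≐-≡ (λ n → tr (solveC 0 (conC 0ℚ ∔ ⊝ conC 0ℚ ≔ conC 0ℚ) refl) (cong (0F ⊹_) (tr (solve 1 (λ s → :0 := :- (s :* :0)) refl (s0 n)) (cong (λ w → - (s0 n * w)) (sym (at-null q j Xv nd)))))))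
    go _ (mult m refl) j1 = ≐-trans (≐-+ (K-Av-mult 1 5 m m1 15≤ 5≤) (≐-neg (K-Av-mult 7 11 m m1 711≤ 11≤)))
     (≐-≡ (λ n → tr (solveC 4 (λ a k x y → a ⨯ (k ⨯ x) ∔ ⊝ (a ⨯ (k ⨯ y)) ≔ a ⨯ (k ⨯ (x ∔ ⊝ y))) refl (0F ⊹ (- inv « m »)) (real (K-κ n)) (K-tb 1 5 m n) (K-tb 7 11 m n))
      (tr (cong (λ w → (0F ⊹ (- inv « m »)) *C (real (K-κ n) *C w)) (tbU m n))
       (cong2 _⊹_ (solve 4 (λ i k r x → :0 :* (k :* r :- :0 :* :0) :- (:- i) :* (k :* :0 :+ :0 :* r) := :0) refl (inv « m ») (K-κ n) (ι q4' * ρ n * ι (χt (m % 12))) 0F)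
        (tr (solve 4 (λ i k r x → :0 :* (k :* :0 :+ :0 :* (r :* x)) :+ (:- i) :* (k :* (r :* x) :- :0 :* :0) := :- ((k :* r) :* (x :* i))) refl (inv « m ») (K-κ n) (ι q4' * ρ n) (ι (χt (m % 12)))) (cong (λ w → - (s0 n * w)) (sym (at-mult q m Xv q≥1))))))))
     where
      m1 : 1 ≤' m
      m1 = pos-of m j1
       where
        pos-of : ∀ m → 1 ≤' q *' m → 1 ≤' m
        pos-of zero l = ⊥-elim (N.<⇒≱ l (N.≤-reflexive (N.*-zeroʳ q)))
        pos-of (suc m) _ = s≤s z≤n

  ĝ : ∀ j → 1 ≤' j → hat g true j ≐ (λ n → real (- (s0 n * at q j Yv)))
  ĝ j j1 = ≐-from (split-g j) (λ n → solveC 1 (λ a → a ≔ a ∔ conC 0ℚ) refl (real (- (s0 n * at q j Yv)))) (≐-+ (go j (at? q j) j1) (≐-trans (≐-*ˡ (λ _ → real (- ι q23)) (Bdd-const _) (one-null j j1)) (≐-≡ (λ _ → zeroCʳ _))))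
   where
    go : ∀ j → At q j → 1 ≤' j → (λ n → K-Av 1 5 j n +C K-Av 7 11 j n) ≐ (λ n → real (- (s0 n * at q j Yv)))
    go j (null nd) _ = ≐-trans (≐-+ (K-Av-null 1 5 j nd 15≤ 5≤) (K-Av-null 7 11 j nd 711≤ 11≤)) (≐-≡ (λ n → tr (solveC 0 (conC 0ℚ ∔ conC 0ℚ ≔ conC 0ℚ) refl) (cong real (tr (solve 1 (λ s → :0 := :- (s :* :0)) refl (s0 n)) (cong (λ w → - (s0 n * w)) (sym (at-null q j Yv nd)))))))
    go _ (mult m refl) j1 = ≐-trans (≐-+ (K-Av-mult 1 5 m m1 15≤ 5≤) (K-Av-mult 7 11 m m1 711≤ 11≤))
     (≐-≡ (λ n → tr (solveC 4 (λ a k x y → a ⨯ (k ⨯ x) ∔ (a ⨯ (k ⨯ y)) ≔ a ⨯ (k ⨯ (x ∔ y))) refl (0F ⊹ (- inv « m »)) (real (K-κ n)) (K-tb 1 5 m n) (K-tb 7 11 m n))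
      (tr (cong (λ w → (0F ⊹ (- inv « m »)) *C (real (K-κ n) *C w)) (tbG m n))
       (cong2 _⊹_ (tr (solve 4 (λ i k r x → :0 :* (k :* :0 :- :0 :* (:- (r :* x))) :- (:- i) :* (k :* (:- (r :* x)) :+ :0 :* :0) := :- ((k :* r) :* (x :* i))) refl (inv « m ») (K-κ n) (ι q4' * ρ n) (ι (ψt (m % 12)))) (cong (λ w → - (s0 n * w)) (sym (at-mult q m Yv q≥1))))
        (solve 3 (λ i k r → :0 :* (k :* r :+ :0 :* :0) :+ (:- i) :* (k :* :0 :- :0 :* r) := :0) refl (inv « m ») (K-κ n) (- (ι q4' * ρ n * ι (ψt (m % 12)))))))))
     where
      m1 : 1 ≤' m
      m1 = pos-of m j1
       where
        pos-of : ∀ m → 1 ≤' q *' m → 1 ≤' m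
        pos-of zero l = ⊥-elim (N.<⇒≱ l (N.≤-reflexive (N.*-zeroʳ q)))
        pos-of (suc m) _ = s≤s z≤n

  ûs : ∀ τ j → 1 ≤' j → hat u τ j ≐ (λ n → 0F ⊹ (- (sg τ * (s0 n * at q j Xv))))
  ûs true j j1 = ≐-from (λ _ → refl) (λ n → cong (λ w → 0F ⊹ (- w)) (1* _)) (û j j1)
  ûs false j j1 = ≐-from (hat-false u j) (λ n → cong (0F ⊹_) (solve 1 (λ w → :- (con (ℚ.- 1ℚ) :* w) := :- (:- w)) refl (s0 n * at q j Xv))) (≐-conj (û j j1))

  ĝs : ∀ τ j → 1 ≤' j → hat g τ j ≐ (λ n → real (- (s0 n * at q j Yv)))
  ĝs true j j1 = ĝ j j1
  ĝs false j j1 = ≐-from (hat-false g j) (λ n → sym (conj-real _)) (≐-conj (ĝ j j1))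

  -- Exact and not only asymptotic: each of the q rounds has 12 τ points, of which the arc receives
  -- 4 τ. The passage from one-sided to two-sided bounds in `Bounded` depends on this.
  mean : ∀ α β → α ≤' β → β <' 12 → β ≡ 4 +' α → ∀ n → N₀ ≤' n → inv « Q n » * ∑ (rng (Q n)) (λ x → Ind α β (Q n) (md (q *' x) (Q n))) ≡ ι q13
  mean α β ab b12 e4 n h = tr (cong (inv « Q n » *_) cnt) (tr (solve 2 (λ i Q → i :* (con q13 :* Q) := con q13 :* (Q :* i)) refl (inv « Q n ») « Q n ») (tr (cong (ι q13 *_) (*-inv (K-Qpos n h))) (*1 _)))
   where
    L = β *' K-τ n ∸' α *' K-τ n
    L4 : L ≡ 4 *' K-τ n
    L4 = tr (cong (λ w → w *' K-τ n ∸' α *' K-τ n) e4) (tr (cong (_∸' α *' K-τ n) (N.*-distribʳ-+ (K-τ n) 4 α)) (N.m+n∸n≡m (4 *' K-τ n) (α *' K-τ n)))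
    Qe : Q n ≡ 12 *' (q *' K-τ n)
    Qe = cong (12 *'_) (K-t12τ n)
    cnt : ∑ (rng (Q n)) (λ x → Ind α β (Q n) (md (q *' x) (Q n))) ≡ ι q13 * « Q n »
    cnt = cong re {y = real (ι q13 * « Q n »)} (tr (sym (∑C-real (rng (Q n)) _)) (tr (∑C-cong (rng (Q n)) (λ x → solveC 1 (λ a → a ≔ a ⨯ conC 1ℚ) refl (real (Ind α β (Q n) (md (q *' x) (Q n)))))) (tr (subst (λ w → ∑C (rng w) (λ x → real (Ind α β w (md (q *' x) w)) *C 1C) ≡ ∑C (rng q) (λ i → ∑C (rng L) (λ y → 1C))) (sym Qe) (decomp q (K-τ n) q≥1 α β (λ _ → 1C) ab b12 (K-τ≥1 n h)))
     (tr (∑C-cong (rng q) (λ _ → ∑C-real (rng L) (λ _ → 1F))) (tr (∑C-real (rng q) _) (cong real (tr (∑-cong (rng q) (λ _ → tr (∑-const (rng L) 1F) (tr (*1 _) (cong «_» (tr (length-rng L) L4))))) (tr (∑-const (rng q) _) (tr (cong2 (λ u w → « u » * w) (length-rng q) («*» 4 (K-τ n))) (tr (cong (λ w → « q » * (w * « K-τ n »)) («»-ι 4)) (sym (tr (cong (ι q13 *_) (tr (cong «_» Qe) (tr («*» 12 _) (cong2 _*_ («»-ι 12) («*» q (K-τ n)))))) (solve 2 (λ q t → con q13 :* (con (# 12) :* (q :* t)) := q :* (con (# 4) :* t)) refl « q » « K-τ n »)))))))))))))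

 module Atom (q m' : ℕ) (q≥1 : 1 ≤' q) (el : suc l' ≡ 4 *' q *' m') where
  private
   E1 : suc l' ≡ q *' (4 *' m')
   E1 = tr el (solveN 2 (λ q m → con' 4 :*' q :*' m :=' q :*' (con' 4 :*' m)) refl q m')
   E2 : suc l' ≡ 2 *' q *' (2 *' m')
   E2 = tr el (solveN 2 (λ q m → con' 4 :*' q :*' m :=' con' 2 :*' q :*' (con' 2 :*' m)) refl q m')
   2q≥1 : 1 ≤' 2 *' q
   2q≥1 = N.≤-trans q≥1 (N.m≤n*m q 2)
   4q≥1 : 1 ≤' 4 *' q
   4q≥1 = N.≤-trans q≥1 (N.m≤n*m q 4)
   O1-g = One.g q (4 *' m') q≥1 E1
   O1-ĝs = One.ĝs q (4 *' m') q≥1 E1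
   O2-g = One.g (2 *' q) (2 *' m') 2q≥1 E2
   O2-u = One.u (2 *' q) (2 *' m') 2q≥1 E2
   O2-ûs = One.ûs (2 *' q) (2 *' m') 2q≥1 E2
   O2-ĝs = One.ĝs (2 *' q) (2 *' m') 2q≥1 E2
   O4-u = One.u (4 *' q) m' 4q≥1 el
   O4-ûs = One.ûs (4 *' q) m' 4q≥1 el

  hatw : Bool → Bool → ℕ → ℕ → ℂ
  hatw σ τ j n = Avg n (λ x → wfun σ (Q n) q x *C Ech τ (zz n) (j *' x))

  hatw-split : ∀ σ τ j n → hatw σ τ j n ≡ (real (- ι 2ℚ) *C hat O1-g τ j n +C (-C 1C) *C hat O2-g τ j n) +C (0F ⊹ sg σ) *C (hat O2-u τ j n +C hat O4-u τ j n)
  hatw-split σ τ j n = tr (Avg-cong n (λ x → tr (cong (_*C Ech τ (zz n) (j *' x)) (wsplit (dg (Q n) (q *' x)) (dg (Q n) (2 *' q *' x)) (du (Q n) (2 *' q *' x)) (du (Q n) (4 *' q *' x))))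
   (solveC 8 (λ a g b g' i u u' e → (((a ⨯ g) ∔ (b ⨯ g')) ∔ i ⨯ (u ∔ u')) ⨯ e ≔ ((a ⨯ (g ⨯ e)) ∔ (b ⨯ (g' ⨯ e))) ∔ (i ⨯ (u ⨯ e) ∔ i ⨯ (u' ⨯ e))) refl (real (- ι 2ℚ)) (real (O1-g n x)) (-C 1C) (real (O2-g n x)) (0F ⊹ sg σ) (real (O2-u n x)) (real (O4-u n x)) (Ech τ (zz n) (j *' x)))))
   (tr (Avg-+ n _ _) (cong2 _+C_ (tr (Avg-+ n _ _) (cong2 _+C_ (Avg-* n (real (- ι 2ℚ)) _) (Avg-* n (-C 1C) _))) (tr (Avg-+ n _ _) (tr (cong2 _+C_ (Avg-* n (0F ⊹ sg σ) _) (Avg-* n (0F ⊹ sg σ) _)) (solveC 3 (λ a b c → a ⨯ b ∔ a ⨯ c ≔ a ⨯ (b ∔ c)) refl (0F ⊹ sg σ) (hat O2-u τ j n) (hat O4-u τ j n))))))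
   where
    wsplit : ∀ g g' u u' → (- (ι 2ℚ * g + g')) ⊹ (sg σ * (u + u')) ≡ (real (- ι 2ℚ) *C real g +C (-C 1C) *C real g') +C (0F ⊹ sg σ) *C (real u +C real u')
    wsplit g g' u u' = cong2 _⊹_ (solve 5 (λ g g' s u u' → :- (:2 :* g :+ g') := ((:- :2) :* g :- :0 :* :0) :+ ((:- :1) :* g' :- (:- :0) :* :0) :+ (:0 :* (u :+ u') :- s :* (:0 :+ :0))) refl g g' (sg σ) u u')
     (solve 5 (λ g g' s u u' → s :* (u :+ u') := ((:- :2) :* :0 :+ :0 :* g) :+ ((:- :1) :* :0 :+ (:- :0) :* g') :+ (:0 :* (:0 :+ :0) :+ s :* (u :+ u'))) refl g g' (sg σ) u u')

  sg-⊙ : ∀ σ τ → sg (σ ⊙ τ) ≡ sg σ * sg τ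
  sg-⊙ true τ = sym (1* _)
  sg-⊙ false true = sym (*1 _)
  sg-⊙ false false = solve 0 (:1 := con (ℚ.- 1ℚ) :* con (ℚ.- 1ℚ)) refl

  ŵ : ∀ σ τ k → 1 ≤' k → hatw σ τ (2 *' k) ≐ (λ n → real (s0 n * (ι 2ℚ * at q k (k0 (σ ⊙ τ)))))
  ŵ σ τ k k1 = ≐-trans (≐-≡ (hatw-split σ τ j)) (≐-trans (≐-+ (≐-+ (≐-*ˡ (λ _ → real (- ι 2ℚ)) (Bdd-const _) (O1-ĝs τ j j1)) (≐-*ˡ (λ _ → -C 1C) (Bdd-const _) (O2-ĝs τ j j1))) (≐-*ˡ (λ _ → 0F ⊹ sg σ) (Bdd-const _) (≐-+ (O2-ûs τ j j1) (O4-ûs τ j j1)))) (≐-≡ fin))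
   where
    j = 2 *' k
    j1 : 1 ≤' j
    j1 = N.≤-trans k1 (N.m≤n*m k 2)
    fin : ∀ n → ((real (- ι 2ℚ) *C real (- (s0 n * at q j Yv))) +C ((-C 1C) *C real (- (s0 n * at (2 *' q) j Yv)))) +C (0F ⊹ sg σ) *C ((0F ⊹ (- (sg τ * (s0 n * at (2 *' q) j Xv)))) +C (0F ⊹ (- (sg τ * (s0 n * at (4 *' q) j Xv))))) ≡ real (s0 n * (ι 2ℚ * at q k (k0 (σ ⊙ τ))))
    fin n = tr (alg (s0 n) (sg σ) (sg τ) (at q j Yv) (at (2 *' q) j Yv) (at (2 *' q) j Xv) (at (4 *' q) j Xv)) (cong (λ w → real (s0 n * w)) (tr (cong (λ w → w * (at (2 *' q) j Xv + at (4 *' q) j Xv) + (ι 2ℚ * at q j Yv + at (2 *' q) j Yv)) (sym (sg-⊙ σ τ))) (kernel-id (σ ⊙ τ) q k q≥1 k1)))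
     where
      alg : ∀ s a b y y' x x' → ((real (- ι 2ℚ) *C real (- (s * y))) +C ((-C 1C) *C real (- (s * y')))) +C (0F ⊹ a) *C ((0F ⊹ (- (b * (s * x)))) +C (0F ⊹ (- (b * (s * x'))))) ≡ real (s * (a * b * (x + x') + (ι 2ℚ * y + y')))
      alg s a b y y' x x' = cong2 _⊹_ (solve 7 (λ s a b y y' x x' → ((:- :2) :* (:- (s :* y)) :- :0 :* :0) :+ ((:- :1) :* (:- (s :* y')) :- (:- :0) :* :0) :+ (:0 :* (:0 :+ :0) :- a :* ((:- (b :* (s :* x))) :+ (:- (b :* (s :* x'))))) := s :* (a :* b :* (x :+ x') :+ (:2 :* y :+ y'))) refl s a b y y' x x')
       (solve 7 (λ s a b y y' x x' → ((:- :2) :* :0 :+ :0 :* (:- (s :* y))) :+ ((:- :1) :* :0 :+ (:- :0) :* (:- (s :* y'))) :+ (:0 :* ((:- (b :* (s :* x))) :+ (:- (b :* (s :* x')))) :+ a :* (:0 :+ :0)) := :0) refl s a b y y' x x')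

-- Rules for `at` and multiplicativity of the kernel.

module _ {q k : ℕ} (q1 : 1 ≤' q) where
 at-rel : (P : F → F → Set) {f g : ℕ → F} → P 0F 0F → (∀ n → k ≡ q *' n → P (f n) (g n)) → P (at q k f) (at q k g)
 at-rel P {f} {g} z h = go (at? q k)
  where
   go : At q k → P (at q k f) (at q k g)
   go (null nd) = subst₂ P (sym (at-null q k f nd)) (sym (at-null q k g nd)) z
   go (mult m e) = subst₂ P (sym (tr (cong (λ w → at q w f) e) (at-mult q m f q1))) (sym (tr (cong (λ w → at q w g) e) (at-mult q m g q1))) (h m e)

 at-cong : {f g : ℕ → F} → (∀ n → k ≡ q *' n → f n ≡ g n) → at q k f ≡ at q k g
 at-cong = at-rel _≡_ refl

 at-mono : {f g : ℕ → F} → (∀ n → k ≡ q *' n → f n ≤ g n) → at q k f ≤ at q k g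
 at-mono = at-rel _≤_ ≤-refl

 at-0 : at q k (λ _ → 0F) ≡ 0F
 at-0 = at-rel (λ _ b → b ≡ 0F) {λ _ → 0F} refl (λ _ _ → refl)

 at≥0 : {f : ℕ → F} → (∀ n → 0F ≤ f n) → 0F ≤ at q k f
 at≥0 h = ≡≤ (sym at-0) (at-mono (λ n _ → h n))

 at-map : (h : F → F) → h 0F ≡ 0F → (f : ℕ → F) → h (at q k f) ≡ at q k (λ n → h (f n))
 at-map h h0 f = at-rel (λ a b → h a ≡ b) {f} h0 (λ _ _ → refl)

 at-abs : (f : ℕ → F) → abs (at q k f) ≡ at q k (λ n → abs (f n))
 at-abs f = at-map abs (∣∣-real ≤-refl) f

 at-+ : (f g : ℕ → F) → at q k (λ n → f n + g n) ≡ at q k f + at q k g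
 at-+ f g = go (at? q k)
  where
   go : At q k → at q k (λ n → f n + g n) ≡ at q k f + at q k g
   go (null nd) = tr (at-null q k _ nd) (sym (tr (cong2 _+_ (at-null q k f nd) (at-null q k g nd)) (+0 0F)))
   go (mult m e) = tr (v _) (sym (cong2 _+_ (v f) (v g)))
    where
     v : ∀ f → at q k f ≡ f m
     v f = tr (cong (λ w → at q w f) e) (at-mult q m f q1)

 at-at : ∀ d (f : ℕ → F) → 1 ≤' d → at (q *' d) k f ≡ at q k (λ n → at d n f)
 at-at d f d1 = go (at? q k)
  where
   go : At q k → at (q *' d) k f ≡ at q k (λ n → at d n f)
   go (null nd) = tr (at-null (q *' d) k f (λ x → nd (Dv.∣-trans (Dv.m∣m*n d) x))) (sym (at-null q k _ nd))
   go (mult m e) = tr (in1 m e (at? d m)) (sym (tr (cong (λ w → at q w (λ n → at d n f)) e) (at-mult q m _ q1)))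
    where
     in1 : ∀ m → k ≡ q *' m → At d m → at (q *' d) k f ≡ at d m f
     in1 m e (null nd) = tr (at-null (q *' d) k f (λ x → nd (∣-cancelˡ q q1 (subst (q *' d ∣_) e x)))) (sym (at-null d m f nd))
     in1 _ e (mult r refl) = tr (cong (λ w → at (q *' d) w f) (tr e (sym (N.*-assoc q d r)))) (tr (at-mult (q *' d) r f (N.*-mono-≤ {1} {q} {1} {d} q1 d1)) (sym (at-mult d r f d1)))

at-∑ : {A : Set} (xs : List A) {q k : ℕ} → 1 ≤' q → (f : A → ℕ → F) → at q k (λ n → ∑ xs (λ a → f a n)) ≡ ∑ xs (λ a → at q k (f a))
at-∑ [] q1 f = at-0 q1
at-∑ (x ∷ xs) q1 f = tr (at-+ q1 (f x) _) (cong (_ +_) (at-∑ xs q1 f))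

at-comm : ∀ a b k f → 1 ≤' a → 1 ≤' b → at a k (λ n → at b n f) ≡ at b k (λ n → at a n f)
at-comm a b k f a1 b1 = tr (sym (at-at a1 b f b1)) (tr (cong (λ w → at w k f) (N.*-comm a b)) (at-at b1 a f a1))

Unit12 : ℕ → Set
Unit12 r = (r ≡ 1) ⊎ (r ≡ 5) ⊎ (r ≡ 7) ⊎ (r ≡ 11)

-- The sign at which `bt` does not vanish on a residue prime to 12. With it `b0` is completely
-- multiplicative up to a change of sign (`b0-mult`).
spr : ℕ → Bool
spr 1 = true
spr 5 = true
spr _ = false

private
 btm : (P c : ℕ) → Set
 btm c r = ∀ σ → bt σ ((c *' r) % 12) ≡ bt (spr c) c ℚ.* bt (spr c ⊙ σ) r

 bt-mult : ∀ c → Unit12 c → ∀ n → btm c (n % 12)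
 bt-mult _ (inj₁ refl) = case12 (btm 1) (t {0} refl refl) (t {1} refl refl) (t {2} refl refl) (t {3} refl refl) (t {4} refl refl) (t {5} refl refl) (t {6} refl refl) (t {7} refl refl) (t {8} refl refl) (t {9} refl refl) (t {10} refl refl) (t {11} refl refl)
  where
   t : ∀ {r} → bt true ((1 *' r) % 12) ≡ bt true 1 ℚ.* bt true r → bt false ((1 *' r) % 12) ≡ bt true 1 ℚ.* bt false r → btm 1 r
   t a b true = a
   t a b false = b
 bt-mult _ (inj₂ (inj₁ refl)) = case12 (btm 5) (t {0} refl refl) (t {1} refl refl) (t {2} refl refl) (t {3} refl refl) (t {4} refl refl) (t {5} refl refl) (t {6} refl refl) (t {7} refl refl) (t {8} refl refl) (t {9} refl refl) (t {10} refl refl) (t {11} refl refl)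
  where
   t : ∀ {r} → bt true ((5 *' r) % 12) ≡ bt true 5 ℚ.* bt true r → bt false ((5 *' r) % 12) ≡ bt true 5 ℚ.* bt false r → btm 5 r
   t a b true = a
   t a b false = b
 bt-mult _ (inj₂ (inj₂ (inj₁ refl))) = case12 (btm 7) (t {0} refl refl) (t {1} refl refl) (t {2} refl refl) (t {3} refl refl) (t {4} refl refl) (t {5} refl refl) (t {6} refl refl) (t {7} refl refl) (t {8} refl refl) (t {9} refl refl) (t {10} refl refl) (t {11} refl refl)
  where
   t : ∀ {r} → bt true ((7 *' r) % 12) ≡ bt false 7 ℚ.* bt false r → bt false ((7 *' r) % 12) ≡ bt false 7 ℚ.* bt true r → btm 7 r
   t a b true = a
   t a b false = b
 bt-mult _ (inj₂ (inj₂ (inj₂ refl))) = case12 (btm 11) (t {0} refl refl) (t {1} refl refl) (t {2} refl refl) (t {3} refl refl) (t {4} refl refl) (t {5} refl refl) (t {6} refl refl) (t {7} refl refl) (t {8} refl refl) (t {9} refl refl) (t {10} refl refl) (t {11} refl refl)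
  where
   t : ∀ {r} → bt true ((11 *' r) % 12) ≡ bt false 11 ℚ.* bt false r → bt false ((11 *' r) % 12) ≡ bt false 11 ℚ.* bt true r → btm 11 r
   t a b true = a
   t a b false = b

sp : ℕ → Bool
sp p = spr (p % 12)

-- The value of χ₃(n)/n at whichever of n = p and n = -p is 1 modulo 4.
βp : ℕ → F
βp p = ι (bt (sp p) (p % 12)) * inv « p »

inv-* : ∀ a b → 1 ≤' a → 1 ≤' b → inv « a *' b » ≡ inv « a » * inv « b »
inv-* a b a1 b1 = sym (tr (cong (inv « a » *_) (inv-2* b b1 a a1)) (tr (solve 3 (λ i a j → i :* (a :* j) := (a :* i) :* j) refl (inv « a ») « a » (inv « a *' b »)) (tr (cong (_* inv « a *' b ») (*-inv («»-pos a1))) (1* _))))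

b0-mult : ∀ p m σ → 1 ≤' p → 1 ≤' m → Unit12 (p % 12) → b0 σ (p *' m) ≡ βp p * b0 (sp p ⊙ σ) m
b0-mult p m σ p1 m1 u = tr (cong2 (λ x y → ι x * y) (tr (cong (bt σ) (tr (red12 p m) (tr (%-distribˡ-* p (m % 12) 12) (tr (cong (λ w → ((p % 12) *' w) % 12) (m%n%n≡m%n m 12)) refl)))) (bt-mult (p % 12) u m σ)) (inv-* p m p1 m1)) (tr (cong (_* (inv « p » * inv « m »)) (ι-* _ _)) (solve 4 (λ a b i j → (a :* b) :* (i :* j) := (a :* i) :* (b :* j)) refl (ι (bt (sp p) (p % 12))) (ι (bt (sp p ⊙ σ) (m % 12))) (inv « p ») (inv « m »)))

unit-odd : ∀ {p} → Unit12 (p % 12) → ¬ (2 ∣ p)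
unit-odd {p} u d = go (p % 12) u (Dv.%-presˡ-∣ d (divides 6 refl))
 where
  go : ∀ r → Unit12 r → ¬ (2 ∣ r)
  go _ (inj₁ refl) = from-no (2 ∣? 1)
  go _ (inj₂ (inj₁ refl)) = from-no (2 ∣? 5)
  go _ (inj₂ (inj₂ (inj₁ refl))) = from-no (2 ∣? 7)
  go _ (inj₂ (inj₂ (inj₂ refl))) = from-no (2 ∣? 11)

k0-mult : ∀ p m σ → 1 ≤' p → 1 ≤' m → Unit12 (p % 12) → k0 σ (p *' m) ≡ βp p * k0 (sp p ⊙ σ) m
k0-mult p m σ p1 m1 u = tr (cong2 _+_ (b0-mult p m σ p1 m1 u) (go m m1 (at? 2 m))) (sym (distribˡ (βp p) _ _))
 where
  2prime : Prime 2
  2prime = from-yes (prime? 2)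
  go : ∀ m → 1 ≤' m → At 2 m → at 2 (p *' m) (b0 σ) ≡ βp p * at 2 m (b0 (sp p ⊙ σ))
  go m _ (null nd) = tr (at-null 2 (p *' m) (b0 σ) nn) (tr (sym (zeroʳ (βp p))) (cong (βp p *_) (sym (at-null 2 m _ nd))))
   where
    nn : ¬ (2 ∣ p *' m)
    nn d = h (euclidsLemma p m 2prime d)
     where
      h : (2 ∣ p) ⊎ (2 ∣ m) → ⊥
      h (inj₁ x) = unit-odd u x
      h (inj₂ y) = nd y
  go _ m1 (mult r refl) = tr (cong (λ w → at 2 w (b0 σ)) (solveN 2 (λ p r → p :*' (con' 2 :*' r) :=' con' 2 :*' (p :*' r)) refl p r)) (tr (at-mult 2 (p *' r) (b0 σ) (s≤s z≤n)) (tr (b0-mult p r σ p1 (r1 r m1) u) (cong (βp p *_) (sym (at-mult 2 r _ (s≤s z≤n))))))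
   where
    r1 : ∀ r → 1 ≤' 2 *' r → 1 ≤' r
    r1 (suc r) _ = s≤s z≤n

-- Sieving the kernel by small primes.

Term : Set
Term = Bool × ℕ × F

tw : ℕ → Term → Term
tw p (σ , d , c) = (σ ⊙ sp p) , (p *' d) , (- βp p * c)

-- expansion of the product over p of 1 - βp p · (dilation by ± p)
terms : List ℕ → List Term
terms [] = (true , 1 , 1F) ∷ []
terms (p ∷ ps) = terms ps ++ map (tw p) (terms ps)

KT : List Term → Bool → ℕ → F
KT ts σ n = ∑ ts (λ t → snd (snd t) * at (fst (snd t)) n (k0 (fst t ⊙ σ)))

Good : ℕ → Set
Good p = Prime p × Unit12 (p % 12)

private
 p≥1 : ∀ {p} → Prime p → 1 ≤' p
 p≥1 {p} pr = ℕ.>-nonZero⁻¹ p {{prime⇒nonZero pr}}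

terms-d≥1 : ∀ ps → All Good ps → All (λ t → 1 ≤' fst (snd t)) (terms ps)
terms-d≥1 [] _ = s≤s z≤n ∷ []
terms-d≥1 (p ∷ ps) ((pr , _) ∷ gs) = AllP.++⁺ ih (AllP.map⁺ (All.map (λ {t} d1 → N.*-mono-≤ {1} {p} {1} {fst (snd t)} (p≥1 pr) d1) ih))
 where ih = terms-d≥1 ps gs

⊙-assoc : ∀ a b c → (a ⊙ b) ⊙ c ≡ a ⊙ (b ⊙ c)
⊙-assoc true b c = refl
⊙-assoc false true c = refl
⊙-assoc false false true = refl
⊙-assoc false false false = refl

KT-step : ∀ p ps σ n → Good p → All Good ps → KT (terms (p ∷ ps)) σ n ≡ KT (terms ps) σ n + (- βp p * at p n (KT (terms ps) (sp p ⊙ σ)))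
KT-step p ps σ n g gs = tr (∑-++ (terms ps) _ _) (cong (KT (terms ps) σ n +_) (tr (∑-map (tw p) (terms ps) _) (tr (∑-cong∈ (terms ps) (λ {t} m → one t (All.lookup (terms-d≥1 ps gs) m))) (tr (∑-* (terms ps) (- βp p) _) (cong (- βp p *_) (sym (at-∑ (terms ps) (p≥1 (fst g)) _)))))))
 where
  one : ∀ t → 1 ≤' fst (snd t) → snd (snd (tw p t)) * at (fst (snd (tw p t))) n (k0 (fst (tw p t) ⊙ σ)) ≡ - βp p * at p n (λ n' → snd (snd t) * at (fst (snd t)) n' (k0 (fst t ⊙ (sp p ⊙ σ))))
  one (σ' , d , c) d1 = tr (*-assoc _ _ _) (cong (- βp p *_) (tr (cong (c *_) (tr (at-at (p≥1 (fst g)) d _ d1) (at-cong (p≥1 (fst g)) (λ n' _ → cong (λ w → at d n' (k0 w)) (⊙-assoc σ' (sp p) σ))))) (at-map (p≥1 (fst g)) (c *_) (zeroʳ c) _)))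

Indiv : List ℕ → ℕ → Set
Indiv ps n = All (λ p → ¬ (p ∣ n)) ps

data Sieved (ps : List ℕ) (n : ℕ) : Set where
 kept : Indiv ps n → Sieved ps n
 hit : ∀ {p} → p ∈ ps → p ∣ n → Sieved ps n

sieved : ∀ ps n → Sieved ps n
sieved [] n = kept []
sieved (p ∷ ps) n = go (p ∣? n) (sieved ps n)
 where
  go : Dec (p ∣ n) → Sieved ps n → Sieved (p ∷ ps) n
  go (yes d) _ = hit (here refl) d
  go (no nd) (kept i) = kept (nd ∷ i)
  go (no nd) (hit m d) = hit (there m) d

prime∤prime : ∀ {p p'} → Prime p → Prime p' → p ≢ p' → ¬ (p' ∣ p)
prime∤prime {p} {p'} pr pr' ne d = go (prime⇒irreducible pr d)
 where
  go : (p' ≡ 1) ⊎ (p' ≡ p) → ⊥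
  go (inj₁ e) = ℕ.nonTrivial⇒≢1 {{prime⇒nonTrivial pr'}} e
  go (inj₂ e) = ne (sym e)

KT-kept : ∀ ps σ n → All Good ps → Unique ps → Indiv ps n → KT (terms ps) σ n ≡ k0 σ n
-- The factor for p subtracts from the value at p r the multiple βp p of the value at r, and by
-- `k0-mult` the two agree. As the multiplicativity is complete, higher powers of p are removed as
-- well.
KT-hit : ∀ ps σ n → 1 ≤' n → All Good ps → Unique ps → ∀ {p} → p ∈ ps → p ∣ n → KT (terms ps) σ n ≡ 0F

KT-kept [] σ n _ _ _ = tr (+0 _) (tr (1* _) (tr (cong (λ w → at 1 w (k0 σ)) (sym (N.*-identityˡ n))) (at-mult 1 n (k0 σ) (s≤s z≤n))))
KT-kept (p ∷ ps) σ n (g ∷ gs) (_ ∷ us) (nd ∷ is) = tr (KT-step p ps σ n g gs) (tr (cong2 _+_ (KT-kept ps σ n gs us is) (tr (cong (- βp p *_) (at-null p n _ nd)) (zeroʳ _))) (+0 _))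
KT-hit (p ∷ ps) σ n n1 (g ∷ gs) (u ∷ us) {p'} mem d = tr (KT-step p ps σ n g gs) (go mem (at? p n) n1 d)
 where
  go : ∀ {n} → p' ∈ p ∷ ps → At p n → 1 ≤' n → p' ∣ n → KT (terms ps) σ n + (- βp p * at p n (KT (terms ps) (sp p ⊙ σ))) ≡ 0F
  go (here refl) (null nd) _ d = ⊥-elim (nd d)
  go {n} (there m) (null nd) n1 d = tr (cong2 _+_ (KT-hit ps σ n n1 gs us m d) (tr (cong (- βp p *_) (at-null p n _ nd)) (zeroʳ _))) (+0 _)
  go _ (mult r refl) n1 d = tr (cong (λ w → KT (terms ps) σ (p *' r) + (- βp p * w)) (at-mult p r _ (p≥1 (fst g)))) (cases (sieved ps r))
   where
    r1 : 1 ≤' r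
    r1 = rr r n1
     where
      rr : ∀ r → 1 ≤' p *' r → 1 ≤' r
      rr zero l = ⊥-elim (N.<⇒≱ l (N.≤-reflexive (N.*-zeroʳ p)))
      rr (suc r) _ = s≤s z≤n
    cases : Sieved ps r → KT (terms ps) σ (p *' r) + (- βp p * KT (terms ps) (sp p ⊙ σ) r) ≡ 0F
    cases (kept i) = tr (cong2 (λ x y → x + (- βp p * y)) (tr (KT-kept ps σ (p *' r) gs us (All.tabulate (λ {p''} m x → h m (euclidsLemma p r (fst (All.lookup gs m)) x)))) (k0-mult p r σ (p≥1 (fst g)) r1 (snd g))) (KT-kept ps (sp p ⊙ σ) r gs us i)) (solve 2 (λ b k → b :* k :+ (:- b) :* k := :0) refl (βp p) (k0 (sp p ⊙ σ) r))
     where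
      h : ∀ {p''} → p'' ∈ ps → (p'' ∣ p) ⊎ (p'' ∣ r) → ⊥
      h m (inj₁ x) = prime∤prime (fst g) (fst (All.lookup gs m)) (All.lookup u m) x
      h m (inj₂ y) = All.lookup i m y
    cases (hit m x) = tr (cong2 (λ x y → x + (- βp p * y)) (KT-hit ps σ (p *' r) n1 gs us m (Dv.∣-trans x (Dv.n∣m*n p))) (KT-hit ps (sp p ⊙ σ) r r1 gs us m x)) (solve 1 (λ b → :0 :+ (:- b) :* :0 := :0) refl (βp p))

prime-divisor : ∀ d → 2 ≤' d → Σ ℕ λ p → Prime p × p ∣ d
prime-divisor (suc d) l = go (factorise (suc d))
 where
  go : PrimeFactorisation (suc d) → Σ ℕ λ p → Prime p × p ∣ suc d
  go record { factors = [] ; isFactorisation = e } = ⊥-elim (N.<⇒≢ l (sym e))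
  go record { factors = p ∷ ps ; isFactorisation = e ; factorsPrime = pr ∷ _ } = p , pr , subst (p ∣_) (sym e) (Dv.m∣m*n _)

-- The primes 2 and 3 are left out: `b0` vanishes at their multiples anyway, and `βp` makes sense
-- only for residues prime to 12.
sieveP? : ∀ p → Dec (5 ≤' p × Prime p)
sieveP? p = (5 ℕ.≤? p) ×-dec prime? p

primesTo : ℕ → List ℕ
primesTo P = filter sieveP? (rng (2 +' P))

primesTo-∈ : ∀ P {p} → p ∈ primesTo P → 5 ≤' p × Prime p × p <' 2 +' P
primesTo-∈ P {p} m = fst (snd w) , snd (snd w) , ∈rng (fst w)
 where w = ∈-filter⁻ sieveP? {xs = rng (2 +' P)} m

primesTo-unique : ∀ P → Unique (primesTo P)
primesTo-unique P = UP.filter⁺ sieveP? (rng-unique (2 +' P))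

private
 U' : ℕ → Set
 U' r = ¬ (2 ∣ r) → ¬ (3 ∣ r) → Unit12 r

 unit12 : ∀ n → U' (n % 12)
 unit12 = case12 U' (λ x _ → ⊥-elim (x (divides 0 refl))) (λ _ _ → inj₁ refl) (λ x _ → ⊥-elim (x (divides 1 refl))) (λ _ x → ⊥-elim (x (divides 1 refl))) (λ x _ → ⊥-elim (x (divides 2 refl))) (λ _ _ → inj₂ (inj₁ refl)) (λ x _ → ⊥-elim (x (divides 3 refl))) (λ _ _ → inj₂ (inj₂ (inj₁ refl))) (λ x _ → ⊥-elim (x (divides 4 refl))) (λ _ x → ⊥-elim (x (divides 3 refl))) (λ x _ → ⊥-elim (x (divides 5 refl))) (λ _ _ → inj₂ (inj₂ (inj₂ refl)))

 %∣ : ∀ {d} p → d ∣ 12 → d ∣ p % 12 → d ∣ p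
 %∣ p d12 h = Dv.∣n∣m%n⇒∣m d12 h

good : ∀ {p} → 5 ≤' p → Prime p → Good p
good {p} l pr = pr , unit12 p (λ x → np 2 (from-yes (prime? 2)) (from-yes (2 ℕ.<? 5)) (%∣ p (divides 6 refl) x)) (λ x → np 3 (from-yes (prime? 3)) (from-yes (3 ℕ.<? 5)) (%∣ p (divides 4 refl) x))
 where
  np : ∀ q → Prime q → q <' 5 → ¬ (q ∣ p)
  np q qr q5 = prime∤prime pr qr (λ e → N.<⇒≱ q5 (subst (5 ≤'_) e l))

primesTo-good : ∀ P → All Good (primesTo P)
primesTo-good P = All.tabulate (λ m → good (fst (primesTo-∈ P m)) (fst (snd (primesTo-∈ P m))))

Rough : ℕ → ℕ → Set
Rough P n = All (λ d → ¬ (2 +' d ∣ n)) (rng P)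

rough? : ∀ P n → Dec (Rough P n)
rough? P n = All.all? (λ d → ¬? (2 +' d ∣? n)) (rng P)

rough> : ∀ {P n} → 1 <' n → Rough P n → P <' n
rough> {P} {suc (suc n)} _ r = case-dec (P ℕ.≤? suc n) (λ l → s≤s l) (λ l → ⊥-elim (All.lookup r (rng∈ (N.<⇒≤ (N.≰⇒> l))) Dv.∣-refl))
rough> {P} {suc zero} (s≤s ())

-- Majorant of what the sieve leaves of `b0` away from n = 1.
rr : ℕ → ℕ → F
rr P n = iv (1 ℕ.<? n) * iv (rough? P n) * inv « n »

rr≥0 : ∀ P n → 0F ≤ rr P n
rr≥0 P n = case-dec (1 ℕ.<? n) (λ l → 0≤* (0≤* (iv≥0 _) (iv≥0 _)) (inv≥0 («»-pos (N.<⇒≤ l)))) (λ l → ≡⇒≤ (sym (tr (cong (λ w → w * iv (rough? P n) * inv « n ») (iv-no (1 ℕ.<? n) l)) (solve 2 (λ a b → :0 :* a :* b := :0) refl (iv (rough? P n)) (inv « n »)))))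

bt-zero : ∀ σ p m → (p ≡ 2) ⊎ (p ≡ 3) → p ∣ m → bt σ (m % 12) ≡ 0ℚ
bt-zero σ p m c d = case12 (Z σ) (z0 σ) (λ x → ⊥-elim (n1 c x)) (z2 σ) (z3 σ) (z4 σ) (λ x → ⊥-elim (n5 c x)) (z6 σ) (λ x → ⊥-elim (n7 c x)) (z8 σ) (z9 σ) (z10 σ) (λ x → ⊥-elim (n11 c x)) m (Dv.%-presˡ-∣ d (p12 c))
 where
  Z : Bool → ℕ → Set
  Z σ r = p ∣ r → bt σ r ≡ 0ℚ
  p12 : (p ≡ 2) ⊎ (p ≡ 3) → p ∣ 12
  p12 (inj₁ refl) = divides 6 refl
  p12 (inj₂ refl) = divides 4 refl
  n1 : (p ≡ 2) ⊎ (p ≡ 3) → ¬ (p ∣ 1)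
  n1 (inj₁ refl) = from-no (2 ∣? 1)
  n1 (inj₂ refl) = from-no (3 ∣? 1)
  n5 : (p ≡ 2) ⊎ (p ≡ 3) → ¬ (p ∣ 5)
  n5 (inj₁ refl) = from-no (2 ∣? 5)
  n5 (inj₂ refl) = from-no (3 ∣? 5)
  n7 : (p ≡ 2) ⊎ (p ≡ 3) → ¬ (p ∣ 7)
  n7 (inj₁ refl) = from-no (2 ∣? 7)
  n7 (inj₂ refl) = from-no (3 ∣? 7)
  n11 : (p ≡ 2) ⊎ (p ≡ 3) → ¬ (p ∣ 11)
  n11 (inj₁ refl) = from-no (2 ∣? 11)
  n11 (inj₂ refl) = from-no (3 ∣? 11)
  z0 : ∀ σ → Z σ 0
  z0 true _ = refl
  z0 false _ = refl
  z2 : ∀ σ → Z σ 2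
  z2 true _ = refl
  z2 false _ = refl
  z3 : ∀ σ → Z σ 3
  z3 true _ = refl
  z3 false _ = refl
  z4 : ∀ σ → Z σ 4
  z4 true _ = refl
  z4 false _ = refl
  z6 : ∀ σ → Z σ 6
  z6 true _ = refl
  z6 false _ = refl
  z8 : ∀ σ → Z σ 8
  z8 true _ = refl
  z8 false _ = refl
  z9 : ∀ σ → Z σ 9
  z9 true _ = refl
  z9 false _ = refl
  z10 : ∀ σ → Z σ 10
  z10 true _ = refl
  z10 false _ = refl

b0-zero : ∀ σ p m → (p ≡ 2) ⊎ (p ≡ 3) → p ∣ m → b0 σ m ≡ 0F
b0-zero σ p m c d = tr (cong (λ w → ι w * inv « m ») (bt-zero σ p m c d)) (zeroˡ _)

abs-bt : ∀ σ m → abs (ι (bt σ (m % 12))) ≤ 1F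
abs-bt true = case12 (λ r → abs (ι (bt true r)) ≤ 1F) z p z z z n z z z z z z
 where
  z = ∣∣-≤ 0≤1 (≡≤ (sym (ι-neg 0ℚ)) (ι-≤ (from-yes (ℚ.- 0ℚ ℚ.≤? 1ℚ))))
  p = ∣∣-≤ ≤-refl (≡≤ (sym (ι-neg 1ℚ)) (ι-≤ (from-yes (ℚ.- 1ℚ ℚ.≤? 1ℚ))))
  n = ∣∣-≤ (ι-≤ (from-yes (ℚ.- 1ℚ ℚ.≤? 1ℚ))) (≡≤ (sym (ι-neg (ℚ.- 1ℚ))) (ι-≤ (from-yes (ℚ.- (ℚ.- 1ℚ) ℚ.≤? 1ℚ))))
abs-bt false = case12 (λ r → abs (ι (bt false r)) ≤ 1F) z z z z z z z p z z z n
 where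
  z = ∣∣-≤ 0≤1 (≡≤ (sym (ι-neg 0ℚ)) (ι-≤ (from-yes (ℚ.- 0ℚ ℚ.≤? 1ℚ))))
  p = ∣∣-≤ ≤-refl (≡≤ (sym (ι-neg 1ℚ)) (ι-≤ (from-yes (ℚ.- 1ℚ ℚ.≤? 1ℚ))))
  n = ∣∣-≤ (ι-≤ (from-yes (ℚ.- 1ℚ ℚ.≤? 1ℚ))) (≡≤ (sym (ι-neg (ℚ.- 1ℚ))) (ι-≤ (from-yes (ℚ.- (ℚ.- 1ℚ) ℚ.≤? 1ℚ))))

rough-fail : ∀ P n → ¬ Rough P n → Σ ℕ λ p → Prime p × (p ∣ n) × p <' 2 +' P
rough-fail P n nr = go (find (rng P) (λ m → m))
 where
  Found : Set
  Found = Σ ℕ λ d → d ∈ rng P × (2 +' d ∣ n)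
  find : ∀ xs → (∀ {x} → x ∈ xs → x ∈ rng P) → All (λ d → ¬ (2 +' d ∣ n)) xs ⊎ Found
  find [] _ = inj₁ []
  find (x ∷ xs) h = st (2 +' x ∣? n) (find xs (λ m → h (there m)))
   where
    st : Dec (2 +' x ∣ n) → All (λ d → ¬ (2 +' d ∣ n)) xs ⊎ Found → All (λ d → ¬ (2 +' d ∣ n)) (x ∷ xs) ⊎ Found
    st (yes d) _ = inj₂ (x , h (here refl) , d)
    st (no nd) (inj₁ a) = inj₁ (nd ∷ a)
    st (no nd) (inj₂ w) = inj₂ w
  go : All (λ d → ¬ (2 +' d ∣ n)) (rng P) ⊎ Found → Σ ℕ λ p → Prime p × (p ∣ n) × p <' 2 +' P
  go (inj₁ a) = ⊥-elim (nr a)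
  go (inj₂ (d , m , dv)) = fin (prime-divisor (2 +' d) (s≤s (s≤s z≤n)))
   where
    fin : (Σ ℕ λ p → Prime p × p ∣ 2 +' d) → Σ ℕ λ p → Prime p × (p ∣ n) × p <' 2 +' P
    fin (p , pr , pd) = p , pr , Dv.∣-trans pd dv , N.≤-<-trans (Dv.∣⇒≤ pd) (s≤s (s≤s (∈rng m)))

prime-cases : ∀ {p} → Prime p → (p ≡ 2) ⊎ (p ≡ 3) ⊎ 5 ≤' p
prime-cases {0} pr = ⊥-elim (from-no (prime? 0) pr)
prime-cases {1} pr = ⊥-elim (from-no (prime? 1) pr)
prime-cases {2} pr = inj₁ refl
prime-cases {3} pr = inj₂ (inj₁ refl)
prime-cases {4} pr = ⊥-elim (from-no (prime? 4) pr)
prime-cases {suc (suc (suc (suc (suc p))))} pr = inj₂ (inj₂ (s≤s (s≤s (s≤s (s≤s (s≤s z≤n))))))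

b0-rr : ∀ P σ m → 1 <' m → Indiv (primesTo P) m → abs (b0 σ m) ≤ rr P m
b0-rr P σ m m1 ind = go (rough? P m)
 where
  ip : 0F ≤ inv « m »
  ip = inv≥0 («»-pos (N.<⇒≤ m1))
  go : Dec (Rough P m) → abs (b0 σ m) ≤ rr P m
  go (yes r) = tr≤ (∣∣-* _ _) (≤≡ (*-mono (∣∣≥0 _) (∣∣≥0 _) (abs-bt σ m) (≡⇒≤ (∣∣-real ip))) (sym (cong (_* inv « m ») (tr (cong2 _*_ (iv-yes (1 ℕ.<? m) m1) (iv-yes (rough? P m) r)) (1* 1F)))))
  go (no nr) = ≡≤ (tr (cong abs (zr (rough-fail P m nr))) (∣∣-real ≤-refl)) (rr≥0 P m)
   where
    zr : (Σ ℕ λ p → Prime p × (p ∣ m) × p <' 2 +' P) → b0 σ m ≡ 0F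
    zr (p , pr , d , l) = cs (prime-cases pr)
     where
      cs : (p ≡ 2) ⊎ (p ≡ 3) ⊎ 5 ≤' p → b0 σ m ≡ 0F
      cs (inj₁ e) = b0-zero σ p m (inj₁ e) d
      cs (inj₂ (inj₁ e)) = b0-zero σ p m (inj₂ e) d
      cs (inj₂ (inj₂ l5)) = ⊥-elim (All.lookup ind (∈-filter⁺ sieveP? (rng∈ l) (l5 , pr)) d)

indσ : Bool → F
indσ true = 1F
indσ false = 0F

δ : ℕ → ℕ → F
δ j n = iv (n ℕ.≟ j)

module _ (P : ℕ) where
 private ts = terms (primesTo P)

 -- If a sieving prime divides n, the value is 0. Otherwise it is `k0`, which vanishes unless n, or
 -- n/2 for even n, is prime to 6 and therefore equal to 1 or rough. The spikes belong to the
 -- positive sign only.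
 KT-bound : ∀ σ n → 1 ≤' n → abs (KT ts σ n - indσ σ * (δ 1 n + δ 2 n)) ≤ rr P n + at 2 n (rr P)
 KT-bound σ n n1 = go (sieved (primesTo P) n)
  where
   Bd : F → ℕ → Set
   Bd x n = abs (x - indσ σ * (δ 1 n + δ 2 n)) ≤ rr P n + at 2 n (rr P)
   nn : 0F ≤ rr P n + at 2 n (rr P)
   nn = 0≤+ (rr≥0 P n) (at≥0 (s≤s z≤n) (rr≥0 P))
   zero' : ∀ {n x} → x ≡ indσ σ * (δ 1 n + δ 2 n) → 0F ≤ rr P n + at 2 n (rr P) → Bd (x) n
   zero' {n} {x} e h = ≡≤ (tr (cong abs (tr (cong (λ w → w - indσ σ * (δ 1 n + δ 2 n)) e) (solve 1 (λ a → a :- a := :0) refl (indσ σ * (δ 1 n + δ 2 n))))) (∣∣-real ≤-refl)) h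
   δ0 : ∀ n → 2 <' n → indσ σ * (δ 1 n + δ 2 n) ≡ 0F
   δ0 n l = tr (cong2 (λ a b → indσ σ * (a + b)) (iv-no (n ℕ.≟ 1) (λ e → N.<⇒≱ l (subst (_≤' 2) (sym e) (s≤s z≤n)))) (iv-no (n ℕ.≟ 2) (λ e → N.<⇒≢ l (sym e)))) (solve 1 (λ s → s :* (:0 :+ :0) := :0) refl (indσ σ))
   big : ∀ {n x} → 2 <' n → abs x ≤ rr P n + at 2 n (rr P) → Bd (x) n
   big {n} {x} l h = ≡≤ (cong abs (tr (cong (λ w → x - w) (δ0 n l)) (solve 1 (λ a → a :- :0 := a) refl x))) h
   val1 : ∀ σ → b0 σ 1 ≡ indσ σ
   val1 true = tr (1* _) (tr (cong inv «1») (tr (sym (1* _)) (*-inv Pos-1)))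
   val1 false = zeroˡ _
   odds : ∀ r → Indiv (primesTo P) (1 +' 2 *' r) → Bd (b0 σ (1 +' 2 *' r)) (1 +' 2 *' r)
   odds zero i = zero' {1} (tr (val1 σ) (tr (sym (*1 _)) (cong (indσ σ *_) (sym (tr (cong2 _+_ (iv-yes (1 ℕ.≟ 1) refl) (iv-no (1 ℕ.≟ 2) (λ ()))) (+0 _)))))) (0≤+ (rr≥0 P 1) (at≥0 (s≤s z≤n) (rr≥0 P)))
   odds (suc r) i = big {1 +' 2 *' suc r} l3 (tr≤ (b0-rr P σ _ (N.<⇒≤ l3) i) (≤-by (at 2 (1 +' 2 *' suc r) (rr P)) (at≥0 (s≤s z≤n) (rr≥0 P)) refl))
    where
     l3 : 2 <' 1 +' 2 *' suc r
     l3 = s≤s (N.*-monoʳ-≤ 2 (s≤s (z≤n {r})))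
   evens : ∀ r → 1 ≤' 2 *' r → Indiv (primesTo P) (2 *' r) → Bd (k0 σ (2 *' r)) (2 *' r)
   evens zero () i
   evens (suc zero) _ i = zero' {2} (tr (tr (k0-even σ 1) (tr (cong2 _+_ (b0-zero σ 2 2 (inj₁ refl) Dv.∣-refl) (val1 σ)) (0+ _))) (tr (sym (*1 _)) (cong (indσ σ *_) (sym (tr (cong2 _+_ (iv-no (2 ℕ.≟ 1) (λ ())) (iv-yes (2 ℕ.≟ 2) refl)) (0+ _)))))) (0≤+ (rr≥0 P 2) (at≥0 (s≤s z≤n) (rr≥0 P)))
   evens (suc (suc r)) _ i = big {2 *' suc (suc r)} l3 (≡≤ (cong abs (tr (k0-even σ (2 +' r)) (tr (cong (_+ b0 σ (2 +' r)) (b0-zero σ 2 (2 *' (2 +' r)) (inj₁ refl) (Dv.m∣m*n (2 +' r)))) (0+ _)))) (tr≤ (b0-rr P σ (2 +' r) (s≤s (s≤s z≤n)) (All.map (λ h x → h (Dv.∣-trans x (Dv.n∣m*n 2))) i)) (≤-by (rr P (2 *' (2 +' r))) (rr≥0 P _) (tr (cong (_+ rr P (2 *' (2 +' r))) (sym (at-mult 2 (2 +' r) (rr P) (s≤s z≤n)))) (+-comm _ _)))))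
    where
     l3 : 2 <' 2 *' suc (suc r)
     l3 = N.<-≤-trans (from-yes (2 ℕ.<? 4)) (N.*-monoʳ-≤ 2 (s≤s (s≤s (z≤n {r}))))
   par : ∀ n → Parity n → 1 ≤' n → Indiv (primesTo P) n → Bd (k0 σ n) n
   par _ (evn r) n1 i = evens r n1 i
   par _ (od r) n1 i = ≡≤ (cong (λ w → abs (w - indσ σ * (δ 1 (1 +' 2 *' r) + δ 2 (1 +' 2 *' r)))) (k0-odd σ r)) (odds r i)
   go : Sieved (primesTo P) n → Bd (KT ts σ n) n
   go (hit {p} m d) = zero' {n} (tr (KT-hit (primesTo P) σ n n1 (primesTo-good P) (primesTo-unique P) m d) (sym (δ0 n (N.≤-trans (from-yes (3 ℕ.≤? 5)) (N.≤-trans (fst (primesTo-∈ P m)) (Dv.∣⇒≤ {{ℕ.>-nonZero n1}} d)))))) nn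
   go (kept i) = ≡≤ (cong (λ w → abs (w - indσ σ * (δ 1 n + δ 2 n))) (KT-kept (primesTo P) σ n (primesTo-good P) (primesTo-unique P) i)) (par n (parity n) n1 i)

 module Target (A : List ℕ) (A1 : All (λ a → 1 ≤' a) A) where

  GT : Bool → ℕ → F
  GT σ k = ∑ ts (λ t → snd (snd t) * ∑ A (λ a → at (fst (snd t) *' a) k (k0 (fst t ⊙ σ))))

  Gf : ℤ → F
  Gf (pos zero) = 0F
  Gf (pos (suc k)) = GT true (suc k)
  Gf (negsuc k) = GT false (suc k)

  gp : ℕ → F
  gp k = ∑ A (λ a → at a k (rr P))

  -- The indicator of A plus that of 2A, in the form in which the kernel delivers it.
  main2 : ℕ → F
  main2 k = ∑ A (λ a → at a k (λ n → δ 1 n + δ 2 n))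

  GT-eq : ∀ σ k → GT σ k ≡ ∑ A (λ a → at a k (KT ts σ))
  GT-eq σ k = tr (∑-cong∈ ts (λ {t} m → tr (sym (∑-* A (snd (snd t)) _)) (∑-cong∈ A (λ {a} ma → cong (snd (snd t) *_) (tr (cong (λ w → at w k (k0 (fst t ⊙ σ))) (N.*-comm (fst (snd t)) a)) (at-at (All.lookup A1 ma) (fst (snd t)) _ (All.lookup (terms-d≥1 (primesTo P) (primesTo-good P)) m)))))))
   (tr (∑-swap ts A _) (∑-cong∈ A (λ {a} ma → tr (∑-cong ts (λ t → at-map (All.lookup A1 ma) (snd (snd t) *_) (zeroʳ _) _)) (sym (at-∑ ts (All.lookup A1 ma) _)))))

  GT-bound : ∀ σ k → 1 ≤' k → abs (GT σ k - indσ σ * main2 k) ≤ gp k + at 2 k gp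
  GT-bound σ k k1 = ≡≤ (cong abs (tr (cong2 _-_ (GT-eq σ k) (sym (∑-* A (indσ σ) _))) (sym (∑-- A _ _)))) (tr≤ (∑-∣∣ A _) (≤≡ (∑-mono∈ A one) (tr (∑-+ A _ _) (cong (gp k +_) (tr (∑-cong∈ A (λ {a} ma → at-comm a 2 k (rr P) (All.lookup A1 ma) (s≤s z≤n))) (sym (at-∑ A (s≤s z≤n) (λ a n → at a n (rr P)))))))))
   where
    one : ∀ {a} → a ∈ A → abs (at a k (KT ts σ) - indσ σ * at a k (λ n → δ 1 n + δ 2 n)) ≤ at a k (rr P) + at a k (λ n → at 2 n (rr P))
    one {a} ma = ≡≤ (tr (cong abs (tr (cong (at a k (KT ts σ) +_) (tr (solve 2 (λ s x → :- (s :* x) := (:- s) :* x) refl (indσ σ) (at a k (λ n → δ 1 n + δ 2 n))) (at-map a1 (- indσ σ *_) (zeroʳ _) _))) (sym (at-+ a1 _ _)))) (at-abs a1 _))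
     (≤≡ (at-mono a1 (λ n e → ≡≤ (cong (λ w → abs (KT ts σ n + w)) (solve 2 (λ s x → (:- s) :* x := :- (s :* x)) refl (indσ σ) (δ 1 n + δ 2 n))) (KT-bound σ n (n1 n e)))) (at-+ a1 _ _))
     where
      a1 = All.lookup A1 ma
      n1 : ∀ n → k ≡ a *' n → 1 ≤' n
      n1 zero e = ⊥-elim (N.<⇒≱ k1 (N.≤-reflexive (tr e (N.*-zeroʳ a))))
      n1 (suc n) _ = s≤s z≤n

-- Sums over sublists and the harmonic sum.

∑-rng-+ : ∀ a b (f : ℕ → F) → ∑ (rng (a +' b)) f ≡ ∑ (rng a) (λ j → f (b +' j)) + ∑ (rng b) f
∑-rng-+ zero b f = sym (0+ _)
∑-rng-+ (suc a) b f = tr (cong2 _+_ (cong f (N.+-comm a b)) (∑-rng-+ a b f)) (sym (+-assoc _ _ _))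

∑-filter : {A : Set} {P : A → Set} (P? : ∀ a → Dec (P a)) (xs : List A) (f : A → F) → ∑ (filter P? xs) f ≡ ∑ xs (λ a → iv (P? a) * f a)
∑-filter P? [] f = refl
∑-filter P? (x ∷ xs) f with P? x
... | yes p = cong2 _+_ (tr (sym (1* _)) (cong (_* f x) (sym (iv-yes (yes p) p)))) (∑-filter P? xs f)
... | no np = tr (tr (sym (0+ _)) (cong (_+ ∑ (filter P? xs) f) (tr (sym (zeroˡ (f x))) (cong (_* f x) (sym (iv-no (no np) np)))))) (cong (iv (no np) * f x +_) (∑-filter P? xs f))

remove : {A : Set} {x : A} (ys : List A) → x ∈ ys → List A
remove (y ∷ ys) (here _) = ys
remove (y ∷ ys) (there m) = y ∷ remove ys m

∑-sub : {A : Set} (xs ys : List A) (f : A → F) → (∀ x → 0F ≤ f x) → Unique xs → (∀ {x} → x ∈ xs → x ∈ ys) → ∑ xs f ≤ ∑ ys f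
∑-sub [] ys f h _ _ = ∑≥0 ys h
∑-sub {A} (x ∷ xs) ys f h (u ∷ us) s = ≤≡ (+-mono ≤-refl (∑-sub xs (remove ys (s (here refl))) f h us (λ {y} m → keep ys (s (here refl)) (s (there m)) (λ e → All.lookup u m (sym e))))) (rem ys (s (here refl)))
 where
  keep : ∀ {x y} (ys : List A) (m : x ∈ ys) → y ∈ ys → y ≢ x → y ∈ remove ys m
  keep (_ ∷ ys) (here refl) (here refl) ne = ⊥-elim (ne refl)
  keep (_ ∷ ys) (here refl) (there m') ne = m'
  keep (_ ∷ ys) (there m) (here refl) ne = here refl
  keep (_ ∷ ys) (there m) (there m') ne = there (keep ys m m' ne)
  rem : ∀ {x} (ys : List A) (m : x ∈ ys) → f x + ∑ (remove ys m) f ≡ ∑ ys f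
  rem (_ ∷ ys) (here refl) = refl
  rem {x} (y ∷ ys) (there m) = tr (solve 3 (λ a b c → a :+ (b :+ c) := b :+ (a :+ c)) refl (f x) (f y) _) (cong (f y +_) (rem ys m))

inv-anti : ∀ {a b} → 1 ≤' a → a ≤' b → inv « b » ≤ inv « a »
inv-anti {a} {b} a1 l = *-cancel-≤ « a » («»-pos a1) (≤≡ (*-monoʳ (inv « b ») (inv≥0 bp) («»-mono l)) (tr (*-inv bp) (sym (*-inv («»-pos a1)))))
 where bp = «»-pos (N.≤-trans a1 l)

2^>0 : ∀ n → 1 ≤' 2 ^' n
2^>0 n = N.m^n>0 2 n

2*≡+ : ∀ n → 2 *' n ≡ n +' n
2*≡+ n = cong (n +'_) (N.+-identityʳ n)

-- Dyadic blocks: the 2^T terms that follow the first 2^T are each at most 1/2^T.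
harmonic : ∀ T → ∑ (rng (2 ^' T)) (λ j → inv « suc j ») ≤ « suc T »
harmonic zero = ≡⇒≤ (tr (+0 _) (tr (cong inv «1») (tr (sym (1* _)) (tr (*-inv Pos-1) (sym «1»)))))
harmonic (suc T) = ≡≤ (tr (cong (λ w → ∑ (rng w) (λ j → inv « suc j »)) (2*≡+ n)) (∑-rng-+ n n (λ j → inv « suc j »))) (≤≡ (+-mono (≤≡ (∑-mono (rng n) (λ j → inv-anti (2^>0 T) (N.≤-trans (N.m≤m+n n j) (N.n≤1+n _)))) (tr (∑-const (rng n) (inv « n »)) (tr (cong (λ w → « w » * inv « n ») (length-rng n)) (*-inv («»-pos (2^>0 T)))))) (harmonic T)) (sym («suc» (suc T))))
 where n = 2 ^' T

-- ⌈log₂ p⌉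
lg : ℕ → ℕ
lg-step : ∀ p w → Dec (suc p ≤' 2 ^' w) → ℕ
lg-step p w (yes _) = w
lg-step p w (no _) = suc w
lg zero = 0
lg (suc p) = lg-step p (lg p) (suc p ℕ.≤? 2 ^' lg p)

lg-up : ∀ p → p ≤' 2 ^' lg p
lg-up zero = z≤n
lg-up (suc p) = go (suc p ℕ.≤? 2 ^' lg p)
 where
  go : (d : Dec (suc p ≤' 2 ^' lg p)) → suc p ≤' 2 ^' lg-step p (lg p) d
  go (yes l) = l
  go (no _) = N.≤-trans (N.+-mono-≤ (2^>0 (lg p)) (lg-up p)) (N.≤-reflexive (sym (2*≡+ (2 ^' lg p))))

lg-low : ∀ p J → p ≤' 2 ^' J → lg p ≤' J
lg-low zero J _ = z≤n
lg-low (suc p) J l = go (suc p ℕ.≤? 2 ^' lg p)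
 where
  ih = lg-low p J (N.<⇒≤ l)
  go : (d : Dec (suc p ≤' 2 ^' lg p)) → lg-step p (lg p) d ≤' J
  go (yes _) = ih
  go (no nl) = N.≤∧≢⇒< ih (λ e → nl (subst (λ w → suc p ≤' 2 ^' w) (sym e) l))

-- Chebyshev's upper bound for primes.

nCk≤2^n : ∀ n k → n choose k ≤' 2 ^' n
nCk≤2^n zero zero = N.≤-refl
nCk≤2^n zero (suc k) = z≤n
nCk≤2^n (suc n) zero = 2^>0 (suc n)
nCk≤2^n (suc n) (suc k) = N.≤-trans (N.≤-reflexive (sym (nCk+nC[k+1]≡[n+1]C[k+1] n k))) (N.≤-trans (N.+-mono-≤ (nCk≤2^n n k) (nCk≤2^n n (suc k))) (N.≤-reflexive (sym (2*≡+ (2 ^' n)))))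

central : ∀ n → ((n +' n) choose n) *' (n ! *' n !) ≡ (n +' n) !
central n = tr (cong2 _*'_ (nCk≡n!/k![n-k]! {n +' n} {n} (N.m≤m+n n n)) (cong (λ w → n ! *' w !) (sym (N.m+n∸n≡m n n)))) (m/n*n≡m {{n !* (n +' n ∸' n) !≢0}} (k![n∸k]!∣n! (N.m≤m+n n n)))

∣! : ∀ {m} n → 1 ≤' m → m ≤' n → m ∣ n !
∣! {suc m} n _ l = Dv.∣-trans (Dv.m∣m*n (m !)) (Dv.m≤n⇒m!∣n! l)

prime∤! : ∀ {p} n → Prime p → n <' p → ¬ (p ∣ n !)
prime∤! {p} zero pr l d = N.<⇒≱ (ℕ.nonTrivial⇒n>1 p {{prime⇒nonTrivial pr}}) (Dv.∣⇒≤ d)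
prime∤! {p} (suc n) pr l d = go (euclidsLemma (suc n) (n !) pr d)
 where
  go : (p ∣ suc n) ⊎ (p ∣ n !) → ⊥
  go (inj₁ x) = N.<⇒≱ l (Dv.∣⇒≤ x)
  go (inj₂ y) = prime∤! n pr (N.<⇒≤ l) y

prime∣central : ∀ {p} n → Prime p → n <' p → p ≤' n +' n → p ∣ (n +' n) choose n
prime∣central {p} n pr l u = go (euclidsLemma ((n +' n) choose n) (n ! *' n !) pr (subst (p ∣_) (sym (central n)) (∣! (n +' n) (N.≤-trans (s≤s z≤n) l) u)))
 where
  no' = prime∤! n pr l
  go : (p ∣ (n +' n) choose n) ⊎ (p ∣ n ! *' n !) → p ∣ (n +' n) choose n
  go (inj₁ x) = x
  go (inj₂ y) = ⊥-elim (h (euclidsLemma (n !) (n !) pr y))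
   where
    h : (p ∣ n !) ⊎ (p ∣ n !) → ⊥
    h (inj₁ x) = no' x
    h (inj₂ x) = no' x

product∣ : ∀ ps m → All Prime ps → Unique ps → All (_∣ m) ps → product ps ∣ m
product∣ [] m _ _ _ = Dv.1∣ m
product∣ (p ∷ ps) _ (pr ∷ prs) (u ∷ us) (divides m' refl ∷ ds) = subst (_∣ m' *' p) (N.*-comm (product ps) p) (Dv.*-monoˡ-∣ p (product∣ ps m' prs us (All.tabulate (λ {p'} mem → go mem (euclidsLemma m' p (All.lookup prs mem) (All.lookup ds mem))))))
 where
  go : ∀ {p'} → p' ∈ ps → (p' ∣ m') ⊎ (p' ∣ p) → p' ∣ m'
  go _ (inj₁ x) = x
  go mem (inj₂ y) = ⊥-elim (prime∤prime pr (All.lookup prs mem) (All.lookup u mem) y)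

^≤product : ∀ n ps → All (n ≤'_) ps → n ^' length ps ≤' product ps
^≤product n [] _ = N.≤-refl
^≤product n (p ∷ ps) (l ∷ ls) = N.*-mono-≤ l (^≤product n ps ls)

blk : ℕ → List ℕ
blk n = filter sieveP? (map (suc n +'_) (rng n))

blk-∈ : ∀ n {p} → p ∈ blk n → Prime p × n <' p × p ≤' n +' n × 5 ≤' p
blk-∈ n {p} m = go (∈-map⁻ (suc n +'_) (fst w))
 where
  w = ∈-filter⁻ sieveP? {xs = map (suc n +'_) (rng n)} m
  go : _ → Prime p × n <' p × p ≤' n +' n × 5 ≤' p
  go (j , mj , refl) = snd (snd w) , N.m≤m+n (suc n) j , N.≤-trans (N.≤-reflexive (sym (N.+-suc n j))) (N.+-monoʳ-≤ n (∈rng mj)) , fst (snd w)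

-- The primes in (n, 2n] divide the central binomial coefficient, which is at most 4ⁿ, and each
-- exceeds n; with n = 2^J the exponents of 2 can be compared.
blk-count : ∀ J → J *' length (blk (2 ^' J)) ≤' 2 *' 2 ^' J
blk-count J = go (J *' length b ℕ.≤? 2 *' n)
 where
  n = 2 ^' J
  b = blk n
  C>0 : 1 ≤' (n +' n) choose n
  C>0 = h ((n +' n) choose n) (central n)
   where
    h : ∀ c → c *' (n ! *' n !) ≡ (n +' n) ! → 1 ≤' c
    h zero e = ⊥-elim (ℕ.≢-nonZero⁻¹ ((n +' n) !) {{(n +' n) !≢0}} (sym e))
    h (suc c) _ = s≤s z≤n
  bound : 2 ^' (J *' length b) ≤' 2 ^' (2 *' n)
  bound = N.≤-trans (N.≤-reflexive (sym (N.^-*-assoc 2 J (length b)))) (N.≤-trans (^≤product n b (All.tabulate (λ m → N.<⇒≤ (fst (snd (blk-∈ n m)))))) (N.≤-trans (Dv.∣⇒≤ {{ℕ.>-nonZero C>0}} (product∣ b ((n +' n) choose n) (All.tabulate (λ m → fst (blk-∈ n m))) (UP.filter⁺ sieveP? (UP.map⁺ (λ {x} {y} → N.+-cancelˡ-≡ (suc n) x y) (rng-unique n))) (All.tabulate (λ m → prime∣central n (fst (blk-∈ n m)) (fst (snd (blk-∈ n m))) (fst (snd (snd (blk-∈ n m)))))))) (N.≤-trans (nCk≤2^n (n +' n) n) (N.≤-reflexive (cong (2 ^'_) (sym (2*≡+ n)))))))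
  go : Dec (J *' length b ≤' 2 *' n) → J *' length b ≤' 2 *' n
  go (yes l) = l
  go (no l) = ⊥-elim (N.<⇒≱ (N.^-monoʳ-< 2 (s≤s (s≤s z≤n)) (N.≰⇒> l)) bound)

E-term : ℕ → F
E-term p = iv (sieveP? p) * (« lg p » * inv « p »)

E-term≥0 : ∀ p → 0F ≤ E-term p
E-term≥0 p = go (sieveP? p)
 where
  go : Dec (5 ≤' p × Prime p) → 0F ≤ E-term p
  go (yes (l , _)) = 0≤* (iv≥0 _) (0≤* («»≥0 (lg p)) (inv≥0 («»-pos (N.≤-trans (s≤s z≤n) l))))
  go (no np) = ≡⇒≤ (sym (tr (cong (_* (« lg p » * inv « p »)) (iv-no (sieveP? p) np)) (zeroˡ _)))

-- At most 2 · 2^J / J primes, each of weight at most (J + 1)/2^J, and J + 1 ≤ 2 J. The case J = 0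
-- is separate: (1, 2] has no prime from 5 on.
blk-bound : ∀ J → ∑ (blk (2 ^' J)) (λ p → « lg p » * inv « p ») ≤ « 4 »
blk-bound zero = tr≤ (∑-mono∈ (blk 1) {f = λ p → « lg p » * inv « p »} {g = λ _ → 0F} (λ {p} m → ⊥-elim (N.<⇒≱ (from-yes (2 ℕ.<? 5)) (N.≤-trans (snd (snd (snd (blk-∈ 1 m)))) (fst (snd (snd (blk-∈ 1 m)))))))) (≡≤ (∑-0 (blk 1)) («»≥0 4))
blk-bound (suc J') = tr≤ (∑-mono∈ (blk n) {f = λ p → « lg p » * inv « p »} {g = λ _ → « suc Jₛ » * inv « n »} (λ {p} m → *-mono («»≥0 (lg p)) (inv≥0 («»-pos (N.≤-trans (s≤s z≤n) (fst (snd (blk-∈ n m)))))) («»-mono (lg-low p (suc Jₛ) (N.≤-trans (fst (snd (snd (blk-∈ n m)))) (N.≤-reflexive (sym (2*≡+ n)))))) (inv-anti (2^>0 Jₛ) (N.<⇒≤ (fst (snd (blk-∈ n m)))))))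
 (≡≤ (tr (∑-const (blk n) (« suc Jₛ » * inv « n »)) (tr (sym (*-assoc _ _ _)) (cong (_* inv « n ») (sym («*» (length (blk n)) (suc Jₛ)))))) (*-cancel-≤ « n » np (≡≤ (tr (solve 3 (λ n x i → n :* (x :* i) := x :* (n :* i)) refl « n » « length (blk n) *' suc Jₛ » (inv « n »)) (tr (cong (« length (blk n) *' suc Jₛ » *_) (*-inv np)) (*1 _))) (≤≡ («»-mono cnt) («*» n 4)))))
 where
  Jₛ = suc J'
  n = 2 ^' Jₛ
  np : Pos « n »
  np = «»-pos (2^>0 Jₛ)
  cnt : length (blk n) *' suc Jₛ ≤' n *' 4
  cnt = N.≤-trans (N.*-monoʳ-≤ (length (blk n)) (N.≤-trans (N.+-monoˡ-≤ Jₛ (s≤s (z≤n {J'}))) (N.≤-reflexive (sym (2*≡+ Jₛ))))) (N.≤-trans (N.≤-reflexive (solveN 2 (λ l j → l :*' (con' 2 :*' j) :=' con' 2 :*' (j :*' l)) refl (length (blk n)) Jₛ)) (N.≤-trans (N.*-monoʳ-≤ 2 (blk-count Jₛ)) (N.≤-reflexive (solveN 1 (λ n → con' 2 :*' (con' 2 :*' n) :=' n :*' con' 4) refl n))))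

E-dyadic : ∀ J → ∑ (rng (suc (2 ^' J))) E-term ≤ « 4 » * « J »
E-dyadic zero = ≡⇒≤ (tr (cong2 (λ a b → a + (b + 0F)) (z 1 (λ h → N.<⇒≱ (from-yes (1 ℕ.<? 5)) (fst h))) (z 0 (λ h → N.<⇒≱ (from-yes (0 ℕ.<? 5)) (fst h)))) (tr (solve 0 (:0 :+ (:0 :+ :0) := :0) refl) (tr (sym (zeroʳ « 4 »)) (cong (« 4 » *_) (sym «0»)))))
 where
  z : ∀ p → ¬ (5 ≤' p × Prime p) → E-term p ≡ 0F
  z p h = tr (cong (_* (« lg p » * inv « p »)) (iv-no (sieveP? p) h)) (zeroˡ _)
E-dyadic (suc J) = ≡≤ (tr (cong (λ w → ∑ (rng w) E-term) (tr (cong suc (2*≡+ n)) (sym (N.+-suc n n)))) (∑-rng-+ n (suc n) E-term)) (≤≡ (+-mono (≡≤ (tr (sym (∑-map (suc n +'_) (rng n) E-term)) (sym (∑-filter sieveP? (map (suc n +'_) (rng n)) (λ p → « lg p » * inv « p »)))) (blk-bound J)) (E-dyadic J)) (tr (solve 2 (λ f j → f :+ f :* j := f :* (:1 :+ j)) refl « 4 » « J ») (cong (« 4 » *_) (sym («suc» J)))))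
 where n = 2 ^' J

-- The upper bound in Mertens' first theorem, with binary logarithms rounded up.
E-primes : ∀ J → ∑ (primesTo (2 ^' J)) (λ p → « lg p » * inv « p ») ≤ « 4 » * « suc J »
E-primes J = ≡≤ (∑-filter sieveP? (rng (2 +' 2 ^' J)) _) (tr≤ (∑-rng-mono (2 +' 2 ^' J) _ E-term E-term≥0 (s≤s (N.≤-trans (N.+-monoˡ-≤ (2 ^' J) (2^>0 J)) (N.≤-reflexive (sym (2*≡+ (2 ^' J))))))) (E-dyadic (suc J)))

-- The total size of the sieve coefficients.

V : List ℕ → F
V [] = 1F
V (p ∷ ps) = (1F + inv « p ») * V ps

V≥0 : ∀ ps → All (1 ≤'_) ps → 0F ≤ V ps
V≥0 [] _ = 0≤1
V≥0 (p ∷ ps) (l ∷ ls) = 0≤* (0≤+ 0≤1 (inv≥0 («»-pos l))) (V≥0 ps ls)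

terms-cost : ∀ ps → All (1 ≤'_) ps → ∑ (terms ps) (λ t → abs (snd (snd t))) ≤ V ps
terms-cost [] _ = ≡⇒≤ (tr (+0 _) (∣∣-real 0≤1))
terms-cost (p ∷ ps) (l ∷ ls) = ≡≤ (tr (∑-++ (terms ps) (map (tw p) (terms ps)) _) (cong (∑ (terms ps) (λ t → abs (snd (snd t))) +_) (∑-map (tw p) (terms ps) _))) (≤≡ (+-mono ih (tr≤ (∑-mono (terms ps) (λ t → one (snd (snd t)))) (≡≤ (∑-* (terms ps) (inv « p ») _) (*-monoˡ _ ip ih)))) (solve 2 (λ i v → v :+ i :* v := (:1 :+ i) :* v) refl (inv « p ») (V ps)))
 where
  ih = terms-cost ps ls
  ip : 0F ≤ inv « p »
  ip = inv≥0 («»-pos l)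
  one : ∀ c → abs (- βp p * c) ≤ inv « p » * abs c
  one c = tr≤ (∣∣-* _ _) (*-monoʳ _ (∣∣≥0 c) (≡≤ (∣∣-neg (βp p)) (tr≤ (∣∣-* _ _) (≤≡ (*-mono (∣∣≥0 _) (∣∣≥0 _) (abs-bt (sp p) p) (≡⇒≤ (∣∣-real ip))) (1* _)))))

-- squarefree products d of the primes, with a weight l such that d ≤ 2 ^ l
dvs : List ℕ → List (ℕ × ℕ)
dvs [] = (1 , 0) ∷ []
dvs (p ∷ ps) = dvs ps ++ map (λ t → p *' fst t , lg p +' snd t) (dvs ps)

dvs-ok : ∀ ps → All (1 ≤'_) ps → All (λ t → 1 ≤' fst t × fst t ≤' 2 ^' snd t) (dvs ps)
dvs-ok [] _ = (s≤s z≤n , s≤s z≤n) ∷ []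
dvs-ok (p ∷ ps) (l ∷ ls) = AllP.++⁺ ih (AllP.map⁺ (All.map (λ {t} h → N.*-mono-≤ {1} {p} {1} {fst t} l (fst h) , N.≤-trans (N.*-mono-≤ (lg-up p) (snd h)) (N.≤-reflexive (sym (N.^-distribˡ-+-* 2 (lg p) (snd t))))) ih))
 where ih = dvs-ok ps ls

dvs-V : ∀ ps → All (1 ≤'_) ps → ∑ (dvs ps) (λ t → inv « fst t ») ≡ V ps
dvs-V [] _ = tr (+0 _) (tr (cong inv «1») (tr (sym (1* _)) (*-inv Pos-1)))
dvs-V (p ∷ ps) (l ∷ ls) = tr (∑-++ (dvs ps) _ _) (tr (cong2 _+_ (dvs-V ps ls) (tr (∑-map _ (dvs ps) _) (tr (∑-cong∈ (dvs ps) (λ {t} m → inv-* p (fst t) l (fst (All.lookup (dvs-ok ps ls) m)))) (tr (∑-* (dvs ps) (inv « p ») _) (cong (inv « p » *_) (dvs-V ps ls)))))) (solve 2 (λ i v → v :+ i :* v := (:1 :+ i) :* v) refl (inv « p ») (V ps)))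

-- Under weights proportional to 1/d, a prime p occurs in d with probability (1/p)/(1 + 1/p) ≤ 1/p,
-- and the logarithmic weight of d is the sum over its primes.
dvs-L : ∀ ps → All (1 ≤'_) ps → ∑ (dvs ps) (λ t → « snd t » * inv « fst t ») ≤ V ps * ∑ ps (λ p → « lg p » * inv « p »)
dvs-L [] _ = ≡⇒≤ (tr (+0 _) (tr (cong (_* inv « 1 ») «0») (tr (zeroˡ _) (sym (zeroʳ _)))))
dvs-L (p ∷ ps) (l ∷ ls) = ≡≤ (tr (∑-++ (dvs ps) _ _) (cong (X +_) (tr (∑-map _ (dvs ps) _) (tr (∑-cong∈ (dvs ps) (λ {t} m → tr (cong2 _*_ («+» (lg p) (snd t)) (inv-* p (fst t) l (fst (All.lookup (dvs-ok ps ls) m)))) (solve 4 (λ w x i j → (w :+ x) :* (i :* j) := (w :* i) :* j :+ i :* (x :* j)) refl « lg p » « snd t » (inv « p ») (inv « fst t »)))) (tr (∑-+ (dvs ps) _ _) (cong2 _+_ (tr (∑-* (dvs ps) (« lg p » * inv « p ») _) (cong (« lg p » * inv « p » *_) (dvs-V ps ls))) (∑-* (dvs ps) (inv « p ») _)))))))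
 (tr≤ (+-mono (dvs-L ps ls) (+-mono ≤-refl (*-monoˡ (inv « p ») ip (dvs-L ps ls)))) (≤-by (inv « p » * (V ps * (« lg p » * inv « p »))) (0≤* ip (0≤* (V≥0 ps ls) (0≤* («»≥0 _) ip))) (solve 4 (λ v e w i → v :* e :+ ((w :* i) :* v :+ i :* (v :* e)) :+ i :* (v :* (w :* i)) := ((:1 :+ i) :* v) :* (w :* i :+ e)) refl (V ps) (∑ ps (λ p → « lg p » * inv « p »)) « lg p » (inv « p »))))
 where
  X = ∑ (dvs ps) (λ t → « snd t » * inv « fst t »)
  ip : 0F ≤ inv « p »
  ip = inv≥0 («»-pos l)

dvs-coprime : ∀ {p} ps → Prime p → All Prime ps → All (λ p' → p ≢ p') ps → All (λ t → ¬ (p ∣ fst t)) (dvs ps)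
dvs-coprime {p} [] pr _ _ = (λ d → N.<⇒≱ (ℕ.nonTrivial⇒n>1 p {{prime⇒nonTrivial pr}}) (Dv.∣⇒≤ d)) ∷ []
dvs-coprime {p} (p' ∷ ps) pr (pr' ∷ prs) (u ∷ us) = AllP.++⁺ ih (AllP.map⁺ (All.map (λ {t} h d → go (fst t) h (euclidsLemma p' (fst t) pr d)) ih))
 where
  ih = dvs-coprime ps pr prs us
  go : ∀ t → ¬ (p ∣ t) → (p ∣ p') ⊎ (p ∣ t) → ⊥
  go t h (inj₁ x) = prime∤prime pr' pr (λ e → u (sym e)) x
  go t h (inj₂ y) = h y

dvs-unique : ∀ ps → All Prime ps → Unique ps → Unique (map fst (dvs ps))
dvs-unique [] _ _ = [] ∷ []
dvs-unique (p ∷ ps) (pr ∷ prs) (u ∷ us) = subst Unique (sym (tr (LP.map-++ fst (dvs ps) _) (cong (map fst (dvs ps) ++_) (tr (sym (LP.map-∘ (dvs ps))) (LP.map-∘ {g = p *'_} {f = fst} (dvs ps))))))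
 (UP.++⁺ ih (UP.map⁺ (λ {x} {y} e → N.*-cancelˡ-≡ x y p {{prime⇒nonZero pr}} e) ih) (λ {x} h → dis (fst h) (∈-map⁻ (p *'_) (snd h))))
 where
  ih = dvs-unique ps prs us
  dis : ∀ {x} → x ∈ map fst (dvs ps) → (∃ λ y → y ∈ map fst (dvs ps) × x ≡ p *' y) → ⊥
  dis m (y , _ , refl) = All.lookup (AllP.map⁺ (dvs-coprime ps pr prs u)) m (Dv.m∣m*n y)

-- Weight at most T forces d ≤ 2^T, and the d are distinct, so this is part of a harmonic sum.
smooth-harmonic : ∀ ps T → All (1 ≤'_) ps → All Prime ps → Unique ps → ∑ (dvs ps) (λ t → iv (snd t ℕ.≤? T) * inv « fst t ») ≤ « suc T »
smooth-harmonic ps T l1 prs us = tr≤ (∑-mono∈ (dvs ps) (λ {t} m → one t (All.lookup (dvs-ok ps l1) m))) (≡≤ (sym (tr (∑-filter (λ d → d ℕ.≤? 2 ^' T) (map fst (dvs ps)) (λ d → inv « d »)) (∑-map fst (dvs ps) _)))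
 (tr≤ (tr≤ (∑-mono∈ ds {g = h} (λ {d} m → ≡⇒≤ (hd d (fst (rd m))))) (∑-sub ds (map suc (rng (2 ^' T))) h h≥0 (UP.filter⁺ (λ d → d ℕ.≤? 2 ^' T) (dvs-unique ps prs us)) (λ {d} m → mem d (rd m)))) (≡≤ (tr (∑-map suc (rng (2 ^' T)) h) (∑-cong (rng (2 ^' T)) (λ j → sym (hd (suc j) (s≤s z≤n))))) (harmonic T))))
 where
  ds = filter (λ d → d ℕ.≤? 2 ^' T) (map fst (dvs ps))
  h : ℕ → F
  h d = iv (1 ℕ.≤? d) * inv « d »
  hd : ∀ d → 1 ≤' d → inv « d » ≡ h d
  hd d l = tr (sym (1* _)) (cong (_* inv « d ») (sym (iv-yes (1 ℕ.≤? d) l)))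
  h≥0 : ∀ d → 0F ≤ h d
  h≥0 d = case-dec (1 ℕ.≤? d) (λ l → ≤≡ (inv≥0 («»-pos l)) (hd d l)) (λ nl → ≡⇒≤ (sym (tr (cong (_* inv « d ») (iv-no (1 ℕ.≤? d) nl)) (zeroˡ _))))
  rd : ∀ {d} → d ∈ ds → (1 ≤' d) × (d ≤' 2 ^' T)
  rd {d} m = All.lookup (AllP.map⁺ (All.map fst (dvs-ok ps l1))) (fst w) , snd w
   where w = ∈-filter⁻ (λ d → d ℕ.≤? 2 ^' T) {xs = map fst (dvs ps)} m
  mem : ∀ d → (1 ≤' d) × (d ≤' 2 ^' T) → d ∈ map suc (rng (2 ^' T))
  mem (suc d) (_ , l) = ∈-map⁺ suc (rng∈ l)
  mem zero (() , _)
  one : ∀ t → (1 ≤' fst t) × (fst t ≤' 2 ^' snd t) → iv (snd t ℕ.≤? T) * inv « fst t » ≤ iv (fst t ℕ.≤? 2 ^' T) * inv « fst t »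
  one (d , l) (d1 , dl) = *-monoʳ (inv « d ») (inv≥0 («»-pos d1)) (go (l ℕ.≤? T))
   where
    go : Dec (l ≤' T) → iv (l ℕ.≤? T) ≤ iv (d ℕ.≤? 2 ^' T)
    go (yes x) = ≡⇒≤ (tr (iv-yes (l ℕ.≤? T) x) (sym (iv-yes (d ℕ.≤? 2 ^' T) (N.≤-trans dl (N.^-monoʳ-≤ 2 x)))))
    go (no x) = ≡≤ (iv-no (l ℕ.≤? T) x) (iv≥0 _)

-- The average of log d over the squarefree d with weights 1/d is at most E, so at least half of the weight
-- sits on d ≤ 2 ^ (2E), where it is bounded by the harmonic sum.
sieve-cost : ∀ J → ∑ (terms (primesTo (2 ^' J))) (λ t → abs (snd (snd t))) ≤ « 2 *' (8 *' suc J) »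
sieve-cost J = tr≤ (terms-cost ps l1) (≤≡ (≤-by (ι 2ℚ * « suc T » - v) (0≤- half') (solve 2 (λ t v → v :+ (:2 :* t :- v) := :2 :* t) refl « suc T » v)) (sym (tr («*» 2 (8 *' suc J)) (cong2 _*_ («»-ι 2) (cong «_» Te)))))
 where
  ps = primesTo (2 ^' J)
  v = V ps
  -- T + 1 = 8 (J + 1) is twice the bound 4 (J + 1) for the mean weight, so by Markov's inequality
  -- the d of weight above T carry at most half of `v`.
  T = 7 +' 8 *' J
  Te : 8 *' suc J ≡ suc T
  Te = N.*-suc 8 J
  prs : All Prime ps
  prs = All.map fst (primesTo-good (2 ^' J))
  l1 : All (1 ≤'_) ps
  l1 = All.map (λ {p} pr → ℕ.>-nonZero⁻¹ p {{prime⇒nonZero pr}}) prs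
  Tp : Pos « suc T »
  Tp = «suc»-pos T
  one : ∀ d l → 1 ≤' d → inv « d » ≤ iv (l ℕ.≤? T) * inv « d » + inv « suc T » * (« l » * inv « d »)
  one d l d1 = go (l ℕ.≤? T)
   where
    ip = inv≥0 («»-pos d1)
    go : Dec (l ≤' T) → inv « d » ≤ iv (l ℕ.≤? T) * inv « d » + inv « suc T » * (« l » * inv « d »)
    go (yes x) = ≤-by (inv « suc T » * (« l » * inv « d »)) (0≤* (inv≥0 Tp) (0≤* («»≥0 l) ip)) (cong (_+ inv « suc T » * (« l » * inv « d »)) (sym (tr (cong (_* inv « d ») (iv-yes (l ℕ.≤? T) x)) (1* _))))
    go (no x) = tr≤ (≡≤ (tr (sym (1* _)) (cong (_* inv « d ») (tr (sym (*-inv Tp)) (*-comm _ _)))) (≤≡ (*-monoʳ _ ip (*-monoˡ _ (inv≥0 Tp) («»-mono (N.≰⇒> x)))) (*-assoc _ _ _))) (≤-by (iv (l ℕ.≤? T) * inv « d ») (0≤* (iv≥0 _) ip) (+-comm _ _))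
  split : v ≤ « suc T » + inv « suc T » * (v * (« 4 » * « suc J »))
  split = ≡≤ (sym (dvs-V ps l1)) (tr≤ (∑-mono∈ (dvs ps) (λ {t} m → one (fst t) (snd t) (fst (All.lookup (dvs-ok ps l1) m)))) (≡≤ (tr (∑-+ (dvs ps) _ _) (cong (∑ (dvs ps) (λ t → iv (snd t ℕ.≤? T) * inv « fst t ») +_) (∑-* (dvs ps) (inv « suc T ») _))) (+-mono (smooth-harmonic ps T l1 prs (primesTo-unique (2 ^' J))) (*-monoˡ _ (inv≥0 Tp) (tr≤ (dvs-L ps l1) (*-monoˡ v (V≥0 ps l1) (E-primes J)))))))
  halve : inv « suc T » * (v * (« 4 » * « suc J »)) ≡ ι ℚ.½ * v
  halve = tr (cong (λ w → inv « suc T » * (v * w)) (sym e)) (tr (solve 3 (λ i v t → i :* (v :* (con ℚ.½ :* t)) := con ℚ.½ :* v :* (t :* i)) refl (inv « suc T ») v « suc T ») (tr (cong (ι ℚ.½ * v *_) (*-inv Tp)) (*1 _)))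
   where
    e : ι ℚ.½ * « suc T » ≡ « 4 » * « suc J »
    e = tr (cong (λ w → ι ℚ.½ * « w ») (sym Te)) (tr (cong (ι ℚ.½ *_) (tr («*» 8 (suc J)) (cong (_* « suc J ») («»-ι 8)))) (tr (solve 1 (λ j → con ℚ.½ :* (con (# 8) :* j) := con (# 4) :* j) refl « suc J ») (cong (_* « suc J ») (sym («»-ι 4)))))
  half' : v ≤ ι 2ℚ * « suc T »
  half' = tr≤ (≤-by ((« suc T » + ι ℚ.½ * v - v) + (« suc T » + ι ℚ.½ * v - v)) (0≤+ h h) (solve 2 (λ t v → v :+ ((t :+ con ℚ.½ :* v :- v) :+ (t :+ con ℚ.½ :* v :- v)) := :2 :* t) refl « suc T » v)) ≤-refl
   where
    h : 0F ≤ « suc T » + ι ℚ.½ * v - v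
    h = 0≤- (≤≡ split (cong (« suc T » +_) halve))

-- Reduced ratios, prime powers, sums over pairs.

record Prim (a b : ℕ) : Set where
 constructor prim
 field
  y x g : ℕ
  ay : a ≡ y *' g
  bx : b ≡ x *' g
  cop : Coprime y x

primPart : ∀ a b → 1 ≤' a → Prim a b
primPart a b a1 = prim (a / gcd a b) (b / gcd a b) (gcd a b) (sym (m/n*n≡m (gcd[m,n]∣m a b))) (sym (m/n*n≡m (gcd[m,n]∣n a b))) (coprime-/gcd a b)
 where
  instance
   nz : ℕ.NonZero (gcd a b)
   nz = ℕ.≢-nonZero (gcd[m,n]≢0 a b (inj₁ (ℕ.≢-nonZero⁻¹ a {{ℕ.>-nonZero a1}})))

factor≥1 : ∀ {a} u v → 1 ≤' a → a ≡ u *' v → 1 ≤' u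
factor≥1 zero v a1 e = ⊥-elim (N.<⇒≱ a1 (N.≤-reflexive e))
factor≥1 (suc u) v _ _ = s≤s z≤n

factor≥1ʳ : ∀ {a} u v → 1 ≤' a → a ≡ u *' v → 1 ≤' v
factor≥1ʳ u v a1 e = factor≥1 v u a1 (tr e (N.*-comm u v))

prime-power-cancel : ∀ {p} → Prime p → ∀ k {x g} → ¬ (p ∣ x) → p ^' k ∣ x *' g → p ^' k ∣ g
prime-power-cancel pr zero nx d = Dv.1∣ _
prime-power-cancel {p} pr (suc k) {x} {g} nx d = go (euclidsLemma x g pr (Dv.∣-trans (Dv.m∣m*n (p ^' k)) d))
 where
  go : (p ∣ x) ⊎ (p ∣ g) → p ^' suc k ∣ g
  go (inj₁ a) = ⊥-elim (nx a)
  go (inj₂ (divides g' refl)) = subst (p ^' suc k ∣_) (N.*-comm p g') (Dv.*-monoʳ-∣ p (prime-power-cancel pr k nx (Dv.*-cancelˡ-∣ p {{prime⇒nonZero pr}} (subst (p *' p ^' k ∣_) (tr (cong (x *'_) (N.*-comm g' p)) (tr (sym (N.*-assoc x p g')) (tr (cong (_*' g') (N.*-comm x p)) (N.*-assoc p x g')))) d))))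

max-power : ∀ p g → 2 ≤' p → 1 ≤' g → Σ ℕ λ e → (p ^' e ∣ g) × ¬ (p ^' suc e ∣ g)
max-power p g p2 g1 = go g 0 (Dv.1∣ g) (subst (λ w → g <' p ^' w) (sym (N.+-identityʳ g)) (grow g))
 where
  grow : ∀ n → n <' p ^' n
  grow zero = s≤s z≤n
  grow (suc n) = N.≤-trans (N.+-mono-≤ (N.≤-trans (s≤s z≤n) (grow n)) (grow n)) (N.≤-trans (N.≤-reflexive (sym (2*≡+ (p ^' n)))) (N.*-monoˡ-≤ (p ^' n) p2))
  go : ∀ fuel e → p ^' e ∣ g → g <' p ^' (fuel +' e) → Σ ℕ λ e → (p ^' e ∣ g) × ¬ (p ^' suc e ∣ g)
  go zero e d l = ⊥-elim (N.<⇒≱ l (Dv.∣⇒≤ {{ℕ.>-nonZero g1}} d))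
  go (suc f) e d l = st (p ^' suc e ∣? g)
   where
    st : Dec (p ^' suc e ∣ g) → Σ ℕ λ e → (p ^' e ∣ g) × ¬ (p ^' suc e ∣ g)
    st (no nd) = e , d , nd
    st (yes d') = go f (suc e) d' (subst (λ w → g <' p ^' w) (sym (N.+-suc f e)) l)

sq-step : ∀ n → 1 ≤' n → inv « suc n » * inv « suc n » ≤ inv « n » - inv « suc n »
sq-step n n1 = ≤≡ (*-monoʳ _ (inv≥0 («suc»-pos n)) (inv-anti n1 (N.n≤1+n n))) (tr (sym (*1 _)) (tr (cong (inv « n » * inv « suc n » *_) one) (tr (solve 4 (λ i j s n → (i :* j) :* (s :- n) := i :* (s :* j) :- j :* (n :* i)) refl (inv « n ») (inv « suc n ») « suc n » « n ») (tr (cong2 (λ a b → inv « n » * a - inv « suc n » * b) (*-inv («suc»-pos n)) (*-inv («»-pos n1))) (cong2 _-_ (*1 _) (*1 _))))))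
 where
  one : 1F ≡ « suc n » - « n »
  one = tr (solve 1 (λ n → :1 := :1 :+ n :- n) refl « n ») (cong (_- « n ») (sym («suc» n)))

∑-inv² : ∀ Y → ∑ (rng (suc Y)) (λ t → inv « suc t » * inv « suc t ») + inv « suc Y » ≤ ι 2ℚ
∑-inv² zero = ≡⇒≤ (tr (cong (λ w → w * w + 0F + w) (tr (cong inv «1») (tr (sym (1* _)) (*-inv Pos-1)))) (solve 0 (:1 :* :1 :+ :0 :+ :1 := :2) refl))
∑-inv² (suc Y) = tr≤ (+-mono (+-mono (sq-step (suc Y) (s≤s z≤n)) ≤-refl) ≤-refl) (≡≤ (solve 3 (λ a b s → (a :- b :+ s) :+ b := s :+ a) refl (inv « suc Y ») (inv « suc (suc Y) ») (∑ (rng (suc Y)) (λ t → inv « suc t » * inv « suc t »))) (∑-inv² Y))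

∑-inv²≤2 : ∀ Y → ∑ (rng Y) (λ t → inv « suc t » * inv « suc t ») ≤ ι 2ℚ
∑-inv²≤2 zero = ι≥0 2ℚ
∑-inv²≤2 (suc Y) = tr≤ (≤-by (inv « suc Y ») (inv≥0 («suc»-pos Y)) refl) (∑-inv² Y)

rr-zero : ∀ P n → ¬ (1 <' n × Rough P n) → rr P n ≡ 0F
rr-zero P n h = case-dec (1 ℕ.<? n) (λ l → tr (cong (λ w → iv (1 ℕ.<? n) * w * inv « n ») (iv-no (rough? P n) (λ r → h (l , r)))) (solve 2 (λ a b → a :* :0 :* b := :0) refl (iv (1 ℕ.<? n)) (inv « n »))) (λ l → tr (cong (λ w → w * iv (rough? P n) * inv « n ») (iv-no (1 ℕ.<? n) l)) (solve 2 (λ a b → :0 :* a :* b := :0) refl (iv (rough? P n)) (inv « n »)))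

rr-≤ : ∀ P n → 1 ≤' n → rr P n ≤ inv « n »
rr-≤ P n n1 = ≤≡ (*-monoʳ _ (inv≥0 («»-pos n1)) (≤≡ (*-mono (iv≥0 _) (iv≥0 _) (iv≤1 (1 ℕ.<? n)) (iv≤1 (rough? P n))) (1* 1F))) (1* _)
 where
  iv≤1 : {X : Set} (d : Dec X) → iv d ≤ 1F
  iv≤1 d = go d
   where
    go : _ → iv d ≤ 1F
    go (yes x) = ≡⇒≤ (iv-yes d x)
    go (no x) = ≡≤ (iv-no d x) 0≤1

rough-∣ : ∀ P {d n} → d ∣ n → Rough P n → Rough P d
rough-∣ P dv r = All.map (λ h x → h (Dv.∣-trans x dv)) r

∑-pick≤ : ∀ Y c → ∑ (rng Y) (λ k → iv (c ℕ.≟ suc k)) ≤ 1F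
∑-pick≤ zero c = 0≤1
∑-pick≤ (suc Y) c = case-dec (c ℕ.≟ suc Y) (λ e → ≡⇒≤ (tr (cong2 _+_ (iv-yes (c ℕ.≟ suc Y) e) (∑-zero∈ (rng Y) (λ {k} m → iv-no (c ℕ.≟ suc k) (λ e' → N.<⇒≢ (∈rng m) (N.suc-injective (tr (sym e') e)))))) (+0 _))) (λ ne → ≡≤ (tr (cong (_+ ∑ (rng Y) (λ k → iv (c ℕ.≟ suc k))) (iv-no (c ℕ.≟ suc Y) ne)) (0+ _)) (∑-pick≤ Y c))

∑-at : ∀ Y Lq (f : ℕ → F) → 1 ≤' Lq → (∀ t → 0F ≤ f t) → ∑ (rng Y) (λ k → at Lq (suc k) f) ≤ ∑ (rng Y) (λ t → f (suc t))
∑-at Y Lq f L1 f0 = tr≤ (∑-mono∈ (rng Y) (λ {k} m → one k (∈rng m) (at? Lq (suc k)))) (≡≤ (∑-swap (rng Y) (rng Y) _) (∑-mono (rng Y) (λ t → ≡≤ (∑-* (rng Y) (f (suc t)) _) (≤≡ (*-monoˡ _ (f0 (suc t)) (∑-pick≤ Y (Lq *' suc t))) (*1 _)))))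
 where
  nn : ∀ k → ∀ t → 0F ≤ f (suc t) * iv (Lq *' suc t ℕ.≟ suc k)
  nn k t = 0≤* (f0 (suc t)) (iv≥0 _)
  one : ∀ k → k <' Y → At Lq (suc k) → at Lq (suc k) f ≤ ∑ (rng Y) (λ t → f (suc t) * iv (Lq *' suc t ℕ.≟ suc k))
  one k l (null nd) = ≡≤ (at-null Lq (suc k) f nd) (∑≥0 (rng Y) (nn k))
  one k l (mult zero e) = ⊥-elim (N.1+n≢0 (tr e (N.*-zeroʳ Lq)))
  one k l (mult (suc t) e) = ≡≤ (tr (cong (λ w → at Lq w f) e) (tr (at-mult Lq (suc t) f L1) (sym (tr (cong (f (suc t) *_) (iv-yes (Lq *' suc t ℕ.≟ suc k) (sym e))) (*1 _))))) (∑-term {xs = rng Y} {f = λ t → f (suc t) * iv (Lq *' suc t ℕ.≟ suc k)} (nn k) (rng∈ (N.≤-trans (N.≤-trans (N.m≤n*m (suc t) Lq {{ℕ.>-nonZero L1}}) (N.≤-reflexive (sym e))) l)))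

-- The pairs in the box up to 2^T are distinct, so their sum is at most the square of a harmonic
-- sum; the others number at most 2^T and each contributes at most 1/2^T.
pair-sum : ∀ T (Cs : List ℕ) (u v : ℕ → ℕ) → length Cs ≤' 2 ^' T → Unique (map (λ b → u b , v b) Cs) → All (λ b → 1 ≤' u b × 1 ≤' v b) Cs →
 ∑ Cs (λ b → inv « u b » * inv « v b ») ≤ « suc T » * « suc T » + 1F
pair-sum T Cs u v len uq ones = tr≤ (∑-mono∈ Cs (λ {b} m → one b (All.lookup ones m))) (≡≤ (∑-+ Cs _ _) (+-mono boxsum rest))
 where
  n = 2 ^' T
  h : ℕ × ℕ → F
  h t = (iv (1 ℕ.≤? fst t) * inv « fst t ») * (iv (1 ℕ.≤? snd t) * inv « snd t »)
  hinv≥0 : ∀ d → 0F ≤ iv (1 ℕ.≤? d) * inv « d »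
  hinv≥0 zero = ≡⇒≤ (sym (tr (cong (_* inv « 0 ») (iv-no (1 ℕ.≤? 0) (λ ()))) (zeroˡ _)))
  hinv≥0 (suc d) = 0≤* (iv≥0 _) (inv≥0 («suc»-pos d))
  hd : ∀ d → 1 ≤' d → iv (1 ℕ.≤? d) * inv « d » ≡ inv « d »
  hd d l = tr (cong (_* inv « d ») (iv-yes (1 ℕ.≤? d) l)) (1* _)
  box? : ∀ t → Dec (fst t ≤' n × snd t ≤' n)
  box? t = (fst t ℕ.≤? n) ×-dec (snd t ℕ.≤? n)
  pr : ℕ → ℕ × ℕ
  pr b = u b , v b
  one : ∀ b → (1 ≤' u b × 1 ≤' v b) → inv « u b » * inv « v b » ≤ iv (box? (pr b)) * h (pr b) + inv « n »
  one b (u1 , v1) = go (box? (pr b))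
   where
    he : h (pr b) ≡ inv « u b » * inv « v b »
    he = cong2 _*_ (hd (u b) u1) (hd (v b) v1)
    iu = inv≥0 («»-pos u1)
    iw = inv≥0 («»-pos v1)
    inn = inv≥0 («»-pos (2^>0 T))
    le1 : ∀ {d} → 1 ≤' d → inv « d » ≤ 1F
    le1 l = ≤≡ (inv-anti (s≤s z≤n) l) (tr (cong inv «1») (tr (sym (1* _)) (*-inv Pos-1)))
    small : n ≤' u b ⊎ n ≤' v b → inv « u b » * inv « v b » ≤ inv « n »
    small (inj₁ l) = ≤≡ (*-mono iu iw (inv-anti (2^>0 T) l) (le1 v1)) (*1 _)
    small (inj₂ l) = ≤≡ (*-mono iu iw (le1 u1) (inv-anti (2^>0 T) l)) (1* _)
    go : Dec (u b ≤' n × v b ≤' n) → inv « u b » * inv « v b » ≤ iv (box? (pr b)) * h (pr b) + inv « n »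
    go (yes y) = ≤-by (inv « n ») inn (cong (_+ inv « n ») (sym (tr (cong2 _*_ (iv-yes (box? (pr b)) y) he) (1* _))))
    go (no ny) = tr≤ (small (c (u b ℕ.≤? n))) (≤-by (iv (box? (pr b)) * h (pr b)) (0≤* (iv≥0 _) (≤≡ (0≤* iu iw) (sym he))) (+-comm _ _))
     where
      c : Dec (u b ≤' n) → n ≤' u b ⊎ n ≤' v b
      c (no x) = inj₁ (N.<⇒≤ (N.≰⇒> x))
      c (yes x) = inj₂ (N.<⇒≤ (N.≰⇒> (λ y → ny (x , y))))
  rest : ∑ Cs (λ _ → inv « n ») ≤ 1F
  rest = ≡≤ (∑-const Cs _) (≤≡ (*-monoʳ _ (inv≥0 («»-pos (2^>0 T))) («»-mono len)) (*-inv («»-pos (2^>0 T))))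
  rs = map suc (rng n)
  grid : List (ℕ × ℕ)
  grid = concatMap (λ i → map (i ,_) rs) rs
  inr : ∀ {d} → 1 ≤' d → d ≤' n → d ∈ rs
  inr {suc d} _ l = ∈-map⁺ suc (rng∈ l)
  inbox = filter box? (map pr Cs)
  ing : ∀ {t} → t ∈ inbox → t ∈ grid
  ing {t} m = go (∈-map⁻ pr (fst w))
   where
    w = ∈-filter⁻ box? {xs = map pr Cs} m
    go : (∃ λ b → b ∈ Cs × t ≡ pr b) → t ∈ grid
    go (b , mb , refl) = ∈-concatMap⁺ (λ i → map (i ,_) rs) {xs = rs} (lose (inr (fst (All.lookup ones mb)) (fst (snd w))) (∈-map⁺ (u b ,_) (inr (snd (All.lookup ones mb)) (snd (snd w)))))
  hs : ∑ rs (λ i → iv (1 ℕ.≤? i) * inv « i ») ≤ « suc T »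
  hs = ≡≤ (tr (∑-map suc (rng n) _) (∑-cong (rng n) (λ j → hd (suc j) (s≤s z≤n)))) (harmonic T)
  boxsum : ∑ Cs (λ b → iv (box? (pr b)) * h (pr b)) ≤ « suc T » * « suc T »
  boxsum = ≡≤ (tr (sym (∑-map pr Cs (λ t → iv (box? t) * h t))) (sym (∑-filter box? (map pr Cs) h))) (tr≤ (∑-sub inbox grid h (λ t → 0≤* (hinv≥0 (fst t)) (hinv≥0 (snd t))) (UP.filter⁺ box? uq) ing)
   (≡≤ (tr (∑-concatMap (λ i → map (i ,_) rs) rs h) (tr (∑-cong rs (λ i → tr (∑-map (i ,_) rs h) (∑-* rs (iv (1 ℕ.≤? i) * inv « i ») (λ j → iv (1 ℕ.≤? j) * inv « j »)))) (∑-*ʳ rs _ _))) (*-mono (∑≥0 rs hinv≥0) (∑≥0 rs hinv≥0) hs hs)))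

lg-mono : ∀ {a b} → a ≤' b → lg a ≤' lg b
lg-mono {a} {b} l = lg-low a (lg b) (N.≤-trans l (lg-up b))

-- The bookkeeping of a recursion that pays for the smaller part: 2 b ≤ b + c makes lg b at most lg
-- (b + c) - 1, which saves b.
lg-split : ∀ b c → 1 ≤' b → b ≤' c → b *' lg b +' c *' lg c +' b ≤' (b +' c) *' lg (b +' c)
lg-split b c b1 bc = go (lg (b +' c)) (lg-up (b +' c)) (lg-mono (N.m≤n+m c b))
 where
  go : ∀ m → b +' c ≤' 2 ^' m → lg c ≤' m → b *' lg b +' c *' lg c +' b ≤' (b +' c) *' m
  go zero l _ = ⊥-elim (N.<⇒≱ (N.≤-trans (N.+-mono-≤ b1 (N.≤-trans b1 bc)) N.≤-refl) l)
  go (suc m) l lc = N.≤-trans (N.+-monoˡ-≤ b (N.+-mono-≤ (N.*-monoʳ-≤ b (lg-low b m (N.*-cancelˡ-≤ 2 (N.≤-trans (N.≤-reflexive (2*≡+ b)) (N.≤-trans (N.+-monoʳ-≤ b bc) l))))) (N.*-monoʳ-≤ c lc))) (N.≤-reflexive (solveN 3 (λ b c m → (b :*' m :+' c :*' (con' 1 :+' m)) :+' b :=' (b :+' c) :*' (con' 1 :+' m)) refl b c m))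

unique-map∈ : {A B : Set} (f : A → B) {xs : List A} → Unique xs → (∀ {a b} → a ∈ xs → b ∈ xs → f a ≡ f b → a ≡ b) → Unique (map f xs)
unique-map∈ f {[]} _ _ = []
unique-map∈ f {x ∷ xs} (u ∷ us) inj = AllP.map⁺ (All.tabulate (λ m e → All.lookup u m (inj (here refl) (there m) e))) ∷ unique-map∈ f us (λ ma mb e → inj (there ma) (there mb) e)

∑-partition : {A : Set} {Q : A → Set} (Q? : ∀ a → Dec (Q a)) (xs : List A) (f : A → F) → ∑ xs f ≡ ∑ (filter Q? xs) f + ∑ (filter (λ a → ¬? (Q? a)) xs) f
∑-partition Q? [] f = sym (+0 _)
∑-partition Q? (x ∷ xs) f with Q? x
... | yes _ = tr (cong (f x +_) (∑-partition Q? xs f)) (sym (+-assoc _ _ _))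
... | no _ = tr (cong (f x +_) (∑-partition Q? xs f)) (solve 3 (λ a b c → a :+ (b :+ c) := b :+ (a :+ c)) refl (f x) _ _)

length-partition : {A : Set} {Q : A → Set} (Q? : ∀ a → Dec (Q a)) (xs : List A) → length (filter Q? xs) +' length (filter (λ a → ¬? (Q? a)) xs) ≡ length xs
length-partition Q? [] = refl
length-partition Q? (x ∷ xs) with Q? x
... | yes _ = cong suc (length-partition Q? xs)
... | no _ = tr (N.+-suc _ _) (cong suc (length-partition Q? xs))

-- Multiplicative energy along rough ratios.

module Energy (P Y : ℕ) (P1 : 1 ≤' P) where
 open Prim
 private r = rr P

 -- Correlation of the sieve tails attached to a and b; summed over pairs it is the mean square of
 -- the whole tail.
 cc : ℕ → ℕ → F
 cc a b = ∑ (rng Y) (λ k → at a (suc k) r * at b (suc k) r)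

 cc-sym : ∀ a b → cc a b ≡ cc b a
 cc-sym a b = ∑-cong (rng Y) (λ k → *-comm _ _)

 -- A common multiple k of a = y g and b = x g is a multiple of a x; for k = a x t the quotients k/a
 -- and k/b are x t and y t.
 joint : ∀ a b (pp : Prim a b) → 1 ≤' a → 1 ≤' b → ∀ k → at a k r * at b k r ≡ at (a *' x pp) k (λ t → r (x pp *' t) * r (y pp *' t))
 joint a b pp a1 b1 k = go (at? a k) (at? b k)
  where
   X = x pp
   Yy = y pp
   G = g pp
   x1 : 1 ≤' X
   x1 = factor≥1 X G b1 (bx pp)
   g1 : 1 ≤' G
   g1 = factor≥1ʳ X G b1 (bx pp)
   axby : a *' X ≡ b *' Yy
   axby = tr (cong (_*' X) (ay pp)) (tr (solveN 3 (λ y g x → (y :*' g) :*' x :=' (x :*' g) :*' y) refl Yy G X) (cong (_*' Yy) (sym (bx pp))))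
   H : ℕ → F
   H t = r (X *' t) * r (Yy *' t)
   go : At a k → At b k → at a k r * at b k r ≡ at (a *' X) k H
   go (null nd) _ = tr (cong (_* at b k r) (at-null a k r nd)) (tr (zeroˡ _) (sym (at-null (a *' X) k H (λ d → nd (Dv.∣-trans (Dv.m∣m*n X) d)))))
   go (mult n e) (null nd) = tr (cong (at a k r *_) (at-null b k r nd)) (tr (zeroʳ _) (sym (at-null (a *' X) k H (λ d → nd (Dv.∣-trans (Dv.m∣m*n Yy) (subst (_∣ k) axby d))))))
   go (mult n e) (mult m e') = fin (coprime-divisor (Cop.sym (cop pp)) (divides m (tr yn (N.*-comm X m))))
    where
     yn : Yy *' n ≡ X *' m
     yn = N.*-cancelˡ-≡ (Yy *' n) (X *' m) G {{ℕ.>-nonZero g1}} (tr (solveN 3 (λ g y n → g :*' (y :*' n) :=' (y :*' g) :*' n) refl G Yy n) (tr (cong (_*' n) (sym (ay pp))) (tr (sym e) (tr e' (tr (cong (_*' m) (bx pp)) (solveN 3 (λ g x m → (x :*' g) :*' m :=' g :*' (x :*' m)) refl G X m))))))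
     fin : X ∣ n → at a k r * at b k r ≡ at (a *' X) k H
     fin (divides t nt) = tr (cong2 _*_ (v a n e a1) (v b m e' b1)) (tr (cong2 (λ u w → r u * r w) (tr nt (N.*-comm t X)) my) (sym (tr (cong (λ w → at (a *' X) w H) (tr e (tr (cong (a *'_) (tr nt (N.*-comm t X))) (sym (N.*-assoc a X t))))) (at-mult (a *' X) t H (N.*-mono-≤ {1} {a} {1} {X} a1 x1)))))
      where
       v : ∀ a n → k ≡ a *' n → 1 ≤' a → at a k r ≡ r n
       v a n e a1 = tr (cong (λ w → at a w r) e) (at-mult a n r a1)
       my : m ≡ Yy *' t
       my = N.*-cancelˡ-≡ m (Yy *' t) X {{ℕ.>-nonZero x1}} (tr (sym yn) (tr (cong (Yy *'_) nt) (solveN 3 (λ y t x → y :*' (t :*' x) :=' x :*' (y :*' t)) refl Yy t X)))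

 cc-joint : ∀ a b (pp : Prim a b) → 1 ≤' a → 1 ≤' b → cc a b ≡ ∑ (rng Y) (λ k → at (a *' x pp) (suc k) (λ t → r (x pp *' t) * r (y pp *' t)))
 cc-joint a b pp a1 b1 = ∑-cong (rng Y) (λ k → joint a b pp a1 b1 (suc k))

 cc-bound : ∀ a b (pp : Prim a b) → 1 ≤' a → 1 ≤' b → cc a b ≤ ι 2ℚ * (inv « y pp » * inv « x pp »)
 cc-bound a b pp a1 b1 = ≡≤ (cc-joint a b pp a1 b1) (tr≤ (∑-mono (rng Y) (λ k → at-mono L1 (λ t e → h≤ t (t1 t (tr e refl))))) (tr≤ (∑-at Y (a *' X) f L1 f≥0) (≡≤ (∑-* (rng Y) (inv « Yy » * inv « X ») _) (≤≡ (*-monoˡ _ (0≤* iy ix) (∑-inv²≤2 Y)) (*-comm _ _)))))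
  where
   X = x pp
   Yy = y pp
   x1 : 1 ≤' X
   x1 = factor≥1 X (g pp) b1 (bx pp)
   y1 : 1 ≤' Yy
   y1 = factor≥1 Yy (g pp) a1 (ay pp)
   L1 : 1 ≤' a *' X
   L1 = N.*-mono-≤ {1} {a} {1} {X} a1 x1
   iy = inv≥0 («»-pos y1)
   ix = inv≥0 («»-pos x1)
   f : ℕ → F
   f t = (inv « Yy » * inv « X ») * (inv « t » * inv « t »)
   f≥0 : ∀ t → 0F ≤ f t
   f≥0 t = 0≤* (0≤* iy ix) (0≤sq _)
   t1 : ∀ {k} t → suc k ≡ a *' X *' t → 1 ≤' t
   t1 t e = factor≥1ʳ (a *' X) t (s≤s z≤n) e
   h≤ : ∀ t → 1 ≤' t → r (X *' t) * r (Yy *' t) ≤ f t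
   h≤ t t1 = ≤≡ (*-mono (rr≥0 P _) (rr≥0 P _) (rr-≤ P (X *' t) (N.*-mono-≤ {1} {X} {1} {t} x1 t1)) (rr-≤ P (Yy *' t) (N.*-mono-≤ {1} {Yy} {1} {t} y1 t1))) (tr (cong2 _*_ (inv-* X t x1 t1) (inv-* Yy t y1 t1)) (solve 3 (λ x y t → (x :* t) :* (y :* t) := (y :* x) :* (t :* t)) refl (inv « X ») (inv « Yy ») (inv « t »)))

 -- Divisors of rough numbers are rough, so only pairs whose reduced ratio is rough on both sides
 -- interact.
 cc-rough : ∀ a b (pp : Prim a b) → 1 ≤' a → 1 ≤' b → cc a b ≢ 0F → Rough P (y pp) × Rough P (x pp)
 cc-rough a b pp a1 b1 ne = go (rough? P (y pp)) (rough? P (x pp))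
  where
   zer : (∀ t → r (x pp *' t) * r (y pp *' t) ≡ 0F) → cc a b ≡ 0F
   zer h = tr (cc-joint a b pp a1 b1) (∑-zero∈ (rng Y) (λ {k} _ → tr (at-cong L1 (λ t _ → h t)) (at-0 L1)))
    where L1 = N.*-mono-≤ {1} {a} {1} {x pp} a1 (factor≥1 (x pp) (g pp) b1 (bx pp))
   go : Dec (Rough P (y pp)) → Dec (Rough P (x pp)) → Rough P (y pp) × Rough P (x pp)
   go (yes u) (yes w) = u , w
   go (no u) _ = ⊥-elim (ne (zer (λ t → tr (cong (r (x pp *' t) *_) (rr-zero P _ (λ h → u (rough-∣ P (Dv.m∣m*n t) (snd h))))) (zeroʳ _))))
   go (yes _) (no w) = ⊥-elim (ne (zer (λ t → tr (cong (_* r (y pp *' t)) (rr-zero P _ (λ h → w (rough-∣ P (Dv.m∣m*n t) (snd h))))) (zeroˡ _))))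

 -- Rough numbers other than 1 exceed P, so the telescoping sum starts at P. The maximum in the
 -- remainder carries the ranges below and above P through one induction.
 tail² : ∀ Z → ∑ (rng Z) (λ t → r (suc t) * r (suc t)) + inv « P ℕ.⊔ Z » ≤ inv « P »
 tail² zero = ≡⇒≤ (tr (0+ _) (cong (λ w → inv « w ») (N.⊔-identityʳ P)))
 tail² (suc Z) = ≡≤ (solve 3 (λ a b c → (a :+ b) :+ c := b :+ (a :+ c)) refl (r (suc Z) * r (suc Z)) (∑ (rng Z) (λ t → r (suc t) * r (suc t))) (inv « P ℕ.⊔ suc Z »)) (tr≤ (+-mono ≤-refl (step (suc Z ℕ.≤? P))) (tail² Z))
  where
   step : Dec (suc Z ≤' P) → r (suc Z) * r (suc Z) + inv « P ℕ.⊔ suc Z » ≤ inv « P ℕ.⊔ Z »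
   step (yes l) = ≡⇒≤ (tr (cong2 (λ u w → u * u + inv « w ») (rr-zero P (suc Z) (λ h → N.<⇒≱ (rough> (fst h) (snd h)) l)) (N.m≥n⇒m⊔n≡m l)) (tr (solve 1 (λ i → :0 :* :0 :+ i := i) refl (inv « P »)) (cong (λ w → inv « w ») (sym (N.m≥n⇒m⊔n≡m (N.<⇒≤ l))))))
   step (no l) = ≤≡ (+-mono (tr≤ (*-mono (rr≥0 P _) (rr≥0 P _) (rr-≤ P (suc Z) (s≤s z≤n)) (rr-≤ P (suc Z) (s≤s z≤n))) (sq-step Z (N.≤-trans P1 PZ))) (≡⇒≤ (cong (λ w → inv « w ») (N.m≤n⇒m⊔n≡n (N.≤-trans PZ (N.n≤1+n Z)))))) (tr (solve 2 (λ a b → a :- b :+ b := a) refl (inv « Z ») (inv « suc Z »)) (cong (λ w → inv « w ») (sym (N.m≤n⇒m⊔n≡n PZ))))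
    where
     PZ : P ≤' Z
     PZ = N.≤-pred (N.≰⇒> l)

 cc-diag : ∀ a → 1 ≤' a → cc a a ≤ inv « P »
 cc-diag a a1 = ≡≤ (∑-cong (rng Y) (λ k → at-map a1 (λ w → w * w) (zeroˡ _) r)) (tr≤ (∑-at Y a (λ t → r t * r t) a1 (λ t → 0≤sq _)) (tr≤ (≤-by (inv « P ℕ.⊔ Y ») (inv≥0 («»-pos (N.≤-trans P1 (N.m≤m⊔n P Y)))) refl) (tail² Y)))

 module Split (T : ℕ) where

  θ : F
  θ = ι 2ℚ * (inv « P » * (« suc T » * « suc T » + 1F))

  θ≥0 : 0F ≤ θ
  θ≥0 = 0≤* (ι≥0 2ℚ) (0≤* (inv≥0 («»-pos P1)) (0≤+ (0≤sq _) 0≤1))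

  -- Across a split the prime p ≥ P divides a fixed side `s b` of every reduced ratio. Taking it out
  -- gains 1/p ≤ 1/P, and the remaining pairs stay distinct, so `pair-sum` applies.
  cross' : ∀ p a (Cs : List ℕ) (s t : ℕ → ℕ) → P ≤' p → Unique Cs → length Cs ≤' 2 ^' T → (∀ {b} → b ∈ Cs → p ∣ s b × 1 ≤' s b × 1 ≤' t b × cc a b ≤ ι 2ℚ * (inv « s b » * inv « t b »)) →
   (∀ {b b'} → b ∈ Cs → b' ∈ Cs → s b ≡ s b' → t b ≡ t b' → b ≡ b') → ∑ Cs (cc a) ≤ θ
  cross' p a Cs s t Pp uC len h inj = tr≤ (∑-mono∈ Cs (λ {b} m → ≤≡ (snd (snd (snd (h m)))) (cong (ι 2ℚ *_) (tr (cong (_* inv « t b ») (sinv b m)) (*-assoc _ _ _))))) (≡≤ (tr (∑-* Cs (ι 2ℚ) _) (cong (ι 2ℚ *_) (∑-* Cs (inv « p ») _))) (*-monoˡ _ (ι≥0 2ℚ) (*-mono (inv≥0 («»-pos p1)) (∑≥0∈ Cs (λ {b} m → 0≤* (inv≥0 («»-pos (u1 b m))) (inv≥0 («»-pos (fst (snd (snd (h m)))))))) (inv-anti P1 Pp) (pair-sum T Cs u t len (unique-map∈ (λ b → u b , t b) uC (λ {b} {b'} m m' e → inj m m' (tr (up b m) (tr (cong (λ w → w *' p) (cong fst e)) (sym (up b' m')))) (cong snd e))) (All.tabulate (λ {b} m → u1 b m , fst (snd (snd (h m)))))))))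
   where
    p1 : 1 ≤' p
    p1 = N.≤-trans P1 Pp
    instance
     nz : ℕ.NonZero p
     nz = ℕ.>-nonZero p1
    u : ℕ → ℕ
    u b = s b / p
    up : ∀ b → b ∈ Cs → s b ≡ u b *' p
    up b m = sym (m/n*n≡m (fst (h m)))
    u1 : ∀ b → b ∈ Cs → 1 ≤' u b
    u1 b m = factor≥1 (u b) p (fst (snd (h m))) (up b m)
    sinv : ∀ b → b ∈ Cs → inv « s b » ≡ inv « p » * inv « u b »
    sinv b m = tr (cong (λ w → inv « w ») (tr (up b m) (N.*-comm (u b) p))) (inv-* p (u b) p1 (u1 b m))

  determined : ∀ {a b b'} (pp : Prim a b) (pp' : Prim a b') → 1 ≤' a → y pp ≡ y pp' → x pp ≡ x pp' → b ≡ b'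
  determined {a} {b} {b'} pp pp' a1 ey ex = N.*-cancelʳ-≡ b b' (y pp) {{ℕ.>-nonZero (factor≥1 (y pp) (g pp) a1 (ay pp))}} (tr (by pp) (tr (cong (_*' a) ex) (tr (sym (by pp')) (cong (b' *'_) (sym ey)))))
   where
    by : ∀ {b} (pp : Prim a b) → b *' y pp ≡ x pp *' a
    by pp = tr (cong (_*' y pp) (bx pp)) (tr (solveN 3 (λ x g y → (x :*' g) :*' y :=' x :*' (y :*' g)) refl (x pp) (g pp) (y pp)) (cong (x pp *'_) (sym (ay pp))))

  separated : ∀ {p} → Prime p → ∀ k {c d} (pp : Prim c d) → p ^' k ∣ c → ¬ (p ^' k ∣ d) → p ∣ y pp
  separated {p} pr k pp qc nqd = case-dec (p ∣? y pp) (λ d → d) (λ nd → ⊥-elim (nqd (Dv.∣-trans (prime-power-cancel pr k nd (subst (p ^' k ∣_) (ay pp) qc)) (divides (x pp) (bx pp)))))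

  flip : ∀ {c d} → Prim c d → Prim d c
  flip pp = prim (x pp) (y pp) (g pp) (bx pp) (ay pp) (Cop.sym (cop pp))

  SS : List ℕ → F
  SS B = ∑ B (λ a → ∑ B (cc a))

  cap : ℕ → F
  cap n = « n » * inv « P » + ι 2ℚ * θ * « n *' lg n »

  Splitter : List ℕ → Set
  Splitter B = Σ ℕ λ p → Σ ℕ λ k → Prime p × (P ≤' p) × (Σ ℕ λ c → c ∈ B × p ^' k ∣ c) × (Σ ℕ λ d → d ∈ B × ¬ (p ^' k ∣ d))

  -- Let p divide y and let pᵉ be the exact power of p in g. Then the next power divides a = y g but
  -- not b = x g, since p does not divide x; and p exceeds P because y is rough.
  splitter1 : ∀ {B a b} → a ∈ B → b ∈ B → (pp : Prim a b) → 1 ≤' a → 1 <' y pp → Rough P (y pp) → Splitter B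
  splitter1 {B} {a} {b} ma mb pp a1 y1 ry = go (prime-divisor (y pp) y1)
   where
    go : (Σ ℕ λ p → Prime p × p ∣ y pp) → Splitter B
    go (p , pr , d) = fin (max-power p (g pp) p2 (factor≥1ʳ (y pp) (g pp) a1 (ay pp)))
     where
      p2 = ℕ.nonTrivial⇒n>1 p {{prime⇒nonTrivial pr}}
      nx : ¬ (p ∣ x pp)
      nx dx = ℕ.nonTrivial⇒≢1 {{prime⇒nonTrivial pr}} (cop pp (d , dx))
      fin : (Σ ℕ λ e → (p ^' e ∣ g pp) × ¬ (p ^' suc e ∣ g pp)) → Splitter B
      fin (e , de , ne) = p , suc e , pr , N.<⇒≤ (rough> p2 (rough-∣ P d ry)) , (a , ma , subst (p ^' suc e ∣_) (sym (ay pp)) (Dv.*-pres-∣ d de)) , (b , mb , λ db → ne (prime-power-cancel pr (suc e) nx (subst (p ^' suc e ∣_) (bx pp) db)))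

  splitter : ∀ {B a b} → a ∈ B → b ∈ B → 1 ≤' a → 1 ≤' b → a ≢ b → cc a b ≢ 0F → Splitter B
  splitter {B} {a} {b} ma mb a1 b1 ne nz = go (1 ℕ.<? y pp) (1 ℕ.<? x pp)
   where
    pp = primPart a b a1
    ro = cc-rough a b pp a1 b1 nz
    one : ∀ {v} → 1 ≤' v → ¬ (1 <' v) → v ≡ 1
    one l nl = N.≤-antisym (N.≮⇒≥ nl) l
    go : Dec (1 <' y pp) → Dec (1 <' x pp) → Splitter B
    go (yes l) _ = splitter1 ma mb pp a1 l (fst ro)
    go (no _) (yes l) = splitter1 mb ma (flip pp) b1 l (snd ro)
    go (no ly) (no lx) = ⊥-elim (ne (tr (ay pp) (tr (cong (_*' g pp) (tr (one (factor≥1 (y pp) (g pp) a1 (ay pp)) ly) (sym (one (factor≥1 (x pp) (g pp) b1 (bx pp)) lx)))) (sym (bx pp)))))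

  -- If no two distinct elements interact, the diagonal gives n/P. Otherwise a prime power splits
  -- the set; each of the two cross sums is at most θ times the smaller part, and by `lg-split`
  -- these costs add up to 2 θ n lg n.
  energy : ∀ fuel B → length B ≤' fuel → length B ≤' 2 ^' T → Unique B → All (1 ≤'_) B → SS B ≤ cap (length B)
  energy fuel [] _ _ _ _ = 0≤+ (0≤* («»≥0 0) (inv≥0 («»-pos P1))) (0≤* (0≤* (ι≥0 2ℚ) θ≥0) («»≥0 0))
  energy zero (_ ∷ _) () _ _ _
  energy (suc fuel) B@(_ ∷ _) lf lT uB B1 = go (AnyM.any? (λ a → AnyM.any? (λ b → ¬? (a ℕ.≟ b) ×-dec ¬? (cc a b ≟F 0F)) B) B)
   where
    Inter : ℕ → ℕ → Set
    Inter a b = a ≢ b × cc a b ≢ 0F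
    none : ¬ AnyM.Any (λ a → AnyM.Any (Inter a) B) B → SS B ≤ cap (length B)
    none h = tr≤ (∑-mono∈ B {g = λ _ → inv « P »} (λ {a} ma → ≡≤ (tr (∑-cong∈ B (λ {b} mb → only a b ma mb (b ℕ.≟ a))) (∑-pick ℕ._≟_ B (cc a) uB ma (λ b → b ℕ.≟ a))) (cc-diag a (All.lookup B1 ma)))) (≡≤ (∑-const B (inv « P »)) (≤-by (ι 2ℚ * θ * « length B *' lg (length B) ») (0≤* (0≤* (ι≥0 2ℚ) θ≥0) («»≥0 (length B *' lg (length B)))) refl))
     where
      only : ∀ a b → a ∈ B → b ∈ B → Dec (b ≡ a) → cc a b ≡ cc a b * iv (b ℕ.≟ a)
      only a b ma mb (yes e) = sym (tr (cong (cc a b *_) (iv-yes (b ℕ.≟ a) e)) (*1 _))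
      only a b ma mb (no ne) = z (cc a b ≟F 0F)
       where
        z : Dec (cc a b ≡ 0F) → cc a b ≡ cc a b * iv (b ℕ.≟ a)
        z (yes e) = tr e (sym (tr (cong (_* iv (b ℕ.≟ a)) e) (zeroˡ _)))
        z (no nz) = ⊥-elim (h (lose ma (lose mb ((λ e → ne (sym e)) , nz))))
    divide : Splitter B → SS B ≤ cap (length B)
    divide (p , k , pr , Pp , (c₀ , mc₀ , qc₀) , (d₀ , md₀ , nd₀)) = ≡≤ expand (≤≡ total (cong cap len))
     where
      q = p ^' k
      B₁ = filter (q ∣?_) B
      B₂ = filter (λ a → ¬? (q ∣? a)) B
      b = length B₁
      c = length B₂
      len : b +' c ≡ length B
      len = length-partition (q ∣?_) B
      in₁ : ∀ {a} → a ∈ B₁ → a ∈ B × q ∣ a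
      in₁ m = ∈-filter⁻ (q ∣?_) {xs = B} m
      in₂ : ∀ {a} → a ∈ B₂ → a ∈ B × ¬ (q ∣ a)
      in₂ m = ∈-filter⁻ (λ a → ¬? (q ∣? a)) {xs = B} m
      b≥1 : 1 ≤' b
      b≥1 = LP.filter-some (q ∣?_) (lose mc₀ qc₀)
      c≥1 : 1 ≤' c
      c≥1 = LP.filter-some (λ a → ¬? (q ∣? a)) (lose md₀ nd₀)
      u₁ = UP.filter⁺ (q ∣?_) uB
      u₂ = UP.filter⁺ (λ a → ¬? (q ∣? a)) uB
      a₁ : All (1 ≤'_) B₁
      a₁ = All.tabulate (λ m → All.lookup B1 (fst (in₁ m)))
      a₂ : All (1 ≤'_) B₂
      a₂ = All.tabulate (λ m → All.lookup B1 (fst (in₂ m)))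
      b≤ : b ≤' length B
      b≤ = LP.length-filter (q ∣?_) B
      c≤ : c ≤' length B
      c≤ = LP.length-filter (λ a → ¬? (q ∣? a)) B
      b<  : b ≤' fuel
      b< = N.≤-pred (N.≤-trans (N.≤-trans (N.≤-reflexive (N.+-comm 1 b)) (N.≤-trans (N.+-monoʳ-≤ b c≥1) (N.≤-reflexive len))) lf)
      c< : c ≤' fuel
      c< = N.≤-pred (N.≤-trans (N.≤-trans (N.+-monoˡ-≤ c b≥1) (N.≤-reflexive len)) lf)
      X12 = ∑ B₁ (λ a → ∑ B₂ (cc a))
      expand : SS B ≡ (SS B₁ + X12) + (X12 + SS B₂)
      expand = tr (∑-partition (q ∣?_) B _) (cong2 _+_ (tr (∑-cong B₁ (λ a → ∑-partition (q ∣?_) B (cc a))) (∑-+ B₁ _ _)) (tr (∑-cong B₂ (λ a → ∑-partition (q ∣?_) B (cc a))) (tr (∑-+ B₂ _ _) (cong (_+ SS B₂) (tr (∑-cong B₂ (λ d → ∑-cong B₁ (λ e → cc-sym d e))) (∑-swap B₂ B₁ (λ d e → cc e d)))))))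
      x≤b : X12 ≤ « b » * θ
      x≤b = ≤≡ (∑-mono∈ B₁ {g = λ _ → θ} (λ {a} ma → cross₁ a ma)) (∑-const B₁ θ)
       where
        cross₁ : ∀ a → a ∈ B₁ → ∑ B₂ (cc a) ≤ θ
        cross₁ a ma = cross' p a B₂ (λ d → y (pa d)) (λ d → x (pa d)) Pp u₂ (N.≤-trans c≤ lT) (λ {d} md → separated pr k (pa d) (snd (in₁ ma)) (snd (in₂ md)) , factor≥1 (y (pa d)) (g (pa d)) a1 (ay (pa d)) , factor≥1 (x (pa d)) (g (pa d)) (All.lookup a₂ md) (bx (pa d)) , cc-bound a d (pa d) a1 (All.lookup a₂ md)) (λ {d} {d'} _ _ ey ex → determined (pa d) (pa d') a1 ey ex)
         where
          a1 = All.lookup a₁ ma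
          pa : ∀ d → Prim a d
          pa d = primPart a d a1
      x≤c : X12 ≤ « c » * θ
      x≤c = ≡≤ (∑-swap B₁ B₂ cc) (≤≡ (∑-mono∈ B₂ {g = λ _ → θ} (λ {d} md → ≡≤ (∑-cong B₁ (λ a → cc-sym a d)) (cross₂ d md))) (∑-const B₂ θ))
       where
        cross₂ : ∀ d → d ∈ B₂ → ∑ B₁ (cc d) ≤ θ
        cross₂ d md = cross' p d B₁ (λ a → x (pd a)) (λ a → y (pd a)) Pp u₁ (N.≤-trans b≤ lT) (λ {a} ma → separated pr k (flip (pd a)) (snd (in₁ ma)) (snd (in₂ md)) , factor≥1 (x (pd a)) (g (pd a)) (All.lookup a₁ ma) (bx (pd a)) , factor≥1 (y (pd a)) (g (pd a)) d1 (ay (pd a)) , ≤≡ (cc-bound d a (pd a) d1 (All.lookup a₁ ma)) (cong (ι 2ℚ *_) (*-comm _ _))) (λ {a} {a'} _ _ ex ey → determined (pd a) (pd a') d1 ey ex)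
         where
          d1 = All.lookup a₂ md
          pd : ∀ a → Prim d a
          pd a = primPart d a d1
      s₁ = energy fuel B₁ b< (N.≤-trans b≤ lT) u₁ a₁
      s₂ = energy fuel B₂ c< (N.≤-trans c≤ lT) u₂ a₂
      total : (SS B₁ + X12) + (X12 + SS B₂) ≤ cap (b +' c)
      total = tot (N.≤-total b c)
       where
        fin : ∀ m → X12 ≤ « m » * θ → b *' lg b +' c *' lg c +' m ≤' (b +' c) *' lg (b +' c) → (SS B₁ + X12) + (X12 + SS B₂) ≤ cap (b +' c)
        fin m xm l = tr≤ (+-mono (+-mono s₁ xm) (+-mono xm s₂)) (≡≤ (tr (solve 7 (λ b c i t lb lc m → ((b :* i :+ :2 :* t :* lb) :+ m :* t) :+ (m :* t :+ (c :* i :+ :2 :* t :* lc)) := (b :+ c) :* i :+ :2 :* t :* (lb :+ lc :+ m)) refl « b » « c » (inv « P ») θ « b *' lg b » « c *' lg c » « m ») (cong2 (λ u w → u * inv « P » + ι 2ℚ * θ * w) (sym («+» b c)) (sym (tr («+» (b *' lg b +' c *' lg c) m) (cong (_+ « m ») («+» (b *' lg b) (c *' lg c))))))) (+-mono ≤-refl (*-monoˡ _ (0≤* (ι≥0 2ℚ) θ≥0) («»-mono l))))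
        tot : b ≤' c ⊎ c ≤' b → (SS B₁ + X12) + (X12 + SS B₂) ≤ cap (b +' c)
        tot (inj₁ l) = fin b x≤b (lg-split b c b≥1 l)
        tot (inj₂ l) = fin c x≤c (N.≤-trans (N.≤-reflexive (cong (_+' c) (N.+-comm (b *' lg b) (c *' lg c)))) (N.≤-trans (lg-split c b c≥1 l) (N.≤-reflexive (cong (λ w → w *' lg w) (N.+-comm c b)))))
    go : Dec (AnyM.Any (λ a → AnyM.Any (Inter a) B) B) → SS B ≤ cap (length B)
    go (no h) = none h
    go (yes h) = st (find∈ h)
     where
      st : (Σ ℕ λ a → a ∈ B × AnyM.Any (Inter a) B) → SS B ≤ cap (length B)
      st (a , ma , h') = st' (find∈ h')
       where
        st' : (Σ ℕ λ b → b ∈ B × Inter a b) → SS B ≤ cap (length B)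
        st' (b , mb , ne , nz) = divide (splitter ma mb (All.lookup B1 ma) (All.lookup B1 mb) ne nz)

∑-inj≤1 : {xs : List ℕ} (f : ℕ → ℕ) → (∀ {a b} → f a ≡ f b → a ≡ b) → Unique xs → ∀ c → ∑ xs (λ a → iv (f a ℕ.≟ c)) ≤ 1F
∑-inj≤1 {[]} f inj _ c = 0≤1
∑-inj≤1 {x ∷ xs} f inj (u ∷ us) c = case-dec (f x ℕ.≟ c) (λ e → ≡⇒≤ (tr (cong2 _+_ (iv-yes (f x ℕ.≟ c) e) (∑-zero∈ xs (λ {a} m → iv-no (f a ℕ.≟ c) (λ e' → All.lookup u m (inj (tr e (sym e'))))))) (+0 _))) (λ ne → ≡≤ (tr (cong (_+ ∑ xs (λ a → iv (f a ℕ.≟ c))) (iv-no (f x ℕ.≟ c) ne)) (0+ _)) (∑-inj≤1 f inj us c))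

length-iv : {A : Set} {Q : A → Set} (Q? : ∀ a → Dec (Q a)) (xs : List A) → « length (filter Q? xs) » ≡ ∑ xs (λ a → iv (Q? a))
length-iv Q? xs = tr (sym (tr (∑-const (filter Q? xs) 1F) (*1 _))) (tr (∑-filter Q? xs (λ _ → 1F)) (∑-cong xs (λ a → *1 _)))

iv-mono : {P Q : Set} (d : Dec P) (e : Dec Q) → (P → Q) → iv d ≤ iv e
iv-mono d e h = go d
 where
  go : _ → iv d ≤ iv e
  go (yes p) = ≡⇒≤ (tr (iv-yes d p) (sym (iv-yes e (h p))))
  go (no np) = ≡≤ (iv-no d np) (iv≥0 e)

-- Geometrically growing blocks and their energy.

module Counting (A : List ℕ) (uA : Unique A) (A1 : All (1 ≤'_) A) where

 ν : ℕ → ℕ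
 ν M = length (filter (ℕ._≤? M) A)

 ν-F : ∀ M → « ν M » ≡ ∑ A (λ a → iv (a ℕ.≤? M))
 ν-F M = length-iv (ℕ._≤? M) A

 ν-mono : ∀ {M M'} → M ≤' M' → ν M ≤' ν M'
 ν-mono {M} {M'} l = «»-cancel (≡≤ (ν-F M) (≤≡ (∑-mono A (λ a → iv-mono (a ℕ.≤? M) (a ℕ.≤? M') (λ x → N.≤-trans x l))) (sym (ν-F M'))))

 ν-0 : ν 0 ≡ 0
 ν-0 = N.≤-antisym («»-cancel (≡≤ (tr (ν-F 0) (∑-zero∈ A (λ {a} m → iv-no (a ℕ.≤? 0) (N.<⇒≱ (All.lookup A1 m))))) (≡⇒≤ (sym «0»)))) z≤n

 ν-suc : ∀ M → ν (suc M) ≤' suc (ν M)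
 ν-suc M = «»-cancel (≡≤ (ν-F (suc M)) (tr≤ (∑-mono A (λ a → one a (a ℕ.≟ suc M))) (≡≤ (∑-+ A _ _) (≤≡ (+-mono (∑-inj≤1 (λ a → a) (λ e → e) uA (suc M)) (≡⇒≤ (sym (ν-F M)))) (sym («suc» (ν M)))))))
  where
   one : ∀ a → Dec (a ≡ suc M) → iv (a ℕ.≤? suc M) ≤ iv (a ℕ.≟ suc M) + iv (a ℕ.≤? M)
   one a (yes e) = ≡≤ (tr (iv-yes (a ℕ.≤? suc M) (N.≤-reflexive e)) (sym (iv-yes (a ℕ.≟ suc M) e))) (≤-by (iv (a ℕ.≤? M)) (iv≥0 _) refl)
   one a (no ne) = tr≤ (iv-mono (a ℕ.≤? suc M) (a ℕ.≤? M) (λ l → N.≤-pred (N.≤∧≢⇒< l ne))) (≤-by (iv (a ℕ.≟ suc M)) (iv≥0 _) (+-comm _ _))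

 ν-top : Σ ℕ λ B → ν B ≡ length A
 ν-top = top A , cong length (LP.filter-all (ℕ._≤? top A) (top-ok A))
  where
   top : List ℕ → ℕ
   top [] = 0
   top (x ∷ xs) = x +' top xs
   top-ok : ∀ xs → All (_≤' top xs) xs
   top-ok [] = []
   top-ok (x ∷ xs) = N.m≤m+n x (top xs) ∷ All.map (λ l → N.≤-trans l (N.m≤n+m (top xs) x)) (top-ok xs)

 ν-hit : ∀ B n → n ≤' ν B → Σ ℕ λ M → ν M ≡ n
 ν-hit zero n l = 0 , tr ν-0 (sym (N.n≤0⇒n≡0 (subst (n ≤'_) ν-0 l)))
 ν-hit (suc B) n l = case-dec (n ℕ.≤? ν B) (λ l' → ν-hit B n l') (λ nl → suc B , N.≤-antisym (N.≤-trans (ν-suc B) (N.≰⇒> nl)) l)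

 -- The counting function of A rises in steps of at most 1 and so takes every value up to
 -- `length A`; larger n are cut down to make this total.
 level : ℕ → ℕ
 level n = fst (ν-hit (fst ν-top) (n ℕ.⊓ length A) (subst (n ℕ.⊓ length A ≤'_) (sym (snd ν-top)) (N.m⊓n≤n n (length A))))

 ν-level : ∀ n → n ≤' length A → ν (level n) ≡ n
 ν-level n l = tr (snd (ν-hit (fst ν-top) (n ℕ.⊓ length A) _)) (N.m≤n⇒m⊓n≡m l)

opaque
 -- This is 2²⁵: a block must dwarf everything before it, and 8/Kb has to stay below the tolerance
 -- 10⁻⁶ of `energyG`, with room for the tail.
 Kb : ℕ
 Kb = 33554432

 Kb-ι : « Kb » ≡ ι (# 33554432)
 Kb-ι = «»-ι 33554432

qK qε qP : ℚ
qK = pos 1 ℚ./ 33554432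
qε = pos 1 ℚ./ 100000000
qP = # 100000000

Kb≥2 : 2 ≤' Kb
Kb≥2 = «»-cancel (≡≤ («»-ι 2) (≤≡ (ι-≤ (from-yes ((# 2) ℚ.≤? (# 33554432)))) (sym Kb-ι)))

nseq : ℕ → ℕ
nseq zero = 0
nseq (suc i) = Kb ^' i

nseq-K : ∀ i → « nseq i » ≤ ι qK * « nseq (suc i) »
nseq-K zero = ≡≤ «0» (0≤* (ι≥0 qK) («»≥0 1))
nseq-K (suc i) = ≡⇒≤ (sym (tr (cong (ι qK *_) (tr («*» Kb (Kb ^' i)) (cong (_* « Kb ^' i ») Kb-ι))) (tr (solve 1 (λ n → con qK :* (con (# 33554432) :* n) := con (qK ℚ.* (# 33554432)) :* n) refl « Kb ^' i ») (tr (cong (_* « Kb ^' i ») (cong ι (from-yes (qK ℚ.* (# 33554432) ℚ.≟ 1ℚ)))) (1* _)))))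

nseq-< : ∀ i → nseq i <' nseq (suc i)
nseq-< zero = s≤s z≤n
nseq-< (suc i) = N.^-monoʳ-< Kb Kb≥2 {i} {suc i} (N.n<1+n i)

module Blocks (P : ℕ) (P1 : 1 ≤' P) (A : List ℕ) (uA : Unique A) (A1 : All (1 ≤'_) A) (T : ℕ) (lenT : length A ≤' 2 ^' T)
 (Pbig : ι qP * (1F + « 4 » * (« suc T » * « suc T » + 1F) * « T ») ≤ « P »)
 (J : ℕ) (JP : 2 *' J ≤' P) (JN : ∀ i → i ≤' J → nseq i ≤' length A) where
 open Counting A uA A1 public
 open Target P A A1 public

 Mq : ℕ → ℕ
 Mq i = level (nseq i)

 νM : ∀ i → i ≤' J → ν (Mq i) ≡ nseq i
 νM i l = ν-level (nseq i) (JN i l)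

 M-< : ∀ i → i <' J → Mq i <' Mq (suc i)
 M-< i l = N.≰⇒> (λ h → N.<⇒≱ (nseq-< i) (subst₂ _≤'_ (νM (suc i) l) (νM i (N.<⇒≤ l)) (ν-mono h)))

 M-le : ∀ {i j} → i ≤' j → j ≤' J → Mq i ≤' Mq j
 M-le {i} {zero} z≤n _ = N.≤-refl
 M-le {i} {suc j} l lj = go (i ℕ.≟ suc j)
  where
   go : Dec (i ≡ suc j) → Mq i ≤' Mq (suc j)
   go (yes refl) = N.≤-refl
   go (no ne) = N.≤-trans (M-le (N.≤-pred (N.≤∧≢⇒< l ne)) (N.<⇒≤ lj)) (N.<⇒≤ (M-< j lj))

 inB? : ∀ i a → Dec (Mq i <' a × a ≤' Mq (suc i))
 inB? i a = (Mq i ℕ.<? a) ×-dec (a ℕ.≤? Mq (suc i))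

 Bl : ℕ → List ℕ
 Bl i = filter (inB? i) A

 Bl-unique : ∀ i → Unique (Bl i)
 Bl-unique i = UP.filter⁺ (inB? i) uA

 Bl-∈ : ∀ i {a} → a ∈ Bl i → a ∈ A × (Mq i <' a × a ≤' Mq (suc i))
 Bl-∈ i m = ∈-filter⁻ (inB? i) {xs = A} m

 Bl-len : ∀ i → i <' J → « length (Bl i) » + « nseq i » ≡ « nseq (suc i) »
 Bl-len i l = tr (cong2 _+_ (length-iv (inB? i) A) (tr (cong «_» (sym (νM i (N.<⇒≤ l)))) (ν-F (Mq i)))) (tr (sym (∑-+ A _ _)) (tr (∑-cong A (λ a → one a (a ℕ.≤? Mq i) (a ℕ.≤? Mq (suc i)))) (tr (sym (ν-F (Mq (suc i)))) (cong «_» (νM (suc i) l)))))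
  where
   one : ∀ a → Dec (a ≤' Mq i) → Dec (a ≤' Mq (suc i)) → iv (inB? i a) + iv (a ℕ.≤? Mq i) ≡ iv (a ℕ.≤? Mq (suc i))
   one a (yes x) _ = tr (cong2 _+_ (iv-no (inB? i a) (λ h → N.<⇒≱ (fst h) x)) (iv-yes (a ℕ.≤? Mq i) x)) (tr (0+ _) (sym (iv-yes (a ℕ.≤? Mq (suc i)) (N.≤-trans x (N.<⇒≤ (M-< i l))))))
   one a (no x) (yes y) = tr (cong2 _+_ (iv-yes (inB? i a) (N.≰⇒> x , y)) (iv-no (a ℕ.≤? Mq i) x)) (tr (+0 _) (sym (iv-yes (a ℕ.≤? Mq (suc i)) y)))
   one a (no x) (no y) = tr (cong2 _+_ (iv-no (inB? i a) (λ h → y (snd h))) (iv-no (a ℕ.≤? Mq i) x)) (tr (+0 _) (sym (iv-no (a ℕ.≤? Mq (suc i)) y)))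

 Bl≥1 : ∀ i → i <' J → 1 ≤' length (Bl i)
 Bl≥1 i l = N.+-cancelʳ-≤ (nseq i) 1 (length (Bl i)) (N.≤-trans (nseq-< i) («»-cancel (≡⇒≤ (tr (sym (Bl-len i l)) (sym («+» (length (Bl i)) (nseq i)))))))

 M≥1 : ∀ i → i <' J → 1 ≤' Mq (suc i)
 M≥1 i l = N.≤-trans (s≤s z≤n) (M-< i l)

 Y≤ : ∀ i → i ≤' J → Yseq Mq i ≤' 2 *' i *' Mq i
 Y≤ zero _ = z≤n
 Y≤ (suc i) l = N.≤-trans (N.+-monoˡ-≤ (Mq (suc i) +' Mq (suc i)) (N.≤-trans (Y≤ i (N.<⇒≤ l)) (N.*-monoʳ-≤ (2 *' i) (N.<⇒≤ (M-< i l))))) (N.≤-reflexive (solveN 2 (λ i m → con' 2 :*' i :*' m :+' (m :+' m) :=' con' 2 :*' (con' 1 :+' i) :*' m) refl i (Mq (suc i))))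

 -- Here 2 J ≤ P enters: stage i of the test function reaches left by at most P times the largest
 -- element so far, the range in which `E-bound` holds.
 Y≤PM : ∀ i → i ≤' J → Yseq Mq i ≤' Mq i *' P
 Y≤PM i l = N.≤-trans (Y≤ i l) (N.≤-trans (N.*-monoˡ-≤ (Mq i) (N.≤-trans (N.*-monoʳ-≤ 2 l) JP)) (N.≤-reflexive (N.*-comm P (Mq i))))

 cap-ε : ∀ Y n → n ≤' 2 ^' T → Energy.Split.cap P Y P1 T n ≤ ι qε * « n »
 cap-ε Y n nT = tr≤ (+-mono ≤-refl (*-monoˡ _ (0≤* (ι≥0 2ℚ) (Energy.Split.θ≥0 P Y P1 T)) (≡≤ («*» n (lg n)) (*-monoˡ _ («»≥0 n) («»-mono (lg-low n T nT))))))
  (≡≤ (tr (solve 4 (λ n i s t → n :* i :+ :2 :* (:2 :* (i :* s)) :* (n :* t) := (n :* i) :* (:1 :+ con (# 4) :* s :* t)) refl « n » (inv « P ») (« suc T » * « suc T » + 1F) « T ») (cong (λ w → (« n » * inv « P ») * (1F + w * (« suc T » * « suc T » + 1F) * « T »)) (sym («»-ι 4))))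
   (≤≡ (*-monoˡ _ (0≤* («»≥0 n) (inv≥0 Pp)) le) (tr (solve 3 (λ n i p → (n :* i) :* (con qε :* p) := con qε :* n :* (p :* i)) refl « n » (inv « P ») « P ») (tr (cong (ι qε * « n » *_) (*-inv Pp)) (*1 _)))))
  where
   Pp = «»-pos P1
   Z = 1F + « 4 » * (« suc T » * « suc T » + 1F) * « T »
   le : Z ≤ ι qε * « P »
   le = ≡≤ (tr (sym (1* Z)) (tr (cong (_* Z) (tr (cong ι (sym (from-yes (qε ℚ.* qP ℚ.≟ 1ℚ)))) (ι-* qε qP))) (*-assoc _ _ _))) (*-monoˡ _ (ι≥0 qε) Pbig)

 E : ℕ → F
 E Y = ∑ (rng Y) (λ k → gp (suc k) * gp (suc k))

 -- A rough n > 1 exceeds P, so below `Mq i *' P` only elements up to `Mq i` have a multiple a n in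
 -- range, and there are `nseq i` of these. The bound `cap` is then at most 10⁻⁸ per element by the
 -- size of P.
 E-bound : ∀ i → i ≤' J → ∀ Y → Y ≤' Mq i *' P → E Y ≤ ι qε * « nseq i »
 E-bound i l Y YP = ≡≤ (tr (∑-cong∈ (rng Y) (λ {k} m → cong (λ w → w * w) (restrict k (∈rng m)))) sq) (tr≤ (energy (length AY) AY N.≤-refl lenAT (UP.filter⁺ near? uA) (All.tabulate (λ m → All.lookup A1 (fst (∈-filter⁻ near? {xs = A} m))))) (tr≤ (cap-ε Y (length AY) lenAT) (*-monoˡ _ (ι≥0 qε) («»-mono lenA))))
  where
   open Energy P Y P1
   open Split T
   near? : ∀ a → Dec (a *' P ≤' Y)
   near? a = a *' P ℕ.≤? Y
   AY = filter near? A
   lenA : length AY ≤' nseq i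
   lenA = subst (length AY ≤'_) (νM i l) («»-cancel (≡≤ (length-iv near? A) (≤≡ (∑-mono A (λ a → iv-mono (near? a) (a ℕ.≤? Mq i) (λ h → N.*-cancelʳ-≤ a (Mq i) P {{ℕ.>-nonZero P1}} (N.≤-trans h YP)))) (sym (ν-F (Mq i))))))
   lenAT : length AY ≤' 2 ^' T
   lenAT = N.≤-trans (LP.length-filter near? A) lenT
   restrict : ∀ k → k <' Y → gp (suc k) ≡ ∑ AY (λ a → at a (suc k) (rr P))
   restrict k kY = tr (∑-partition near? A _) (tr (cong (∑ AY (λ a → at a (suc k) (rr P)) +_) (∑-zero∈ (filter (λ a → ¬? (near? a)) A) (λ {a} m → far a (∈-filter⁻ (λ a → ¬? (near? a)) {xs = A} m)))) (+0 _))
    where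
     far : ∀ a → a ∈ A × ¬ (a *' P ≤' Y) → at a (suc k) (rr P) ≡ 0F
     far a (m , nf) = tr (at-cong a1 (λ n e → rr-zero P n (λ h → nf (N.≤-trans (N.*-monoʳ-≤ a (N.<⇒≤ (rough> (fst h) (snd h)))) (N.≤-trans (N.≤-reflexive (sym e)) kY))))) (at-0 a1)
      where a1 = All.lookup A1 m
   sq : ∑ (rng Y) (λ k → ∑ AY (λ a → at a (suc k) (rr P)) * ∑ AY (λ a → at a (suc k) (rr P))) ≡ SS AY
   sq = tr (∑-cong (rng Y) (λ k → tr (sym (∑-*ʳ AY _ _)) (∑-cong AY (λ a → sym (∑-* AY (at a (suc k) (rr P)) _))))) (tr (∑-swap (rng Y) AY _) (∑-cong AY (λ a → ∑-swap (rng Y) AY _)))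

 ρt : ℕ → F
 ρt k = gp k + at 2 k gp

 ρt-E : ∀ Y → ∑ (rng Y) (λ k → ρt (suc k) * ρt (suc k)) ≤ ι (# 4) * E Y
 ρt-E Y = tr≤ (∑-mono (rng Y) (λ k → am (gp (suc k)) (at 2 (suc k) gp))) (≡≤ (tr (∑-* (rng Y) (ι 2ℚ) _) (cong (ι 2ℚ *_) (∑-+ (rng Y) _ _))) (≤≡ (*-monoˡ _ (ι≥0 2ℚ) (+-mono ≤-refl (≡≤ (∑-cong (rng Y) (λ k → at-map (s≤s z≤n) (λ w → w * w) (zeroˡ _) gp)) (∑-at Y 2 (λ t → gp t * gp t) (s≤s z≤n) (λ t → 0≤sq _))))) (solve 1 (λ e → :2 :* (e :+ e) := con (# 4) :* e) refl (E Y))))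
  where
   am : ∀ a b → (a + b) * (a + b) ≤ ι 2ℚ * (a * a + b * b)
   am a b = ≤-by ((a - b) * (a - b)) (0≤sq _) (solve 2 (λ a b → (a :+ b) :* (a :+ b) :+ (a :- b) :* (a :- b) := :2 :* (a :* a :+ b :* b)) refl a b)

 at-δ : ∀ j {a} k → 1 ≤' a → at a k (δ j) ≤ iv (j *' a ℕ.≟ k)
 at-δ j {a} k a1 = go (at? a k)
  where
   go : At a k → at a k (δ j) ≤ iv (j *' a ℕ.≟ k)
   go (null nd) = ≡≤ (at-null a k _ nd) (iv≥0 _)
   go (mult m e) = ≡≤ (tr (cong (λ w → at a w (δ j)) e) (at-mult a m (δ j) a1)) (iv-mono (m ℕ.≟ j) (j *' a ℕ.≟ k) (λ h → tr (N.*-comm j a) (tr (cong (a *'_) (sym h)) (sym e))))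

 main2-≤ : ∀ k → main2 k ≤ ∑ A (λ a → iv (1 *' a ℕ.≟ k) + iv (2 *' a ℕ.≟ k))
 main2-≤ k = ∑-mono∈ A (λ {a} m → ≡≤ (at-+ (All.lookup A1 m) _ _) (+-mono (at-δ 1 k (All.lookup A1 m)) (at-δ 2 k (All.lookup A1 m))))

 main2≥0 : ∀ k → 0F ≤ main2 k
 main2≥0 k = ∑≥0∈ A (λ m → at≥0 (All.lookup A1 m) (λ n → 0≤+ (iv≥0 _) (iv≥0 _)))

 main2≤2 : ∀ k → main2 k ≤ ι 2ℚ
 main2≤2 k = tr≤ (main2-≤ k) (≡≤ (∑-+ A _ _) (≤≡ (+-mono (∑-inj≤1 (1 *'_) (λ {a} {b} → N.*-cancelˡ-≡ a b 1) uA k) (∑-inj≤1 (2 *'_) (λ {a} {b} → N.*-cancelˡ-≡ a b 2) uA k)) (solve 0 (:1 :+ :1 := :2) refl)))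

 main2-sum : ∀ R M → ∑ (rng R) (λ k → iv (suc k ℕ.≤? M) * main2 (suc k)) ≤ ι 2ℚ * « ν M »
 main2-sum R M = tr≤ (∑-mono (rng R) (λ k → *-monoˡ _ (iv≥0 _) (main2-≤ (suc k)))) (≡≤ (tr (∑-cong (rng R) (λ k → sym (∑-* A (iv (suc k ℕ.≤? M)) _))) (∑-swap (rng R) A _)) (≤≡ (∑-mono A (λ a → tr≤ (∑-mono (rng R) (λ k → one a k)) (≡≤ (tr (∑-* (rng R) (iv (a ℕ.≤? M)) _) (cong (iv (a ℕ.≤? M) *_) (∑-+ (rng R) _ _))) (*-monoˡ _ (iv≥0 _) (≤≡ (+-mono (∑-pick≤ R (1 *' a)) (∑-pick≤ R (2 *' a))) (solve 0 (:1 :+ :1 := :2) refl)))))) (tr (∑-*ʳ A (ι 2ℚ) _) (tr (*-comm _ _) (cong (ι 2ℚ *_) (sym (ν-F M)))))))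
  where
   one : ∀ a k → iv (suc k ℕ.≤? M) * (iv (1 *' a ℕ.≟ suc k) + iv (2 *' a ℕ.≟ suc k)) ≤ iv (a ℕ.≤? M) * (iv (1 *' a ℕ.≟ suc k) + iv (2 *' a ℕ.≟ suc k))
   one a k = ≡≤ (distribˡ _ _ _) (≤≡ (+-mono (two 1 (s≤s z≤n)) (two 2 (s≤s z≤n))) (sym (distribˡ _ _ _)))
    where
     two : ∀ j → 1 ≤' j → iv (suc k ℕ.≤? M) * iv (j *' a ℕ.≟ suc k) ≤ iv (a ℕ.≤? M) * iv (j *' a ℕ.≟ suc k)
     two j j1 = case-dec (j *' a ℕ.≟ suc k) (λ e → *-monoʳ _ (iv≥0 _) (iv-mono (suc k ℕ.≤? M) (a ℕ.≤? M) (λ l → N.≤-trans (N.m≤n*m a j {{ℕ.>-nonZero j1}}) (N.≤-trans (N.≤-reflexive e) l)))) (λ ne → ≡⇒≤ (tr (cong (iv (suc k ℕ.≤? M) *_) (iv-no (j *' a ℕ.≟ suc k) ne)) (tr (zeroʳ _) (sym (tr (cong (iv (a ℕ.≤? M) *_) (iv-no (j *' a ℕ.≟ suc k) ne)) (zeroʳ _))))))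

 sq-near : ∀ g m r → abs (g - m) ≤ r → g * g ≤ ι 2ℚ * (m * m) + ι 2ℚ * (r * r)
 sq-near g m r h = tr≤ (≤-by ((g - m - m) * (g - m - m)) (0≤sq _) (solve 2 (λ g m → g :* g :+ (g :- m :- m) :* (g :- m :- m) := :2 :* (m :* m) :+ :2 :* ((g :- m) :* (g :- m))) refl g m)) (+-mono ≤-refl (*-monoˡ _ (ι≥0 2ℚ) (≡≤ (sym (∣∣-sq (g - m))) (*-mono (∣∣≥0 _) (∣∣≥0 _) h h))))

 Gf-pos : ∀ k → abs (Gf (pos (suc k)) - main2 (suc k)) ≤ ρt (suc k)
 Gf-pos k = ≡≤ (cong (λ w → abs (GT true (suc k) - w)) (sym (1* _))) (GT-bound true (suc k) (s≤s z≤n))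

 Gf-pos² : ∀ k → Gf (pos (suc k)) * Gf (pos (suc k)) ≤ ι (# 4) * main2 (suc k) + ι 2ℚ * (ρt (suc k) * ρt (suc k))
 Gf-pos² k = tr≤ (sq-near _ (main2 (suc k)) (ρt (suc k)) (Gf-pos k)) (+-mono (≤≡ (*-monoˡ _ (ι≥0 2ℚ) (*-monoʳ _ (main2≥0 (suc k)) (main2≤2 (suc k)))) (solve 1 (λ m → :2 :* (:2 :* m) := con (# 4) :* m) refl (main2 (suc k)))) ≤-refl)

 Gf-neg² : ∀ k → Gf (negsuc k) * Gf (negsuc k) ≤ ι 2ℚ * (ρt (suc k) * ρt (suc k))
 Gf-neg² k = ≤≡ (sq-near _ (0F * main2 (suc k)) (ρt (suc k)) (GT-bound false (suc k) (s≤s z≤n))) (solve 2 (λ m r → :2 :* ((:0 :* m) :* (:0 :* m)) :+ r := r) refl (main2 (suc k)) (ι 2ℚ * (ρt (suc k) * ρt (suc k))))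

 -- Negative frequencies carry the tail alone. The main part lives on positive frequencies, which
 -- stop at M, and is at most 2 pointwise, so its square is controlled by its sum.
 En-bound : ∀ R Y M → Y ≤' R → M ≤' Y → En Gf R (ℤ.- pos Y) (pos M) ≤ ι (# 8) * « ν M » + ι (# 16) * E Y
 En-bound R Y M YR MY = ≡≤ (tr (∑-++ (map pos (rng (suc R))) (map negsuc (rng R)) f) (cong2 _+_ (tr (∑-map pos (rng (suc R)) f) (tr (cong (λ w → ∑ (rng w) (λ j → f (pos j))) (N.+-comm 1 R)) (tr (∑-rng-+ R 1 (λ j → f (pos j))) (tr (cong (∑ (rng R) (λ j → f (pos (suc j))) +_) (tr (+0 _) (tr (cong (iv (ℤ.- pos Y ℤ.≤? pos 0) * iv (pos 0 ℤ.≤? pos M) *_) (zeroˡ 0F)) (zeroʳ _)))) (+0 _))))) (∑-map negsuc (rng R) f)))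
  (tr≤ (+-mono (tr≤ (∑-mono (rng R) pterm) (≡≤ (tr (∑-+ (rng R) _ _) (cong2 _+_ (∑-* (rng R) (ι (# 4)) _) (∑-* (rng R) (ι 2ℚ) _))) (+-mono (*-monoˡ _ (ι≥0 (# 4)) (main2-sum R M)) ≤-refl))) (≤≡ (∑-mono (rng R) nterm) (∑-* (rng R) (ι 2ℚ) _)))
  (≡≤ (solve 2 (λ v s → (con (# 4) :* (:2 :* v) :+ :2 :* s) :+ :2 :* s := con (# 8) :* v :+ con (# 4) :* s) refl « ν M » S) (+-mono ≤-refl (≤≡ (*-monoˡ _ (ι≥0 (# 4)) (≡≤ trunc (ρt-E Y))) (solve 1 (λ e → con (# 4) :* (con (# 4) :* e) := con (# 16) :* e) refl (E Y))))))
  where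
   f : ℤ → F
   f k = iv (ℤ.- pos Y ℤ.≤? k) * iv (k ℤ.≤? pos M) * (Gf k * Gf k)
   S = ∑ (rng R) (λ k → iv (suc k ℕ.≤? Y) * (ρt (suc k) * ρt (suc k)))
   trunc : S ≡ ∑ (rng Y) (λ k → ρt (suc k) * ρt (suc k))
   trunc = tr (∑-rng-trunc R Y _ YR (λ j l _ → tr (cong (_* (ρt (suc j) * ρt (suc j))) (iv-no (suc j ℕ.≤? Y) (N.<⇒≱ (s≤s l)))) (zeroˡ _))) (∑-cong∈ (rng Y) (λ {k} m → tr (cong (_* (ρt (suc k) * ρt (suc k))) (iv-yes (suc k ℕ.≤? Y) (∈rng m))) (1* _)))
   iv≤1 : {X : Set} (d : Dec X) → iv d ≤ 1F
   iv≤1 d = ≤≡ (iv-mono d (yes 0≤1) (λ _ → 0≤1)) (iv-yes (yes 0≤1) 0≤1)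
   pterm : ∀ k → f (pos (suc k)) ≤ ι (# 4) * (iv (suc k ℕ.≤? M) * main2 (suc k)) + ι 2ℚ * (iv (suc k ℕ.≤? Y) * (ρt (suc k) * ρt (suc k)))
   pterm k = tr≤ (*-mono (0≤* (iv≥0 (ℤ.- pos Y ℤ.≤? pos (suc k))) (iv≥0 (pos (suc k) ℤ.≤? pos M))) (0≤sq (Gf (pos (suc k)))) (≤≡ (*-mono (iv≥0 (ℤ.- pos Y ℤ.≤? pos (suc k))) (iv≥0 (pos (suc k) ℤ.≤? pos M)) (iv≤1 (ℤ.- pos Y ℤ.≤? pos (suc k))) (iv-mono (pos (suc k) ℤ.≤? pos M) (suc k ℕ.≤? M) ℤP.drop‿+≤+)) (1* _)) (Gf-pos² k))
    (≡≤ (solve 3 (λ i m r → i :* (con (# 4) :* m :+ :2 :* r) := con (# 4) :* (i :* m) :+ :2 :* (i :* r)) refl (iv (suc k ℕ.≤? M)) (main2 (suc k)) (ρt (suc k) * ρt (suc k))) (+-mono ≤-refl (*-monoˡ _ (ι≥0 2ℚ) (*-monoʳ _ (0≤sq _) (iv-mono (suc k ℕ.≤? M) (suc k ℕ.≤? Y) (λ l → N.≤-trans l MY))))))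
   nterm : ∀ k → f (negsuc k) ≤ ι 2ℚ * (iv (suc k ℕ.≤? Y) * (ρt (suc k) * ρt (suc k)))
   nterm k = ≤≡ (*-mono (0≤* (iv≥0 (ℤ.- pos Y ℤ.≤? negsuc k)) (iv≥0 (negsuc k ℤ.≤? pos M))) (0≤sq (Gf (negsuc k))) (≤≡ (*-mono (iv≥0 (ℤ.- pos Y ℤ.≤? negsuc k)) (iv≥0 (negsuc k ℤ.≤? pos M)) (iv-mono (ℤ.- pos Y ℤ.≤? negsuc k) (suc k ℕ.≤? Y) (λ h → abs≤ {Y} (negsuc k) h ℤ.-≤+)) (iv≤1 (negsuc k ℤ.≤? pos M))) (*1 _)) (Gf-neg² k)) (solve 2 (λ i r → i :* (:2 :* r) := :2 :* (i :* r)) refl (iv (suc k ℕ.≤? Y)) (ρt (suc k) * ρt (suc k)))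

 M≤Y : ∀ i → i <' J → Mq (suc i) ≤' Yseq Mq (suc i)
 M≤Y i l = N.≤-trans (N.m≤m+n (Mq (suc i)) (Mq (suc i))) (N.m≤n+m _ (Yseq Mq i))

 -- The main part costs 8 `nseq i`, negligible against the next block because sizes grow by the
 -- factor `Kb`; the tail costs 16 · 10⁻⁸ `nseq (suc i)`.
 energyG : ∀ R i → i <' J → Yseq Mq (suc i) ≤' R → En Gf R (ℤ.- pos (Yseq Mq (suc i))) (pos (Mq i)) ≤ ι qM * « length (Bl i) »
 energyG R i l YR = tr≤ (En-bound R (Yseq Mq (suc i)) (Mq i) YR (N.≤-trans (N.<⇒≤ (M-< i l)) (M≤Y i l))) (tr≤ (+-mono (*-monoˡ _ (ι≥0 (# 8)) (≡⇒≤ (cong «_» (νM i (N.<⇒≤ l))))) (*-monoˡ _ (ι≥0 (# 16)) (E-bound (suc i) l (Yseq Mq (suc i)) (Y≤PM (suc i) l))))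
  (≤≡ (≤-by (ι (# 8 ℚ.+ qM) * (ι qK * n' - n) + ι (qM ℚ.- (# 16 ℚ.* qε ℚ.+ (# 8 ℚ.+ qM) ℚ.* qK)) * n')
   (0≤+ (0≤* (ι≥0 (# 8 ℚ.+ qM)) (0≤- (nseq-K i))) (0≤* (ι≥0 (qM ℚ.- (# 16 ℚ.* qε ℚ.+ (# 8 ℚ.+ qM) ℚ.* qK))) («»≥0 (nseq (suc i)))))
   (solve 2 (λ n n' → con (# 8) :* n :+ con (# 16) :* (con qε :* n') :+ (con (# 8 ℚ.+ qM) :* (con qK :* n' :- n) :+ con (qM ℚ.- (# 16 ℚ.* qε ℚ.+ (# 8 ℚ.+ qM) ℚ.* qK)) :* n') := con qM :* (n' :- n)) refl n n')) (cong (ι qM *_) (tr (cong (_- n) (sym (Bl-len i l))) (solve 2 (λ b n → b :+ n :- n := b) refl « length (Bl i) » n)))))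
  where
   n = « nseq i »
   n' = « nseq (suc i) »

 massG : ∀ i → i <' J → ι q34 * « length (Bl i) » ≤ ∑ (Bl i) (λ a → Gf (pos a))
 massG i l = tr≤ fin (∑-mono∈ B (λ {a} m → low a m))
  where
   B = Bl i
   b = « length B »
   Y = Mq (suc i)
   n' = « nseq (suc i) »
   h : ℕ → F
   h a = ρt a * ρt a
   -- 1 - r ≥ 7/8 - 2 r², by completing the square at r = 1/4. This trades the tail for its square,
   -- whose sum is known to be small.
   low : ∀ a → a ∈ B → ι (pos 7 ℚ./ 8) + (- (ι 2ℚ * h a)) ≤ Gf (pos a)
   low a m = lo a (fst (Bl-∈ i m)) (All.lookup A1 (fst (Bl-∈ i m)))
    where
     lo : ∀ a → a ∈ A → 1 ≤' a → ι (pos 7 ℚ./ 8) + (- (ι 2ℚ * h a)) ≤ Gf (pos a)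
     lo (suc k) ma _ = tr≤ (≤-by (ι 2ℚ * ((ρ - ι (pos 1 ℚ./ 4)) * (ρ - ι (pos 1 ℚ./ 4))) + (main2 (suc k) - 1F)) (0≤+ (0≤* (ι≥0 2ℚ) (0≤sq _)) (0≤- one)) (solve 2 (λ r m → con (pos 7 ℚ./ 8) :+ (:- (:2 :* (r :* r))) :+ (:2 :* ((r :- con (pos 1 ℚ./ 4)) :* (r :- con (pos 1 ℚ./ 4))) :+ (m :- :1)) := m :- r) refl ρ (main2 (suc k)))) (≤≡ (+-mono ≤-refl (neg-mono (tr≤ (neg≤∣∣ _) (Gf-pos k)))) (solve 2 (λ m g → m :+ (:- (:- (g :- m))) := g) refl (main2 (suc k)) (Gf (pos (suc k)))))
      where
       ρ = ρt (suc k)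
       one : 1F ≤ main2 (suc k)
       one = tr≤ (≤≡ (≤-by (δ 2 1) (iv≥0 _) refl) (tr (cong (_+ δ 2 1) (sym (iv-yes (1 ℕ.≟ 1) refl))) (tr (sym (at-mult (suc k) 1 (λ n → δ 1 n + δ 2 n) (s≤s z≤n))) (cong (λ w → at (suc k) w (λ n → δ 1 n + δ 2 n)) (N.*-identityʳ (suc k)))))) (term A (λ m → All.lookup A1 m) ma)
        where
         term : ∀ xs → (∀ {a} → a ∈ xs → 1 ≤' a) → suc k ∈ xs → at (suc k) (suc k) (λ n → δ 1 n + δ 2 n) ≤ ∑ xs (λ a → at a (suc k) (λ n → δ 1 n + δ 2 n))
         nn : ∀ a → 1 ≤' a → 0F ≤ at a (suc k) (λ n → δ 1 n + δ 2 n)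
         nn a a1 = at≥0 a1 (λ n → 0≤+ (iv≥0 _) (iv≥0 _))
         term (_ ∷ xs) x1 (here refl) = ≤-by (∑ xs (λ a → at a (suc k) (λ n → δ 1 n + δ 2 n))) (∑≥0∈ xs (λ {a} m → nn a (x1 (there m)))) refl
         term (x ∷ xs) x1 (there m) = tr≤ (term xs (λ m → x1 (there m)) m) (≤-by (at x (suc k) (λ n → δ 1 n + δ 2 n)) (nn x (x1 (here refl))) (+-comm _ _))
   hsum : ∑ B h ≤ ι (# 4 ℚ.* qε) * n'
   hsum = tr≤ (∑-sub B (map suc (rng Y)) h (λ a → 0≤sq _) (Bl-unique i) (λ {a} m → mem a (All.lookup A1 (fst (Bl-∈ i m))) (snd (snd (Bl-∈ i m))))) (≡≤ (∑-map suc (rng Y) h) (tr≤ (ρt-E Y) (≤≡ (*-monoˡ _ (ι≥0 (# 4)) (E-bound (suc i) l Y (N.m≤m*n Y P {{ℕ.>-nonZero P1}}))) (solve 1 (λ n → con (# 4) :* (con qε :* n) := con (# 4 ℚ.* qε) :* n) refl n'))))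
    where
     mem : ∀ a → 1 ≤' a → a ≤' Y → a ∈ map suc (rng Y)
     mem (suc a) _ l = ∈-map⁺ suc (rng∈ l)
   n'≤ : n' ≤ ι 2ℚ * b
   n'≤ = ≤≡ (≤-by (ι 2ℚ * (ι qK * n' - « nseq i ») + ι (1ℚ ℚ.- 2ℚ ℚ.* qK) * n') (0≤+ (0≤* (ι≥0 2ℚ) (0≤- (nseq-K i))) (0≤* (ι≥0 (1ℚ ℚ.- 2ℚ ℚ.* qK)) («»≥0 _))) (solve 2 (λ n n' → n' :+ (:2 :* (con qK :* n' :- n) :+ con (1ℚ ℚ.- 2ℚ ℚ.* qK) :* n') := :2 :* (n' :- n)) refl « nseq i » n')) (cong (ι 2ℚ *_) (tr (cong (_- « nseq i ») (sym (Bl-len i l))) (solve 2 (λ b n → b :+ n :- n := b) refl b « nseq i »)))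
   fin : ι q34 * b ≤ ∑ B (λ a → ι (pos 7 ℚ./ 8) + (- (ι 2ℚ * h a)))
   fin = ≤≡ (tr≤ (≤-by (ι (pos 7 ℚ./ 8 ℚ.- (q34 ℚ.+ # 16 ℚ.* qε)) * b) (0≤* (ι≥0 (pos 7 ℚ./ 8 ℚ.- (q34 ℚ.+ # 16 ℚ.* qε))) («»≥0 _)) (solve 1 (λ b → con q34 :* b :+ con (pos 7 ℚ./ 8 ℚ.- (q34 ℚ.+ # 16 ℚ.* qε)) :* b := b :* con (pos 7 ℚ./ 8) :+ (:- (:2 :* (con (# 4 ℚ.* qε) :* (:2 :* b))))) refl b)) (+-mono ≤-refl (neg-mono (*-monoˡ _ (ι≥0 2ℚ) (tr≤ hsum (*-monoˡ _ (ι≥0 (# 4 ℚ.* qε)) n'≤))))))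
    (sym (tr (∑-+ B _ _) (cong2 _+_ (∑-const B _) (tr (∑-neg B _) (cong -_ (∑-* B (ι 2ℚ) h))))))

-- From bounds on the counts to bounds on the coefficients.

re-N1 : ∀ a w → nrm w ≤ 1F → re (a *C w) ≤ N1 a
re-N1 (a ⊹ b) (c ⊹ d) h = +-mono (one a c (∣re∣≤1 h)) (≡≤ (solve 2 (λ b d → :- (b :* d) := b :* (:- d)) refl b d) (one b (- d) (≡≤ (∣∣-neg d) (∣im∣≤1 h))))
 where
  one : ∀ x y → abs y ≤ 1F → x * y ≤ abs x
  one x y h = tr≤ (≤∣∣ _) (tr≤ (∣∣-* x y) (≤≡ (*-monoˡ _ (∣∣≥0 x) h) (*1 _)))

module Test (P : ℕ) (A : List ℕ) (A1 : All (1 ≤'_) A) where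
 open Target P A A1

 ts : List Term
 ts = terms (primesTo P)

 sgn : Term → Bool
 sgn t = fst t
 dd : Term → ℕ
 dd t = fst (snd t)
 cf : Term → F
 cf t = snd (snd t)

 dd≥1 : ∀ {t} → t ∈ ts → 1 ≤' dd t
 dd≥1 m = All.lookup (terms-d≥1 (primesTo P) (primesTo-good P)) m

 Dp Ap : ℕ
 Dp = product (map dd ts)
 Ap = product A

 pos' : ∀ xs → All (1 ≤'_) xs → 1 ≤' product xs
 pos' xs h = ℕ.>-nonZero⁻¹ (product xs) {{product≢0 (All.map (λ l → ℕ.>-nonZero l) h)}}

 l0≥1 : 1 ≤' 4 *' (Dp *' Ap)
 l0≥1 = N.*-mono-≤ {1} {4} {1} {Dp *' Ap} (s≤s z≤n) (N.*-mono-≤ {1} {Dp} {1} {Ap} (pos' (map dd ts) (AllP.map⁺ (All.tabulate dd≥1))) (pos' A A1))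

 opaque
  -- Makes the grid divisible by 12 · 4 d a for all sieve divisors d and all a in A, so that every
  -- dilated arc is met exactly. The predecessor is taken because `Grid` adds 1.
  l' : ℕ
  l' = ℕ.pred (4 *' (Dp *' Ap))

  sl' : suc l' ≡ 4 *' (Dp *' Ap)
  sl' = N.suc-pred (4 *' (Dp *' Ap)) {{ℕ.>-nonZero l0≥1}}

 fac : ∀ {t a} → t ∈ ts → a ∈ A → Σ ℕ λ m' → suc l' ≡ 4 *' (dd t *' a) *' m'
 fac {t} {a} mt ma = go (∈⇒∣product (∈-map⁺ dd mt)) (∈⇒∣product ma)
  where
   go : dd t ∣ Dp → a ∣ Ap → Σ ℕ λ m' → suc l' ≡ 4 *' (dd t *' a) *' m'
   go (divides u eu) (divides v ev) = u *' v , tr sl' (tr (cong2 (λ x y → 4 *' (x *' y)) eu ev) (solveN 4 (λ u d v a → con' 4 :*' ((u :*' d) :*' (v :*' a)) :=' con' 4 :*' (d :*' a) :*' (u :*' v)) refl u (dd t) v a))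

 open Avgs l' public

 da≥1 : ∀ {t a} → t ∈ ts → a ∈ A → 1 ≤' dd t *' a
 da≥1 {t} {a} mt ma = N.*-mono-≤ {1} {dd t} {1} {a} (dd≥1 mt) (All.lookup A1 ma)

 𝒲t : Term → ℕ → ℕ → ℂ
 𝒲t t n x = ∑C A (λ a → wfun (sgn t) (Q n) (dd t *' a) x)

 𝒲 : ℕ → ℕ → ℂ
 𝒲 n x = ∑C ts (λ t → real (cf t) *C 𝒲t t n x)

 av : ℕ → (ℕ → F) → F
 av n f = inv « Q n » * ∑ (rng (Q n)) f

 Qp : ∀ n → N₀ ≤' n → Pos « Q n »
 Qp n h = «»-pos (N.≤-trans (s≤s z≤n) (S≤Q n h))

 iQ : ∀ n → N₀ ≤' n → 0F ≤ inv « Q n »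
 iQ n h = inv≥0 (Qp n h)

 Cp Cm vp vm : ℕ → ℕ → F
 Cp n y = ∑ A (λ a → hp (Q n) (a *' y))
 Cm n y = ∑ A (λ a → hm (Q n) (a *' y))
 vp n y = Cp n y - ι q13 * « length A »
 vm n y = Cm n y - ι q13 * « length A »

 av-mono : ∀ n → N₀ ≤' n → ∀ {f g} → (∀ x → f x ≤ g x) → av n f ≤ av n g
 av-mono n h l = *-monoˡ _ (iQ n h) (∑-mono (rng (Q n)) l)

 av-+ : ∀ n f g → av n (λ x → f x + g x) ≡ av n f + av n g
 av-+ n f g = tr (cong (inv « Q n » *_) (∑-+ (rng (Q n)) f g)) (distribˡ _ _ _)

 av-* : ∀ n c f → av n (λ x → c * f x) ≡ c * av n f
 av-* n c f = tr (cong (inv « Q n » *_) (∑-* (rng (Q n)) c f)) (solve 3 (λ i c s → i :* (c :* s) := c :* (i :* s)) refl (inv « Q n ») c (∑ (rng (Q n)) f))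

 av-const : ∀ n → N₀ ≤' n → ∀ c → av n (λ _ → c) ≡ c
 av-const n h c = tr (cong (inv « Q n » *_) (tr (∑-const (rng (Q n)) c) (cong (λ w → « w » * c) (length-rng (Q n))))) (tr (solve 3 (λ i q c → i :* (q :* c) := (q :* i) :* c) refl (inv « Q n ») « Q n » c) (tr (cong (_* c) (*-inv (Qp n h))) (1* c)))

 av-∑ : {B : Set} (xs : List B) → ∀ n (f : B → ℕ → F) → av n (λ x → ∑ xs (λ b → f b x)) ≡ ∑ xs (λ b → av n (f b))
 av-∑ xs n f = tr (cong (inv « Q n » *_) (∑-swap (rng (Q n)) xs (λ x b → f b x))) (sym (∑-* xs (inv « Q n ») _))

 data Mul : ℕ → Set where
  m1 : Mul 1
  m2 : Mul 2
  m4 : Mul 4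

 facj : ∀ {t a j} → Mul j → t ∈ ts → a ∈ A → Σ ℕ λ m' → suc l' ≡ j *' (dd t *' a) *' m'
 facj {t} {a} mj mt ma = go mj (fac mt ma)
  where
   go : ∀ {j} → Mul j → (Σ ℕ λ m' → suc l' ≡ 4 *' (dd t *' a) *' m') → Σ ℕ λ m' → suc l' ≡ j *' (dd t *' a) *' m'
   go m1 (m' , e) = 4 *' m' , tr e (solveN 2 (λ q m → con' 4 :*' q :*' m :=' con' 1 :*' q :*' (con' 4 :*' m)) refl (dd t *' a) m')
   go m2 (m' , e) = 2 *' m' , tr e (solveN 2 (λ q m → con' 4 :*' q :*' m :=' con' 2 :*' q :*' (con' 2 :*' m)) refl (dd t *' a) m')
   go m4 (m' , e) = m' , e

 j≥1 : ∀ {j} → Mul j → 1 ≤' j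
 j≥1 m1 = s≤s z≤n
 j≥1 m2 = s≤s z≤n
 j≥1 m4 = s≤s z≤n

 meanI : ∀ α β → α ≤' β → β <' 12 → β ≡ 4 +' α → ∀ {t j} → Mul j → t ∈ ts → ∀ n → N₀ ≤' n → av n (λ x → ∑ A (λ a → Ind α β (Q n) (md (a *' (j *' dd t *' x)) (Q n)))) ≡ ι q13 * « length A »
 meanI α β ab b12 e4 {t} {j} mj mt n h = tr (av-∑ A n _) (tr (∑-cong∈ A (λ {a} ma → one a ma)) (tr (∑-const A (ι q13)) (*-comm _ _)))
  where
   one : ∀ a → a ∈ A → av n (λ x → Ind α β (Q n) (md (a *' (j *' dd t *' x)) (Q n))) ≡ ι q13
   one a ma = tr (cong (inv « Q n » *_) (∑-cong (rng (Q n)) (λ x → cong (λ w → Ind α β (Q n) (md w (Q n))) (solveN 4 (λ a j d x → a :*' (j :*' d :*' x) :=' j :*' (d :*' a) :*' x) refl a j (dd t) x)))) (One.mean (j *' (dd t *' a)) (fst fj) (N.*-mono-≤ {1} {j} {1} {dd t *' a} (j≥1 mj) (da≥1 mt ma)) (snd fj) α β ab b12 e4 n h)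
    where fj = facj mj mt ma

 G-v : ∀ n j d x → ∑ A (λ a → dg (Q n) (j *' (d *' a) *' x)) ≡ vp n (j *' d *' x) + vm n (j *' d *' x)
 G-v n j d x = tr (∑-cong A (λ a → cong (dg (Q n)) (re-arr a))) (tr (∑-- A _ _) (tr (cong2 _-_ (∑-+ A _ _) (∑-const A (ι q23))) (tr (cong (λ w → (Cp n y + Cm n y) - « length A » * w) (cong ι (sym (from-yes (q13 ℚ.+ q13 ℚ.≟ q23))))) (tr (cong (λ w → (Cp n y + Cm n y) - « length A » * w) (ι-+ q13 q13)) (solve 4 (λ p m l i → (p :+ m) :- l :* (i :+ i) := (p :- i :* l) :+ (m :- i :* l)) refl (Cp n y) (Cm n y) « length A » (ι q13))))))
  where
   y = j *' d *' x
   re-arr : ∀ a → j *' (d *' a) *' x ≡ a *' (j *' d *' x)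
   re-arr a = solveN 4 (λ j d a x → j :*' (d :*' a) :*' x :=' a :*' (j :*' d :*' x)) refl j d a x

 U-v : ∀ n j d x → ∑ A (λ a → du (Q n) (j *' (d *' a) *' x)) ≡ vp n (j *' d *' x) - vm n (j *' d *' x)
 U-v n j d x = tr (∑-cong A (λ a → cong (du (Q n)) (solveN 4 (λ j d a x → j :*' (d :*' a) :*' x :=' a :*' (j :*' d :*' x)) refl j d a x))) (tr (∑-- A _ _) (solve 3 (λ p m l → p :- m := (p :- l) :- (m :- l)) refl (Cp n y) (Cm n y) (ι q13 * « length A »)))
  where y = j *' d *' x

 module Bounded (n : ℕ) (hn : N₀ ≤' n) (B : F) (B≥0 : 0F ≤ B)
  (Hp : ∀ y → Cp n y ≤ ι q13 * « length A » + B) (Hm : ∀ y → Cm n y ≤ ι q13 * « length A » + B) where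

  -- A function bounded above by B with mean 0 satisfies |v| ≤ 2 B - v pointwise, hence has mean
  -- absolute value at most 2 B. Only an upper bound on the counts is available.
  abs-av : (C : ℕ → F) → (∀ y → C y ≤ ι q13 * « length A » + B) → ∀ (f : ℕ → ℕ) → av n (λ x → C (f x)) ≡ ι q13 * « length A » → av n (λ x → abs (C (f x) - ι q13 * « length A »)) ≤ ι 2ℚ * B
  abs-av C H f m = ≤≡ (av-mono n hn (λ x → one (C (f x)) (H (f x)))) (tr (av-+ n _ _) (tr (cong2 _+_ (av-const n hn _) (tr (av-* n (- 1F) _) (cong (- 1F *_) m))) (solve 2 (λ b c → (:2 :* b :+ c) :+ (:- :1) :* c := :2 :* b) refl B (ι q13 * « length A »))))
   where
    one : ∀ c → c ≤ ι q13 * « length A » + B → abs (c - ι q13 * « length A ») ≤ (ι 2ℚ * B + ι q13 * « length A ») + - 1F * c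
    one c h = ∣∣-≤ (≤-by (ι 2ℚ * ((M + B) - c)) (0≤* (ι≥0 2ℚ) (0≤- h)) (solve 3 (λ c m b → (c :- m) :+ :2 :* ((m :+ b) :- c) := (:2 :* b :+ m) :+ (:- :1) :* c) refl c M B)) (≤-by (ι 2ℚ * B) (0≤* (ι≥0 2ℚ) B≥0) (solve 3 (λ c m b → :- (c :- m) :+ :2 :* b := (:2 :* b :+ m) :+ (:- :1) :* c) refl c M B))
     where M = ι q13 * « length A »

  apv amv : ℕ → ℕ → ℕ → F
  apv j d x = abs (vp n (j *' d *' x))
  amv j d x = abs (vm n (j *' d *' x))

  bnd : ∀ {t j} → Mul j → t ∈ ts → av n (λ x → apv j (dd t) x + amv j (dd t) x) ≤ ι (# 4) * B
  bnd {t} {j} mj mt = ≡≤ (av-+ n _ _) (≤≡ (+-mono (abs-av (Cp n) Hp (λ x → j *' dd t *' x) (meanI 1 5 (from-yes (1 ℕ.≤? 5)) (from-yes (5 ℕ.<? 12)) refl mj mt n hn)) (abs-av (Cm n) Hm (λ x → j *' dd t *' x) (meanI 7 11 (from-yes (7 ℕ.≤? 11)) (from-yes (11 ℕ.<? 12)) refl mj mt n hn))) (solve 1 (λ b → :2 :* b :+ :2 :* b := con (# 4) :* b) refl B))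

  sg≤1 : ∀ σ → abs (sg σ) ≤ 1F
  sg≤1 true = ∣∣-≤ ≤-refl (≡≤ (sym (ι-neg 1ℚ)) (ι-≤ (from-yes (ℚ.- 1ℚ ℚ.≤? 1ℚ))))
  sg≤1 false = ∣∣-≤ (ι-≤ (from-yes (ℚ.- 1ℚ ℚ.≤? 1ℚ))) (≡≤ (sym (ι-neg (ℚ.- 1ℚ))) (ι-≤ (from-yes (ℚ.- (ℚ.- 1ℚ) ℚ.≤? 1ℚ))))

  s4 : ℕ → ℕ → ℕ → F
  s4 j d x = apv j d x + amv j d x

  N1-𝒲t : ∀ t x → N1 (𝒲t t n x) ≤ (ι 2ℚ * s4 1 (dd t) x + s4 2 (dd t) x) + (s4 2 (dd t) x + s4 4 (dd t) x)
  N1-𝒲t t x = +-mono (≡≤ (tr (cong abs (tr (∑-neg A _) (cong -_ (tr (∑-+ A _ _) (cong2 _+_ (tr (∑-* A (ι 2ℚ) _) (cong (ι 2ℚ *_) (tr (∑-cong A (λ a → cong (λ w → dg (Q n) (w *' x)) (sym (N.*-identityˡ (d *' a))))) (G-v n 1 d x)))) (G-v n 2 d x)))))) (∣∣-neg _)) (tr≤ (∣∣-+ _ _) (+-mono (tr≤ (∣∣-* _ _) (*-mono (∣∣≥0 _) (∣∣≥0 _) (≡⇒≤ (∣∣-real (ι≥0 2ℚ))) (∣∣-+ _ _))) (∣∣-+ _ _))))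
   (≡≤ (cong abs (tr (∑-* A (sg (sgn t)) _) (cong (sg (sgn t) *_) (tr (∑-+ A _ _) (cong2 _+_ (U-v n 2 d x) (U-v n 4 d x)))))) (tr≤ (∣∣-* _ _) (tr≤ (*-monoʳ _ (∣∣≥0 _) (sg≤1 (sgn t))) (≡≤ (1* _) (tr≤ (∣∣-+ _ _) (+-mono (sub _ _) (sub _ _)))))))
   where
    d = dd t
    sub : ∀ a b → abs (a - b) ≤ abs a + abs b
    sub a b = tr≤ (∣∣-+ a (- b)) (+-mono ≤-refl (≡⇒≤ (∣∣-neg b)))

  -- 20 = (2 · 4 + 4) + (4 + 4): the real part contains the sum of the counts twice and once, the
  -- imaginary part their difference at two dilations.
  av-𝒲t : ∀ {t} → t ∈ ts → av n (λ x → N1 (𝒲t t n x)) ≤ ι (# 20) * B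
  av-𝒲t {t} mt = tr≤ (av-mono n hn (N1-𝒲t t)) (≡≤ (tr (av-+ n _ _) (cong2 _+_ (tr (av-+ n _ _) (cong (_+ av n (s4 2 (dd t))) (av-* n (ι 2ℚ) _))) (av-+ n _ _))) (≤≡ (+-mono (+-mono (*-monoˡ _ (ι≥0 2ℚ) (bnd m1 mt)) (bnd m2 mt)) (+-mono (bnd m2 mt) (bnd m4 mt))) (solve 1 (λ b → (:2 :* (con (# 4) :* b) :+ con (# 4) :* b) :+ (con (# 4) :* b :+ con (# 4) :* b) := con (# 20) :* b) refl B)))

  pairing : ∀ (w : ℕ → ℂ) → (∀ x → nrm (w x) ≤ 1F) → re (Avg n (λ x → 𝒲 n x *C w x)) ≤ ∑ ts (λ t → abs (cf t)) * (ι (# 20) * B)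
  pairing w hw = ≡≤ (re-real-* (inv « Q n ») _) (tr≤ (av-mono n hn (λ x → tr≤ (re-N1 (𝒲 n x) (w x) (hw x)) (tr≤ (∑C-N1 ts _) (∑-mono ts (λ t → ≤≡ (N1-* _ _) (cong (_* N1 (𝒲t t n x)) (N1-real' (cf t))))))))
   (≡≤ (av-∑ ts n _) (≤≡ (∑-mono∈ ts (λ {t} mt → ≡≤ (av-* n (abs (cf t)) _) (*-monoˡ _ (∣∣≥0 _) (av-𝒲t mt)))) (∑-*ʳ ts _ _))))
   where
    N1-real' : ∀ r → N1 (real r) ≡ abs r
    N1-real' r = tr (cong (abs r +_) (∣∣-real ≤-refl)) (+0 _)

 -- Frequency 2k, since `kernel` is read off at even frequencies.
 ck : ℤ → ℕ → ℕ → ℂ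
 ck k n x = conj (Char.ch (zz n) (uu n) k (2 *' x))

 ck-pos : ∀ j n x → ck (pos (suc j)) n x ≡ Ech true (zz n) (2 *' suc j *' x)
 ck-pos j n x = tr (cong (λ w → conj (Char.e (zz n) (uu n) w)) (sym (ℤP.pos-* (suc j) (2 *' x)))) (tr (conj-^C (zz n) (suc j *' (2 *' x))) (cong (conj (zz n) ^C_) (solveN 2 (λ j x → j :*' (con' 2 :*' x) :=' con' 2 :*' j :*' x) refl (suc j) x)))

 ck-neg : ∀ j n x → ck (negsuc j) n x ≡ Ech false (zz n) (2 *' suc j *' x)
 ck-neg j n x = tr (cong conj (Char.ch-neg (zz n) (uu n) (pos (suc j)) (2 *' x))) (tr (conj-conj _) (tr (cong (Char.e (zz n) (uu n)) (sym (ℤP.pos-* (suc j) (2 *' x)))) (cong (zz n ^C_) (solveN 2 (λ j x → j :*' (con' 2 :*' x) :=' con' 2 :*' j :*' x) refl (suc j) x))))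

 Avg-𝒲 : ∀ n (w : ℕ → ℂ) → Avg n (λ x → 𝒲 n x *C w x) ≡ ∑C ts (λ t → real (cf t) *C ∑C A (λ a → Avg n (λ x → wfun (sgn t) (Q n) (dd t *' a) x *C w x)))
 Avg-𝒲 n w = tr (Avg-cong n (λ x → sym (∑C-*ʳ ts (w x) _))) (tr (Avg-∑ ts n _) (∑C-cong ts (λ t → tr (Avg-cong n (λ x → tr (*C-assoc _ _ _) (cong (real (cf t) *C_) (sym (∑C-*ʳ A (w x) _))))) (tr (Avg-* n (real (cf t)) _) (cong (real (cf t) *C_) (Avg-∑ A n _))))))

 coef-sgn : ∀ τ j → (λ n → Avg n (λ x → 𝒲 n x *C Ech τ (zz n) (2 *' suc j *' x))) ≐ (λ n → real (s0 n * (ι 2ℚ * GT τ (suc j))))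
 coef-sgn τ j = ≐-from (λ n → Avg-𝒲 n _) (λ n → sym (gather n)) (≐-∑ ts (λ {t} mt → ≐-*ˡ (λ _ → real (cf t)) (Bdd-const _) (≐-∑ A (λ {a} ma → Atom.ŵ (dd t *' a) (fst (fac mt ma)) (da≥1 mt ma) (snd (fac mt ma)) (sgn t) τ (suc j) (s≤s z≤n)))))
  where
   gather : ∀ n → ∑C ts (λ t → real (cf t) *C ∑C A (λ a → real (s0 n * (ι 2ℚ * at (dd t *' a) (suc j) (k0 (sgn t ⊙ τ)))))) ≡ real (s0 n * (ι 2ℚ * GT τ (suc j)))
   gather n = tr (∑C-cong ts (λ t → tr (cong (real (cf t) *C_) (∑C-real A _)) (sym (real-* _ _)))) (tr (∑C-real ts _) (cong real (tr (∑-cong ts (λ t → tr (cong (cf t *_) (tr (∑-* A (s0 n) _) (cong (s0 n *_) (∑-* A (ι 2ℚ) _)))) (solve 4 (λ c s t g → c :* (s :* (t :* g)) := s :* (t :* (c :* g))) refl (cf t) (s0 n) (ι 2ℚ) (∑ A (λ a → at (dd t *' a) (suc j) (k0 (sgn t ⊙ τ))))))) (tr (∑-* ts (s0 n) _) (cong (s0 n *_) (∑-* ts (ι 2ℚ) _))))))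

 -- At frequency 0 the asymptotic formula does not apply; instead the counts have mean exactly a
 -- third of `length A`, and all combinations vanish.
 coef-zero : (λ n → Avg n (λ x → 𝒲 n x *C 1C)) ≐ (λ n → real (s0 n * (ι 2ℚ * 0F)))
 coef-zero = ≐-from-eventually N₀ z (≐-≡ (λ n → cong real (solve 1 (λ s → :0 := s :* (:2 :* :0)) refl (s0 n))))
  where
   z : ∀ n → N₀ ≤' n → Avg n (λ x → 𝒲 n x *C 1C) ≡ 0C
   z n h = tr (Avg-𝒲 n (λ _ → 1C)) (∑C-zero∈ ts (λ {t} mt → tr (cong (real (cf t) *C_) (tr (sym (Avg-∑ A n _)) (tr (Avg-cong n (λ x → tr (∑C-*ʳ A 1C _) (*C-identityʳ _))) (zt t mt)))) (zeroCʳ _)))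
    where
     vz : ∀ {t j} → Mul j → t ∈ ts → (av n (λ x → vp n (j *' dd t *' x)) ≡ 0F) × (av n (λ x → vm n (j *' dd t *' x)) ≡ 0F)
     vz mj mt = sub _ (meanI 1 5 (from-yes (1 ℕ.≤? 5)) (from-yes (5 ℕ.<? 12)) refl mj mt n h) , sub _ (meanI 7 11 (from-yes (7 ℕ.≤? 11)) (from-yes (11 ℕ.<? 12)) refl mj mt n h)
      where
       sub : ∀ f → av n f ≡ ι q13 * « length A » → av n (λ x → f x - ι q13 * « length A ») ≡ 0F
       sub f e = tr (av-+ n f _) (tr (cong2 _+_ e (av-const n h _)) (solve 1 (λ a → a :+ (:- a) := :0) refl (ι q13 * « length A »)))
     zt : ∀ t → t ∈ ts → Avg n (𝒲t t n) ≡ 0C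
     zt t mt = cong2 _⊹_ (tr (re-real-* (inv « Q n ») _) (tr (cong (inv « Q n » *_) (∑-cong (rng (Q n)) rex)) (tr (av-* n (- 1F) _) (tr (cong (- 1F *_) (tr (av-+ n _ _) (cong2 _+_ (tr (av-* n (ι 2ℚ) _) (cong (ι 2ℚ *_) (gz m1))) (gz m2)))) (solve 0 ((:- :1) :* (:2 :* :0 :+ :0) := :0) refl)))))
      (tr (im-real-* (inv « Q n ») _) (tr (cong (inv « Q n » *_) (∑-cong (rng (Q n)) imx)) (tr (av-* n (sg (sgn t)) _) (tr (cong (sg (sgn t) *_) (tr (av-+ n _ _) (cong2 _+_ (uz m2) (uz m4)))) (solve 1 (λ s → s :* (:0 :+ :0) := :0) refl (sg (sgn t)))))))
      where
       d = dd t
       g u : ℕ → ℕ → F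
       g j x = vp n (j *' d *' x) + vm n (j *' d *' x)
       u j x = vp n (j *' d *' x) - vm n (j *' d *' x)
       gz : ∀ {j} → Mul j → av n (g j) ≡ 0F
       gz mj = tr (av-+ n _ _) (tr (cong2 _+_ (fst (vz mj mt)) (snd (vz mj mt))) (+0 _))
       uz : ∀ {j} → Mul j → av n (u j) ≡ 0F
       uz {j} mj = tr (av-+ n _ _) (tr (cong2 _+_ (fst (vz mj mt)) (tr (tr (cong (inv « Q n » *_) (∑-neg (rng (Q n)) _)) (solve 2 (λ i s → i :* (:- s) := :- (i :* s)) refl (inv « Q n ») (∑ (rng (Q n)) (λ x → vm n (j *' d *' x))))) (cong -_ (snd (vz mj mt))))) (solve 0 (:0 :+ (:- :0) := :0) refl))
       rex : ∀ x → re (𝒲t t n x) ≡ - 1F * (ι 2ℚ * g 1 x + g 2 x)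
       rex x = tr (∑-neg A _) (tr (cong -_ (tr (∑-+ A _ _) (cong2 _+_ (tr (∑-* A (ι 2ℚ) _) (cong (ι 2ℚ *_) (tr (∑-cong A (λ a → cong (λ w → dg (Q n) (w *' x)) (sym (N.*-identityˡ (d *' a))))) (G-v n 1 d x)))) (G-v n 2 d x)))) (solve 1 (λ a → :- a := (:- :1) :* a) refl (ι 2ℚ * g 1 x + g 2 x)))
       imx : ∀ x → im (𝒲t t n x) ≡ sg (sgn t) * (u 2 x + u 4 x)
       imx x = tr (∑-* A (sg (sgn t)) _) (cong (sg (sgn t) *_) (tr (∑-+ A _ _) (cong2 _+_ (U-v n 2 d x) (U-v n 4 d x))))

 coefW : ∀ k → (λ n → Avg n (λ x → 𝒲 n x *C ck k n x)) ≐ (λ n → real (s0 n * (ι 2ℚ * Gf k)))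
 coefW (pos zero) = ≐-from (λ n → Avg-cong n (λ x → cong (𝒲 n x *C_) (conj-real 1F))) (λ _ → refl) coef-zero
 coefW (pos (suc j)) = ≐-from (λ n → Avg-cong n (λ x → cong (𝒲 n x *C_) (ck-pos j n x))) (λ _ → refl) (coef-sgn true j)
 coefW (negsuc j) = ≐-from (λ n → Avg-cong n (λ x → cong (𝒲 n x *C_) (ck-neg j n x))) (λ _ → refl) (coef-sgn false j)

-- Choice of the precision and the contradiction.

sumN : ℕ → (ℕ → ℕ) → ℕ
sumN zero f = 0
sumN (suc n) f = f n +' sumN n f

sumN-≤ : ∀ {n i} f → i <' n → f i ≤' sumN n f
sumN-≤ {suc n} {i} f (s≤s l) = go (i ℕ.≟ n)
 where
  go : Dec (i ≡ n) → f i ≤' f n +' sumN n f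
  go (yes refl) = N.m≤m+n (f i) _
  go (no ne) = N.≤-trans (sumN-≤ f (N.≤∧≢⇒< l ne)) (N.m≤n+m _ (f n))

md-red : ∀ Q a y → 1 ≤' Q → md (a *' y) Q ≡ md (a *' md y Q) Q
md-red (suc q) a y _ = tr (%-distribˡ-* a y (suc q)) (tr (cong (λ w → ((a % suc q) *' w) % suc q) (sym (m%n%n≡m%n y (suc q)))) (sym (%-distribˡ-* a (y % suc q) (suc q))))

md-< : ∀ Q y → 1 ≤' Q → md y Q <' Q
md-< (suc q) y _ = m%n<n y (suc q)

Yseq-mono : ∀ M {i j} → i ≤' j → Yseq M i ≤' Yseq M j
Yseq-mono M {i} {zero} z≤n = N.≤-refl
Yseq-mono M {i} {suc j} l = go (i ℕ.≟ suc j)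
 where
  go : Dec (i ≡ suc j) → Yseq M i ≤' Yseq M (suc j)
  go (yes refl) = N.≤-refl
  go (no ne) = N.≤-trans (Yseq-mono M (N.≤-pred (N.≤∧≢⇒< l ne))) (N.m≤m+n _ _)

Unif : List ℤ → (a b : ℤ → ℕ → ℂ) → Set
Unif ks a b = Σ ℕ λ m → Σ F λ C' → 0F ≤ C' × (∀ n → m ≤' n → ∀ {k} → k ∈ ks → N1 (a k n +C (-C b k n)) ≤ C' * inv « suc n »)

-- The spectrum is bounded before the precision is chosen, so finitely many frequencies need one
-- common threshold and constant.
uniform : (ks : List ℤ) (a b : ℤ → ℕ → ℂ) → (∀ k → a k ≐ b k) → Unif ks a b
uniform [] a b h = 0 , 0F , ≤-refl , λ _ _ ()
uniform (k ∷ ks) a b h = go (uniform ks a b h)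
 where
  go : Unif ks a b → Unif (k ∷ ks) a b
  go (m , C' , C0 , f) = n₀ (h k) +' m , C (h k) + C' , 0≤+ (C≥0 (h k)) C0 , res
   where
    res : ∀ n → n₀ (h k) +' m ≤' n → ∀ {k'} → k' ∈ k ∷ ks → N1 (a k' n +C (-C b k' n)) ≤ (C (h k) + C') * inv « suc n »
    res n l (here refl) = tr≤ (bd (h k) n (N.m+n≤o⇒m≤o (n₀ (h k)) l)) (*-monoʳ _ (inv≥0 («suc»-pos n)) (≤-by C' C0 refl))
    res n l (there mem) = tr≤ (f n (N.m+n≤o⇒n≤o (n₀ (h k)) l) mem) (*-monoʳ _ (inv≥0 («suc»-pos n)) (≤-by (C (h k)) (C≥0 (h k)) (+-comm _ _)))

Hits : List ℕ → ℕ → ℕ → F → Set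
Hits A Q x X = (X ≤ ∑ A (λ a → hp Q (a *' x))) ⊎ (X ≤ ∑ A (λ a → hm Q (a *' x)))

module Assemble (s : ℕ) (A : List ℕ) (uA : Unique A) (A1 : All (1 ≤'_) A) (T : ℕ) (lenT : length A ≤' 2 ^' T)
 (Pbig : ι qP * (1F + « 4 » * (« suc T » * « suc T » + 1F) * « T ») ≤ « 2 ^' s »)
 (J : ℕ) (J1 : 1 ≤' J) (JP : 2 *' J ≤' 2 ^' s) (JN : ∀ i → i ≤' J → nseq i ≤' length A) where

 open Blocks (2 ^' s) (2^>0 s) A uA A1 T lenT Pbig J JP JN
 open Test (2 ^' s) A A1

 R D W : ℕ
 R = Yseq Mq J +' Mq J
 D = R +' sumN J (λ i → mdeg (Mq (suc i) +' Mq (suc i)) (length (Bl i)) *' (Mq (suc i) +' Mq (suc i)))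
 W = D +' D

 Y≤R : ∀ i → i ≤' J → Yseq Mq i ≤' R
 Y≤R i l = N.≤-trans (Yseq-mono Mq l) (N.m≤m+n _ _)

 M≤R : ∀ i → i ≤' J → Mq i ≤' R
 M≤R i l = N.≤-trans (M-le l N.≤-refl) (N.m≤n+m _ _)

 Λ : F
 Λ = Λseq Mq J

 U = uniform (zs R) (λ k n → Avg n (λ x → 𝒲 n x *C ck k n x)) (λ k n → real (s0 n * (ι 2ℚ * Gf k))) coefW

 mU : ℕ
 mU = fst U
 CU : F
 CU = fst (snd U)

 Vc : F
 Vc = « 2 *' (8 *' suc s) »

 Vc-pos : Pos Vc
 Vc-pos = «»-pos (s≤s z≤n)

 q9600 q240 : ℚ
 q9600 = pos 1 ℚ./ 9600
 q240 = pos 1 ℚ./ 240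

 -- With this value the upper bound 20 B Vc for the pairing is J/480, half of the lower bound J/240.
 B : F
 B = ι q9600 * (« J » * inv Vc)

 B≥0 : 0F ≤ B
 B≥0 = 0≤* (ι≥0 q9600) (0≤* («»≥0 J) (inv≥0 Vc-pos))

 s0-low : ∀ n → N₀ ≤' n → ι (pos 1 ℚ./ 4) ≤ s0 n
 s0-low n h = ≡≤ (tr (cong ι (sym (from-yes ((pos 1 ℚ./ 8) ℚ.* ((# 4) ℚ.* ℚ.½) ℚ.≟ pos 1 ℚ./ 4)))) (tr (ι-* (pos 1 ℚ./ 8) ((# 4) ℚ.* ℚ.½)) (cong (ι (pos 1 ℚ./ 8) *_) (ι-* (# 4) ℚ.½)))) (*-mono (ι≥0 (pos 1 ℚ./ 8)) (0≤* (ι≥0 (# 4)) (ι≥0 ℚ.½)) κlow (*-monoˡ _ (ι≥0 (# 4)) (ρ-lo n h)))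
  where
   2Qp : Pos (ι 2ℚ * « Q n »)
   2Qp = Pos-* (λ w → from-no (2ℚ ℚ.≤? 0ℚ) (ι-≤⁻ w)) (Qp n h)
   κlow : ι (pos 1 ℚ./ 8) ≤ κ n
   κlow = *-cancel-≤ (ι 2ℚ * « Q n ») 2Qp (≤≡ (≡≤ (solve 1 (λ q → (:2 :* q) :* con (pos 1 ℚ./ 8) := con (pos 1 ℚ./ 4) :* q) refl « Q n ») (≤≡ (*-monoˡ _ (ι≥0 (pos 1 ℚ./ 4)) («»-mono (Q≤4S n))) (tr (cong (ι (pos 1 ℚ./ 4) *_) (tr («*» 4 (suc n)) (cong (_* « suc n ») («»-ι 4)))) (solve 1 (λ s → con (pos 1 ℚ./ 4) :* (con (# 4) :* s) := s) refl « suc n »))))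
    (sym (tr (solve 3 (λ a s i → a :* (s :* i) := s :* (a :* i)) refl (ι 2ℚ * « Q n ») « suc n » (inv (ι 2ℚ * « Q n »))) (tr (cong (« suc n » *_) (*-inv 2Qp)) (*1 _)))))

 module At-n (n : ℕ) (hN : N₀ ≤' n) (hU : mU ≤' n) (hW : W <' T4 n) (hΛ : Λ * (CU * inv « suc n ») ≤ ι q240) where

  quad : Quadrature (zz n) (uu n) W
  quad = Build.quadrature (zz n) (uu n) W (λ k k1 kW → Quarter.z^≢1 n k k1 (N.≤-<-trans kW hW))

  open Mean (zz n) (uu n) W D N.≤-refl quad using (TP)
  open TP using (L; freq; ℓ1; ev)

  private
   res = Littlewood.result (zz n) (uu n) W D N.≤-refl quad Gf R (N.m≤m+n R _) J Mq Bl (λ i l → N.<⇒≤ (M-< i l)) (λ i _ → Bl-unique i) (λ i _ m → snd (snd (Bl-∈ i m))) Bl≥1 M≥1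
    (λ i l → N.≤-trans (sumN-≤ (λ i → mdeg (Mq (suc i) +' Mq (suc i)) (length (Bl i)) *' (Mq (suc i) +' Mq (suc i))) l) (N.m≤n+m _ R)) Y≤R M≤R (λ i l → energyG R i l (Y≤R (suc i) l)) massG

  φ : ℕ → ℂ
  φ = fst res
  φTP : TP (ℤ.- pos (Yseq Mq J)) (pos (Mq J)) (Λseq Mq J) φ
  φTP = fst (snd res)
  φ≤1 : ∀ x → nrm (φ x) ≤ 1F
  φ≤1 = fst (snd (snd res))
  φL = snd (snd (snd res))

  Lφ : List (ℂ × ℤ)
  Lφ = L φTP

  absY : ℤ.∣ ℤ.- pos (Yseq Mq J) ∣ ≤' R
  absY = subst (_≤' R) (sym (ℤP.∣-i∣≡∣i∣ (pos (Yseq Mq J)))) (Y≤R J N.≤-refl)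

  inR : ∀ {t} → t ∈ Lφ → snd t ∈ zs R
  inR {t} m = ∈zs (snd t) (abs≤ (snd t) (ℤP.≤-trans (ℤP.neg-mono-≤ (ℤ.+≤+ (Y≤R J N.≤-refl))) (fst (freq φTP m))) (ℤP.≤-trans (snd (freq φTP m)) (ℤ.+≤+ (M≤R J N.≤-refl))))

  w : ℕ → ℂ
  w x = conj (φ (2 *' x))

  expand : Avg n (λ x → 𝒲 n x *C w x) ≡ ∑C Lφ (λ t → conj (fst t) *C Avg n (λ x → 𝒲 n x *C ck (snd t) n x))
  expand = tr (Avg-cong n (λ x → tr (cong (λ v → 𝒲 n x *C conj v) (ev φTP (2 *' x))) (tr (cong (𝒲 n x *C_) (tr (∑C-conj Lφ _) (∑C-cong Lφ (λ t → conj-* (fst t) _)))) (tr (sym (∑C-* Lφ (𝒲 n x) _)) (∑C-cong Lφ (λ t → solveC 3 (λ a b c → a ⨯ (b ⨯ c) ≔ b ⨯ (a ⨯ c)) refl (𝒲 n x) (conj (fst t)) (ck (snd t) n x))))))) (tr (Avg-∑ Lφ n _) (∑C-cong Lφ (λ t → Avg-* n (conj (fst t)) _)))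

  δ' : F
  δ' = CU * inv « suc n »

  term-low : ∀ {t} → t ∈ Lφ → (ι 2ℚ * s0 n) * (Gf (snd t) * re (fst t)) + (- (N1 (fst t) * δ')) ≤ re (conj (fst t) *C Avg n (λ x → 𝒲 n x *C ck (snd t) n x))
  term-low {t} m = go (fst t) (Avg n (λ x → 𝒲 n x *C ck (snd t) n x)) (snd (snd (snd U)) n hU (inR m))
   where
    g = s0 n * (ι 2ℚ * Gf (snd t))
    go : ∀ c v → N1 (v +C (-C real g)) ≤ δ' → (ι 2ℚ * s0 n) * (Gf (snd t) * re c) + (- (N1 c * δ')) ≤ re (conj c *C v)
    go c v h = ≤≡ (+-mono ≤-refl (≤≡ (neg-mono (tr≤ (tr≤ (neg≤∣∣ _) re≤N1) (tr≤ (N1-* (conj c) (v +C (-C real g))) (*-mono (N1≥0 _) (N1≥0 _) (≡⇒≤ (N1-conj c)) h)))) (solve 1 (λ a → :- (:- a) := a) refl (re (conj c *C (v +C (-C real g))))))) (alg c v)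
     where
      re≤N1 : abs (re (conj c *C (v +C (-C real g)))) ≤ N1 (conj c *C (v +C (-C real g)))
      re≤N1 = ≤-by (abs (im (conj c *C (v +C (-C real g))))) (∣∣≥0 _) refl
      alg : ∀ c v → (ι 2ℚ * s0 n) * (Gf (snd t) * re c) + re (conj c *C (v +C (-C real g))) ≡ re (conj c *C v)
      alg (a ⊹ b) (p ⊹ q) = solve 6 (λ s G a b p q → (:2 :* s) :* (G :* a) :+ (a :* (p :+ (:- (s :* (:2 :* G)))) :- (:- b) :* (q :+ (:- :0))) := a :* p :- (:- b) :* q) refl (s0 n) (Gf (snd t)) a b p q

  -- 2 s0 ≥ 1/2 times the J/60 of the test function, minus a discretisation error of at most 1/240;
  -- then J ≥ 1.
  lower : ι q240 * « J » ≤ re (Avg n (λ x → 𝒲 n x *C w x))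
  lower = tr≤ (tr≤ (≤-by (ι q240 * (« J » - 1F)) (0≤* (ι≥0 q240) (0≤- (≡≤ (sym «1») («»-mono J1)))) (solve 1 (λ j → con q240 :* j :+ con q240 :* (j :- :1) := (:2 :* con (pos 1 ℚ./ 4)) :* (con q60 :* j) :+ (:- con q240)) refl « J »))
   (+-mono (*-mono (0≤* (ι≥0 2ℚ) (ι≥0 (pos 1 ℚ./ 4))) (0≤* (ι≥0 q60) («»≥0 J)) (*-monoˡ _ (ι≥0 2ℚ) (s0-low n hN)) φL) (neg-mono (tr≤ (*-monoʳ _ δ≥0 (ℓ1 φTP)) hΛ))))
   (≡≤ (tr (cong2 (λ u v → (ι 2ℚ * s0 n) * u + (- v)) (Functional.Lf-TP (zz n) (uu n) W D N.≤-refl quad Gf R (N.m≤m+n R _) φTP absY (M≤R J N.≤-refl)) (sym (∑-*ʳ Lφ δ' _))) (tr (cong2 _+_ (sym (∑-* Lφ (ι 2ℚ * s0 n) _)) (sym (∑-neg Lφ _))) (sym (∑-+ Lφ _ _)))) (≤≡ (∑-mono∈ Lφ term-low) (cong re (sym expand))))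
   where
    δ≥0 : 0F ≤ δ'
    δ≥0 = 0≤* (fst (snd (snd U))) (inv≥0 («suc»-pos n))

  third : F
  third = ι q13 * « length A »

  impossible : (∀ y → Cp n y ≤ third + B) → (∀ y → Cm n y ≤ third + B) → ⊥
  impossible Hp Hm = pos⇒≢ (tr≤ lower (tr≤ (Bounded.pairing n hN B B≥0 Hp Hm w (λ x → ≡≤ (nrm-conj _) (φ≤1 (2 *' x)))) (≤≡ (*-monoʳ _ (0≤* (ι≥0 (# 20)) B≥0) (sieve-cost s)) (tr (solve 3 (λ v j i → v :* (con (# 20) :* (con q9600 :* (j :* i))) := con (# 20 ℚ.* q9600) :* j :* (v :* i)) refl Vc « J » (inv Vc)) (tr (cong (ι (# 20 ℚ.* q9600) * « J » *_) (*-inv Vc-pos)) (*1 _))))))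
   where
    pos⇒≢ : ι q240 * « J » ≤ ι (# 20 ℚ.* q9600) * « J » → ⊥
    pos⇒≢ h = from-no (q240 ℚ.≤? # 20 ℚ.* q9600) (ι-≤⁻ (*-cancel-≤ « J » («»-pos J1) (≡≤ (*-comm _ _) (≤≡ h (*-comm _ _)))))

  Hit : ℕ → Set
  Hit x = (third + B ≤ Cp n x) ⊎ (third + B ≤ Cm n x)

  hitting : Σ ℕ λ x → Hit x
  -- The counts depend on x only modulo Q, so a search through one turn is exhaustive.
  hitting = go (AnyM.any? (λ x → ((third + B) ≤? (Cp n x)) ⊎-dec ((third + B) ≤? (Cm n x))) (rng (Q n)))
   where
    Q1 : 1 ≤' Q n
    Q1 = N.≤-trans (s≤s z≤n) (S≤Q n hN)
    go : Dec (AnyM.Any Hit (rng (Q n))) → Σ ℕ λ x → Hit x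
    go (yes a) = AnyM.satisfied a
    go (no na) = ⊥-elim (impossible (λ y → ≡≤ (∑-cong A (λ a → cong (Ind 1 5 (Q n)) (md-red (Q n) a y Q1))) (up (Cp n (md y (Q n))) (λ h → na (lose (rng∈ (md-< (Q n) y Q1)) (inj₁ h))))) (λ y → ≡≤ (∑-cong A (λ a → cong (Ind 7 11 (Q n)) (md-red (Q n) a y Q1))) (up (Cm n (md y (Q n))) (λ h → na (lose (rng∈ (md-< (Q n) y Q1)) (inj₂ h))))))
     where
      up : ∀ c → ¬ (third + B ≤ c) → c ≤ third + B
      up c h = o (≤-total c (third + B))
       where
        o : c ≤ third + B ⊎ third + B ≤ c → c ≤ third + B
        o (inj₁ l) = l
        o (inj₂ l) = ⊥-elim (h l)

 -- Fixed last: beyond all thresholds, with a quarter turn longer than the bandwidth W, and so fine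
 -- that the error Λ CU / S is below 1/240.
 n* : ℕ
 n* = N₀ +' (mU +' ((W +' W +' 6) +' fst (arch (ι (# 240) * (Λ * CU)))))

 T4-big : W <' T4 n*
 T4-big = N.≰⇒> (λ h → N.<⇒≱ (lt h) (Near.S≤2T+4 n*))
  where
   big : W +' W +' 6 ≤' n*
   big = N.≤-trans (N.m≤m+n _ _) (N.≤-trans (N.m≤n+m _ mU) (N.m≤n+m _ N₀))
   lt : T4 n* ≤' W → 2 *' T4 n* +' 4 <' suc n*
   lt h = s≤s (N.≤-trans (N.≤-trans (N.+-monoˡ-≤ 4 (N.*-monoʳ-≤ 2 h)) (N.+-mono-≤ (N.≤-reflexive (2*≡+ W)) (from-yes (4 ℕ.≤? 6)))) big)

 Λ-small : Λ * (CU * inv « suc n* ») ≤ ι q240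
 Λ-small = *-cancel-≤ « suc n* » («suc»-pos n*) (≡≤ (tr (solve 4 (λ s l c i → s :* (l :* (c :* i)) := (l :* c) :* (s :* i)) refl « suc n* » Λ CU (inv « suc n* »)) (tr (cong (Λ * CU *_) (*-inv («suc»-pos n*))) (*1 _))) (≡≤ (tr (sym (1* _)) (tr (cong (_* (Λ * CU)) (tr (cong ι (sym (from-yes (q240 ℚ.* (# 240) ℚ.≟ 1ℚ)))) (ι-* q240 (# 240)))) (*-assoc _ _ _))) (≤≡ (*-monoˡ _ (ι≥0 q240) (tr≤ (snd (arch (ι (# 240) * (Λ * CU)))) («»-mono (N.≤-trans (N.≤-trans (N.m≤n+m _ (W +' W +' 6)) (N.≤-trans (N.m≤n+m _ mU) (N.m≤n+m _ N₀))) (N.n≤1+n n*))))) (*-comm _ _))))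

 hits : Σ ℕ λ Q' → Σ ℕ λ x → 1 ≤' Q' × Hits A Q' x (ι q13 * « length A » + B)
 hits = Q n* , fst h , N.≤-trans (s≤s z≤n) (S≤Q n* (N.m≤m+n N₀ _)) , snd h
  where h = At-n.hitting n* (N.m≤m+n N₀ _) (N.≤-trans (N.m≤m+n mU _) (N.m≤n+m _ N₀)) T4-big Λ-small

-- From a large count to a sum-free subset.

max-index : ∀ n (f : ℕ → F) → Σ ℕ λ j → j ≤' n × (∀ i → i ≤' n → f i ≤ f j)
max-index zero f = 0 , z≤n , λ { zero _ → ≤-refl }
max-index (suc n) f = go (max-index n f)
 where
  go : (Σ ℕ λ j → j ≤' n × (∀ i → i ≤' n → f i ≤ f j)) → Σ ℕ λ j → j ≤' suc n × (∀ i → i ≤' suc n → f i ≤ f j)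
  go (j , jn , h) = st (≤-total (f j) (f (suc n)))
   where
    ext : ∀ k → f j ≤ f k → f (suc n) ≤ f k → ∀ i → i ≤' suc n → f i ≤ f k
    ext k a b i l = cs (i ℕ.≟ suc n)
     where
      cs : Dec (i ≡ suc n) → f i ≤ f k
      cs (yes refl) = b
      cs (no ne) = tr≤ (h i (N.≤-pred (N.≤∧≢⇒< l ne))) a
    st : f j ≤ f (suc n) ⊎ f (suc n) ≤ f j → Σ ℕ λ j → j ≤' suc n × (∀ i → i ≤' suc n → f i ≤ f j)
    st (inj₁ l) = suc n , N.≤-refl , ext (suc n) l ≤-refl
    st (inj₂ l) = j , N.≤-trans jn (N.n≤1+n n) , ext j ≤-refl l

-- a ↦ a x / (2 l Q) modulo 1 is cut at the 2l translates by 1/(2l) of one arc; Q = suc q and l = suc k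
module Arcs (k q x : ℕ) (A : List ℕ) (uA : Unique A) where
 l Q M : ℕ
 l = suc k
 Q = suc q
 M = 2 *' l *' Q

 pt : ℕ → ℕ
 pt a = (a *' x) % M

 lo : ℕ → ℕ
 lo β = β *' Q

 arc? : ∀ β a → Dec (lo β <' 12 *' pt a × 12 *' pt a ≤' lo (4 +' β))
 arc? β a = (lo β ℕ.<? 12 *' pt a) ×-dec (12 *' pt a ℕ.≤? lo (4 +' β))

 Sβ : ℕ → List ℕ
 Sβ β = filter (arc? β) A

 subset : ∀ β → SubsetOf (Sβ β) A
 subset β = UP.filter⁺ (arc? β) uA , All.tabulate (λ m → fst (∈-filter⁻ (arc? β) {xs = A} m))

 record Total (β n : ℕ) (tot : ℕ) : Set where
  field
   m w : ℕ
   eq : tot *' x ≡ m +' w *' M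
   low : n *' suc (lo β) ≤' 12 *' m
   high : 12 *' m ≤' n *' lo (4 +' β)

 total : ∀ β {n} (xs : Vec ℕ n) → VAll.All (λ a → a ∈ Sβ β) xs → Total β n (Vec.sum xs)
 total β Vec.[] _ = record { m = 0 ; w = 0 ; eq = refl ; low = z≤n ; high = z≤n }
 total β {suc n} (a Vec.∷ xs) (ma VAll.∷ ms) = record
  { m = pt a +' m ; w = (a *' x) / M +' w
  ; eq = tr (N.*-distribʳ-+ x a (Vec.sum xs)) (tr (cong2 _+'_ (m≡m%n+[m/n]*n (a *' x) M) eq) (solveN 5 (λ p q m w M → (p :+' q :*' M) :+' (m :+' w :*' M) :=' (p :+' m) :+' (q :+' w) :*' M) refl (pt a) ((a *' x) / M) m w M))
  ; low = N.≤-trans (N.+-mono-≤ (fst ia) low) (N.≤-reflexive (sym (N.*-distribˡ-+ 12 (pt a) m)))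
  ; high = N.≤-trans (N.≤-reflexive (N.*-distribˡ-+ 12 (pt a) m)) (N.+-mono-≤ (snd ia) high) }
  where
   open Total (total β xs ms)
   ia = snd (∈-filter⁻ (arc? β) {xs = A} ma)

 -- The difference of a (5l)-fold sum and an l-fold sum of points of the arc starting at (6i+1)/(24l)
 -- lies strictly between i and i + 1.
 sumfree : ∀ i → SumFree (5 *' l) l (Sβ (1 +' 6 *' i))
 sumfree i xs ys hx hy e = N.<⇒≱ (N.*-cancelʳ-< M (i +' X.w) Y.w lt1) (N.≤-pred (N.*-cancelʳ-< M Y.w (suc (i +' X.w)) lt2))
  where
   β = 1 +' 6 *' i
   module X = Total (total β xs hx)
   module Y = Total (total β ys hy)
   eq : X.m +' X.w *' M ≡ Y.m +' Y.w *' M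
   eq = tr (sym X.eq) (tr (cong (_*' x) e) Y.eq)
   gap1 : Y.m +' i *' M <' X.m
   gap1 = N.*-cancelˡ-< 12 _ _ (N.<-≤-trans (N.≤-<-trans (N.≤-trans (N.≤-reflexive (N.*-distribˡ-+ 12 Y.m (i *' M))) (N.+-monoˡ-≤ (12 *' (i *' M)) Y.high)) (subst (l *' lo (4 +' β) +' 12 *' (i *' M) <'_) (sym calc) (N.m<m+n _ {5 *' l} (s≤s z≤n)))) X.low)
    where
     calc : 5 *' l *' suc (lo β) ≡ l *' lo (4 +' β) +' 12 *' (i *' M) +' 5 *' l
     calc = solveN 3 (λ l i Q → con' 5 :*' l :*' (con' 1 :+' (con' 1 :+' con' 6 :*' i) :*' Q) :=' l :*' ((con' 4 :+' (con' 1 :+' con' 6 :*' i)) :*' Q) :+' con' 12 :*' (i :*' (con' 2 :*' l :*' Q)) :+' con' 5 :*' l) refl l i Q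
   gap2 : X.m <' Y.m +' suc i *' M
   gap2 = N.*-cancelˡ-< 12 _ _ (N.≤-<-trans X.high (N.<-≤-trans (subst (5 *' l *' lo (4 +' β) <'_) (sym calc) (N.m<m+n _ {l} (s≤s z≤n))) (N.≤-trans (N.+-monoˡ-≤ (12 *' (suc i *' M)) Y.low) (N.≤-reflexive (sym (N.*-distribˡ-+ 12 Y.m (suc i *' M)))))))
    where
     calc : l *' suc (lo β) +' 12 *' (suc i *' M) ≡ 5 *' l *' lo (4 +' β) +' l
     calc = solveN 3 (λ l i Q → l :*' (con' 1 :+' (con' 1 :+' con' 6 :*' i) :*' Q) :+' con' 12 :*' ((con' 1 :+' i) :*' (con' 2 :*' l :*' Q)) :=' con' 5 :*' l :*' ((con' 4 :+' (con' 1 :+' con' 6 :*' i)) :*' Q) :+' l) refl l i Q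
   lt1 : (i +' X.w) *' M <' Y.w *' M
   lt1 = N.+-cancelˡ-< Y.m _ _ (subst₂ _<'_ (solveN 4 (λ y i w M → y :+' i :*' M :+' w :*' M :=' y :+' (i :+' w) :*' M) refl Y.m i X.w M) eq (N.+-monoˡ-< (X.w *' M) gap1))
   lt2 : Y.w *' M <' suc (i +' X.w) *' M
   lt2 = N.+-cancelˡ-< Y.m _ _ (subst₂ _<'_ eq (solveN 4 (λ y i w M → y :+' (con' 1 :+' i) :*' M :+' w :*' M :=' y :+' (con' 1 :+' (i :+' w)) :*' M) refl Y.m i X.w M) (N.+-monoˡ-< (X.w *' M) gap2))

 -- Q divides the modulus 2 l Q, so `pt a` reduces modulo Q to the residue of a x; its quotient by Q
 -- names the translate that contains it.
 cover : ∀ α a → Ind α (4 +' α) Q (md (a *' x) Q) ≤ ∑ (rng (2 *' l)) (λ j → iv (arc? (α +' 12 *' j) a))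
 cover α a = tr≤ (one (α *' Q ℕ.<? 12 *' r) (12 *' r ℕ.≤? (4 +' α) *' Q)) (∑-term {xs = rng (2 *' l)} {f = λ j → iv (arc? (α +' 12 *' j) a)} (λ j → iv≥0 _) (rng∈ j<))
  where
   r = (a *' x) % Q
   j = pt a / Q
   j< : j <' 2 *' l
   j< = m<n*o⇒m/o<n {pt a} {2 *' l} {Q} (m%n<n (a *' x) M)
   rr' : pt a % Q ≡ r
   rr' = sym (tr (cong (_% Q) (tr (m≡m%n+[m/n]*n (a *' x) M) (cong (pt a +'_) (sym (N.*-assoc ((a *' x) / M) (2 *' l) Q))))) ([m+kn]%n≡m%n (pt a) ((a *' x) / M *' (2 *' l)) Q))
   pe : pt a ≡ r +' j *' Q
   pe = tr (m≡m%n+[m/n]*n (pt a) Q) (cong (_+' j *' Q) rr')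
   12p : 12 *' pt a ≡ 12 *' r +' 12 *' j *' Q
   12p = tr (cong (12 *'_) pe) (tr (N.*-distribˡ-+ 12 r (j *' Q)) (cong (12 *' r +'_) (sym (N.*-assoc 12 j Q))))
   one : (d : Dec (α *' Q <' 12 *' r)) (e : Dec (12 *' r ≤' (4 +' α) *' Q)) → iv d * iv e ≤ iv (arc? (α +' 12 *' j) a)
   one d@(no n) e = ≡≤ (tr (cong (_* iv e) (iv-no d n)) (zeroˡ _)) (iv≥0 _)
   one d@(yes _) e@(no n) = ≡≤ (tr (cong (iv d *_) (iv-no e n)) (zeroʳ _)) (iv≥0 _)
   one d@(yes u) e@(yes v) = ≡⇒≤ (tr (tr (cong2 _*_ (iv-yes d u) (iv-yes e v)) (1* 1F)) (sym (iv-yes (arc? (α +' 12 *' j) a) (subst (_<' 12 *' pt a) (sym (N.*-distribʳ-+ Q α (12 *' j))) (subst (α *' Q +' 12 *' j *' Q <'_) (sym 12p) (N.+-monoˡ-< (12 *' j *' Q) u)) , subst (_≤' lo (4 +' (α +' 12 *' j))) (sym 12p) (N.≤-trans (N.+-monoˡ-≤ (12 *' j *' Q) v) (N.≤-reflexive (solveN 3 (λ a j Q → (con' 4 :+' a) :*' Q :+' con' 12 :*' j :*' Q :=' (con' 4 :+' (a :+' con' 12 :*' j)) :*' Q) refl α j Q)))))))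

 pigeon : ∀ α (X : F) → X ≤ ∑ A (λ a → Ind α (4 +' α) Q (md (a *' x) Q)) → Σ ℕ λ j → X ≤ « 2 *' l » * « length (Sβ (α +' 12 *' j)) »
 pigeon α X h = j , tr≤ h (tr≤ (∑-mono A (cover α)) (≡≤ (∑-swap A (rng (2 *' l)) _) (≤≡ (∑-mono∈ (rng (2 *' l)) {g = λ _ → f j} (λ {i} m → ≡≤ (sym (length-iv (arc? (α +' 12 *' i)) A)) (snd (snd mx) i (N.<⇒≤ (∈rng m))))) (tr (∑-const (rng (2 *' l)) (f j)) (cong (λ w → « w » * f j) (length-rng (2 *' l)))))))
  where
   f : ℕ → F
   f i = « length (Sβ (α +' 12 *' i)) »
   mx = max-index (2 *' l) f
   j = fst mx

 Dense : F → Set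
 Dense X = Σ (List ℕ) λ S → SubsetOf S A × SumFree (5 *' l) l S × X ≤ « 2 *' l » * « length S »

 sumfree-subset : ∀ (X : F) → (X ≤ ∑ A (λ a → Ind 1 5 Q (md (a *' x) Q))) ⊎ (X ≤ ∑ A (λ a → Ind 7 11 Q (md (a *' x) Q))) → Dense X
 sumfree-subset X (inj₁ h) = go (pigeon 1 X h)
  where
   go : (Σ ℕ λ j → X ≤ « 2 *' l » * « length (Sβ (1 +' 12 *' j)) ») → Dense X
   go (j , p) = Sβ (1 +' 12 *' j) , subset (1 +' 12 *' j) , subst (λ w → SumFree (5 *' l) l (Sβ w)) (solveN 1 (λ j → con' 1 :+' con' 6 :*' (con' 2 :*' j) :=' con' 1 :+' con' 12 :*' j) refl j) (sumfree (2 *' j)) , p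
 sumfree-subset X (inj₂ h) = go (pigeon 7 X h)
  where
   go : (Σ ℕ λ j → X ≤ « 2 *' l » * « length (Sβ (7 +' 12 *' j)) ») → Dense X
   go (j , p) = Sβ (7 +' 12 *' j) , subset (7 +' 12 *' j) , subst (λ w → SumFree (5 *' l) l (Sβ w)) (solveN 1 (λ j → con' 1 :+' con' 6 :*' (con' 1 :+' con' 2 :*' j) :=' con' 7 :+' con' 12 :*' j) refl j) (sumfree (1 +' 2 *' j)) , p

-- Exponential and power inequalities.

frac-* : ∀ n d → ι (pos n ℚ./ suc d) * « suc d » ≡ « n »
frac-* n d = tr (cong (ι (pos n ℚ./ suc d) *_) («»-ι (suc d))) (tr (sym (ι-* _ _)) (tr (cong ι eq) (sym («»-ι n))))
 where
  eq : (pos n ℚ./ suc d) ℚ.* (pos (suc d) ℚ./ 1) ≡ pos n ℚ./ 1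
  eq = ℚP.toℚᵘ-injective (ℚᵘP.≃-trans (ℚP.toℚᵘ-homo-* (pos n ℚ./ suc d) (pos (suc d) ℚ./ 1)) (ℚᵘP.≃-trans (ℚᵘP.*-cong (ℚP.toℚᵘ-fromℚᵘ (ℚᵘ.mkℚᵘ (pos n) d)) (ℚP.toℚᵘ-fromℚᵘ (ℚᵘ.mkℚᵘ (pos (suc d)) 0))) (ℚᵘP.≃-trans (ℚᵘ.*≡* (tr (ℤP.*-identityʳ _) (cong (λ w → pos n ℤ.* pos w) (sym (N.*-identityʳ (suc d)))))) (ℚᵘP.≃-sym (ℚP.toℚᵘ-fromℚᵘ (ℚᵘ.mkℚᵘ (pos n) 0))))))

num-den : ∀ x → 0ℚ ℚ.≤ x → ι x * « ℚ.↧ₙ x » ≡ « ℤ.∣ ℚ.↥ x ∣ »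
num-den x@(ℚ.mkℚ (pos n) d _) _ = tr (cong (λ w → ι w * « suc d ») (sym (ℚP.↥p/↧p≡p x))) (frac-* n d)
num-den (ℚ.mkℚ (negsuc n) d _) (ℚ.*≤* ())

tF EF : F → ℕ → F
tF x zero = 1F
tF x (suc i) = (tF x i * x) * inv « suc i »
EF x zero = 0F
EF x (suc n) = EF x n + tF x n

ι-inv : ∀ i → ι (pos 1 ℚ./ suc i) ≡ inv « suc i »
ι-inv i = tr (sym (*1 _)) (tr (cong (ι (pos 1 ℚ./ suc i) *_) (sym (*-inv («suc»-pos i)))) (tr (sym (*-assoc _ _ _)) (tr (cong (_* inv « suc i ») (tr (frac-* 1 i) «1»)) (1* _))))

ι-expTerm : ∀ s i → ι (expTerm s i) ≡ tF (ι s) i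
ι-expTerm s zero = refl
ι-expTerm s (suc i) = tr (ι-* _ _) (cong2 _*_ (tr (ι-* _ _) (cong (_* ι s) (ι-expTerm s i))) (ι-inv i))

ι-expPartial : ∀ s n → ι (expPartial s n) ≡ EF (ι s) n
ι-expPartial s zero = refl
ι-expPartial s (suc n) = tr (ι-+ _ _) (cong2 _+_ (ι-expPartial s n) (ι-expTerm s n))

tF≥0 : ∀ {x} i → 0F ≤ x → 0F ≤ tF x i
tF≥0 zero _ = 0≤1
tF≥0 (suc i) h = 0≤* (0≤* (tF≥0 i h) h) (inv≥0 («suc»-pos i))

tF-mono : ∀ {x y} i → 0F ≤ x → x ≤ y → tF x i ≤ tF y i
tF-mono zero _ _ = ≤-refl
tF-mono (suc i) h l = *-monoʳ _ (inv≥0 («suc»-pos i)) (*-mono (tF≥0 i h) h (tF-mono i h l) l)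

EF-mono : ∀ {x y} n → 0F ≤ x → x ≤ y → EF x n ≤ EF y n
EF-mono zero _ _ = ≤-refl
EF-mono (suc n) h l = +-mono (EF-mono n h l) (tF-mono n h l)

module _ (x h : F) (x0 : 0F ≤ x) (h0 : 0F ≤ h) where
 private
  s : F
  s = x + h
  s0' : 0F ≤ s
  s0' = 0≤+ x0 h0

 exp-termˣ : ∀ i → x * tF s i ≤ x * tF x i + h * (« i » * tF s i)
 -- The mean value inequality for t ↦ tⁱ⁺¹/(i+1)! between x and x + h, with the derivative taken at
 -- the right end; `exp-termˣ` is the companion that closes the induction.
 exp-term : ∀ i → tF s (suc i) ≤ tF x (suc i) + h * tF s i

 exp-termˣ zero = ≤-by (h * (« 0 » * 1F)) (0≤* h0 (0≤* («»≥0 0) 0≤1)) refl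
 exp-termˣ (suc i) = tr≤ (*-monoˡ x x0 (exp-term i)) (tr≤ (≤-by (h * (h * tF s i)) (0≤* h0 (0≤* h0 (tF≥0 i s0'))) (solve 4 (λ x t h u → x :* (t :+ h :* u) :+ h :* (h :* u) := x :* t :+ h :* ((x :+ h) :* u)) refl x (tF x (suc i)) h (tF s i))) (+-mono ≤-refl (*-monoˡ h h0 (≡⇒≤ (sym (tr (solve 4 (λ k t s i → k :* ((t :* s) :* i) := (s :* t) :* (k :* i)) refl « suc i » (tF s i) s (inv « suc i »)) (tr (cong (s * tF s i *_) (*-inv («suc»-pos i))) (*1 _))))))))
 exp-term i = ≤≡ (*-monoʳ I I0 (≤-by ((x * tF x i + h * (« i » * t)) - x * t) (0≤- (exp-termˣ i)) (solve 5 (λ t x h t0 i → t :* (x :+ h) :+ ((x :* t0 :+ h :* (i :* t)) :- x :* t) := t0 :* x :+ (h :* t) :* (:1 :+ i)) refl t x h (tF x i) « i »)))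
  (tr (solve 4 (λ a b k i → (a :+ b :* k) :* i := a :* i :+ b :* (k :* i)) refl (tF x i * x) (h * t) (1F + « i ») I) (cong (tF x i * x * I +_) (tr (cong (λ w → h * t * (w * I)) (sym («suc» i))) (tr (cong (h * t *_) (*-inv («suc»-pos i))) (*1 _)))))
  where
   t = tF s i
   I = inv « suc i »
   I0 = inv≥0 («suc»-pos i)

 exp-shift' : ∀ n → EF s (suc n) ≤ EF x (suc n) + h * EF s n
 exp-shift' zero = ≡⇒≤ (solve 1 (λ h → :0 :+ :1 := (:0 :+ :1) :+ h :* :0) refl h)
 exp-shift' (suc n) = ≤≡ (+-mono (exp-shift' n) (exp-term n)) (solve 5 (λ a h e t u → (a :+ h :* e) :+ (t :+ h :* u) := (a :+ t) :+ h :* (e :+ u)) refl (EF x (suc n)) h (EF s n) (tF x (suc n)) (tF s n))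

 -- The truncated form of exp(-h) ≥ 1 - h; iterated, it bounds exp by powers of 1/(1 - h).
 exp-shift : ∀ n → (1F - h) * EF s n ≤ EF x n
 exp-shift zero = ≡⇒≤ (zeroʳ _)
 exp-shift (suc n) = tr≤ (≤-by ((EF x (suc n) + h * EF s n) - EF s (suc n) + h * tF s n) (0≤+ (0≤- (exp-shift' n)) (0≤* h0 (tF≥0 n s0'))) (solve 4 (λ h e t a → (:1 :- h) :* (e :+ t) :+ ((a :+ h :* e) :- (e :+ t) :+ h :* t) := a) refl h (EF s n) (tF s n) (EF x (suc n)))) ≤-refl

EF-0 : ∀ n → EF 0F n ≤ 1F
EF-0 zero = 0≤1
EF-0 (suc zero) = ≡⇒≤ (0+ _)
EF-0 (suc (suc n)) = ≡≤ (tr (cong (EF 0F (suc n) +_) (tr (cong (_* inv « suc n ») (zeroʳ _)) (zeroˡ _))) (+0 _)) (EF-0 (suc n))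

exp-multiple : ∀ (h k : ℚ) → 0ℚ ℚ.≤ h → 0ℚ ℚ.≤ k → k ℚ.* (1ℚ ℚ.- h) ≡ 1ℚ → ∀ L n → EF (« L » * ι h) n ≤ ι k ^F L
exp-multiple h k h0 k0 e zero n = ≡≤ (cong (λ w → EF w n) (tr (cong (_* ι h) «0») (zeroˡ _))) (EF-0 n)
exp-multiple h k h0 k0 e (suc L) n = ≡≤ (tr (cong (λ w → EF w n) (tr (cong (_* ι h) («suc» L)) (solve 2 (λ l h → (:1 :+ l) :* h := l :* h :+ h) refl « L » (ι h)))) (tr (sym (1* _)) (tr (cong (_* EF (« L » * ι h + ι h) n) (tr (cong ι (sym e)) (tr (ι-* k (1ℚ ℚ.- h)) (cong (ι k *_) (tr (ι-+ 1ℚ (ℚ.- h)) (cong (1F +_) (ι-neg h))))))) (*-assoc _ _ _)))) (*-monoˡ (ι k) (0≤ι k0) (tr≤ (exp-shift (« L » * ι h) (ι h) (0≤* («»≥0 L) (0≤ι h0)) (0≤ι h0) n) (exp-multiple h k h0 k0 e L n)))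

ι-^ : ∀ q n → ι (q ^ℚ n) ≡ ι q ^F n
ι-^ q zero = refl
ι-^ q (suc n) = tr (ι-* q _) (cong (ι q *_) (ι-^ q n))

«^» : ∀ m n → « m ^' n » ≡ « m » ^F n
«^» m zero = «1»
«^» m (suc n) = tr («*» m _) (cong (« m » *_) («^» m n))

^F-+ : ∀ a m n → a ^F (m +' n) ≡ a ^F m * a ^F n
^F-+ a zero n = sym (1* _)
^F-+ a (suc m) n = tr (cong (a *_) (^F-+ a m n)) (sym (*-assoc _ _ _))

^F-^ : ∀ a m n → a ^F (m *' n) ≡ (a ^F n) ^F m
^F-^ a zero n = refl
^F-^ a (suc m) n = tr (^F-+ a n (m *' n)) (cong (a ^F n *_) (^F-^ a m n))

^F-monoʳ : ∀ {a m n} → 1F ≤ a → m ≤' n → a ^F m ≤ a ^F n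
^F-monoʳ {a} {n = n} h z≤n = one n
 where
  one : ∀ n → 1F ≤ a ^F n
  one zero = ≤-refl
  one (suc n) = ≡≤ (sym (1* 1F)) (*-mono 0≤1 0≤1 h (one n))
^F-monoʳ {a} h (s≤s l) = *-monoˡ a (tr≤ 0≤1 h) (^F-monoʳ h l)

root-mono : ∀ {a b} n → 0F ≤ a → 0F ≤ b → b ^F suc n ≤ a ^F suc n → b ≤ a
root-mono {a} {b} n a0 b0 h = go (≤-total b a)
 where
  go : b ≤ a ⊎ a ≤ b → b ≤ a
  go (inj₁ l) = l
  go (inj₂ l) = cs (b ≤? 0F)
   where
    cs : Dec (b ≤ 0F) → b ≤ a
    cs (yes z) = tr≤ z a0
    cs (no p) = *-cancel-≤ (b ^F n) (pp n) (≡≤ (*-comm _ _) (tr≤ h (≤≡ (*-monoˡ a a0 (^F-mono n a0 l)) (*-comm _ _))))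
     where
      pp : ∀ n → Pos (b ^F n)
      pp zero = Pos-1
      pp (suc n) = Pos-* p (pp n)

lg-half : ∀ p → 1 ≤' p → 2 ^' lg (suc p) ≤' 2 *' p
lg-half p p1 = go (lg (suc p)) refl
 where
  go : ∀ v → lg (suc p) ≡ v → 2 ^' v ≤' 2 *' p
  go zero _ = N.≤-trans p1 (N.m≤n*m p 2)
  go (suc v) e = N.*-monoʳ-≤ 2 (N.≤-pred (N.≰⇒> (λ l → N.<⇒≱ N.≤-refl (subst (_≤' v) e (lg-low (suc p) v l)))))

q2120 : ℚ
q2120 = pos 21 ℚ./ 20

-- 21 steps of 1/20, each with factor 20/19, and (20/19)²¹ < 3.
exp-3 : ∀ {y} n → 0F ≤ y → y ≤ ι q2120 → EF y n ≤ « 3 »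
exp-3 n y0 l = tr≤ (EF-mono n y0 (≤≡ l (sym (tr (cong (_* ι (pos 1 ℚ./ 20)) («»-ι 21)) (tr (sym (ι-* (# 21) (pos 1 ℚ./ 20))) (cong ι (from-yes ((# 21) ℚ.* (pos 1 ℚ./ 20) ℚ.≟ q2120))))))) ) (tr≤ (exp-multiple (pos 1 ℚ./ 20) (pos 20 ℚ./ 19) (from-yes (0ℚ ℚ.≤? pos 1 ℚ./ 20)) (from-yes (0ℚ ℚ.≤? pos 20 ℚ./ 19)) (from-yes ((pos 20 ℚ./ 19) ℚ.* (1ℚ ℚ.- pos 1 ℚ./ 20) ℚ.≟ 1ℚ)) 21 n) (≡≤ (sym (ι-^ (pos 20 ℚ./ 19) 21)) (≤≡ (ι-≤ (from-yes ((pos 20 ℚ./ 19) ^ℚ 21 ℚ.≤? # 3))) (sym («»-ι 3)))))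

exp-half : ∀ {y} L n → 0F ≤ y → y ≤ « L » * ι ℚ.½ → EF y n ≤ « 2 ^' L »
exp-half L n y0 l = tr≤ (EF-mono n y0 l) (≤≡ (exp-multiple ℚ.½ (# 2) (from-yes (0ℚ ℚ.≤? ℚ.½)) (from-yes (0ℚ ℚ.≤? # 2)) (from-yes ((# 2) ℚ.* (1ℚ ℚ.- ℚ.½) ℚ.≟ 1ℚ)) L n) (tr (cong (_^F L) (sym («»-ι 2))) (sym («^» 2 L))))

-- The range of y in which exp y ≤ N is not evident. Here y dominates a root of log N, so a large
-- power of it beats the required power of N and the premise of `LogTermLe` fails.
module Large (y : F) (L : ℕ) (y1 : ι q2120 ≤ y) (yL : « L » * ι ℚ.½ ≤ y) where

 y≥0 : 0F ≤ y
 y≥0 = tr≤ (ι≥0 q2120) y1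

 y≥1 : 1F ≤ y
 y≥1 = tr≤ (ι-≤ (from-yes (1ℚ ℚ.≤? q2120))) y1

 q43 : ℚ
 q43 = pos 43 ℚ./ 10

 -- (21/20)³⁰ > 4.3, and the two remaining factors y are kept to compare with L².
 y³² : ι q43 * (y * y) ≤ y ^F 32
 y³² = ≤≡ (*-monoʳ _ (0≤sq y) (tr≤ (≤≡ (ι-≤ (from-yes (q43 ℚ.≤? q2120 ^ℚ 30))) (ι-^ q2120 30)) (^F-mono 30 (ι≥0 q2120) y1))) (tr (cong (y ^F 30 *_) (cong (y *_) (sym (*1 y)))) (sym (^F-+ y 30 2)))

 four : ι (# 4) ≤ y ^F 32
 four = tr≤ (≤≡ (ι-≤ (from-yes (# 4 ℚ.≤? q43 ℚ.* (q2120 ℚ.* q2120)))) (tr (ι-* q43 _) (cong (ι q43 *_) (ι-* q2120 q2120)))) (tr≤ (*-monoˡ _ (ι≥0 q43) (*-mono (ι≥0 q2120) (ι≥0 q2120) y1 y1)) y³²)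

 L+2 : « 2 +' L » ≤ y ^F 32
 L+2 = go (2 ℕ.≤? L)
  where
   go : Dec (2 ≤' L) → « 2 +' L » ≤ y ^F 32
   go (no h) = tr≤ («»-mono (N.+-monoʳ-≤ 2 (N.<⇒≤ (N.≰⇒> h)))) (≡≤ («»-ι 4) four)
   go (yes h) = tr≤ (≡≤ (tr («+» 2 L) (cong (_+ « L ») («»-ι 2))) (≤-by (ι (pos 43 ℚ./ 40) * (« L » * (« L » - ι (# 2))) + ι (pos 46 ℚ./ 40) * (« L » - ι (# 2)) + ι (pos 3 ℚ./ 10)) (0≤+ (0≤+ (0≤* (ι≥0 (pos 43 ℚ./ 40)) (0≤* («»≥0 L) L2)) (0≤* (ι≥0 (pos 46 ℚ./ 40)) L2)) (ι≥0 (pos 3 ℚ./ 10))) (solve 1 (λ l → con (# 2) :+ l :+ (con (pos 43 ℚ./ 40) :* (l :* (l :- con (# 2))) :+ con (pos 46 ℚ./ 40) :* (l :- con (# 2)) :+ con (pos 3 ℚ./ 10)) := con q43 :* ((l :* con ℚ.½) :* (l :* con ℚ.½))) refl « L »))) (tr≤ (*-monoˡ _ (ι≥0 q43) (*-mono L½ L½ yL yL)) y³²)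
    where
     L½ : 0F ≤ « L » * ι ℚ.½
     L½ = 0≤* («»≥0 L) (ι≥0 ℚ.½)
     L2 : 0F ≤ « L » - ι (# 2)
     L2 = 0≤- (≡≤ (sym («»-ι 2)) («»-mono h))

 -- For u = lg (3 + L), twice 2^u is at most 4 (L + 2), hence at most y⁶⁴, and s + 1 = 30 + 3 u ≤ 30
 -- (u + 1); 1920 is 30 · 64.
 y-power : ∀ s → s ≡ 29 +' 3 *' lg (3 +' L) → « 2 » ^F suc s ≤ y ^F 1920
 y-power _ refl = tr≤ (^F-monoʳ 1≤2 (N.≤-trans (N.+-monoʳ-≤ 30 (N.*-monoˡ-≤ u (from-yes (3 ℕ.≤? 30)))) (N.≤-reflexive (solveN 1 (λ u → con' 30 :+' con' 30 :*' u :=' con' 30 :*' (con' 1 :+' u)) refl u)))) (≡≤ (^F-^ « 2 » 30 (suc u)) (≤≡ (^F-mono 30 (^F≥0 (suc u) («»≥0 2)) base) (sym (^F-^ y 30 64))))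
  where
   u = lg (3 +' L)
   1≤2 : 1F ≤ « 2 »
   1≤2 = ≡≤ (sym «1») («»-mono (from-yes (1 ℕ.≤? 2)))
   base : « 2 » ^F suc u ≤ y ^F 64
   base = tr≤ (*-monoˡ _ («»≥0 2) (≡≤ (sym («^» 2 u)) (tr≤ («»-mono (lg-half (2 +' L) (s≤s z≤n))) (≡≤ («*» 2 (2 +' L)) (*-monoˡ _ («»≥0 2) L+2))))) (≡≤ (tr (cong (λ w → w * (w * y ^F 32)) («»-ι 2)) (solve 1 (λ a → con (# 2) :* (con (# 2) :* a) := con (# 4) :* a) refl (y ^F 32))) (≤≡ (*-monoʳ _ (^F≥0 32 y≥0) four) (sym (^F-+ y 32 32))))

 -- Compared after raising both sides to the power s + 1: from N ≤ 2^T, the left becomes at most 2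
 -- to the (s + 1) T q, which `y-power` bounds by y to the 1920 T q.
 large : ∀ N T s p q → s ≡ 29 +' 3 *' lg (3 +' L) → N ≤' 2 ^' T → (T *' q) *' 1920 ≤' suc s *' p → « N ^' q » ≤ y ^F p
 large N T s p q es NT h = root-mono s (^F≥0 p y≥0) («»≥0 _) (tr≤ (^F-mono (suc s) («»≥0 (N ^' q)) (≤≡ («»-mono (N.≤-trans (N.^-monoˡ-≤ q NT) (N.≤-reflexive (N.^-*-assoc 2 T q)))) («^» 2 (T *' q)))) (≡≤ (tr (sym (^F-^ « 2 » (suc s) (T *' q))) (tr (cong (« 2 » ^F_) (N.*-comm (suc s) (T *' q))) (^F-^ « 2 » (T *' q) (suc s)))) (tr≤ (^F-mono (T *' q) (^F≥0 (suc s) («»≥0 2)) (y-power s es)) (≡≤ (sym (^F-^ y (T *' q) 1920)) (≤≡ (^F-monoʳ y≥1 h) (^F-^ y (suc s) p))))))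

-- Parameters and conclusion.

opaque
 unfolding Kb

 Kb-2^25 : Kb ≡ 2 ^' 25
 Kb-2^25 = refl

opaque
 -- 25 · 153600 · 2 · 1920: from T ≤ 25 J, the factor 16 · 9600 in `J≤`, the 2 in the number 2 l of
 -- arcs, and the exponent in `y-power`.
 C₀ : ℕ
 C₀ = 14745600000

 C₀-ι : « C₀ » ≡ ι (# 14745600000)
 C₀-ι = «»-ι 14745600000

C₀≥1 : 1 ≤' C₀
C₀≥1 = «»-cancel (≡≤ «1» (≤≡ (ι-≤ (from-yes (1ℚ ℚ.≤? # 14745600000))) (sym C₀-ι)))

-- The exponent is opaque because 2 ^' (29 +' u) would otherwise unfold to an exponentially large sum.
opaque
 e₀ : ℕ
 e₀ = 29

 e₀-29 : e₀ ≡ 29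
 e₀-29 = refl

 2^e₀ : « 2 ^' e₀ » ≡ ι (# 536870912)
 2^e₀ = «»-ι 536870912

module Choice (N L : ℕ) (lgN : lg N ≡ suc L) where
 -- P = 2^s is at least 2²⁹ (L + 3)³, as `Pbig` requires, while s remains of order log log N. The
 -- largest block size is a power of 2²⁵ with exponent L/25, hence at most 2^L ≤ N.
 T s u J : ℕ
 T = suc L
 u = lg (3 +' L)
 s = e₀ +' 3 *' u
 J = suc (L / 25)

 N≤ : N ≤' 2 ^' T
 N≤ = subst (λ w → N ≤' 2 ^' w) lgN (lg-up N)

 N≥ : 2 ^' L ≤' N
 N≥ = N.<⇒≤ (N.≰⇒> (λ l → N.<⇒≱ N.≤-refl (subst (_≤' L) lgN (lg-low N L l))))

 u-up : 3 +' L ≤' 2 ^' u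
 u-up = lg-up (3 +' L)

 JP : 2 *' J ≤' 2 ^' s
 JP = N.≤-trans (N.*-monoʳ-≤ 2 (N.≤-trans (s≤s (m/n≤m L 25)) (N.≤-trans (N.m≤n+m (suc L) 2) u-up))) (N.^-monoʳ-≤ 2 (N.≤-trans (N.+-mono-≤ (subst (1 ≤'_) (sym e₀-29) (from-yes (1 ℕ.≤? 29))) (N.m≤n*m u 3)) N.≤-refl))

 JN : ∀ i → i ≤' J → nseq i ≤' N
 JN zero _ = z≤n
 JN (suc i) (s≤s l) = N.≤-trans (N.≤-reflexive (tr (cong (_^' i) Kb-2^25) (N.^-*-assoc 2 25 i))) (N.≤-trans (N.^-monoʳ-≤ 2 (N.≤-trans (N.*-monoʳ-≤ 25 l) (N.≤-trans (N.≤-reflexive (N.*-comm 25 (L / 25))) (m/n*n≤m L 25)))) N≥)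

 T≤25J : T ≤' 25 *' J
 T≤25J = N.≤-trans (s≤s (N.≤-reflexive (m≡m%n+[m/n]*n L 25))) (N.≤-trans (N.+-monoˡ-≤ ((L / 25) *' 25) (m%n<n L 25)) (N.≤-reflexive (N.*-comm J 25)))

 Pbig : ι qP * (1F + « 4 » * (« suc T » * « suc T » + 1F) * « T ») ≤ « 2 ^' s »
 Pbig = ≡≤ (cong2 (λ a b → ι qP * (1F + a * (b * b + 1F) * t)) («»-ι 4) («suc» T)) (tr≤ (≤-by (ι qP * (ι (# 16) * (t * t) + ι (# 40) * t + ι (# 31)) + ι (q29 ℚ.- qP ℚ.* (# 4)) * ((ι 2ℚ + t) * ((ι 2ℚ + t) * (ι 2ℚ + t))))
  (0≤+ (0≤* (ι≥0 qP) (0≤+ (0≤+ (0≤* (ι≥0 (# 16)) (0≤sq t)) (0≤* (ι≥0 (# 40)) t0)) (ι≥0 (# 31)))) (0≤* (ι≥0 (q29 ℚ.- qP ℚ.* (# 4))) (0≤* v0 (0≤* v0 v0))))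
  (solve 1 (λ t → con qP :* (:1 :+ con (# 4) :* ((:1 :+ t) :* (:1 :+ t) :+ :1) :* t) :+ (con qP :* (con (# 16) :* (t :* t) :+ con (# 40) :* t :+ con (# 31)) :+ con (q29 ℚ.- qP ℚ.* (# 4)) :* ((:2 :+ t) :* ((:2 :+ t) :* (:2 :+ t)))) := con q29 :* ((:2 :+ t) :* ((:2 :+ t) :* (:2 :+ t)))) refl t))
  (≤≡ (*-monoˡ _ (ι≥0 q29) (*-mono v0 (0≤* v0 v0) vw (*-mono v0 v0 vw vw))) (sym (tr (cong «_» (tr (N.^-distribˡ-+-* 2 e₀ (3 *' u)) (cong (2 ^' e₀ *'_) (tr (cong (2 ^'_) (N.*-comm 3 u)) (sym (N.^-*-assoc 2 u 3)))))) (tr («*» (2 ^' e₀) ((2 ^' u) ^' 3)) (cong2 _*_ 2^e₀ (tr («^» (2 ^' u) 3) (cong (λ z → w * (w * z)) (*1 w)))))))))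
  where
   q29 : ℚ
   q29 = # 536870912
   t w : F
   t = « T »
   w = « 2 ^' u »
   t0 = «»≥0 T
   v0 : 0F ≤ ι 2ℚ + t
   v0 = 0≤+ (ι≥0 2ℚ) t0
   vw : ι 2ℚ + t ≤ w
   vw = ≡≤ (tr (cong (_+ t) (sym («»-ι 2))) (sym («+» 2 T))) («»-mono u-up)

module Conclude (k N L : ℕ) (N≥3 : 3 ≤' N) (lgN : lg N ≡ suc L) (c : ℚ) (c0 : 0ℚ ℚ.≤ c) (ce : ι c * « C₀ *' suc k » ≡ 1F) where
 open Choice N L lgN

 l : ℕ
 l = suc k

 σ : F
 σ = « suc s »

 Vc : F
 Vc = « 2 *' (8 *' suc s) »

 Vp : Pos Vc
 Vp = «»-pos (s≤s z≤n)

 B : F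
 B = ι (pos 1 ℚ./ 9600) * (« J » * inv Vc)

 frac : ι (fracℕ N (5 *' l +' l)) * « 5 *' l +' l » ≡ « N »
 frac = frac-* N _

 module _ (Sn : ℕ) (h : ι q13 * « N » + B ≤ « 2 *' l » * « Sn ») where

  Xq : ℚ
  Xq = toℚ Sn ℚ.- fracℕ N (5 *' l +' l)

  ιX : ι Xq ≡ « Sn » - ι (fracℕ N (5 *' l +' l))
  ιX = tr (ι-+ (toℚ Sn) (ℚ.- fracℕ N (5 *' l +' l))) (cong2 _+_ (sym («»-ι Sn)) (ι-neg (fracℕ N (5 *' l +' l))))

  -- Multiplied by 2 l, the main term N/(6 l) becomes N/3 and cancels.
  gain : B ≤ « 2 *' l » * ι Xq
  gain = ≤≡ (≤-by (« 2 *' l » * « Sn » - (ι q13 * « N » + B)) (0≤- h) (solve 3 (λ b m x → b :+ (x :- (m :+ b)) := x :- m) refl B (ι q13 * « N ») (« 2 *' l » * « Sn »))) (sym (tr (cong (« 2 *' l » *_) ιX) (tr (solve 3 (λ a x f → a :* (x :- f) := a :* x :- a :* f) refl « 2 *' l » « Sn » f) (cong (λ w → « 2 *' l » * « Sn » - w) third))))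
   where
    f = ι (fracℕ N (5 *' l +' l))
    third : « 2 *' l » * f ≡ ι q13 * « N »
    third = sym (tr (cong (ι q13 *_) (tr (sym frac) (cong (f *_) (tr (cong «_» (solveN 1 (λ l → con' 5 :*' l :+' l :=' con' 3 :*' (con' 2 :*' l)) refl l)) (tr («*» 3 (2 *' l)) (cong (_* « 2 *' l ») («»-ι 3))))))) (solve 2 (λ f a → con q13 :* (f :* (con (# 3) :* a)) := a :* f) refl f « 2 *' l »))

  Bp : Pos B
  Bp = Pos-* (λ w → from-no (pos 1 ℚ./ 9600 ℚ.≤? 0ℚ) (ι-≤⁻ w)) (Pos-* («suc»-pos (L / 25)) (Pos-inv Vp))

  ¬X≤0 : ¬ (Xq ℚ.≤ 0ℚ)
  ¬X≤0 l0 = Bp (tr≤ gain (≤≡ (*-monoˡ _ («»≥0 (2 *' l)) (ι-≤ l0)) (zeroʳ _)))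

  X>0 : 0ℚ ℚ.< Xq
  X>0 = ℚP.≰⇒> ¬X≤0

  X≥0 : 0ℚ ℚ.≤ Xq
  X≥0 = ℚP.<⇒≤ X>0

  p q : ℕ
  p = ℤ.∣ ℚ.↥ Xq ∣ *' ℚ.↧ₙ c
  q = ℚ.↧ₙ Xq *' ℤ.∣ ℚ.↥ c ∣

  p-q : « p » ≡ « C₀ *' l » * ι Xq * « q »
  p-q = sym (tr (cong (« C₀ *' l » * ι Xq *_) (tr («*» (ℚ.↧ₙ Xq) ℤ.∣ ℚ.↥ c ∣) (cong (« ℚ.↧ₙ Xq » *_) (sym (num-den c c0))))) (tr (solve 5 (λ C x dx c dc → (C :* x) :* (dx :* (c :* dc)) := ((c :* C) :* (x :* dx)) :* dc) refl « C₀ *' l » (ι Xq) « ℚ.↧ₙ Xq » (ι c) « ℚ.↧ₙ c ») (tr (cong2 (λ a b → a * b * « ℚ.↧ₙ c ») ce (num-den Xq X≥0)) (tr (cong (_* « ℚ.↧ₙ c ») (1* _)) (sym («*» ℤ.∣ ℚ.↥ Xq ∣ (ℚ.↧ₙ c)))))))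

  J≤ : « J » ≤ ι (# 153600) * σ * (« 2 *' l » * ι Xq)
  J≤ = ≡≤ (sym (tr (solve 3 (λ s j i → con (# 153600) :* s :* (con (pos 1 ℚ./ 9600) :* (j :* i)) := j :* ((con (# 16) :* s) :* i)) refl σ « J » (inv Vc)) (tr (cong (« J » *_) (tr (cong (_* inv Vc) (sym Ve)) (*-inv Vp))) (*1 _)))) (*-monoˡ _ (0≤* (ι≥0 (# 153600)) («»≥0 (suc s))) gain)
   where
    Ve : Vc ≡ ι (# 16) * σ
    Ve = tr (cong «_» (sym (N.*-assoc 2 8 (suc s)))) (tr («*» 16 (suc s)) (cong (_* σ) («»-ι 16)))

  exponents : (T *' q) *' 1920 ≤' suc s *' p
  exponents = «»-cancel (≡≤ (tr («*» (T *' q) 1920) (cong2 _*_ («*» T q) («»-ι 1920))) (≤≡ (*-monoʳ _ (ι≥0 (# 1920)) (*-monoʳ _ («»≥0 q) (tr≤ («»-mono T≤25J) (≡≤ (tr («*» 25 J) (cong (_* « J ») («»-ι 25))) (*-monoˡ _ (ι≥0 (# 25)) J≤)))))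
   (tr (tr (cong (λ w → (ι (# 25) * (ι (# 153600) * σ * (w * ι Xq)) * « q ») * ι (# 1920)) (tr («*» 2 l) (cong (_* « l ») («»-ι 2)))) (solve 4 (λ s l x q → (con (# 25) :* (con (# 153600) :* s :* ((con (# 2) :* l) :* x)) :* q) :* con (# 1920) := s :* ((con (# 14745600000) :* l) :* x :* q)) refl σ « l » (ι Xq) « q »)) (tr (cong (λ w → σ * (w * ι Xq * « q »)) (tr (cong (_* « l ») (sym C₀-ι)) (sym («*» C₀ l)))) (tr (cong (σ *_) (sym p-q)) (sym («*» (suc s) p)))))))

  logTerm : LogTermLe c N Xq
  logTerm = X>0 , λ y y0 yp n → ι-≤⁻ (≡≤ (ι-expPartial y n) (≤≡ (bound y y0 yp n (ι y ≤? ι q2120) (ι y ≤? (« L » * ι ℚ.½))) («»-ι N)))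
   where
    not≤ : ∀ {a b} → ¬ (a ≤ b) → b ≤ a
    not≤ {a} {b} na = o (≤-total a b)
     where
      o : a ≤ b ⊎ b ≤ a → b ≤ a
      o (inj₁ x) = ⊥-elim (na x)
      o (inj₂ x) = x
    -- Three ranges of y: up to 21/20, N ≥ 3 suffices; up to L/2, exp y ≤ 2^L ≤ N; beyond both,
    -- `large` contradicts the premise on y.
    bound : ∀ y → 0ℚ ℚ.≤ y → y ^ℚ p ℚ.< (pos (N ^' q) ℚ./ 1) → ∀ n → Dec (ι y ≤ ι q2120) → Dec (ι y ≤ « L » * ι ℚ.½) → EF (ι y) n ≤ « N »
    bound y y0 yp n (yes a) _ = tr≤ (exp-3 n (0≤ι y0) a) («»-mono N≥3)
    bound y y0 yp n (no _) (yes b) = tr≤ (exp-half L n (0≤ι y0) b) («»-mono N≥)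
    bound y y0 yp n (no a) (no b) = ⊥-elim (ℚP.<-irrefl refl (ℚP.<-≤-trans yp (ι-≤⁻ (≡≤ (sym («»-ι (N ^' q))) (≤≡ (Large.large (ι y) L (not≤ a) (not≤ b) N T s p q (cong (_+' 3 *' u) e₀-29) N≤ exponents) (sym (ι-^ y p)))))))

Goal : ℚ → ℕ → ℕ → List ℕ → Set
Goal c l N A = Σ (List ℕ) λ S → SubsetOf S A × SumFree (5 *' l) l S × LogTermLe c N (toℚ (length S) ℚ.- fracℕ N (5 *' l +' l))

theorem1p1 : (l : ℕ) → 1 ℕ.≤ l →
    Σ ℚ λ c → 0ℚ ℚ.< c ×
      ((N : ℕ) → 3 ℕ.≤ N → (A : List ℕ) → PosSet A → length A ≡ N →
        Σ (List ℕ) λ S → SubsetOf S A × SumFree (5 ℕ.* l) l S ×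
          LogTermLe c N (toℚ (length S) ℚ.- fracℕ N (5 ℕ.* l ℕ.+ l)))
theorem1p1 (suc k) _ = c , c>0 , main
 where
  d : ℕ
  d = ℕ.pred (C₀ *' suc k)
  sd : suc d ≡ C₀ *' suc k
  sd = N.suc-pred (C₀ *' suc k) {{ℕ.>-nonZero (N.*-mono-≤ {1} {C₀} {1} {suc k} C₀≥1 (s≤s z≤n))}}
  c : ℚ
  c = pos 1 ℚ./ suc d
  ce : ι c * « C₀ *' suc k » ≡ 1F
  ce = tr (cong (λ w → ι c * « w ») (sym sd)) (tr (frac-* 1 d) «1»)
  c>0 : 0ℚ ℚ.< c
  c>0 = ℚP.≰⇒> (λ h → 1≰0 (≡≤ (sym ce) (≤≡ (*-monoʳ _ («»≥0 (C₀ *' suc k)) (ι-≤ h)) (zeroˡ _))))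
  main : (N : ℕ) → 3 ≤' N → (A : List ℕ) → PosSet A → length A ≡ N → Goal c (suc k) N A
  main N N3 A (uA , A1) refl = go (lg N) refl
   where
    go : ∀ t → lg N ≡ t → Goal c (suc k) N A
    go zero e = ⊥-elim (N.<⇒≱ (N.≤-trans (from-yes (2 ℕ.≤? 3)) N3) (subst (λ w → N ≤' 2 ^' w) e (lg-up N)))
    go (suc L) e = arcs (Assemble.hits s A uA A1 T N≤ Pbig J (s≤s z≤n) JP JN)
     where
      open Choice N L e
      open Conclude k N L N3 e c (ℚP.<⇒≤ c>0) ce using (B; logTerm)
      arcs : (Σ ℕ λ Q' → Σ ℕ λ x → 1 ≤' Q' × Hits A Q' x (ι q13 * « length A » + B)) →
       Goal c (suc k) N A
      arcs (suc q , x , _ , h) = fin (Arcs.sumfree-subset k q x A uA (ι q13 * « length A » + B) h)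
       where
        fin : Arcs.Dense k q x A uA (ι q13 * « length A » + B) → Goal c (suc k) N A
        fin (S , sub , free , b) = S , sub , free , logTerm (length S) b
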